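{- Let $k$ and $r$ be integers. For every easel $(\mathcal G,z,x,\psi)\in\mathcal G_{k,r}$, at least one of the following holds: (SMALL) $|V(\mathcal G)|=3$; or $\mathcal G_{k,r}$ contains an easel $(\mathcal G',z,x',\psi')$ with $(\mathcal G',z,x')\prec(\mathcal G,z,x)$ such that one of: (EXP) $(\mathcal G,z)$ is a $(\mathcal G_k,x\to x',\mathcal G_{k,r},\emptyset)$-expansion of $(\mathcal G',z)$; (EXPA) $(\mathcal G,z)$ is a $(\mathcal G_k,x\to x',\mathcal G_{k,r},\{y_1,y_2\})$-expansion of a 2-alteration of $(\mathcal G',z)$ on some vertices or edges $y_1$ and $y_2$; (EXPX) $\deg(z)=k+1$, $\deg(x)=k-2-r$, $\deg(x')\ge\deg(x)$, and $(\mathcal G,z)$ is a $(\mathcal G_k,x\to x',\mathcal G_{k,r},\{y,x'\})$-expansion of an $x'$-alteration of $(\mathcal G',z)$ on some vertex or edge $y$; (EXPB) $(\mathcal G,z)$ is a $(\mathcal G_k,x\to x',\mathcal G_{k,r},\emptyset)$-expansion of a 1-alteration of $(\mathcal G',z)$; (ADD) $x'=x$ and $(\mathcal G,z)$ is a tip-alteration of $(\mathcal G',z)$ at a vertex different from $x$; or (REM) $\mathcal G_{k,r}\cup\mathcal G_{k+1,r}$ contains an easel $(\mathcal G',z,x,\psi')$ with $(\mathcal G',z,x)\prec(\mathcal G,z,x)$ such that $(\mathcal G,z)$ is a tip-reduction of $(\mathcal G',z)$ at a vertex different from $x$. Moreover: if $\mathcal G$ contains a vertex other than $x$ of degree four,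 then (SMALL), (EXP), (EXPA), or (EXPX) holds; and if $(\mathcal G,z)$ is not $\psi$-critical, then (EXP) holds.
   Context: Graphs are finite, loopless, may have parallel edges. A $\mathbb{Z}_3$-boundary of $G$ is $\beta:V(G)\to\mathbb{Z}_3$ summing to $0$ over every component; $\mathcal G=(G,\beta)$ is a $\mathbb{Z}_3$-bordered graph. A nowhere-zero flow is an orientation with $\deg^+(v)-\deg^-(v)\equiv\beta(v)\pmod 3$ for all $v$. For a vertex $v$, $\tau(v)$ is $\{0\}$ ($\deg(v)$ even, $\beta(v)=0$), $\{ -2\}$ (even, $\beta(v)=1$), $\{2\}$ (even, $\beta(v)=-1$), $\{ -3,3\}$ (odd, $\beta(v)=0$), $\{1\}$ (odd, $\beta(v)=1$), $\{ -1\}$ (odd, $\beta(v)=-1$); $|\tau(v)|$ is the absolute value of its elements. For a partition $\mathcal P$ of $V(G)$, $\mathcal G/\mathcal P$ identifies each part into one vertex, deletes loops and sums $\beta$ over parts; $\mathcal P$ is non-trivial if some part has $\ge2$ vertices. A canvas $(\mathcal G,z)$ is a $\mathbb{Z}_3$-bordered graph with tip $z$. A tip preflow is an orientation $\psi$ of the edges at $z$ with (in $\psi$) $\deg^+(z)-\deg^-(z)\equiv\beta(z)\pmod 3$; it extends if some nowhere-zero flow agrees with it at $z$. $\mathcal P$ is tip-respecting if $\{z\}$ is a part. The canvas is $\psi$-critical if $\psi$ does not extend in $\mathcal G$ but extends in $\mathcal G/\mathcal P$ for every non-trivial tip-respecting $\mathcal P$; flow-critical if for every non-trivial tip-respecting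 $\mathcal P$ some tip preflow extends in $\mathcal G/\mathcal P$ but not in $\mathcal G$; tame if $\deg(v)\ge4+|\tau(v)|$ for $v\ne z$. For $A\subseteq V(\mathcal G)\setminus\{z\}$, $(\mathcal G,z)\restriction A$ is the canvas obtained by contracting $V(\mathcal G)\setminus A$ into one vertex $b$, with tip $b$. An easel is $(\mathcal G,z,x,\psi)$ with $(\mathcal G,z)$ a canvas, $x\ne z$ a vertex, $\psi$ a tip preflow. A tip preflow of a canvas with $\deg(z)\le k+1$ is $k$-tallness-witnessing if it does not extend to a nowhere-zero flow and, if $\deg(z)=k+1$, it does not direct all edges at $z$ the same way. $\mathcal G_k$: flow-critical tame canvases with $\deg(z)\le k+1$ having a $k$-tallness-witnessing preflow (up to isomorphism). For a canvas with $\deg(z)\le k+1$, $(x,\psi)$ is a witness of $(k,r)$-tallness if $\psi$ is $k$-tallness-witnessing, $x\ne z$ has $\deg(x)\ge k-2-r$, and if $\deg(x)=k-2-r$ and $\deg(z)=k+1$ then $\psi$ does not direct all edges between $z$ and $V(\mathcal G)\setminus\{z,x\}$ the same way. $\mathcal G_{k,r}$: easels $(\mathcal G,z,x,\psi)$ with $(\mathcal G,z)$ tame flow-critical, $\deg(z)\le k+1$, and $(x,\psi)$ a witness of $(k,r)$-tallness. Ordering: a vertex is in-friendly (out-friendly) if $\tau(v)$ contains a non-positive (non-negative) value; an edge $uv$, $u\ne z\ne v$, is mixed if one end is in-friendly and the other out-friendly; $(\mathcal G,z)$ is $x$-homogeneous if all mixed edges are incident with $x$. With $o(\mathcal G,z)=|V(\mathcal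 G)|+|E(\mathcal G-z)|$, $(\mathcal G_1,z_1,x_1)\prec(\mathcal G_2,z_2,x_2)$ if $o(\mathcal G_1,z_1)<o(\mathcal G_2,z_2)$; or $o$ values equal, $(\mathcal G_1,z_1)$ not $x_1$-homogeneous and $(\mathcal G_2,z_2)$ $x_2$-homogeneous; or $o$ values equal, both homogeneous, $\deg(z_1)<\deg(z_2)$. Operations: adding an edge between distinct $u,v$, boundary $+1$ at $u$ and $-1$ at $v$, is a 1-alteration if $u\ne z\ne v$ and a tip-alteration at the vertex of $\{u,v\}\setminus\{z\}$ otherwise. Deleting one of at least two parallel edges between $z$ and $v$ is a tip-reduction at $v$. For a non-empty set $X$ of at most two elements, each an edge or vertex, the 2-alteration on $X$ deletes the edges of $X$, adds a vertex $y$ of boundary $0$, edges $uy,yv$ for each edge $uv\in X$, and two parallel edges $yw$ for each vertex $w\in X$. For a vertex $x\ne z$ and $y$ either a vertex $v$ of $\mathcal G'-\{x,z\}$ (set $u=v$) or an edge $uv$ of $\mathcal G'-\{x,z\}$, the $x$-alteration on $y$ adds (possibly parallel) edges $ux$ and $vx$ and, if $y$ is an edge, deletes it. A $\mathcal C$-partition of $(\mathcal G,z)$ is a tip-respecting partition $\mathcal P$ with $(\mathcal G,z)\restriction P$ isomorphic to a member of $\mathcal C$ for every part $P$ with $|P|\ge 2$; $(\mathcal G,z)$ is a $\mathcal C$-expansion of $(\mathcal G',z)$ if it has a $\mathcal C$-partition $\mathcal P$ with $\mathcal G/\mathcal P=\mathcal G'$. For $x\in V(\mathcal G)$, $x'\in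 V(\mathcal G')\setminus\{z\}$, a class of easels $\mathcal E$ and a set $Y$ of vertices and edges of $\mathcal G'$, $(\mathcal G,z)$ is a $(\mathcal C,x\to x',\mathcal E,Y)$-expansion of $(\mathcal G',z)$ if it is a $\mathcal C$-expansion via $\mathcal P$, the part $P\ni x$ is contracted into $x'$, if $|P|>1$ then there is a tip preflow $\psi_1$ with $((\mathcal G,z)\restriction P,\ x,\ \psi_1)\in\mathcal E$ (the tip being the contracted vertex), and for every vertex $y\in Y$ other than $z$ the part contracted into $y$ has size at least two (edges in $Y$ impose nothing). -}

module Defs where

open import Data.Nat using (ℕ; zero; suc; _+_; _<_; _≤_)
open import Data.Integer using (ℤ; +_; -_; _-_) renaming (_+_ to _+ℤ_; _≤_ to _≤ℤ_)
open import Data.Fin using (Fin; zero; suc; _≟_)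
open import Data.Bool using (Bool; true; false; if_then_else_; not; _∨_)
open import Data.Product using (Σ; Σ-syntax; ∃; ∃₂; _×_; _,_; proj₁; proj₂)
open import Data.Sum using (_⊎_; inj₁; inj₂)
open import Data.Sum.Properties using (≡-dec)
open import Data.List using (List; []; _∷_; _++_; tabulate; allFin; filterᵇ; lookup; length; concatMap; map)
open import Data.List.Relation.Unary.Any using (Any)
open import Data.List.Relation.Unary.All using (All)
open import Relation.Nullary using (¬_; does)
open import Relation.Binary.PropositionalEquality using (_≡_; _≢_)
open import Function.Bundles using (_↔_; Inverse)

data Z3 : Set where
  z0 z1 z2 : Z3

_⊕_ : Z3 → Z3 → Z3
z0 ⊕ b = b
z1 ⊕ z0 = z1
z1 ⊕ z1 = z2
z1 ⊕ z2 = z0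
z2 ⊕ z0 = z2
z2 ⊕ z1 = z0
z2 ⊕ z2 = z1

sumℕ : ∀ {k} → (Fin k → ℕ) → ℕ
sumℕ {zero} f = 0
sumℕ {suc k} f = f zero + sumℕ (λ i → f (suc i))

sumZ : ∀ {k} → (Fin k → Z3) → Z3
sumZ {zero} f = z0
sumZ {suc k} f = f zero ⊕ sumZ (λ i → f (suc i))

_≡ᵇ_ : ∀ {k} → Fin k → Fin k → Bool
a ≡ᵇ b = does (a ≟ b)

ind : Bool → ℕ
ind true = 1
ind false = 0

-- Raw multigraphs with a ℤ₃ boundary: vertices Fin n, edges Fin m,
-- each edge with an (arbitrarily ordered) pair of ends.

record Gr : Set where
  field
    n : ℕ
    m : ℕ
    ends : Fin m → Fin n × Fin n
    β : Fin n → Z3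
open Gr public

V : Gr → Set
V G = Fin (n G)

E : Gr → Set
E G = Fin (m G)

mkGr : (k : ℕ) → List (Fin k × Fin k) → (Fin k → Z3) → Gr
mkGr k L b = record { n = k ; m = length L ; ends = lookup L ; β = b }

edgeList : (G : Gr) → List (V G × V G)
edgeList G = tabulate (ends G)

deg : (G : Gr) → V G → ℕ
deg G v = sumℕ (λ e → ind (v ≡ᵇ proj₁ (ends G e)) + ind (v ≡ᵇ proj₂ (ends G e)))

Loopless : Gr → Set
Loopless G = ∀ e → proj₁ (ends G e) ≢ proj₂ (ends G e)

Incident : (G : Gr) → V G → E G → Set
Incident G v e = proj₁ (ends G e) ≡ v ⊎ proj₂ (ends G e) ≡ v

Joins : (G : Gr) → E G → V G → V G → Set
Joins G e a b = ends G e ≡ (a , b) ⊎ ends G e ≡ (b , a)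

data Walk (G : Gr) : V G → V G → Set where
  here : ∀ {v} → Walk G v v
  step : ∀ {u w v} (e : E G) → Joins G e u w → Walk G w v → Walk G u v

IsComponent : (G : Gr) → (V G → Bool) → Set
IsComponent G C =
  (∃ λ v → C v ≡ true)
  × (∀ e → C (proj₁ (ends G e)) ≡ C (proj₂ (ends G e)))
  × (∀ u v → C u ≡ true → C v ≡ true → Walk G u v)

Bordered : Gr → Set
Bordered G = Loopless G
  × (∀ C → IsComponent G C → sumZ (λ v → if C v then β G v else z0) ≡ z0)

Orientation : Gr → Set
Orientation G = E G → Bool

tl hd : (G : Gr) → Orientation G → E G → V G
tl G o e = if o e then proj₁ (ends G e) else proj₂ (ends G e)
hd G o e = if o e then proj₂ (ends G e) else proj₁ (ends G e)

net : (G : Gr) → Orientation G → V G → Z3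
net G o v = sumZ (λ e → (if v ≡ᵇ tl G o e then z1 else z0)
                        ⊕ (if v ≡ᵇ hd G o e then z2 else z0))

IsFlow : (G : Gr) → Orientation G → Set
IsFlow G o = ∀ v → net G o v ≡ β G v

-- a tip preflow is represented by any orientation; only its values on
-- edges incident with z matter (net at z only depends on those)
TipPreflow : (G : Gr) → V G → Orientation G → Set
TipPreflow G z ψ = net G ψ z ≡ β G z

Extends : (G : Gr) → V G → Orientation G → Set
Extends G z ψ = Σ (Orientation G) λ o → IsFlow G o × (∀ e → Incident G z e → o e ≡ ψ e)

-- Partitions (as surjections onto Fin p) and contraction G/P

Surj : ∀ {A : Set} {p} → (A → Fin p) → Set
Surj {A} f = ∀ q → ∃ λ (v : A) → f v ≡ q

TipResp : ∀ {k p} → (Fin k → Fin p) → Fin k → Set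
TipResp f z = ∀ v → f v ≡ f z → v ≡ z

NonTriv : ∀ {k p} → (Fin k → Fin p) → Set
NonTriv f = ∃₂ λ u v → u ≢ v × f u ≡ f v

kept : (G : Gr) {p : ℕ} → (V G → Fin p) → List (E G)
kept G f = filterᵇ (λ e → not (f (proj₁ (ends G e)) ≡ᵇ f (proj₂ (ends G e)))) (allFin (m G))

quot : (G : Gr) {p : ℕ} → (V G → Fin p) → Gr
quot G {p} f = record
  { n = p
  ; m = length (kept G f)
  ; ends = λ i → f (proj₁ (ends G (lookup (kept G f) i))) , f (proj₂ (ends G (lookup (kept G f) i)))
  ; β = λ q → sumZ (λ v → if f v ≡ᵇ q then β G v else z0)
  }

orig : (G : Gr) {p : ℕ} (f : V G → Fin p) → E (quot G f) → E G
orig G f i = lookup (kept G f) i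

Big : ∀ {k p} → (Fin k → Fin p) → Fin p → Set
Big f q = ∃₂ λ u v → u ≢ v × f u ≡ q × f v ≡ q

PsiCritical : (G : Gr) → V G → Orientation G → Set
PsiCritical G z ψ = ¬ Extends G z ψ
  × (∀ p (f : V G → Fin p) → Surj f → TipResp f z → NonTriv f
       → Extends (quot G f) (f z) (λ i → ψ (orig G f i)))

FlowCritical : (G : Gr) → V G → Set
FlowCritical G z = ∀ p (f : V G → Fin p) → Surj f → TipResp f z → NonTriv f
  → Σ (Orientation G) λ ψ → TipPreflow G z ψ
      × Extends (quot G f) (f z) (λ i → ψ (orig G f i)) × ¬ Extends G z ψ

isEven : ℕ → Bool
isEven zero = true
isEven (suc k) = not (isEven k)

tauOf : ℕ → Z3 → List ℤ
tauOf d b with isEven d | b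
... | true  | z0 = + 0 ∷ []
... | true  | z1 = - (+ 2) ∷ []
... | true  | z2 = + 2 ∷ []
... | false | z0 = - (+ 3) ∷ + 3 ∷ []
... | false | z1 = + 1 ∷ []
... | false | z2 = - (+ 1) ∷ []

tau : (G : Gr) → V G → List ℤ
tau G v = tauOf (deg G v) (β G v)

absHead : List ℤ → ℕ
absHead [] = 0
absHead (t ∷ _) = Data.Integer.∣ t ∣
  where import Data.Integer

absTau : (G : Gr) → V G → ℕ
absTau G v = absHead (tau G v)

Tame : (G : Gr) → V G → Set
Tame G z = ∀ v → v ≢ z → 4 + absTau G v ≤ deg G v

AllSame : (G : Gr) → V G → (E G → Set) → Orientation G → Set
AllSame G z S ψ = (∀ e → S e → tl G ψ e ≡ z) ⊎ (∀ e → S e → hd G ψ e ≡ z)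

TallWit : ℤ → (G : Gr) → V G → Orientation G → Set
TallWit k G z ψ = TipPreflow G z ψ × ¬ Extends G z ψ
  × (+ deg G z ≡ k +ℤ + 1 → ¬ AllSame G z (Incident G z) ψ)

Witness : ℤ → ℤ → (G : Gr) → V G → V G → Orientation G → Set
Witness k r G z x ψ = TallWit k G z ψ × x ≢ z × (k - + 2 - r ≤ℤ + deg G x)
  × (+ deg G x ≡ k - + 2 - r → + deg G z ≡ k +ℤ + 1
      → ¬ AllSame G z (λ e → ∃ λ w → w ≢ z × w ≢ x × Joins G e z w) ψ)

InGk : ℤ → (G : Gr) → V G → Set
InGk k G z = Bordered G × Tame G z × FlowCritical G z × (+ deg G z ≤ℤ k +ℤ + 1)
  × Σ (Orientation G) (TallWit k G z)

InGkr : ℤ → ℤ → (G : Gr) → V G → V G → Orientation G → Set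
InGkr k r G z x ψ = Bordered G × Tame G z × FlowCritical G z
  × (+ deg G z ≤ℤ k +ℤ + 1) × Witness k r G z x ψ

ord : (G : Gr) → V G → ℕ
ord G z = n G + sumℕ (λ e → ind (not ((z ≡ᵇ proj₁ (ends G e)) ∨ (z ≡ᵇ proj₂ (ends G e)))))

InFriendly OutFriendly : (G : Gr) → V G → Set
InFriendly G v = Any (λ t → t ≤ℤ + 0) (tau G v)
OutFriendly G v = Any (λ t → + 0 ≤ℤ t) (tau G v)

Mixed : (G : Gr) → V G → E G → Set
Mixed G z e = proj₁ (ends G e) ≢ z × proj₂ (ends G e) ≢ z
  × ((InFriendly G (proj₁ (ends G e)) × OutFriendly G (proj₂ (ends G e)))
     ⊎ (OutFriendly G (proj₁ (ends G e)) × InFriendly G (proj₂ (ends G e))))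

Homog : (G : Gr) → V G → V G → Set
Homog G z x = ∀ e → Mixed G z e → Incident G x e

Prec : (G₁ : Gr) → V G₁ → V G₁ → (G₂ : Gr) → V G₂ → V G₂ → Set
Prec G₁ z₁ x₁ G₂ z₂ x₂ =
  ord G₁ z₁ < ord G₂ z₂
  ⊎ (ord G₁ z₁ ≡ ord G₂ z₂ × ¬ Homog G₁ z₁ x₁ × Homog G₂ z₂ x₂)
  ⊎ (ord G₁ z₁ ≡ ord G₂ z₂ × Homog G₁ z₁ x₁ × Homog G₂ z₂ x₂ × deg G₁ z₁ < deg G₂ z₂)

mapP : ∀ {A B : Set} → (A → B) → A × A → B × B
mapP f (a , b) = f a , f b

swapP : ∀ {A : Set} → A × A → A × A
swapP (a , b) = b , a

record Iso (G H : Gr) : Set where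
  field
    vm : V G ↔ V H
    em : E G ↔ E H
    ends-ok : ∀ e → ends H (Inverse.to em e) ≡ mapP (Inverse.to vm) (ends G e)
                  ⊎ ends H (Inverse.to em e) ≡ swapP (mapP (Inverse.to vm) (ends G e))
    β-ok : ∀ v → β H (Inverse.to vm v) ≡ β G v

vto : ∀ {G H} → Iso G H → V G → V H
vto I = Inverse.to (Iso.vm I)

vfrom : ∀ {G H} → Iso G H → V H → V G
vfrom I = Inverse.from (Iso.vm I)

addEdge : (G : Gr) → V G → V G → Gr
addEdge G u v = mkGr (n G) (edgeList G ++ (u , v) ∷ [])
  (λ w → (β G w ⊕ (if w ≡ᵇ u then z1 else z0)) ⊕ (if w ≡ᵇ v then z2 else z0))

delEdge : (G : Gr) → E G → Gr
delEdge G e₀ = mkGr (n G) (map (ends G) (filterᵇ (λ e → not (e ≡ᵇ e₀)) (allFin (m G)))) (β G)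

Item : Gr → Set
Item G = V G ⊎ E G

eqI : (G : Gr) → Item G → Item G → Bool
eqI G a b = does (≡-dec _≟_ _≟_ a b)

itemSet : (G : Gr) → Item G → Item G → List (Item G)
itemSet G y₁ y₂ = y₁ ∷ (if eqI G y₁ y₂ then [] else y₂ ∷ [])

edgeIn : (G : Gr) → List (Item G) → E G → Bool
edgeIn G [] e = false
edgeIn G (inj₁ _ ∷ X) e = edgeIn G X e
edgeIn G (inj₂ e' ∷ X) e = (e' ≡ᵇ e) ∨ edgeIn G X e

-- 2-alteration on X = {y₁,y₂}: new vertex y = zero, old v ↦ suc v
alt2 : (G : Gr) → Item G → Item G → Gr
alt2 G y₁ y₂ = mkGr (suc (n G))
  (map (λ e → mapP suc (ends G e)) (filterᵇ (λ e → not (edgeIn G X e)) (allFin (m G)))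
    ++ concatMap gadget X)
  β'
  where
  X = itemSet G y₁ y₂
  gadget : Item G → List (Fin (suc (n G)) × Fin (suc (n G)))
  gadget (inj₁ w) = (zero , suc w) ∷ (zero , suc w) ∷ []
  gadget (inj₂ e) = (suc (proj₁ (ends G e)) , zero) ∷ (zero , suc (proj₂ (ends G e))) ∷ []
  β' : Fin (suc (n G)) → Z3
  β' zero = z0
  β' (suc v) = β G v

itemV2 : ∀ {G} → Item G → List (Fin (suc (n G)))
itemV2 (inj₁ v) = suc v ∷ []
itemV2 (inj₂ _) = []

itemV : ∀ {G} → Item G → List (V G)
itemV (inj₁ v) = v ∷ []
itemV (inj₂ _) = []

xaltEdges : (G : Gr) → V G → Item G → List (V G × V G)
xaltEdges G x (inj₁ v) = edgeList G ++ (v , x) ∷ (v , x) ∷ []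
xaltEdges G x (inj₂ e₀) =
  map (ends G) (filterᵇ (λ e → not (e ≡ᵇ e₀)) (allFin (m G)))
    ++ (proj₁ (ends G e₀) , x) ∷ (proj₂ (ends G e₀) , x) ∷ []

xalt : (G : Gr) → V G → Item G → Gr
xalt G x y = mkGr (n G) (xaltEdges G x y) (β G)

XValid : (G : Gr) → V G → V G → Item G → Set
XValid G z x (inj₁ v) = v ≢ x × v ≢ z
XValid G z x (inj₂ e) = proj₁ (ends G e) ≢ x × proj₁ (ends G e) ≢ z
                        × proj₂ (ends G e) ≢ x × proj₂ (ends G e) ≢ z

-- g realises the partition of V(G) into singletons of A and the rest (part b)
RestrRep : (G : Gr) → (V G → Set) → {p : ℕ} → (V G → Fin p) → Fin p → Set
RestrRep G A g b = Surj g × (∀ v → ¬ A v → g v ≡ b) × (∀ a → A a → g a ≢ b)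
  × (∀ a a' → A a → A a' → g a ≡ g a' → a ≡ a')

RestrInGk : ℤ → (G : Gr) → (V G → Set) → Set
RestrInGk k G A = Σ ℕ λ p → Σ (V G → Fin p) λ g → Σ (Fin p) λ b →
  RestrRep G A g b × InGk k (quot G g) b

RestrInGkr : ℤ → ℤ → (G : Gr) → (V G → Set) → V G → Set
RestrInGkr k r G A x = Σ ℕ λ p → Σ (V G → Fin p) λ g → Σ (Fin p) λ b →
  RestrRep G A g b × Σ (Orientation (quot G g)) λ ψ₁ → InGkr k r (quot G g) b (g x) ψ₁

Expansion : ℤ → ℤ → (G : Gr) → V G → V G → (H : Gr) → V H → V H → List (V H) → Set
Expansion k r G z x H zH x' Y =
  Σ ℕ λ p → Σ (V G → Fin p) λ f → Surj f × TipResp f z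
  × Σ (Iso (quot G f) H) λ I → vto I (f z) ≡ zH × vto I (f x) ≡ x'
  × (∀ q → Big f q → RestrInGk k G (λ v → f v ≡ q))
  × (Big f (f x) → RestrInGkr k r G (λ v → f v ≡ f x) x)
  × All (λ y → y ≢ zH → Big f (vfrom I y)) Y

EXP EXPA EXPX EXPB ADD : ℤ → ℤ → (G : Gr) → V G → V G → (G' : Gr) → V G' → V G' → Set
EXP k r G z x G' z' x' = Expansion k r G z x G' z' x' []
EXPA k r G z x G' z' x' = Σ (Item G') λ y₁ → Σ (Item G') λ y₂ →
  Expansion k r G z x (alt2 G' y₁ y₂) (suc z') (suc x') (itemV2 {G'} y₁ ++ itemV2 {G'} y₂)
EXPX k r G z x G' z' x' = (+ deg G z ≡ k +ℤ + 1) × (+ deg G x ≡ k - + 2 - r)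
  × deg G x ≤ deg G' x'
  × Σ (Item G') λ y → XValid G' z' x' y
    × Expansion k r G z x (xalt G' x' y) z' x' (itemV {G'} y ++ x' ∷ [])
EXPB k r G z x G' z' x' = Σ (V G') λ u → Σ (V G') λ v → u ≢ v × u ≢ z' × v ≢ z'
  × Expansion k r G z x (addEdge G' u v) z' x' []
ADD k r G z x G' z' x' = Σ (V G') λ w → w ≢ z' × w ≢ x'
  × ((Σ (Iso G (addEdge G' z' w)) λ I → vto I z ≡ z' × vto I x ≡ x')
     ⊎ (Σ (Iso G (addEdge G' w z')) λ I → vto I z ≡ z' × vto I x ≡ x'))

Better : ℤ → ℤ → (G : Gr) → V G → V G → ((G' : Gr) → V G' → V G' → Set) → Set
Better k r G z x R = Σ Gr λ G' → Σ (V G') λ z' → Σ (V G') λ x' → Σ (Orientation G') λ ψ' →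
  InGkr k r G' z' x' ψ' × Prec G' z' x' G z x × R G' z' x'

REM : ℤ → ℤ → (G : Gr) → V G → V G → Set
REM k r G z x = Σ Gr λ G' → Σ (V G') λ z' → Σ (V G') λ x' → Σ (Orientation G') λ ψ' →
  (InGkr k r G' z' x' ψ' ⊎ InGkr (k +ℤ + 1) r G' z' x' ψ') × Prec G' z' x' G z x
  × Σ (V G') λ w → w ≢ x' × Σ (E G') λ e₁ → Σ (E G') λ e₂ → e₁ ≢ e₂
    × Joins G' e₁ z' w × Joins G' e₂ z' w
    × Σ (Iso G (delEdge G' e₁)) λ I → vto I z ≡ z' × vto I x ≡ x'

{-# OPTIONS --safe #-}
module Submission where

-- All reductions keep the vertex and edge sets: deleted edges become loops, lifted edges change their
-- ends, and the reduced canvas is a coarsest contraction of the result to which the preflow does not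
-- extend, which is flow-critical. Its tameness, and the tallness of the parts of the contraction, follow
-- from the bound 2 + deg x ≤ deg z for smaller easels, in which equality forces ψ to direct all edges
-- between z and V∖{z,x} alike.
-- If ψ is not critical, contracting suffices (EXP). A flow off a vertex of degree four directs two of
-- its edges in and two out, so its edges can be lifted in pairs (EXPA). Mixed edges away from x can be
-- deleted (EXPB), and so can edges at z whose direction fits the sign of their other end (ADD). If none
-- is left, then all vertices other than x and z have the same strict sign and all edges from z to them
-- have the same direction; modulo 3, one such edge can be replaced by two of the opposite direction,
-- and this yields a non-homogeneous canvas (REM). The bound itself is proved along the same reductions.
-- EXPX never arises.

open import Defs
open import Data.Nat using (ℕ; zero; suc; _+_; _<_; _≤_; z≤n; s≤s)
import Data.Nat.Properties as ℕₚ
open import Data.Integer using (ℤ; -_; _-_) renaming (_+_ to _+ℤ_; _≤_ to _≤ℤ_; +_ to pos)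
import Data.Integer as ℤ
import Data.Integer.Properties as ℤₚ
open import Data.Fin using (Fin; zero; suc; _≟_; punchIn; punchOut; cast; _↑ˡ_; _↑ʳ_; splitAt)
import Data.Fin.Properties as Finₚ
import Data.Fin.Permutation as FinPerm
open import Data.Bool using (Bool; true; false; if_then_else_; not; _∨_; _∧_; _xor_)
import Data.Bool.Properties as Boolₚ
open import Data.Product using (Σ; ∃; ∃₂; _×_; _,_; proj₁; proj₂)
open import Data.Sum as Sum using (_⊎_; inj₁; inj₂)
open import Data.Empty using (⊥; ⊥-elim)
open import Data.List using (List; []; _∷_; _++_; tabulate; allFin; filterᵇ; lookup; length; map)
import Data.List.Properties as Listₚ
open import Data.List.Membership.Propositional using (_∈_)
open import Data.List.Membership.Propositional.Properties using (∈-lookup; ∈-allFin)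
open import Data.List.Relation.Unary.All as All using (All; []; _∷_)
import Data.List.Relation.Unary.All.Properties as Allₚ
open import Data.List.Relation.Unary.AllPairs using ([]; _∷_)
open import Data.List.Relation.Unary.Any as Any using (Any; here; there)
open import Data.List.Relation.Unary.Unique.Propositional using (Unique)
import Data.List.Relation.Unary.Unique.Propositional.Properties as Uniqueₚ
open import Data.List.Relation.Binary.Permutation.Propositional as Perm using (_↭_)
import Data.List.Relation.Binary.Permutation.Propositional.Properties as Permₚ
import Data.List.Relation.Binary.Permutation.Homogeneous as Hom
import Data.List.Relation.Binary.Permutation.Setoid as PermS
import Data.List.Relation.Binary.Permutation.Setoid.Properties as PermSₚ
open import Relation.Nullary using (¬_; Dec; yes; no; does)
open import Relation.Nullary.Decidable using (map′; from-yes; T?; _×-dec_; _→-dec_; _⊎-dec_; ¬?)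
open import Relation.Binary.Bundles using (Setoid)
open import Relation.Binary.PropositionalEquality using (_≡_; _≢_; refl; sym; trans; cong; cong₂; subst; subst₂; module ≡-Reasoning)
open import Function using (_∘_; id; case_of_)
open import Function.Bundles using (Inverse)

-- The constants belong together. Lifting a path through a set can remove two of its boundary edges,
-- so tameness of the reduced canvas, 4 + |τ|, requires cuts of size 6 + |τ| beforehand. This is the
-- degree bound applied to the tip of a restriction: its summand 2 supplies the two extra edges, and
-- tip degrees 6 and 7 need an argument about parity and boundaries. The equality case is carried
-- along because tallness restricts directions only at extremal degrees.
--
-- The main obstacle arises at a vertex of degree four, when a part of the expansion gets as many
-- boundary edges as the tip. Such a part is tall only if some preflow of its restriction is not
-- constant on the relevant edges. The bound does not give this directly; a separate argument
-- shrinks a set around the part. The three pairings of the four edges may fail individually, but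
-- not all at once.
--
-- The bound is proved by induction along `Prec`. Inhomogeneous canvases refer only to smaller
-- orders, so they are available to homogeneous canvases of the same order even when the step
-- increases the tip degree.

allB? : {P : Bool → Set} → (∀ b → Dec (P b)) → Dec (∀ b → P b)
allB? {P} P? with P? true | P? false
... | yes p | yes q = yes λ { true → p ; false → q }
... | no ¬p | _ = no λ h → ¬p (h true)
... | yes _ | no ¬q = no λ h → ¬q (h false)

-- Together with `allB?`, this turns identities in finitely many Boolean and ternary variables into
-- the evaluation of a decision procedure under `from-yes`.
all3? : {P : Z3 → Set} → (∀ b → Dec (P b)) → Dec (∀ b → P b)
all3? {P} P? with P? z0 | P? z1 | P? z2
... | yes p | yes q | yes r = yes λ { z0 → p ; z1 → q ; z2 → r }
... | no ¬p | _ | _ = no λ h → ¬p (h z0)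
... | yes _ | no ¬q | _ = no λ h → ¬q (h z1)
... | yes _ | yes _ | no ¬r = no λ h → ¬r (h z2)

-- Arithmetic modulo 3

_≟3_ : (a b : Z3) → Dec (a ≡ b)
z0 ≟3 z0 = yes refl
z0 ≟3 z1 = no λ ()
z0 ≟3 z2 = no λ ()
z1 ≟3 z0 = no λ ()
z1 ≟3 z1 = yes refl
z1 ≟3 z2 = no λ ()
z2 ≟3 z0 = no λ ()
z2 ≟3 z1 = no λ ()
z2 ≟3 z2 = yes refl

_≟B_ : (a b : Bool) → Dec (a ≡ b)
_≟B_ = Boolₚ._≟_

neg : Z3 → Z3
neg z0 = z0
neg z1 = z2
neg z2 = z1

⊕-comm : ∀ a b → a ⊕ b ≡ b ⊕ a
⊕-comm = from-yes (all3? λ a → all3? λ b → (a ⊕ b) ≟3 (b ⊕ a))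

⊕-assoc : ∀ a b c → (a ⊕ b) ⊕ c ≡ a ⊕ (b ⊕ c)
⊕-assoc = from-yes (all3? λ a → all3? λ b → all3? λ c → ((a ⊕ b) ⊕ c) ≟3 (a ⊕ (b ⊕ c)))

⊕-identityʳ : ∀ a → a ⊕ z0 ≡ a
⊕-identityʳ = from-yes (all3? λ a → (a ⊕ z0) ≟3 a)

⊕-cancelʳ : ∀ c a b → a ⊕ c ≡ b ⊕ c → a ≡ b
⊕-cancelʳ = from-yes (all3? λ c → all3? λ a → all3? λ b → ((a ⊕ c) ≟3 (b ⊕ c)) →-dec (a ≟3 b))

⊕-cancelˡ : ∀ c a b → c ⊕ a ≡ c ⊕ b → a ≡ b
⊕-cancelˡ = from-yes (all3? λ c → all3? λ a → all3? λ b → ((c ⊕ a) ≟3 (c ⊕ b)) →-dec (a ≟3 b))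

⊕-interchange : ∀ a b c d → (a ⊕ b) ⊕ (c ⊕ d) ≡ (a ⊕ c) ⊕ (b ⊕ d)
⊕-interchange = from-yes (all3? λ a → all3? λ b → all3? λ c → all3? λ d →
  ((a ⊕ b) ⊕ (c ⊕ d)) ≟3 ((a ⊕ c) ⊕ (b ⊕ d)))

-- Sums

sumZ-cong : ∀ {k} {f g : Fin k → Z3} → (∀ i → f i ≡ g i) → sumZ f ≡ sumZ g
sumZ-cong {zero} h = refl
sumZ-cong {suc k} h = cong₂ _⊕_ (h zero) (sumZ-cong (h ∘ suc))

sumℕ-cong : ∀ {k} {f g : Fin k → ℕ} → (∀ i → f i ≡ g i) → sumℕ f ≡ sumℕ g
sumℕ-cong {zero} h = refl
sumℕ-cong {suc k} h = cong₂ _+_ (h zero) (sumℕ-cong (h ∘ suc))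

sumZ-zero : ∀ {k} {f : Fin k → Z3} → (∀ i → f i ≡ z0) → sumZ f ≡ z0
sumZ-zero {zero} h = refl
sumZ-zero {suc k} h rewrite h zero = sumZ-zero (h ∘ suc)

sumℕ-zero : ∀ {k} {f : Fin k → ℕ} → (∀ i → f i ≡ 0) → sumℕ f ≡ 0
sumℕ-zero {zero} h = refl
sumℕ-zero {suc k} h rewrite h zero = sumℕ-zero (h ∘ suc)

sumZ-⊕ : ∀ {k} (f g : Fin k → Z3) → sumZ (λ i → f i ⊕ g i) ≡ sumZ f ⊕ sumZ g
sumZ-⊕ {zero} f g = refl
sumZ-⊕ {suc k} f g = trans (cong ((f zero ⊕ g zero) ⊕_) (sumZ-⊕ (f ∘ suc) (g ∘ suc)))
  (⊕-interchange (f zero) (g zero) _ _)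

+-interchange : ∀ a b c d → (a + b) + (c + d) ≡ (a + c) + (b + d)
+-interchange a b c d = begin
  (a + b) + (c + d) ≡⟨ ℕₚ.+-assoc a b (c + d) ⟩
  a + (b + (c + d)) ≡⟨ cong (a +_) (sym (ℕₚ.+-assoc b c d)) ⟩
  a + ((b + c) + d) ≡⟨ cong (λ t → a + (t + d)) (ℕₚ.+-comm b c) ⟩
  a + ((c + b) + d) ≡⟨ cong (a +_) (ℕₚ.+-assoc c b d) ⟩
  a + (c + (b + d)) ≡⟨ sym (ℕₚ.+-assoc a c (b + d)) ⟩
  (a + c) + (b + d) ∎
  where open ≡-Reasoning

sumℕ-+ : ∀ {k} (f g : Fin k → ℕ) → sumℕ (λ i → f i + g i) ≡ sumℕ f + sumℕ g
sumℕ-+ {zero} f g = refl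
sumℕ-+ {suc k} f g = trans (cong ((f zero + g zero) +_) (sumℕ-+ (f ∘ suc) (g ∘ suc)))
  (+-interchange (f zero) (g zero) _ _)

sumℕ-mono : ∀ {k} {f g : Fin k → ℕ} → (∀ i → f i ≤ g i) → sumℕ f ≤ sumℕ g
sumℕ-mono {zero} h = z≤n
sumℕ-mono {suc k} h = ℕₚ.+-mono-≤ (h zero) (sumℕ-mono (h ∘ suc))

sumℕ-mono-< : ∀ {k} {f g : Fin k → ℕ} → (∀ i → f i ≤ g i) → ∀ j → f j < g j → sumℕ f < sumℕ g
sumℕ-mono-< {suc k} h zero l = ℕₚ.+-mono-<-≤ l (sumℕ-mono (h ∘ suc))
sumℕ-mono-< {suc k} h (suc j) l = ℕₚ.+-mono-≤-< (h zero) (sumℕ-mono-< (h ∘ suc) j l)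

sumZ-swap : ∀ {k l} (f : Fin k → Fin l → Z3) →
  sumZ (λ i → sumZ (λ j → f i j)) ≡ sumZ (λ j → sumZ (λ i → f i j))
sumZ-swap {zero} {l} f = sym (sumZ-zero {l} (λ _ → refl))
sumZ-swap {suc k} f = trans (cong (sumZ (f zero) ⊕_) (sumZ-swap (f ∘ suc)))
  (sym (sumZ-⊕ (f zero) (λ j → sumZ (λ i → f (suc i) j))))

sumℕ-swap : ∀ {k l} (f : Fin k → Fin l → ℕ) →
  sumℕ (λ i → sumℕ (λ j → f i j)) ≡ sumℕ (λ j → sumℕ (λ i → f i j))
sumℕ-swap {zero} {l} f = sym (sumℕ-zero {l} (λ _ → refl))
sumℕ-swap {suc k} f = trans (cong (sumℕ (f zero) +_) (sumℕ-swap (f ∘ suc)))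
  (sym (sumℕ-+ (f zero) (λ j → sumℕ (λ i → f (suc i) j))))

≡ᵇ-refl : ∀ {k} (a : Fin k) → (a ≡ᵇ a) ≡ true
≡ᵇ-refl a with a ≟ a
... | yes _ = refl
... | no h = ⊥-elim (h refl)

≡ᵇ-true : ∀ {k} (a b : Fin k) → (a ≡ᵇ b) ≡ true → a ≡ b
≡ᵇ-true a b h with a ≟ b
≡ᵇ-true a b h | yes p = p
≡ᵇ-true a b () | no _

≡ᵇ-≢ : ∀ {k} {a b : Fin k} → a ≢ b → (a ≡ᵇ b) ≡ false
≡ᵇ-≢ {a = a} {b} h with a ≟ b
... | yes p = ⊥-elim (h p)
... | no _ = refl

≡ᵇ-false : ∀ {k} (a b : Fin k) → (a ≡ᵇ b) ≡ false → a ≢ b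
≡ᵇ-false a .a h refl with trans (sym (≡ᵇ-refl a)) h
... | ()

≡ᵇ-≡ : ∀ {k} {a b : Fin k} → a ≡ b → (a ≡ᵇ b) ≡ true
≡ᵇ-≡ {a = a} refl = ≡ᵇ-refl a

≡ᵇ-iff : ∀ {k l} (a b : Fin k) (c d : Fin l) → (a ≡ b → c ≡ d) → (c ≡ d → a ≡ b) → (a ≡ᵇ b) ≡ (c ≡ᵇ d)
≡ᵇ-iff a b c d f g with a ≟ b
... | yes p = sym (≡ᵇ-≡ (f p))
... | no h = sym (≡ᵇ-≢ (h ∘ g))

≡ᵇ-sym : ∀ {k} (a b : Fin k) → (a ≡ᵇ b) ≡ (b ≡ᵇ a)
≡ᵇ-sym a b = ≡ᵇ-iff a b b a sym sym

true≢false : true ≢ false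
true≢false ()

bool-ne : ∀ {b} → b ≢ true → b ≡ false
bool-ne {true} h = ⊥-elim (h refl)
bool-ne {false} h = refl

-- Replacing a summand by zero keeps the index type, so repeated splitting of a sum causes no
-- reindexing of `Fin`.
zeroAt : ∀ {k} → Fin k → (Fin k → Z3) → Fin k → Z3
zeroAt j f i = if j ≡ᵇ i then z0 else f i

sumZ-split : ∀ {k} (f : Fin k → Z3) j → sumZ f ≡ f j ⊕ sumZ (zeroAt j f)
sumZ-split {suc k} f zero = cong (f zero ⊕_) (sumZ-cong {f = f ∘ suc} λ i → refl)
sumZ-split {suc k} f (suc j) = begin
  f zero ⊕ sumZ (f ∘ suc) ≡⟨ cong (f zero ⊕_) (sumZ-split (f ∘ suc) j) ⟩
  f zero ⊕ (f (suc j) ⊕ sumZ (zeroAt j (f ∘ suc))) ≡⟨ from-yes (all3? λ a → all3? λ b → all3? λ c → (a ⊕ (b ⊕ c)) ≟3 (b ⊕ (a ⊕ c))) (f zero) (f (suc j)) _ ⟩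
  f (suc j) ⊕ (f zero ⊕ sumZ (zeroAt j (f ∘ suc)))
    ≡⟨ cong (λ s → f (suc j) ⊕ (f zero ⊕ s)) (sumZ-cong λ i → cong (λ b → if b then z0 else f (suc i)) (≡ᵇ-iff j i (suc j) (suc i) (cong suc) Finₚ.suc-injective)) ⟩
  f (suc j) ⊕ (f zero ⊕ sumZ (λ i → zeroAt (suc j) f (suc i))) ∎
  where open ≡-Reasoning

zeroAtℕ : ∀ {k} → Fin k → (Fin k → ℕ) → Fin k → ℕ
zeroAtℕ j f i = if j ≡ᵇ i then 0 else f i

sumℕ-split : ∀ {k} (f : Fin k → ℕ) j → sumℕ f ≡ f j + sumℕ (zeroAtℕ j f)
sumℕ-split {suc k} f zero = cong (f zero +_) (sumℕ-cong {f = f ∘ suc} λ i → refl)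
sumℕ-split {suc k} f (suc j) = begin
  f zero + sumℕ (f ∘ suc) ≡⟨ cong (f zero +_) (sumℕ-split (f ∘ suc) j) ⟩
  f zero + (f (suc j) + r) ≡⟨ sym (ℕₚ.+-assoc (f zero) (f (suc j)) r) ⟩
  (f zero + f (suc j)) + r ≡⟨ cong (_+ r) (ℕₚ.+-comm (f zero) (f (suc j))) ⟩
  (f (suc j) + f zero) + r ≡⟨ ℕₚ.+-assoc (f (suc j)) (f zero) r ⟩
  f (suc j) + (f zero + r)
    ≡⟨ cong (λ s → f (suc j) + (f zero + s)) (sumℕ-cong λ i → cong (λ b → if b then 0 else f (suc i)) (≡ᵇ-iff j i (suc j) (suc i) (cong suc) Finₚ.suc-injective)) ⟩
  f (suc j) + (f zero + sumℕ (λ i → zeroAtℕ (suc j) f (suc i))) ∎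
  where
  open ≡-Reasoning
  r = sumℕ (zeroAtℕ j (f ∘ suc))

sumZ-single : ∀ {k} (f : Fin k → Z3) j → (∀ i → j ≢ i → f i ≡ z0) → sumZ f ≡ f j
sumZ-single f j h = trans (sumZ-split f j)
  (trans (cong (f j ⊕_) (sumZ-zero g)) (⊕-identityʳ (f j)))
  where
  g : ∀ i → zeroAt j f i ≡ z0
  g i with j ≟ i
  ... | yes _ = refl
  ... | no n = h i n

sumZ-change : ∀ {k} (f g : Fin k → Z3) j → (∀ i → j ≢ i → f i ≡ g i) → ∀ a b → a ⊕ f j ≡ b ⊕ g j → a ⊕ sumZ f ≡ b ⊕ sumZ g
sumZ-change f g j h a b e = begin
  a ⊕ sumZ f ≡⟨ cong (a ⊕_) (sumZ-split f j) ⟩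
  a ⊕ (f j ⊕ sumZ (zeroAt j f)) ≡⟨ sym (⊕-assoc a _ _) ⟩
  (a ⊕ f j) ⊕ sumZ (zeroAt j f) ≡⟨ cong₂ _⊕_ e (sumZ-cong k) ⟩
  (b ⊕ g j) ⊕ sumZ (zeroAt j g) ≡⟨ ⊕-assoc b _ _ ⟩
  b ⊕ (g j ⊕ sumZ (zeroAt j g)) ≡⟨ cong (b ⊕_) (sym (sumZ-split g j)) ⟩
  b ⊕ sumZ g ∎
  where
  open ≡-Reasoning
  k : ∀ i → zeroAt j f i ≡ zeroAt j g i
  k i with j ≟ i
  ... | yes _ = refl
  ... | no n = h i n

-- The summands `a` and `b` stand for a difference, since natural numbers have no subtraction that
-- could express how one edge changes a boundary.
sumℕ-change : ∀ {k} (f g : Fin k → ℕ) j → (∀ i → j ≢ i → f i ≡ g i) → ∀ a b → a + f j ≡ b + g j → a + sumℕ f ≡ b + sumℕ g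
sumℕ-change f g j h a b e = begin
  a + sumℕ f ≡⟨ cong (a +_) (sumℕ-split f j) ⟩
  a + (f j + sumℕ (zeroAtℕ j f)) ≡⟨ sym (ℕₚ.+-assoc a _ _) ⟩
  (a + f j) + sumℕ (zeroAtℕ j f) ≡⟨ cong₂ _+_ e (sumℕ-cong k) ⟩
  (b + g j) + sumℕ (zeroAtℕ j g) ≡⟨ ℕₚ.+-assoc b _ _ ⟩
  b + (g j + sumℕ (zeroAtℕ j g)) ≡⟨ cong (b +_) (sym (sumℕ-split g j)) ⟩
  b + sumℕ g ∎
  where
  open ≡-Reasoning
  k : ∀ i → zeroAtℕ j f i ≡ zeroAtℕ j g i
  k i with j ≟ i
  ... | yes _ = refl
  ... | no n = h i n

sumZ-change₂ : ∀ {k} (f g : Fin k → Z3) i j → i ≢ j → (∀ l → i ≢ l → j ≢ l → f l ≡ g l) →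
  ∀ a b → a ⊕ (f i ⊕ f j) ≡ b ⊕ (g i ⊕ g j) → a ⊕ sumZ f ≡ b ⊕ sumZ g
sumZ-change₂ f g i j i≢j h a b e = trans (trans (cong (a ⊕_) (sumZ-split f i)) (sym (⊕-assoc a _ _)))
  (trans (sumZ-change (zeroAt i f) (zeroAt i g) j k (a ⊕ f i) (b ⊕ g i)
     (trans (cong ((a ⊕ f i) ⊕_) (zj f)) (trans (⊕-assoc a _ _) (trans e (trans (sym (⊕-assoc b _ _)) (cong ((b ⊕ g i) ⊕_) (sym (zj g))))))))
  (trans (⊕-assoc b _ _) (cong (b ⊕_) (sym (sumZ-split g i)))))
  where
  zj : ∀ f → zeroAt i f j ≡ f j
  zj f rewrite ≡ᵇ-≢ i≢j = refl
  k : ∀ l → j ≢ l → zeroAt i f l ≡ zeroAt i g l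
  k l n with i ≟ l
  ... | yes _ = refl
  ... | no n' = h l n' n

sumℕ-change₂ : ∀ {k} (f g : Fin k → ℕ) i j → i ≢ j → (∀ l → i ≢ l → j ≢ l → f l ≡ g l) →
  ∀ a b → a + (f i + f j) ≡ b + (g i + g j) → a + sumℕ f ≡ b + sumℕ g
sumℕ-change₂ f g i j i≢j h a b e = trans (trans (cong (a +_) (sumℕ-split f i)) (sym (ℕₚ.+-assoc a _ _)))
  (trans (sumℕ-change (zeroAtℕ i f) (zeroAtℕ i g) j k (a + f i) (b + g i)
     (trans (cong ((a + f i) +_) (zj f)) (trans (ℕₚ.+-assoc a _ _) (trans e (trans (sym (ℕₚ.+-assoc b _ _)) (cong ((b + g i) +_) (sym (zj g))))))))
  (trans (ℕₚ.+-assoc b _ _) (cong (b +_) (sym (sumℕ-split g i)))))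
  where
  zj : ∀ f → zeroAtℕ i f j ≡ f j
  zj f rewrite ≡ᵇ-≢ i≢j = refl
  k : ∀ l → j ≢ l → zeroAtℕ i f l ≡ zeroAtℕ i g l
  k l n with i ≟ l
  ... | yes _ = refl
  ... | no n' = h l n' n

ind-true : ∀ {b} → b ≡ true → ind b ≡ 1
ind-true refl = refl

-- The predicate for the remaining elements is again of the form that the lemma accepts. Iteration
-- lists, for instance, the four edges at a vertex of degree four.
count-pick : ∀ {k} (p : Fin k → Bool) {c} → sumℕ (ind ∘ p) ≡ suc c →
  Σ (Fin k) λ j → p j ≡ true × sumℕ (ind ∘ (λ i → p i ∧ not (j ≡ᵇ i))) ≡ c
count-pick {k} p {c} h with Finₚ.any? (λ i → p i ≟B true)
... | no n = ⊥-elim (ℕₚ.0≢1+n (trans (sym (sumℕ-zero λ i → cong ind (bool-ne λ e → n (i , e)))) h))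
... | yes (j , e) = j , e , ℕₚ.suc-injective (trans (sym (trans (sumℕ-split (ind ∘ p) j) (cong₂ _+_ (ind-true e) (sumℕ-cong q)))) h)
  where
  q : ∀ i → zeroAtℕ j (ind ∘ p) i ≡ ind (p i ∧ not (j ≡ᵇ i))
  q i with j ≟ i | p i
  ... | yes _ | true = refl
  ... | yes _ | false = refl
  ... | no _ | true = refl
  ... | no _ | false = refl

count-none : ∀ {k} (p : Fin k → Bool) → sumℕ (ind ∘ p) ≡ 0 → ∀ i → p i ≡ false
count-none p h i = bool-ne λ e → ℕₚ.<⇒≢ (ℕₚ.≤-trans (ℕₚ.≤-reflexive (sym (ind-true e)))
  (ℕₚ.≤-trans (ℕₚ.m≤m+n (ind (p i)) _) (ℕₚ.≤-reflexive (sym (sumℕ-split (ind ∘ p) i))))) (sym h)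

-- Exhaustive search over functions between finite types

cons : ∀ {k} {X : Set} → X → (Fin k → X) → Fin (suc k) → X
cons x f zero = x
cons x f (suc i) = f i

-- The search rebuilds a function from its values and so meets every function only up to pointwise
-- equality; hence the hypothesis that `P` respects it.
anyFun? : {X : Set} → (∀ {Q : X → Set} → (∀ x → Dec (Q x)) → Dec (Σ X Q)) →
  ∀ {k} {P : (Fin k → X) → Set} → (∀ {f g} → (∀ i → f i ≡ g i) → P f → P g) →
  (∀ f → Dec (P f)) → Dec (Σ (Fin k → X) P)
anyFun? s {zero} {P} ext P? with P? (λ ())
... | yes p = yes (_ , p)
... | no n = no λ (f , p) → n (ext (λ ()) p)
anyFun? s {suc k} {P} ext P? = map′
  (λ (x , f , p) → cons x f , p)
  (λ (f , p) → f zero , f ∘ suc , ext (λ { zero → refl ; (suc i) → refl }) p)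
  (s λ x → anyFun? s {k} {λ f → P (cons x f)} (λ e → ext λ { zero → refl ; (suc i) → e i }) (λ f → P? (cons x f)))

anyB? : {Q : Bool → Set} → (∀ b → Dec (Q b)) → Dec (Σ Bool Q)
anyB? Q? with Q? true | Q? false
... | yes p | _ = yes (true , p)
... | no _ | yes p = yes (false , p)
... | no n | no m = no λ { (true , p) → n p ; (false , p) → m p }

anyOr? : ∀ {k} {P : (Fin k → Bool) → Set} → (∀ {f g} → (∀ i → f i ≡ g i) → P f → P g) →
  (∀ f → Dec (P f)) → Dec (Σ (Fin k → Bool) P)
anyOr? = anyFun? anyB?

-- Vertex sets: boundary, net outflow, total boundary value

VSet : Gr → Set
VSet G = V G → Bool

p₁ p₂ : (G : Gr) → E G → V G
p₁ G e = proj₁ (ends G e)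
p₂ G e = proj₂ (ends G e)

cr touch : (G : Gr) → VSet G → E G → Bool
cr G A e = A (p₁ G e) xor A (p₂ G e)
touch G A e = A (p₁ G e) ∨ A (p₂ G e)

-- The degree of the vertex obtained by contracting `A`.
dd : (G : Gr) → VSet G → ℕ
dd G A = sumℕ (λ e → ind (cr G A e))

-- Contribution of one edge to the net outflow of a set, given whether its tail and its head lie in
-- the set.
ct : Bool → Bool → Z3
ct t h = (if t then z1 else z0) ⊕ (if h then z2 else z0)

ctE : (G : Gr) → Orientation G → VSet G → E G → Z3
ctE G o A e = ct (A (tl G o e)) (A (hd G o e))

nt : (G : Gr) → Orientation G → VSet G → Z3
nt G o A = sumZ (ctE G o A)

bs : (G : Gr) → VSet G → Z3
bs G A = sumZ (λ v → if A v then β G v else z0)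

Sat : (G : Gr) → Orientation G → VSet G → Set
Sat G o A = nt G o A ≡ bs G A

-- Unlike the condition on components, this survives when edges are lifted, or deleted with a
-- correction of the boundary. For the canvases considered here both conditions agree, by
-- `Cv→Bordered` and `Bordered→Tot`.
Tot : Gr → Set
Tot G = bs G (λ _ → true) ≡ z0

ct-same : ∀ b → ct b b ≡ z0
ct-same = from-yes (allB? λ b → ct b b ≟3 z0)

xor-true : ∀ {a b} → a xor b ≡ true → a ≡ not b
xor-true {true} {false} _ = refl
xor-true {false} {true} _ = refl

xor-false : ∀ {a b} → a xor b ≡ false → a ≡ b
xor-false {true} {true} _ = refl
xor-false {false} {false} _ = refl

dd-cong : ∀ G {A A'} → (∀ v → A v ≡ A' v) → dd G A ≡ dd G A'
dd-cong G h = sumℕ-cong {m G} λ e → cong₂ (λ a b → ind (a xor b)) (h (p₁ G e)) (h (p₂ G e))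

bs-cong : ∀ G {A A'} → (∀ v → A v ≡ A' v) → bs G A ≡ bs G A'
bs-cong G h = sumZ-cong {n G} λ v → cong (λ b → if b then β G v else z0) (h v)

nt-cong : ∀ G o {A A'} → (∀ v → A v ≡ A' v) → nt G o A ≡ nt G o A'
nt-cong G o h = sumZ-cong {m G} λ e → cong₂ ct (h (tl G o e)) (h (hd G o e))

Sat-cong : ∀ G {o A A'} → (∀ v → A v ≡ A' v) → Sat G o A → Sat G o A'
Sat-cong G {o} h s = trans (sym (nt-cong G o h)) (trans s (bs-cong G h))

ctE-local : ∀ G {o o'} A e → (cr G A e ≡ true → o e ≡ o' e) → ctE G o A e ≡ ctE G o' A e
ctE-local G {o} {o'} A e h with cr G A e in eq
... | true rewrite h refl = refl
... | false with o e | o' e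
... | true | true = refl
... | false | false = refl
... | true | false rewrite xor-false {A (p₁ G e)} eq = refl
... | false | true rewrite xor-false {A (p₁ G e)} eq = refl

nt-local : ∀ G {o o'} A → (∀ e → cr G A e ≡ true → o e ≡ o' e) → nt G o A ≡ nt G o' A
nt-local G {o} {o'} A h = sumZ-cong {m G} λ e → ctE-local G {o} {o'} A e (h e)

Sat-local : ∀ G {o o' : Orientation G} A → (∀ e → cr G A e ≡ true → o e ≡ o' e) → Sat G o A → Sat G o' A
Sat-local G {o} {o'} A h s = trans (sym (nt-local G {o} {o'} A h)) s

cr⇒touch : ∀ G A e → cr G A e ≡ true → touch G A e ≡ true
cr⇒touch G A e h with A (p₁ G e) | A (p₂ G e)
... | true | _ = refl
... | false | true = refl

-- Labelings (contractions)

cls : ∀ {k p} → (Fin k → Fin p) → Fin p → Fin k → Bool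
cls f q v = q ≡ᵇ f v

-- A flow of the contraction by `f`, expressed on the edges of `G`; edges inside a class contribute
-- nothing. This avoids `quot`, whose edges are positions in a filtered list, and makes iterated
-- contraction a composition of maps.
Flow : (G : Gr) {p : ℕ} → (V G → Fin p) → Orientation G → Set
Flow G f o = ∀ q → Sat G o (cls f q)

Ext : (G : Gr) {p : ℕ} → (V G → Fin p) → Fin p → Orientation G → Set
Ext G f t ψ = Σ (Orientation G) λ o → Flow G f o × (∀ e → touch G (cls f t) e ≡ true → o e ≡ ψ e)

if-⊕ : ∀ b x y → (if b then x ⊕ y else z0) ≡ (if b then x else z0) ⊕ (if b then y else z0)
if-⊕ true x y = refl
if-⊕ false x y = refl

if-sumZ : ∀ {k} b (f : Fin k → Z3) → (if b then sumZ f else z0) ≡ sumZ (λ i → if b then f i else z0)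
if-sumZ true f = refl
if-sumZ {k} false f = sym (sumZ-zero {k} λ _ → refl)

sum-pick : ∀ {k} (C : Fin k → Bool) j x → sumZ (λ q → if C q then (if q ≡ᵇ j then x else z0) else z0) ≡ (if C j then x else z0)
sum-pick C j x = trans (sumZ-single _ j h) (cong (λ b → if C j then (if b then x else z0) else z0) (≡ᵇ-refl j))
  where
  h : ∀ i → j ≢ i → (if C i then (if i ≡ᵇ j then x else z0) else z0) ≡ z0
  h i n rewrite ≡ᵇ-≢ {a = i} {j} (n ∘ sym) with C i
  ... | true = refl
  ... | false = refl

-- An edge inside the union of the selected classes is counted once as outgoing and once as
-- incoming, so it cancels.
nt-push : ∀ G o {p} (f : V G → Fin p) (C : Fin p → Bool) →
  nt G o (C ∘ f) ≡ sumZ (λ q → if C q then nt G o (cls f q) else z0)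
nt-push G o {p} f C = sym (begin
  sumZ (λ q → if C q then nt G o (cls f q) else z0)
    ≡⟨ sumZ-cong {p} (λ q → if-sumZ {m G} (C q) (ctE G o (cls f q))) ⟩
  sumZ (λ q → sumZ (λ e → if C q then ctE G o (cls f q) e else z0))
    ≡⟨ sumZ-swap (λ q e → if C q then ctE G o (cls f q) e else z0) ⟩
  sumZ (λ e → sumZ (λ q → if C q then ctE G o (cls f q) e else z0))
    ≡⟨ sumZ-cong {m G} (λ e → h (f (tl G o e)) (f (hd G o e))) ⟩
  nt G o (C ∘ f) ∎)
  where
  open ≡-Reasoning
  h : ∀ s t → sumZ (λ q → if C q then ct (q ≡ᵇ s) (q ≡ᵇ t) else z0) ≡ ct (C s) (C t)
  h s t = trans (sumZ-cong {p} λ q → if-⊕ (C q) (if q ≡ᵇ s then z1 else z0) (if q ≡ᵇ t then z2 else z0))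
    (trans (sumZ-⊕ {p} _ _) (cong₂ _⊕_ (sum-pick C s z1) (sum-pick C t z2)))

bs-push : ∀ G {p} (f : V G → Fin p) (C : Fin p → Bool) →
  bs G (C ∘ f) ≡ sumZ (λ q → if C q then bs G (cls f q) else z0)
bs-push G {p} f C = sym (begin
  sumZ (λ q → if C q then bs G (cls f q) else z0)
    ≡⟨ sumZ-cong {p} (λ q → if-sumZ {n G} (C q) (λ v → if q ≡ᵇ f v then β G v else z0)) ⟩
  sumZ (λ q → sumZ (λ v → if C q then (if q ≡ᵇ f v then β G v else z0) else z0))
    ≡⟨ sumZ-swap {p} {n G} _ ⟩
  sumZ (λ v → sumZ (λ q → if C q then (if q ≡ᵇ f v then β G v else z0) else z0))
    ≡⟨ sumZ-cong {n G} (λ v → sum-pick C (f v) (β G v)) ⟩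
  bs G (C ∘ f) ∎)
  where open ≡-Reasoning

Sat-push : ∀ G {o p} (f : V G → Fin p) (C : Fin p → Bool) →
  (∀ q → C q ≡ true → Sat G o (cls f q)) → Sat G o (C ∘ f)
Sat-push G {o} {p} f C h = trans (nt-push G o f C) (trans (sumZ-cong {p} k) (sym (bs-push G f C)))
  where
  k : ∀ q → (if C q then nt G o (cls f q) else z0) ≡ (if C q then bs G (cls f q) else z0)
  k q with C q in eq
  ... | true = h q eq
  ... | false = refl

Sat-set : ∀ G {o} (A : VSet G) → (∀ v → A v ≡ true → Sat G o (cls id v)) → Sat G o A
Sat-set G A h = Sat-push G id A h

nt-all : ∀ G o → nt G o (λ _ → true) ≡ z0
nt-all G o = sumZ-zero {m G} {f = ctE G o (λ _ → true)} (λ _ → refl)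

nt-split : ∀ G o {A B C : VSet G} → (∀ v → ct (A v) false ⊕ ct (B v) false ≡ ct (C v) false) →
  nt G o A ⊕ nt G o B ≡ nt G o C
nt-split G o {A} {B} {C} h = trans (sym (sumZ-⊕ {m G} _ _)) (sumZ-cong {m G} λ e → k (A (tl G o e)) (B (tl G o e)) (C (tl G o e)) (A (hd G o e)) (B (hd G o e)) (C (hd G o e)) (h (tl G o e)) (h (hd G o e)))
  where
  k : ∀ a b c a' b' c' → ct a false ⊕ ct b false ≡ ct c false → ct a' false ⊕ ct b' false ≡ ct c' false →
    ct a a' ⊕ ct b b' ≡ ct c c'
  k = from-yes (allB? λ a → allB? λ b → allB? λ c → allB? λ a' → allB? λ b' → allB? λ c' →
    ((ct a false ⊕ ct b false) ≟3 ct c false) →-dec (((ct a' false ⊕ ct b' false) ≟3 ct c' false) →-dec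
    ((ct a a' ⊕ ct b b') ≟3 ct c c')))

bs-split : ∀ G {A B C : VSet G} → (∀ v → ct (A v) false ⊕ ct (B v) false ≡ ct (C v) false) →
  bs G A ⊕ bs G B ≡ bs G C
bs-split G {A} {B} {C} h = trans (sym (sumZ-⊕ {n G} _ _)) (sumZ-cong {n G} λ v → k (A v) (B v) (C v) (β G v) (h v))
  where
  k : ∀ a b c x → ct a false ⊕ ct b false ≡ ct c false →
    (if a then x else z0) ⊕ (if b then x else z0) ≡ (if c then x else z0)
  k = from-yes (allB? λ a → allB? λ b → allB? λ c → all3? λ x →
    ((ct a false ⊕ ct b false) ≟3 ct c false) →-dec (((if a then x else z0) ⊕ (if b then x else z0)) ≟3 (if c then x else z0)))

compl-split : ∀ b → ct b false ⊕ ct (not b) false ≡ ct true false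
compl-split = from-yes (allB? λ b → (ct b false ⊕ ct (not b) false) ≟3 ct true false)

-- The net outflow of the whole vertex set and its total boundary both vanish, so balance of a set
-- and of its complement are equivalent. It therefore suffices to check a flow at all vertices but
-- one.
Sat-compl : ∀ G {o} → Tot G → (A : VSet G) → Sat G o (not ∘ A) → Sat G o A
Sat-compl G {o} tot A s = ⊕-cancelʳ (nt G o (not ∘ A)) _ _ (begin
  nt G o A ⊕ nt G o (not ∘ A) ≡⟨ nt-split G o {A} {not ∘ A} {λ _ → true} (compl-split ∘ A) ⟩
  nt G o (λ _ → true) ≡⟨ nt-all G o ⟩
  z0 ≡⟨ sym tot ⟩
  bs G (λ _ → true) ≡⟨ sym (bs-split G {A} {not ∘ A} {λ _ → true} (compl-split ∘ A)) ⟩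
  bs G A ⊕ bs G (not ∘ A) ≡⟨ cong (bs G A ⊕_) (sym s) ⟩
  bs G A ⊕ nt G o (not ∘ A) ∎)
  where open ≡-Reasoning

Sat-congO : ∀ G {o o'} A → (∀ e → o e ≡ o' e) → Sat G o A → Sat G o' A
Sat-congO G {o} {o'} A h = Sat-local G {o} {o'} A (λ e _ → h e)

Ext? : ∀ G {p} (f : V G → Fin p) t ψ → Dec (Ext G f t ψ)
Ext? G f t ψ = anyOr?
  (λ {o} {o'} h (fl , ag) → (λ q → Sat-congO G {o} {o'} (cls f q) h (fl q)) , λ e k → trans (sym (h e)) (ag e k))
  (λ o → Finₚ.all? (λ q → nt G o (cls f q) ≟3 bs G (cls f q))
    ×-dec Finₚ.all? (λ e → (touch G (cls f t) e ≟B true) →-dec (o e ≟B ψ e)))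

cls-cong : ∀ {k p} {f g : Fin k → Fin p} → (∀ v → f v ≡ g v) → ∀ q v → cls f q v ≡ cls g q v
cls-cong h q v = cong (q ≡ᵇ_) (h v)

touch-mono : ∀ G {A A' : VSet G} → (∀ v → A v ≡ true → A' v ≡ true) → ∀ e → touch G A e ≡ true → touch G A' e ≡ true
touch-mono G {A} {A'} h e k with A (p₁ G e) in eq
... | true rewrite h _ eq = refl
... | false rewrite h _ k = Boolₚ.∨-zeroʳ _

Ext-congL : ∀ G {p} {f g : V G → Fin p} {t ψ} → (∀ v → f v ≡ g v) → Ext G f t ψ → Ext G g t ψ
Ext-congL G {f = f} {g} {t} h (o , fl , ag) = o , (λ q → Sat-cong G (cls-cong h q) (fl q)) ,
  λ e k → ag e (touch-mono G {cls g t} {cls f t} (λ v → trans (cls-cong h t v)) e k)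

-- Since no other class joins the tip class, the edges on which agreement with `ψ` is demanded do
-- not increase.
Ext-push : ∀ G {p N} {f : V G → Fin p} {t ψ} (g : Fin p → Fin N) → (∀ q → g q ≡ g t → q ≡ t) →
  Ext G f t ψ → Ext G (g ∘ f) (g t) ψ
Ext-push G {f = f} {t} g tr (o , fl , ag) = o , (λ r → Sat-push G f (λ q → r ≡ᵇ g q) (λ q _ → fl q)) ,
  λ e k → ag e (touch-mono G {cls (g ∘ f) (g t)} {cls f t} (λ v e' → ≡ᵇ-≡ (sym (tr _ (sym (≡ᵇ-true (g t) (g (f v)) e'))))) e k)

Ext-relabel : ∀ G {p N} {f : V G → Fin p} {h : V G → Fin N} {t ψ} (g : Fin p → Fin N) → (∀ q → g q ≡ g t → q ≡ t) →
  (∀ v → h v ≡ g (f v)) → Ext G f t ψ → Ext G h (g t) ψ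
Ext-relabel G {t = t} g tr e x = Ext-congL G {t = g t} (λ v → sym (e v)) (Ext-push G g tr x)

-- Coarsest contraction to which a preflow does not extend

allOr : ∀ {k} {P Q : Fin k → Set} → (∀ i → P i ⊎ Q i) → (∀ i → P i) ⊎ Σ (Fin k) Q
allOr {zero} h = inj₁ λ ()
allOr {suc k} h with h zero | allOr (h ∘ suc)
... | inj₂ q | _ = inj₂ (zero , q)
... | inj₁ p | inj₂ (i , q) = inj₂ (suc i , q)
... | inj₁ p | inj₁ r = inj₁ λ { zero → p ; (suc i) → r i }

Dec→⊎ : {P : Set} → Dec P → P ⊎ ¬ P
Dec→⊎ (yes p) = inj₁ p
Dec→⊎ (no n) = inj₂ n

-- Labelings arise as arbitrary maps. Passing to the image gives the surjection that `FlowCritical`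
-- and expansions ask for, without changing which vertices are identified.
record Factor {k N : ℕ} (h : Fin k → Fin N) : Set where
  field
    size : ℕ
    fac : Fin k → Fin size
    fac-surj : Surj fac
    inj : Fin size → Fin N
    inj-inj : ∀ {a b} → inj a ≡ inj b → a ≡ b
    fac-eq : ∀ v → h v ≡ inj (fac v)

factor : ∀ {k N} (h : Fin k → Fin N) → Factor h
factor {k} {N} h with allOr (λ q → Dec→⊎ (Finₚ.any? λ v → h v ≟ q))
... | inj₁ s = record { size = N ; fac = h ; fac-surj = s ; inj = id ; inj-inj = id ; fac-eq = λ _ → refl }
factor {k} {suc N} h | inj₂ (q , n) = record
  { size = size ; fac = fac ; fac-surj = fac-surj
  ; inj = λ a → punchIn q (inj a)
  ; inj-inj = λ e → inj-inj (Finₚ.punchIn-injective q _ _ e)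
  ; fac-eq = λ v → trans (sym (Finₚ.punchIn-punchOut (ne v))) (cong (punchIn q) (fac-eq v)) }
  where
  ne : ∀ v → q ≢ h v
  ne v e = n (v , sym e)
  open Factor (factor (λ v → punchOut (ne v)))

merge : ∀ {p} (u v : Fin (suc p)) → u ≢ v → Fin (suc p) → Fin p
merge u v ne q with v ≟ q
... | yes _ = punchOut {i = v} {u} (ne ∘ sym)
... | no n = punchOut n

merge-punchIn : ∀ {p} (u v : Fin (suc p)) (ne : u ≢ v) r → merge u v ne (punchIn v r) ≡ r
merge-punchIn u v ne r with v ≟ punchIn v r
... | yes e = ⊥-elim (Finₚ.punchInᵢ≢i v r (sym e))
... | no n = trans (Finₚ.punchOut-cong v refl) (Finₚ.punchOut-punchIn v)

-- Any map that identifies `u` and `v` factors through `merge u v`, with `punchIn v` as a section.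
merge-sec : ∀ {p} (u v : Fin (suc p)) (ne : u ≢ v) {N} (g : Fin (suc p) → Fin N) → g u ≡ g v → ∀ q → g q ≡ g (punchIn v (merge u v ne q))
merge-sec u v ne g e q with v ≟ q
... | yes refl = trans (sym e) (cong g (sym (Finₚ.punchIn-punchOut _)))
... | no n = cong g (sym (Finₚ.punchIn-punchOut _))

merge-tip : ∀ {p} (u v : Fin (suc p)) (ne : u ≢ v) t → t ≢ u → t ≢ v → ∀ q → merge u v ne q ≡ merge u v ne t → q ≡ t
merge-tip u v ne t tu tv q e with v ≟ q | v ≟ t
... | _ | yes h = ⊥-elim (tv (sym h))
... | yes _ | no n = ⊥-elim (tu (sym (Finₚ.punchOut-injective _ n e)))
... | no m | no n = Finₚ.punchOut-injective m n e

-- Criticality of the contraction by `f`, phrased with arbitrary coarsening maps, so that no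
-- iterated quotient has to be formed.
CritL : (G : Gr) {p : ℕ} → (V G → Fin p) → Fin p → Orientation G → Set
CritL G {p} f t ψ = ∀ {N} (g : Fin p → Fin N) → (∀ q → g q ≡ g t → q ≡ t) → ∀ u v → u ≢ v → g u ≡ g v →
  Ext G (g ∘ f) (g t) ψ

BadPair : (G : Gr) {p : ℕ} → (V G → Fin (suc p)) → Fin (suc p) → Orientation G → Set
BadPair G f t ψ = Σ _ λ u → Σ _ λ v → Σ (u ≢ v) λ ne → t ≢ u × t ≢ v × ¬ Ext G (merge u v ne ∘ f) (merge u v ne t) ψ

-- Every coarsening that identifies `u` and `v` factors through `merge u v`, and extensions pass on
-- to coarser contractions. So finitely many mergers of two classes decide criticality.
critOrBad : ∀ G {p} (f : V G → Fin (suc p)) t ψ → CritL G f t ψ ⊎ BadPair G f t ψ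
critOrBad G {p} f t ψ with allOr (λ u → allOr (λ v → test u v))
  where
  Ok Bad : Fin (suc p) → Fin (suc p) → Set
  Ok u v = u ≢ v → t ≢ u → t ≢ v → Σ (u ≢ v) λ ne → Ext G (merge u v ne ∘ f) (merge u v ne t) ψ
  Bad u v = Σ (u ≢ v) λ ne → t ≢ u × t ≢ v × ¬ Ext G (merge u v ne ∘ f) (merge u v ne t) ψ
  test : ∀ u v → Ok u v ⊎ Bad u v
  test u v with u ≟ v | t ≟ u | t ≟ v
  ... | yes e | _ | _ = inj₁ λ n _ _ → ⊥-elim (n e)
  ... | no _ | yes e | _ = inj₁ λ _ n _ → ⊥-elim (n e)
  ... | no _ | no _ | yes e = inj₁ λ _ _ n → ⊥-elim (n e)
  ... | no a | no b | no c with Ext? G (merge u v a ∘ f) (merge u v a t) ψ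
  ... | yes x = inj₁ λ _ _ _ → a , x
  ... | no x = inj₂ (a , b , c , x)
... | inj₂ (u , v , b) = inj₂ (u , v , b)
... | inj₁ ok = inj₁ crit
  where
  crit : CritL G f t ψ
  crit g tr u v ne e with t ≟ u | t ≟ v
  ... | yes refl | _ = ⊥-elim (ne (sym (tr v (sym e))))
  ... | no _ | yes refl = ⊥-elim (ne (tr u e))
  ... | no a | no b with ok u v ne a b
  ... | ne' , x = subst (λ s → Ext G (g ∘ f) s ψ) (sym (merge-sec u v ne' g e t))
    (Ext-relabel G (λ r → g (punchIn v r)) tr' (λ w → merge-sec u v ne' g e (f w)) x)
    where
    tr' : ∀ q → g (punchIn v q) ≡ g (punchIn v (merge u v ne' t)) → q ≡ merge u v ne' t
    tr' q h = trans (sym (merge-punchIn u v ne' q)) (cong (merge u v ne') (tr _ (trans h (sym (merge-sec u v ne' g e t)))))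

record Coarse (G : Gr) {N : ℕ} (f : V G → Fin N) (z : V G) (ψ : Orientation G) : Set where
  field
    p : ℕ
    lab : V G → Fin p
    surj : Surj lab
    refines : ∀ {u v} → f u ≡ f v → lab u ≡ lab v
    tip : ∀ {v} → lab v ≡ lab z → f v ≡ f z
    nonext : ¬ Ext G lab (lab z) ψ
    crit : CritL G lab (lab z) ψ

-- Each call merges two classes whose merger still obstructs extension; the number of classes
-- decreases, so the recursion ends at a critical contraction.
coarsenSurj : ∀ G {p} (f : V G → Fin p) z ψ → Surj f → ¬ Ext G f (f z) ψ → Coarse G f z ψ
coarsenSurj G {zero} f z ψ s n with f z
... | ()
coarsenSurj G {suc p} f z ψ s n with critOrBad G f (f z) ψ
... | inj₁ c = record { p = suc p ; lab = f ; surj = s ; refines = id ; tip = id ; nonext = n ; crit = c }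
... | inj₂ (u , v , ne , a , b , x) = record
  { p = C.p ; lab = C.lab ; surj = C.surj ; refines = λ e → C.refines (cong (merge u v ne) e)
  ; tip = λ e → merge-tip u v ne (f z) a b _ (C.tip e) ; nonext = C.nonext ; crit = C.crit }
  where
  s' : Surj (merge u v ne ∘ f)
  s' q with s (punchIn v q)
  ... | w , e = w , trans (cong (merge u v ne) e) (merge-punchIn u v ne q)
  module C = Coarse (coarsenSurj G (merge u v ne ∘ f) z ψ s' x)

coarsen : ∀ G {N} (f : V G → Fin N) z ψ → ¬ Ext G f (f z) ψ → Coarse G f z ψ
coarsen G f z ψ n = record
  { p = C.p ; lab = C.lab ; surj = C.surj
  ; refines = λ {u} {v} e → C.refines (F.inj-inj (trans (sym (F.fac-eq u)) (trans e (F.fac-eq v))))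
  ; tip = λ {v} e → trans (F.fac-eq v) (trans (cong F.inj (C.tip e)) (sym (F.fac-eq z)))
  ; nonext = C.nonext ; crit = C.crit }
  where
  module F = Factor (factor f)
  n' : ¬ Ext G F.fac (F.fac z) ψ
  n' x = n (subst (λ s → Ext G f s ψ) (sym (F.fac-eq z)) (Ext-relabel G F.inj (λ q → F.inj-inj) F.fac-eq x))
  module C = Coarse (coarsenSurj G F.fac z ψ F.fac-surj n')

-- Sums over filtered lists

sumZ-filter : ∀ {A : Set} (p : A → Bool) (F : A → Z3) L →
  sumZ (λ i → F (lookup (filterᵇ p L) i)) ≡ sumZ (λ i → if p (lookup L i) then F (lookup L i) else z0)
sumZ-filter p F [] = refl
sumZ-filter p F (x ∷ L) with p x
... | true = cong (F x ⊕_) (sumZ-filter p F L)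
... | false = sumZ-filter p F L

sumℕ-filter : ∀ {A : Set} (p : A → Bool) (F : A → ℕ) L →
  sumℕ (λ i → F (lookup (filterᵇ p L) i)) ≡ sumℕ (λ i → if p (lookup L i) then F (lookup L i) else 0)
sumℕ-filter p F [] = refl
sumℕ-filter p F (x ∷ L) with p x
... | true = cong (F x +_) (sumℕ-filter p F L)
... | false = sumℕ-filter p F L

sumZ-tabulate : ∀ {A : Set} {k} (g : Fin k → A) (F : A → Z3) → sumZ (λ i → F (lookup (tabulate g) i)) ≡ sumZ (F ∘ g)
sumZ-tabulate {k = zero} g F = refl
sumZ-tabulate {k = suc k} g F = cong (F (g zero) ⊕_) (sumZ-tabulate (g ∘ suc) F)

sumℕ-tabulate : ∀ {A : Set} {k} (g : Fin k → A) (F : A → ℕ) → sumℕ (λ i → F (lookup (tabulate g) i)) ≡ sumℕ (F ∘ g)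
sumℕ-tabulate {k = zero} g F = refl
sumℕ-tabulate {k = suc k} g F = cong (F (g zero) +_) (sumℕ-tabulate (g ∘ suc) F)

lookup-filter : ∀ {A : Set} (p : A → Bool) L i → p (lookup (filterᵇ p L) i) ≡ true
lookup-filter p (x ∷ L) i with p x in eq
lookup-filter p (x ∷ L) zero | true = eq
lookup-filter p (x ∷ L) (suc i) | true = lookup-filter p L i
lookup-filter p (x ∷ L) i | false = lookup-filter p L i

filter-index : ∀ {A : Set} (p : A → Bool) L i → p (lookup L i) ≡ true → Σ _ λ j → lookup (filterᵇ p L) j ≡ lookup L i
filter-index p (x ∷ L) zero h with p x
filter-index p (x ∷ L) zero refl | true = zero , refl
filter-index p (x ∷ L) (suc i) h with p x
... | true = let (j , e) = filter-index p L i h in suc j , e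
... | false = filter-index p L i h

tabulate-index : ∀ {A : Set} {k} (g : Fin k → A) j → Σ _ λ i → lookup (tabulate g) i ≡ g j
tabulate-index g zero = zero , refl
tabulate-index g (suc j) = let (i , e) = tabulate-index (g ∘ suc) j in suc i , e

lookup-injective : ∀ {A : Set} {L : List A} → Unique L → ∀ i j → lookup L i ≡ lookup L j → i ≡ j
lookup-injective {L = x ∷ L} (h ∷ u) zero zero e = refl
lookup-injective {L = x ∷ L} (h ∷ u) zero (suc j) e = ⊥-elim (All.lookup h (∈-lookup {xs = L} j) e)
lookup-injective {L = x ∷ L} (h ∷ u) (suc i) zero e = ⊥-elim (All.lookup h (∈-lookup {xs = L} i) (sym e))
lookup-injective {L = x ∷ L} (h ∷ u) (suc i) (suc j) e = cong suc (lookup-injective u i j e)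

-- Edges of a contraction

keep : (G : Gr) {p : ℕ} → (V G → Fin p) → E G → Bool
keep G f e = not (f (p₁ G e) ≡ᵇ f (p₂ G e))

orig-keep : ∀ G {p} (f : V G → Fin p) i → keep G f (orig G f i) ≡ true
orig-keep G f i = lookup-filter (keep G f) (allFin (m G)) i

back : ∀ G {p} (f : V G → Fin p) e → keep G f e ≡ true → Σ (E (quot G f)) λ i → orig G f i ≡ e
back G f e h with tabulate-index {k = m G} id e
... | i , q with filter-index (keep G f) (allFin (m G)) i (trans (cong (keep G f) q) h)
... | j , r = j , trans r q

orig-inj : ∀ G {p} (f : V G → Fin p) {i j} → orig G f i ≡ orig G f j → i ≡ j
orig-inj G f = lookup-injective (Uniqueₚ.filter⁺ (λ e → T? (keep G f e)) (Uniqueₚ.allFin⁺ (m G))) _ _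

sumZ-quot : ∀ G {p} (f : V G → Fin p) (F : E G → Z3) → (∀ e → keep G f e ≡ false → F e ≡ z0) →
  sumZ {m (quot G f)} (λ i → F (orig G f i)) ≡ sumZ F
sumZ-quot G f F h = trans (sumZ-filter (keep G f) F (allFin (m G)))
  (trans (sumZ-tabulate {k = m G} id (λ e → if keep G f e then F e else z0)) (sumZ-cong {m G} k))
  where
  k : ∀ e → (if keep G f e then F e else z0) ≡ F e
  k e with keep G f e in eq
  ... | true = refl
  ... | false = sym (h e eq)

sumℕ-quot : ∀ G {p} (f : V G → Fin p) (F : E G → ℕ) →
  sumℕ {m (quot G f)} (λ i → F (orig G f i)) ≡ sumℕ (λ e → if keep G f e then F e else 0)
sumℕ-quot G f F = trans (sumℕ-filter (keep G f) F (allFin (m G)))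
  (sumℕ-tabulate {k = m G} id (λ e → if keep G f e then F e else 0))

unkeep : ∀ G {p} (f : V G → Fin p) e → keep G f e ≡ false → f (p₁ G e) ≡ f (p₂ G e)
unkeep G f e h = ≡ᵇ-true _ _ (trans (sym (Boolₚ.not-involutive _)) (cong not h))

ctE-noncr : ∀ G o A e → A (p₁ G e) ≡ A (p₂ G e) → ctE G o A e ≡ z0
ctE-noncr G o A e h with o e
... | true rewrite h = ct-same (A (p₂ G e))
... | false rewrite h = ct-same (A (p₂ G e))

ctE-quot : ∀ G {p} (f : V G → Fin p) o C i → ctE (quot G f) (o ∘ orig G f) C i ≡ ctE G o (C ∘ f) (orig G f i)
ctE-quot G f o C i with o (orig G f i)
... | true = refl
... | false = refl

nt-quot : ∀ G {p} (f : V G → Fin p) o C → nt (quot G f) (o ∘ orig G f) C ≡ nt G o (C ∘ f)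
nt-quot G f o C = trans (sumZ-cong {m (quot G f)} (ctE-quot G f o C))
  (sumZ-quot G f (ctE G o (C ∘ f)) λ e k → ctE-noncr G o (C ∘ f) e (cong C (unkeep G f e k)))

dd-quot : ∀ G {p} (f : V G → Fin p) C → dd (quot G f) C ≡ dd G (C ∘ f)
dd-quot G f C = trans (sumℕ-quot G f (λ e → ind (cr G (C ∘ f) e))) (sumℕ-cong {m G} k)
  where
  k : ∀ e → (if keep G f e then ind (cr G (C ∘ f) e) else 0) ≡ ind (cr G (C ∘ f) e)
  k e with keep G f e in eq
  ... | true = refl
  ... | false rewrite unkeep G f e eq = cong ind (sym (Boolₚ.xor-same (C (f (p₂ G e)))))

β-quot : ∀ G {p} (f : V G → Fin p) q → β (quot G f) q ≡ bs G (cls f q)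
β-quot G f q = sumZ-cong {n G} λ v → cong (λ b → if b then β G v else z0) (≡ᵇ-sym (f v) q)

bs-quot : ∀ G {p} (f : V G → Fin p) C → bs (quot G f) C ≡ bs G (C ∘ f)
bs-quot G {p} f C = trans (sumZ-cong {p} λ q → cong (λ b → if C q then b else z0) (β-quot G f q)) (sym (bs-push G f C))

bs-single : ∀ G v → bs G (cls id v) ≡ β G v
bs-single G v = trans (sumZ-single {n G} _ v λ i h → cong (λ b → if b then β G i else z0) (≡ᵇ-≢ h))
  (cong (λ b → if b then β G v else z0) (≡ᵇ-refl v))

Sat-quot→ : ∀ G {p} (f : V G → Fin p) {o} C → Sat (quot G f) (o ∘ orig G f) C → Sat G o (C ∘ f)
Sat-quot→ G f {o} C s = trans (sym (nt-quot G f o C)) (trans s (bs-quot G f C))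

Sat-quot← : ∀ G {p} (f : V G → Fin p) {o} C → Sat G o (C ∘ f) → Sat (quot G f) (o ∘ orig G f) C
Sat-quot← G f {o} C s = trans (nt-quot G f o C) (trans s (sym (bs-quot G f C)))

Loopless-quot : ∀ G {p} (f : V G → Fin p) → Loopless (quot G f)
Loopless-quot G f i h with trans (sym (orig-keep G f i)) (cong not (≡ᵇ-≡ h))
... | ()

deg-dd : ∀ G → Loopless G → ∀ v → deg G v ≡ dd G (cls id v)
deg-dd G ll v = sumℕ-cong {m G} k
  where
  k : ∀ e → ind (v ≡ᵇ p₁ G e) + ind (v ≡ᵇ p₂ G e) ≡ ind (cr G (cls id v) e)
  k e with v ≡ᵇ p₁ G e in a | v ≡ᵇ p₂ G e in b
  ... | true | true = ⊥-elim (ll e (trans (sym (≡ᵇ-true v (p₁ G e) a)) (≡ᵇ-true v (p₂ G e) b)))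
  ... | true | false = refl
  ... | false | true = refl
  ... | false | false = refl

deg-quot : ∀ G {p} (f : V G → Fin p) q → deg (quot G f) q ≡ dd G (cls f q)
deg-quot G f q = trans (deg-dd (quot G f) (Loopless-quot G f) q) (dd-quot G f (cls id q))

Ext-quot← : ∀ G {p} (f : V G → Fin p) {N} (g : Fin p → Fin N) t ψ →
  Ext G (g ∘ f) t ψ → Ext (quot G f) g t (ψ ∘ orig G f)
Ext-quot← G f g t ψ (o , fl , ag) = o ∘ orig G f , (λ q → Sat-quot← G f {o} (cls g q) (fl q)) , λ i k → ag (orig G f i) k

Ext-quot→ : ∀ G {p} (f : V G → Fin p) {N} (g : Fin p → Fin N) t ψ →
  Ext (quot G f) g t (ψ ∘ orig G f) → Ext G (g ∘ f) t ψ
Ext-quot→ G f g t ψ (o' , fl , ag) = o , (λ q → Sat-quot→ G f {o} (cls g q) (Sat-congO (quot G f) {o'} {o ∘ orig G f} (cls g q) (λ i → sym (oo i)) (fl q))) , ag'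
  where
  -- Edges inside a class do not exist in the quotient and do not affect balance; giving them the
  -- value of `ψ` secures agreement at the tip class. The outcome of the test is an argument with
  -- its equation so that later proofs can match on it.
  choose : ∀ e b → keep G f e ≡ b → Bool
  choose e true k = o' (proj₁ (back G f e k))
  choose e false k = ψ e
  o : Orientation G
  o e = choose e (keep G f e) refl
  choose-t : ∀ e b (k : keep G f e ≡ b) i → orig G f i ≡ e → choose e b k ≡ o' i
  choose-t e true k i h = cong o' (orig-inj G f (trans (proj₂ (back G f e k)) (sym h)))
  choose-t e false k i refl with trans (sym (orig-keep G f i)) k
  ... | ()
  oo : ∀ i → o (orig G f i) ≡ o' i
  oo i = choose-t _ _ refl i refl
  choose-ag : ∀ e b (k : keep G f e ≡ b) → touch G (cls (g ∘ f) t) e ≡ true → choose e b k ≡ ψ e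
  choose-ag e true k h = trans (ag (proj₁ (back G f e k)) (trans (cong (touch G (cls (g ∘ f) t)) (proj₂ (back G f e k))) h))
    (cong ψ (proj₂ (back G f e k)))
  choose-ag e false k h = refl
  ag' : ∀ e → touch G (cls (g ∘ f) t) e ≡ true → o e ≡ ψ e
  ag' e h = choose-ag e _ refl h

touch-Incident : ∀ G v e → Incident G v e → touch G (cls id v) e ≡ true
touch-Incident G v e (inj₁ h) rewrite ≡ᵇ-≡ (sym h) = refl
touch-Incident G v e (inj₂ h) rewrite ≡ᵇ-≡ (sym h) = Boolₚ.∨-zeroʳ _

Incident-touch : ∀ G v e → touch G (cls id v) e ≡ true → Incident G v e
Incident-touch G v e h with v ≡ᵇ p₁ G e in eq
... | true = inj₁ (sym (≡ᵇ-true v (p₁ G e) eq))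
... | false = inj₂ (sym (≡ᵇ-true v (p₂ G e) h))

Extends→Ext : ∀ G z ψ → Extends G z ψ → Ext G id z ψ
Extends→Ext G z ψ (o , fl , ag) = o , (λ q → trans (fl q) (sym (bs-single G q))) , λ e k → ag e (Incident-touch G z e k)

Ext→Extends : ∀ G z ψ → Ext G id z ψ → Extends G z ψ
Ext→Extends G z ψ (o , fl , ag) = o , (λ q → trans (fl q) (bs-single G q)) , λ e k → ag e (touch-Incident G z e k)

ExtQ← : ∀ G {p} (f : V G → Fin p) t ψ → Ext G f t ψ → Extends (quot G f) t (ψ ∘ orig G f)
ExtQ← G f t ψ x = Ext→Extends (quot G f) t _ (Ext-quot← G f id t ψ x)

ExtQ→ : ∀ G {p} (f : V G → Fin p) t ψ → Extends (quot G f) t (ψ ∘ orig G f) → Ext G f t ψ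
ExtQ→ G f t ψ x = Ext-quot→ G f id t ψ (Extends→Ext (quot G f) t _ x)

Tip→Sat : ∀ G z ψ → TipPreflow G z ψ → Sat G ψ (cls id z)
Tip→Sat G z ψ h = trans h (sym (bs-single G z))

Sat→Tip : ∀ G z ψ → Sat G ψ (cls id z) → TipPreflow G z ψ
Sat→Tip G z ψ h = trans h (bs-single G z)

TipQ← : ∀ G {p} (f : V G → Fin p) t ψ → Sat G ψ (cls f t) → TipPreflow (quot G f) t (ψ ∘ orig G f)
TipQ← G f t ψ s = Sat→Tip (quot G f) t (ψ ∘ orig G f) (Sat-quot← G f {ψ} (cls id t) s)

FC-use : ∀ G z → FlowCritical G z → ∀ {N} (h : V G → Fin N) → (∀ v → h v ≡ h z → v ≡ z) → ∀ u v → u ≢ v → h u ≡ h v →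
  Σ (Orientation G) λ ψ → TipPreflow G z ψ × Ext G h (h z) ψ × ¬ Extends G z ψ
FC-use G z fc h tr u v ne e with fc F.size F.fac F.fac-surj (λ w k → tr w (trans (F.fac-eq w) (trans (cong F.inj k) (sym (F.fac-eq z)))))
    (u , v , ne , F.inj-inj (trans (sym (F.fac-eq u)) (trans e (F.fac-eq v))))
  where module F = Factor (factor h)
... | ψ , tp , x , nx = ψ , tp , subst (λ s → Ext G h s ψ) (sym (F.fac-eq z)) (Ext-relabel G F.inj (λ q → F.inj-inj) F.fac-eq (ExtQ→ G F.fac (F.fac z) ψ x)) , nx
  where module F = Factor (factor h)

-- In contrast to `CritL`, the preflow may depend on the coarser contraction.
FCL : (G : Gr) {p : ℕ} → (V G → Fin p) → Fin p → Set
FCL G {p} f t = ∀ {N} (g : Fin p → Fin N) → (∀ q → g q ≡ g t → q ≡ t) → ∀ u v → u ≢ v → g u ≡ g v →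
  Σ (Orientation G) λ ψ → Sat G ψ (cls f t) × Ext G (g ∘ f) (g t) ψ × ¬ Ext G f t ψ

CritL→FCL : ∀ G {p} (f : V G → Fin p) t ψ → Sat G ψ (cls f t) → ¬ Ext G f t ψ → CritL G f t ψ → FCL G f t
CritL→FCL G f t ψ s n c g tr u v ne e = ψ , s , c g tr u v ne e , n

FCL→FC : ∀ G {p} (f : V G → Fin p) t → FCL G f t → FlowCritical (quot G f) t
FCL→FC G f t fcl p' g _ tr (u , v , ne , e) with fcl g tr u v ne e
... | ψ , s , x , n = ψ ∘ orig G f , TipQ← G f t ψ s
  , ExtQ← (quot G f) g (g t) (ψ ∘ orig G f) (Ext-quot← G f g (g t) ψ x)
  , λ y → n (ExtQ→ G f t ψ y)

-- Canvases

at : ℕ → Z3 → ℕ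
at d b = absHead (tauOf d b)

record Cv (H : Gr) (z : V H) : Set where
  field
    loopless : Loopless H
    tot : Tot H
    tame : Tame H z
    fc : FlowCritical H z

Cv-quot : ∀ G {p} (f : V G → Fin p) t → Tot G → FCL G f t →
  (∀ q → q ≢ t → 4 + at (dd G (cls f q)) (bs G (cls f q)) ≤ dd G (cls f q)) → Cv (quot G f) t
Cv-quot G f t tot fcl tm = record
  { loopless = Loopless-quot G f
  ; tot = trans (bs-quot G f (λ _ → true)) tot
  ; tame = λ q h → subst (λ d → 4 + at d (β (quot G f) q) ≤ d) (sym (deg-quot G f q))
      (subst (λ b → 4 + at (dd G (cls f q)) b ≤ dd G (cls f q)) (sym (β-quot G f q)) (tm q h))
  ; fc = FCL→FC G f t fcl }

setLab : ∀ {k} → (Fin k → Bool) → Fin k → Fin (suc k)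
setLab A v = if A v then zero else suc v

setLab-zero : ∀ {k} (A : Fin k → Bool) v → cls (setLab A) zero v ≡ A v
setLab-zero A v with A v
... | true = refl
... | false = refl

setLab-suc : ∀ {k} (A : Fin k → Bool) {u} → A u ≡ false → ∀ v → cls (setLab A) (suc u) v ≡ cls id u v
setLab-suc A {u} h v with A v in eq
... | false = ≡ᵇ-iff (suc u) (suc v) u v Finₚ.suc-injective (cong suc)
... | true = sym (≡ᵇ-≢ {a = u} {v} λ { refl → true≢false (trans (sym eq) h) })

setLab-eq : ∀ {k} (A : Fin k → Bool) {u v} → A u ≡ true → A v ≡ true → setLab A u ≡ setLab A v
setLab-eq A h k rewrite h | k = refl

setLab-tip : ∀ {k} (A : Fin k → Bool) {z} → A z ≡ false → ∀ v → setLab A v ≡ setLab A z → v ≡ z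
setLab-tip A h v e with A v
setLab-tip A h v e | false rewrite h = Finₚ.suc-injective e
setLab-tip A h v e | true rewrite h with e
... | ()

Pair : ∀ {k} → (Fin k → Bool) → Set
Pair C = ∃₂ λ u v → u ≢ v × C u ≡ true × C v ≡ true

pair? : ∀ {k} (C : Fin k → Bool) → Dec (Pair C)
pair? C = Finₚ.any? (λ u → Finₚ.any? (λ v → ¬? (u ≟ v) ×-dec ((C u ≟B true) ×-dec (C v ≟B true))))

Cv-flow : ∀ {H z} → FlowCritical H z → (C : VSet H) → C z ≡ false → Pair C →
  Σ (Orientation H) λ o → Flow H (setLab C) o
Cv-flow {H} {z} fc C cz (u , v , ne , cu , cv) =
  let (ψ , _ , (o , fl , _) , _) = FC-use H z fc (setLab C) (setLab-tip C cz) u v ne (setLab-eq C cu cv)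
  in o , fl

no-edge : ∀ {H} → Loopless H → ∀ v → 1 ≤ deg H v → Σ (E H) λ e → cr H (cls id v) e ≡ true
no-edge {H} ll v d with Finₚ.any? (λ e → cr H (cls id v) e ≟B true)
... | yes h = h
... | no h = ⊥-elim (ℕₚ.<⇒≱ d (ℕₚ.≤-reflexive (trans (deg-dd H ll v)
    (sumℕ-zero {m H} λ e → cong ind (bool-ne λ q → h (e , q))))))

other : ∀ H v e → cr H (cls id v) e ≡ true → Σ (V H) λ w → v ≢ w × Joins H e v w
other H v e c with v ≟ p₁ H e | v ≟ p₂ H e
other H v e () | yes _ | yes _
other H v e () | no _ | no _
... | yes a | no b = p₂ H e , b , inj₁ (cong (_, p₂ H e) (sym a))
... | no a | yes b = p₁ H e , a , inj₂ (cong (p₁ H e ,_) (sym b))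

-- If `C` has two vertices, contracting it produces a vertex without edges in a graph that has a
-- flow, so its boundary value is zero. A single vertex is impossible: by tameness it has a
-- neighbour, which lies in `C` as well.
closed-zero : ∀ {H z} → Cv H z → (C : VSet H) → (∀ e → C (p₁ H e) ≡ C (p₂ H e)) → C z ≡ false → bs H C ≡ z0
closed-zero {H} {z} cv C cl cz = go (Dec→⊎ (pair? C))
  where
  joins-cl : ∀ {e a b} → Joins H e a b → C a ≡ C b
  joins-cl {e} (inj₁ h) = trans (cong (C ∘ proj₁) (sym h)) (trans (cl e) (cong (C ∘ proj₂) h))
  joins-cl {e} (inj₂ h) = trans (cong (C ∘ proj₂) (sym h)) (trans (sym (cl e)) (cong (C ∘ proj₁) h))
  go : Pair C ⊎ ¬ Pair C → bs H C ≡ z0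
  go (inj₁ pr) = let (o , fl) = Cv-flow (Cv.fc cv) C cz pr in
    trans (sym (Sat-cong H {o} (setLab-zero C) (fl zero))) (sumZ-zero {m H} {ctE H o C} λ e → ctE-noncr H o C e (cl e))
  go (inj₂ none) = sumZ-zero {n H} λ v → k v (C v) refl
    where
    k : ∀ v b → C v ≡ b → (if b then β H v else z0) ≡ z0
    k v false _ = refl
    k v true eq = ⊥-elim (none (v , w , v≢w , eq , trans (sym (joins-cl j)) eq))
      where
      edge = no-edge {H} (Cv.loopless cv) v (ℕₚ.≤-trans (s≤s z≤n) (Cv.tame cv v λ h → true≢false (trans (sym eq) (trans (cong C h) cz))))
      ow = other H v (proj₁ edge) (proj₂ edge)
      w = proj₁ ow
      v≢w = proj₁ (proj₂ ow)
      j = proj₂ (proj₂ ow)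

Cv→Bordered : ∀ {H z} → Cv H z → Bordered H
Cv→Bordered {H} {z} cv = Cv.loopless cv , λ C (_ , cl , _) → zero-sum C cl (C z) refl
  where
  zero-sum : ∀ C → (∀ e → C (p₁ H e) ≡ C (p₂ H e)) → ∀ b → C z ≡ b → bs H C ≡ z0
  zero-sum C cl false eq = closed-zero cv C cl eq
  zero-sum C cl true eq = trans (trans (sym (⊕-identityʳ _)) (cong (bs H C ⊕_) (sym (closed-zero cv (not ∘ C) (cong not ∘ cl) (cong not eq)))))
    (trans (bs-split H {C} {not ∘ C} {λ _ → true} (compl-split ∘ C)) (Cv.tot cv))

Joins-sym : ∀ {H e a b} → Joins H e a b → Joins H e b a
Joins-sym (inj₁ q) = inj₂ q
Joins-sym (inj₂ q) = inj₁ q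

-- Contracting everything but the tip yields a flow, and this forces the total to vanish. If `x` is
-- the only other vertex, there is nothing to contract; then tameness gives an edge between `x` and
-- `z`, and the graph is a single component.
Bordered→Tot : ∀ {H z x} → Bordered H → Tame H z → FlowCritical H z → x ≢ z → Tot H
Bordered→Tot {H} {z} {x} (ll , bd) tm fc x≢z = go (Dec→⊎ (pair? A))
  where
  A : VSet H
  A w = not (w ≡ᵇ z)
  ne : ∀ {w} → w ≢ z → A w ≡ true
  ne h = cong not (≡ᵇ-≢ h)
  go : Pair A ⊎ ¬ Pair A → Tot H
  go (inj₁ pr) = let (o , fl) = Cv-flow fc A (cong not (≡ᵇ-refl z)) pr in
    trans (sym (Sat-push H {o} (setLab A) (λ _ → true) (λ q _ → fl q))) (nt-all H o)
  go (inj₂ none) = bd (λ _ → true) ((z , refl) , (λ _ → refl) , λ u v _ _ → walk u v (only u) (only v))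
    where
    only : ∀ v → v ≡ z ⊎ v ≡ x
    only v with v ≟ z | v ≟ x
    ... | yes a | _ = inj₁ a
    ... | no _ | yes b = inj₂ b
    ... | no a | no b = ⊥-elim (none (v , x , b , ne a , ne x≢z))
    edge = no-edge {H} ll x (ℕₚ.≤-trans (s≤s z≤n) (tm x x≢z))
    e = proj₁ edge
    toz : (w : V H) → x ≢ w → Joins H e x w → w ≡ z ⊎ w ≡ x → Joins H e x z
    toz w h j (inj₁ refl) = j
    toz w h j (inj₂ q) = ⊥-elim (h (sym q))
    xz : Joins H e x z
    xz = let (w , h , j) = other H x e (proj₂ edge) in toz w h j (only w)
    walk : ∀ u v → u ≡ z ⊎ u ≡ x → v ≡ z ⊎ v ≡ x → Walk H u v
    walk u v (inj₁ refl) (inj₁ refl) = here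
    walk u v (inj₂ refl) (inj₂ refl) = here
    walk u v (inj₁ refl) (inj₂ refl) = step e (Joins-sym {H} xz) here
    walk u v (inj₂ refl) (inj₁ refl) = step e xz here

-- Directions along a boundary

-- With `T` the tip and `X` a vertex, this is the conclusion in the equality case of the degree
-- bound; with `X` empty, it is the configuration that tallness forbids at extremal tip degree.
SameD : (G : Gr) → Orientation G → (T X : VSet G) → Set
SameD G o T X = Σ Bool λ s → ∀ e → cr G T e ≡ true → touch G X e ≡ false → T (tl G o e) ≡ s

-- All preflows and all vertices are covered, because the preflows to which the bound is applied
-- later come from flows over which there is no control.
TBound : (H : Gr) (z : V H) → Set
TBound H z = Cv H z → ∀ ψ → TipPreflow H z ψ → ¬ Extends H z ψ → ∀ x → x ≢ z →
  2 + deg H x ≤ deg H z × (2 + deg H x ≡ deg H z → SameD H ψ (cls id z) (cls id x))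

TBelow : ℕ → Set
TBelow N = ∀ H z → ord H z < N → TBound H z

tl-quot : ∀ G {p} (f : V G → Fin p) ψ i → tl (quot G f) (ψ ∘ orig G f) i ≡ f (tl G ψ (orig G f i))
tl-quot G f ψ i with ψ (orig G f i)
... | true = refl
... | false = refl

cr-keep : ∀ G {p} (f : V G → Fin p) C e → cr G (C ∘ f) e ≡ true → keep G f e ≡ true
cr-keep G f C e h with keep G f e in eq
... | true = refl
... | false rewrite unkeep G f e eq = trans (sym (Boolₚ.xor-same (C (f (p₂ G e))))) h

SameD-quot→ : ∀ G {p} (f : V G → Fin p) ψ C X → SameD (quot G f) (ψ ∘ orig G f) C X → SameD G ψ (C ∘ f) (X ∘ f)
SameD-quot→ G f ψ C X (s , h) = s , λ e c t → go e c t (back G f e (cr-keep G f C e c))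
  where
  go : ∀ e → cr G (C ∘ f) e ≡ true → touch G (X ∘ f) e ≡ false → Σ _ (λ i → orig G f i ≡ e) → C (f (tl G ψ e)) ≡ s
  go e c t (i , refl) = trans (sym (cong C (tl-quot G f ψ i))) (h i c t)

SameD-cong : ∀ G ψ {T T' X X'} → (∀ v → T v ≡ T' v) → (∀ v → X v ≡ X' v) → SameD G ψ T X → SameD G ψ T' X'
SameD-cong G ψ {T} {T'} {X} {X'} hT hX (s , h) = s , λ e c t → trans (sym (hT _)) (h e
  (trans (cong₂ _xor_ (hT (p₁ G e)) (hT (p₂ G e))) c) (trans (cong₂ _∨_ (hX (p₁ G e)) (hX (p₂ G e))) t))

SameD? : ∀ G ψ T X → Dec (SameD G ψ T X)
SameD? G ψ T X = anyB? λ s → Finₚ.all? λ e → (cr G T e ≟B true) →-dec ((touch G X e ≟B false) →-dec (T (tl G ψ e) ≟B s))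

T-quot : ∀ {N} → TBelow N → ∀ G {p} (f : V G → Fin p) t → ord (quot G f) t < N → Cv (quot G f) t →
  ∀ ψ → Sat G ψ (cls f t) → ¬ Ext G f t ψ → ∀ q → q ≢ t →
  2 + dd G (cls f q) ≤ dd G (cls f t) × (2 + dd G (cls f q) ≡ dd G (cls f t) → SameD G ψ (cls f t) (cls f q))
T-quot tb G f t lt cv ψ s nx q ne =
  let (a , b) = tb (quot G f) t lt cv (ψ ∘ orig G f) (TipQ← G f t ψ s) (λ x → nx (ExtQ→ G f t ψ x)) q ne
      dq = deg-quot G f q
      dt = deg-quot G f t
  in subst (λ k → 2 + k ≤ dd G (cls f t)) dq (subst (2 + deg (quot G f) q ≤_) dt a)
   , λ e → SameD-quot→ G f ψ (cls id t) (cls id q) (b (trans (cong (2 +_) dq) (trans e (sym dt))))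

inn : (G : Gr) {p : ℕ} → (V G → Fin p) → Fin p → E G → Bool
inn G f t e = keep G f e ∧ not (touch G (cls f t) e)

ord-quot : ∀ G {p} (f : V G → Fin p) t → ord (quot G f) t ≡ p + sumℕ (λ e → ind (inn G f t e))
ord-quot G {p} f t = cong (p +_) (trans (sumℕ-quot G f (λ e → ind (not (touch G (cls f t) e)))) (sumℕ-cong {m G} k))
  where
  k : ∀ e → (if keep G f e then ind (not (touch G (cls f t) e)) else 0) ≡ ind (inn G f t e)
  k e with keep G f e
  ... | true = refl
  ... | false = refl

surj-le : ∀ {k p} (f : Fin k → Fin p) → Surj f → p ≤ k
surj-le f s = Finₚ.injective⇒≤ {f = λ q → proj₁ (s q)} λ {a} {b} e → trans (sym (proj₂ (s a))) (trans (cong f e) (proj₂ (s b)))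

-- One of `u` and `v` is not the chosen preimage of their common label, hence of no label. Added to
-- the section, it gives `suc p` distinct elements.
surj-lt : ∀ {k p} (f : Fin k → Fin p) → Surj f → ∀ u v → u ≢ v → f u ≡ f v → p < k
surj-lt {k} {p} f s u v ne e = Finₚ.injective⇒≤ {f = g} g-inj
  where
  pick : Σ (Fin k) λ w → ∀ q → w ≢ proj₁ (s q)
  pick with proj₁ (s (f u)) ≟ u
  ... | yes h = v , λ q k → ne (trans (sym h) (trans (cong (proj₁ ∘ s) (trans e (trans (cong f k) (proj₂ (s q))))) (sym k)))
  ... | no h = u , λ q k → h (trans (cong (proj₁ ∘ s) (trans (cong f k) (proj₂ (s q)))) (sym k))
  g : Fin (suc p) → Fin k
  g zero = proj₁ pick
  g (suc q) = proj₁ (s q)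
  g-inj : ∀ {a b} → g a ≡ g b → a ≡ b
  g-inj {zero} {zero} _ = refl
  g-inj {zero} {suc b} h = ⊥-elim (proj₂ pick b h)
  g-inj {suc a} {zero} h = ⊥-elim (proj₂ pick a (sym h))
  g-inj {suc a} {suc b} h = cong suc (trans (sym (proj₂ (s a))) (trans (cong f h) (proj₂ (s b))))

ind-mono : ∀ {a b} → (a ≡ true → b ≡ true) → ind a ≤ ind b
ind-mono {true} h rewrite h refl = ℕₚ.≤-refl
ind-mono {false} h = z≤n

∧-trueˡ : ∀ {a b} → a ∧ b ≡ true → a ≡ true
∧-trueˡ {true} _ = refl

∧-trueʳ : ∀ {a b} → a ∧ b ≡ true → b ≡ true
∧-trueʳ {true} h = h

not-true : ∀ {a} → not a ≡ true → a ≡ false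
not-true {false} _ = refl

-- The restriction to A: everything outside A is contracted to the tip.

Restr : (G : Gr) (A : VSet G) → Factor (setLab (not ∘ A))
Restr G A = factor (setLab (not ∘ A))

rp : (G : Gr) (A : VSet G) → ℕ
rp G A = Factor.size (Restr G A)

rf : (G : Gr) (A : VSet G) → V G → Fin (rp G A)
rf G A = Factor.fac (Restr G A)

rf-eq : ∀ G A {u v} → setLab (not ∘ A) u ≡ setLab (not ∘ A) v → rf G A u ≡ rf G A v
rf-eq G A {u} {v} e = Factor.inj-inj R (trans (sym (Factor.fac-eq R u)) (trans e (Factor.fac-eq R v)))
  where R = Restr G A

rf-eq' : ∀ G A {u v} → rf G A u ≡ rf G A v → setLab (not ∘ A) u ≡ setLab (not ∘ A) v
rf-eq' G A {u} {v} e = trans (Factor.fac-eq R u) (trans (cong (Factor.inj R) e) (sym (Factor.fac-eq R v)))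
  where R = Restr G A

rf-out : ∀ G A {u v} → A u ≡ false → A v ≡ false → rf G A u ≡ rf G A v
rf-out G A h k = rf-eq G A (setLab-eq (not ∘ A) (cong not h) (cong not k))

rf-in : ∀ G A {u} → A u ≡ true → ∀ v → rf G A v ≡ rf G A u → v ≡ u
rf-in G A h v e = setLab-tip (not ∘ A) (cong not h) v (rf-eq' G A e)

cls-out : ∀ G A {z} → A z ≡ false → ∀ v → cls (rf G A) (rf G A z) v ≡ not (A v)
cls-out G A {z} h v with A v in eq
... | false = ≡ᵇ-≡ (rf-out G A h eq)
... | true = ≡ᵇ-≢ λ e → true≢false (trans (sym eq) (trans (cong A (sym (rf-in G A eq z e))) h))

cls-in : ∀ G A {u} → A u ≡ true → ∀ v → cls (rf G A) (rf G A u) v ≡ cls id u v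
cls-in G A {u} h v = ≡ᵇ-iff (rf G A u) (rf G A v) u v (λ e → sym (rf-in G A h v (sym e))) (cong (rf G A))

RExt : (G : Gr) (A : VSet G) → V G → Orientation G → Set
RExt G A z φ = Ext G (rf G A) (rf G A z) φ

dd-not : ∀ G A → dd G (not ∘ A) ≡ dd G A
dd-not G A = sumℕ-cong {m G} λ e → cong ind (k (A (p₁ G e)) (A (p₂ G e)))
  where
  k : ∀ a b → not a xor not b ≡ a xor b
  k = from-yes (allB? λ a → allB? λ b → (not a xor not b) ≟B (a xor b))

touch-cong : ∀ G {A B : VSet G} → (∀ v → A v ≡ B v) → ∀ e → touch G A e ≡ touch G B e
touch-cong G h e = cong₂ _∨_ (h (p₁ G e)) (h (p₂ G e))

-- The flow `o₂` of the restriction agrees with `o` on every edge that meets the complement of `A`.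
-- So it may replace `o` on all edges meeting `A` without disturbing the vertices outside.
glue : ∀ G z ψ A → A z ≡ false → (o : Orientation G) → (∀ v → A v ≡ false → Sat G o (cls id v)) →
  (∀ e → touch G (cls id z) e ≡ true → o e ≡ ψ e) → RExt G A z o → Ext G id z ψ
glue G z ψ A az o off ag (o₂ , fl₂ , ag₂) = c , sat , agc
  where
  c : Orientation G
  c e = if touch G A e then o₂ e else o e
  out : ∀ e v → A v ≡ false → touch G (cls id v) e ≡ true → o₂ e ≡ o e
  out e v h t = ag₂ e (touch-mono G {cls id v} {cls (rf G A) (rf G A z)}
    (λ w q → trans (cls-out G A az w) (cong not (trans (cong A (sym (≡ᵇ-true v w q))) h))) e t)
  c-in : ∀ e v → A v ≡ true → touch G (cls id v) e ≡ true → o₂ e ≡ c e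
  c-in e v h t rewrite touch-mono G {cls id v} {A} (λ w q → trans (cong A (sym (≡ᵇ-true v w q))) h) e t = refl
  c-out : ∀ e v → A v ≡ false → touch G (cls id v) e ≡ true → o e ≡ c e
  c-out e v h t with touch G A e
  ... | true = sym (out e v h t)
  ... | false = refl
  satb : ∀ v b → A v ≡ b → Sat G c (cls id v)
  satb v true h = Sat-local G {o₂} {c} (cls id v) (λ e k → c-in e v h (cr⇒touch G (cls id v) e k))
    (Sat-cong G {o₂} (cls-in G A h) (fl₂ (rf G A v)))
  satb v false h = Sat-local G {o} {c} (cls id v) (λ e k → c-out e v h (cr⇒touch G (cls id v) e k)) (off v h)
  sat : Flow G id c
  sat v = satb v (A v) refl
  agc : ∀ e → touch G (cls id z) e ≡ true → c e ≡ ψ e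
  agc e t = trans (sym (c-out e z az t)) (ag e t)

Sat-out : ∀ G A {z o} → A z ≡ false → (∀ v → A v ≡ false → Sat G o (cls id v)) → Sat G o (cls (rf G A) (rf G A z))
Sat-out G A {z} {o} az h = Sat-cong G {o} (λ v → sym (cls-out G A az v)) (Sat-set G {o} (not ∘ A) λ v k → h v (not-true k))

-- A contraction `g` of the restriction is realised in `G` by keeping the vertices outside `A`
-- separate. The flow `o` obtained there serves as preflow of the restriction: it extends after the
-- contraction, and if it extended before, `glue` would extend the original preflow in `G`.
RFCL : ∀ G z A → FlowCritical G z → A z ≡ false → FCL G (rf G A) (rf G A z)
RFCL G z A fc az {N} g tr u v ne e =
  let (u₀ , eu) = surjR u
      (v₀ , ev) = surjR v
      au = inA u₀ λ h → ub (trans (sym eu) h)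
      av = inA v₀ λ h → vb (trans (sym ev) h)
      (ψ₀ , _ , (o , fl , ag) , nx) = FC-use G z fc P Ptip u₀ v₀ (λ q → ne (trans (sym eu) (trans (cong (rf G A) q) ev)))
        (trans (P-in u₀ au) (trans (cong (_↑ˡ n G) (trans (cong g eu) (trans e (cong g (sym ev))))) (sym (P-in v₀ av))))
      off : ∀ w → A w ≡ false → Sat G o (cls id w)
      off w h = Sat-cong G {o} (Pcls w h) (fl (P w))
      fl' : Flow G (g ∘ rf G A) o
      fl' q = Sat-cong G {o} (λ w → cong (q ≡ᵇ_) (rP w)) (Sat-push G {o} P (λ l → q ≡ᵇ r l) (λ l _ → fl l))
  in o , Sat-out G A {z} {o} az off , (o , fl' , λ _ _ → refl)
   , λ x → nx (Ext→Extends G z ψ₀ (glue G z ψ₀ A az o off (λ k t → ag k (touch-mono G {cls id z} {cls P (P z)} (λ w q → ≡ᵇ-≡ (cong P (≡ᵇ-true z w q))) k t)) x))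
  where
  surjR = Factor.fac-surj (Restr G A)
  b = rf G A z
  ub : u ≢ b
  ub refl = ne (sym (tr v (sym e)))
  vb : v ≢ b
  vb refl = ne (tr u e)
  inA : ∀ w → rf G A w ≢ b → A w ≡ true
  inA w h with A w in eq
  ... | true = refl
  ... | false = ⊥-elim (h (rf-out G A eq az))
  P : V G → Fin (N + n G)
  P w = if A w then g (rf G A w) ↑ˡ n G else N ↑ʳ w
  P-in : ∀ w → A w ≡ true → P w ≡ g (rf G A w) ↑ˡ n G
  P-in w h rewrite h = refl
  P-out : ∀ w → A w ≡ false → P w ≡ N ↑ʳ w
  P-out w h rewrite h = refl
  lr : ∀ {i : Fin N} {j : Fin (n G)} → i ↑ˡ n G ≢ N ↑ʳ j
  lr {i} {j} h with trans (sym (Finₚ.splitAt-↑ˡ N i (n G))) (trans (cong (splitAt N) h) (Finₚ.splitAt-↑ʳ N (n G) j))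
  ... | ()
  Peq : ∀ w w' → A w' ≡ false → P w ≡ P w' → w ≡ w'
  Peq w w' h q with A w
  ... | true = ⊥-elim (lr (trans q (P-out w' h)))
  ... | false = Finₚ.↑ʳ-injective N w w' (trans q (P-out w' h))
  Ptip : ∀ w → P w ≡ P z → w ≡ z
  Ptip w = Peq w z az
  Pcls : ∀ w → A w ≡ false → ∀ v → cls P (P w) v ≡ cls id w v
  Pcls w h v = ≡ᵇ-iff (P w) (P v) w v (λ q → sym (Peq v w h (sym q))) (cong P)
  -- Collapsing the right summand, which holds the vertices outside `A`, to the tip recovers `g`
  -- from `P`.
  r : Fin (N + n G) → Fin N
  r l = Sum.[ id , (λ _ → g b) ] (splitAt N l)
  rP : ∀ w → r (P w) ≡ g (rf G A w)
  rP w with A w in eq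
  ... | true = cong Sum.[ id , (λ _ → g b) ] (Finₚ.splitAt-↑ˡ N (g (rf G A w)) (n G))
  ... | false = trans (cong Sum.[ id , (λ _ → g b) ] (Finₚ.splitAt-↑ʳ N (n G) w)) (cong g (rf-out G A az eq))

bs-not : ∀ G A → Tot G → bs G (not ∘ A) ≡ neg (bs G A)
bs-not G A tot = k (bs G A) (bs G (not ∘ A)) (trans (bs-split G {A} {not ∘ A} {λ _ → true} (compl-split ∘ A)) tot)
  where
  k : ∀ a b → a ⊕ b ≡ z0 → b ≡ neg a
  k = from-yes (all3? λ a → all3? λ b → ((a ⊕ b) ≟3 z0) →-dec (b ≟3 neg a))

RCv : ∀ G z A → Cv G z → A z ≡ false → Cv (quot G (rf G A)) (rf G A z)
RCv G z A cv az = Cv-quot G (rf G A) (rf G A z) (Cv.tot cv) (RFCL G z A (Cv.fc cv) az) λ q ne → tm q ne (Factor.fac-surj (Restr G A) q)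
  where
  tm : ∀ q → q ≢ rf G A z → Σ _ (λ v → rf G A v ≡ q) → 4 + at (dd G (cls (rf G A) q)) (bs G (cls (rf G A) q)) ≤ dd G (cls (rf G A) q)
  tm q ne (v , refl) = subst (λ d → 4 + at d (bs G (cls (rf G A) q)) ≤ d) (sym (trans (dd-cong G (cls-in G A av)) (sym (deg-dd G (Cv.loopless cv) v))))
    (subst (λ b → 4 + at (deg G v) b ≤ deg G v) (sym (trans (bs-cong G (cls-in G A av)) (bs-single G v))) (Cv.tame cv v λ { refl → ne refl }))
    where
    av : A v ≡ true
    av with A v in eq
    ... | true = refl
    ... | false = ⊥-elim (ne (rf-out G A eq az))

R-ord : ∀ G z A → A z ≡ false → ∀ w → A w ≡ false → w ≢ z → ord (quot G (rf G A)) (rf G A z) < ord G z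
R-ord G z A az w aw wz = subst (_< ord G z) (sym (ord-quot G (rf G A) (rf G A z)))
  (ℕₚ.+-mono-<-≤ (surj-lt (rf G A) (Factor.fac-surj (Restr G A)) w z wz (rf-out G A aw az))
    (sumℕ-mono {m G} λ e → ind-mono λ h → cong not (bool-ne λ t → true≢false (trans
      (sym (touch-mono G {cls id z} {cls (rf G A) (rf G A z)} (λ v q → ≡ᵇ-≡ (cong (rf G A) (≡ᵇ-true z v q))) e t))
      (not-true (∧-trueʳ {keep G (rf G A) e} h))))))

-- In the restriction the tip has degree `dd G A` while vertices of `A` keep their degrees, so the
-- degree bound becomes a statement about the boundary of `A`. The vertex `w` makes the restriction
-- a smaller canvas.
TR : ∀ G z → Cv G z → TBelow (ord G z) → ∀ A → A z ≡ false → ∀ w → A w ≡ false → w ≢ z →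
  ∀ φ → Sat G φ (cls (rf G A) (rf G A z)) → ¬ RExt G A z φ → ∀ x → A x ≡ true →
  2 + deg G x ≤ dd G A × (2 + deg G x ≡ dd G A → SameD G φ (not ∘ A) (cls id x))
TR G z cv tb A az w aw wz φ s nx x ax =
  let (a , b) = T-quot tb G (rf G A) (rf G A z) (R-ord G z A az w aw wz) (RCv G z A cv az) φ s nx (rf G A x)
        (λ e → true≢false (trans (sym ax) (trans (cong A (sym (rf-in G A ax z (sym e)))) az)))
      dx = trans (dd-cong G (cls-in G A ax)) (sym (deg-dd G (Cv.loopless cv) x))
      dA = trans (dd-cong G (cls-out G A az)) (dd-not G A)
  in subst (λ k → 2 + k ≤ dd G A) dx (subst (2 + dd G (cls (rf G A) (rf G A x)) ≤_) dA a)
   , λ e → SameD-cong G φ {cls (rf G A) (rf G A z)} {not ∘ A} {cls (rf G A) (rf G A x)} {cls id x} (cls-out G A az) (cls-in G A ax) (b (trans (cong (2 +_) dx) (trans e (sym dA))))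

-- A flow of the contraction of `A` is its own witness: if it extended into `A`, then by `glue` so
-- would the preflow that flow-criticality provides for this contraction.
R-nonext : ∀ G z A → Cv G z → A z ≡ false → Pair A →
  Σ (Orientation G) λ φ → Sat G φ (cls (rf G A) (rf G A z)) × ¬ RExt G A z φ
R-nonext G z A cv az (u , v , ne , au , av) =
  let (ψ , _ , (o , fl , ag) , nx) = FC-use G z (Cv.fc cv) (setLab A) (setLab-tip A az) u v ne (setLab-eq A au av)
      off : ∀ w → A w ≡ false → Sat G o (cls id w)
      off w h = Sat-cong G {o} (setLab-suc A h) (fl (suc w))
  in o , Sat-out G A {z} {o} az off
   , λ x → nx (Ext→Extends G z ψ (glue G z ψ A az o off (λ k t → ag k
       (touch-mono G {cls id z} {cls (setLab A) (setLab A z)} (λ w q → ≡ᵇ-≡ (cong (setLab A) (≡ᵇ-true z w q))) k t)) x))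

-- At tip degree 6 all other vertices have degree four and boundary 0, so β(z) = 0. At tip degree 7 with
-- β(z) = 0 at least three vertices have degree five, and equality in the bound on their degrees forces one
-- direction on all edges at z, which contradicts β(z) = 0.

rep : Z3 → ℕ → Z3
rep c zero = z0
rep c (suc k) = c ⊕ rep c k

sumZ-rep : ∀ {k} (p : Fin k → Bool) c → sumZ (λ i → if p i then c else z0) ≡ rep c (sumℕ (λ i → ind (p i)))
sumZ-rep {zero} p c = refl
sumZ-rep {suc k} p c with p zero
... | true = cong (c ⊕_) (sumZ-rep (p ∘ suc) c)
... | false = sumZ-rep (p ∘ suc) c

cr-ctE : ∀ G o A e s → cr G A e ≡ true → A (tl G o e) ≡ s → ctE G o A e ≡ ct s (not s)
cr-ctE G o A e s c h with o e
... | true = cong₂ ct h (trans (sym (Boolₚ.not-involutive _)) (cong not (trans (sym (xor-true c)) h)))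
... | false = cong₂ ct h (trans (xor-true c) (cong not h))

nt-same : ∀ G o A s → (∀ e → cr G A e ≡ true → A (tl G o e) ≡ s) → nt G o A ≡ rep (ct s (not s)) (dd G A)
nt-same G o A s h = trans (sumZ-cong {m G} k) (sumZ-rep (cr G A) (ct s (not s)))
  where
  k : ∀ e → ctE G o A e ≡ (if cr G A e then ct s (not s) else z0)
  k e with cr G A e in eq
  ... | true = cr-ctE G o A e s eq (h e eq)
  ... | false = ctE-noncr G o A e (xor-false eq)

isEven-+ : ∀ a b → isEven a ≡ true → isEven (a + b) ≡ isEven b
isEven-+ zero b h = refl
isEven-+ (suc zero) b ()
isEven-+ (suc (suc a)) b h = trans (Boolₚ.not-involutive _) (isEven-+ a b (trans (sym (Boolₚ.not-involutive _)) h))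

isEven-sum : ∀ {k} (f : Fin k → ℕ) → (∀ i → isEven (f i) ≡ true) → isEven (sumℕ f) ≡ true
isEven-sum {zero} f h = refl
isEven-sum {suc k} f h = trans (isEven-+ (f zero) _ (h zero)) (isEven-sum (f ∘ suc) (h ∘ suc))

count-≡ : ∀ {k} (a : Fin k) → sumℕ (λ v → ind (v ≡ᵇ a)) ≡ 1
count-≡ a = trans (sumℕ-split (λ v → ind (v ≡ᵇ a)) a) (cong₂ _+_ (ind-true (≡ᵇ-refl a)) (sumℕ-zero h))
  where
  h : ∀ i → zeroAtℕ a (λ v → ind (v ≡ᵇ a)) i ≡ 0
  h i with a ≟ i
  ... | yes _ = refl
  ... | no n = cong ind (≡ᵇ-≢ (n ∘ sym))

handshake : ∀ G → isEven (sumℕ (deg G)) ≡ true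
handshake G = trans (cong isEven (trans (sumℕ-swap {n G} {m G} (λ v e → ind (v ≡ᵇ p₁ G e) + ind (v ≡ᵇ p₂ G e)))
  (sumℕ-cong {m G} {g = λ _ → 2} λ e → trans (sumℕ-+ {n G} (λ v → ind (v ≡ᵇ p₁ G e)) (λ v → ind (v ≡ᵇ p₂ G e))) (cong₂ _+_ (count-≡ (p₁ G e)) (count-≡ (p₂ G e))))))
  (isEven-sum {m G} (λ _ → 2) λ _ → refl)

at-2+ : ∀ d b → at (2 + d) b ≡ at d b
at-2+ d b rewrite Boolₚ.not-involutive (isEven d) = refl

at-≤3 : ∀ d b → at d b ≤ 3
at-≤3 d b with isEven d | b
... | true | z0 = z≤n
... | true | z1 = s≤s (s≤s z≤n)
... | true | z2 = s≤s (s≤s z≤n)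
... | false | z0 = s≤s (s≤s (s≤s z≤n))
... | false | z1 = s≤s z≤n
... | false | z2 = s≤s z≤n

at-neg : ∀ d b → at d (neg b) ≡ at d b
at-neg d b with isEven d | b
... | true | z0 = refl
... | true | z1 = refl
... | true | z2 = refl
... | false | z0 = refl
... | false | z1 = refl
... | false | z2 = refl

small-deg : ∀ d b → 4 + at d b ≤ d → d ≤ 5 → (d ≡ 4 × b ≡ z0) ⊎ (d ≡ 5 × b ≢ z0)
small-deg 4 z0 _ _ = inj₁ (refl , refl)
small-deg 4 z1 (s≤s (s≤s (s≤s (s≤s ())))) _
small-deg 4 z2 (s≤s (s≤s (s≤s (s≤s ())))) _
small-deg 5 z0 (s≤s (s≤s (s≤s (s≤s (s≤s ()))))) _
small-deg 5 z1 _ _ = inj₂ (refl , λ ())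
small-deg 5 z2 _ _ = inj₂ (refl , λ ())
small-deg 0 _ () _
small-deg 1 _ (s≤s ()) _
small-deg 2 _ (s≤s (s≤s ())) _
small-deg 3 _ (s≤s (s≤s (s≤s ()))) _
small-deg (suc (suc (suc (suc (suc (suc d)))))) b _ (s≤s (s≤s (s≤s (s≤s (s≤s ())))))

β-single : ∀ {k} (f : Fin k → Z3) z → (∀ v → v ≢ z → f v ≡ z0) → sumZ f ≡ f z
β-single f z h = sumZ-single f z λ i n → h i (n ∘ sym)

LT-tip : ∀ H z → Cv H z → ∀ ψ → TipPreflow H z ψ → ∀ x → x ≢ z →
  (∀ v → v ≢ z → 2 + deg H v ≤ deg H z × (2 + deg H v ≡ deg H z → SameD H ψ (cls id z) (cls id v))) →
  6 + at (deg H z) (β H z) ≤ deg H z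
LT-tip H z cv ψ tp x x≢z T = go (deg H z) refl (ℕₚ.≤-trans (s≤s (s≤s (ℕₚ.≤-trans (ℕₚ.m≤m+n 4 _) (Cv.tame cv x x≢z)))) (proj₁ (T x x≢z))) (β H z) refl
  where
  βsum : sumZ (β H) ≡ z0
  βsum = Cv.tot cv
  small : ∀ v → v ≢ z → deg H z ≤ 7 → (deg H v ≡ 4 × β H v ≡ z0) ⊎ (deg H v ≡ 5 × β H v ≢ z0)
  small v ne h = small-deg (deg H v) (β H v) (Cv.tame cv v ne) (ℕₚ.+-cancelˡ-≤ 2 _ _ (ℕₚ.≤-trans (proj₁ (T v ne)) h))
  six : deg H z ≡ 6 → β H z ≢ z0 → ⊥
  six d b = b (trans (sym (β-single (β H) z z4)) βsum)
    where
    z4 : ∀ v → v ≢ z → β H v ≡ z0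
    z4 v ne with small v ne (ℕₚ.≤-trans (ℕₚ.≤-reflexive d) (ℕₚ.n≤1+n 6))
    ... | inj₁ (_ , q) = q
    ... | inj₂ (q , _) = ⊥-elim (ℕₚ.<⇒≱ (ℕₚ.n<1+n 6) (ℕₚ.≤-trans (ℕₚ.≤-reflexive (cong (2 +_) (sym q))) (ℕₚ.≤-trans (proj₁ (T v ne)) (ℕₚ.≤-reflexive d))))
  module Seven (d7 : deg H z ≡ 7) (b0 : β H z ≡ z0) where
    sm : ∀ v → v ≢ z → (deg H v ≡ 4 × β H v ≡ z0) ⊎ (deg H v ≡ 5 × β H v ≢ z0)
    sm v ne = small v ne (ℕₚ.≤-reflexive d7)
    z? : ∀ v → v ≢ z → ¬ deg H v ≡ 5 → deg H v ≡ 4 × β H v ≡ z0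
    z? v ne h with sm v ne
    ... | inj₁ q = q
    ... | inj₂ (q , _) = ⊥-elim (h q)
    even-four : ∀ {k} → k ≡ 4 → isEven k ≡ true
    even-four refl = refl
    -- The degree sum is even and the tip has degree 7, so the other degrees cannot all be four.
    x₀ : Σ (V H) λ v → v ≢ z × deg H v ≡ 5
    x₀ with Finₚ.any? (λ v → ¬? (v ≟ z) ×-dec (deg H v ℕₚ.≟ 5))
    ... | yes h = h
    ... | no h = ⊥-elim (true≢false (trans (sym (handshake H)) (trans (cong isEven (trans (sumℕ-split (deg H) z) (cong (_+ sumℕ (zeroAtℕ z (deg H))) d7)))
            (cong not (trans (isEven-+ 6 (sumℕ (zeroAtℕ z (deg H))) refl) (isEven-sum (zeroAtℕ z (deg H)) ev))))))
      where
      ev : ∀ i → isEven (zeroAtℕ z (deg H) i) ≡ true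
      ev i with z ≟ i
      ... | yes _ = refl
      ... | no n = even-four (proj₁ (z? i (n ∘ sym) λ q → h (i , n ∘ sym , q)))
    a = proj₁ x₀
    a≢z = proj₁ (proj₂ x₀)
    a5 = proj₂ (proj₂ x₀)
    βne : ∀ v → v ≢ z → deg H v ≡ 5 → β H v ≢ z0
    βne v ne q with sm v ne
    ... | inj₁ (r , _) = ⊥-elim (ℕₚ.<⇒≢ (ℕₚ.n<1+n 4) (trans (sym r) q))
    ... | inj₂ (_ , r) = r
    -- Vertices of degree four have boundary zero and those of degree five do not. A single vertex
    -- of degree five would leave a nonzero total.
    x₁ : Σ (V H) λ v → v ≢ z × v ≢ a × deg H v ≡ 5
    x₁ with Finₚ.any? (λ v → ¬? (v ≟ z) ×-dec (¬? (v ≟ a) ×-dec (deg H v ℕₚ.≟ 5)))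
    ... | yes h = h
    ... | no h = ⊥-elim (βne a a≢z a5 (trans (sym (β-single (β H) a bz)) βsum))
      where
      bz : ∀ v → v ≢ a → β H v ≡ z0
      bz v ne with v ≟ z
      ... | yes refl = b0
      ... | no vz = proj₂ (z? v vz λ q → h (v , vz , ne , q))
    b = proj₁ x₁
    b≢z = proj₁ (proj₂ x₁)
    b≢a = proj₁ (proj₂ (proj₂ x₁))
    b5 = proj₂ (proj₂ (proj₂ x₁))
    f₁ f₂ f₃ : V H → ℕ
    f₁ = zeroAtℕ z (deg H)
    f₂ = zeroAtℕ a f₁
    f₃ = zeroAtℕ b f₂
    f₁-at : f₁ a ≡ 5
    f₁-at rewrite ≡ᵇ-≢ {a = z} {a} (a≢z ∘ sym) = a5
    f₂-at : f₂ b ≡ 5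
    f₂-at rewrite ≡ᵇ-≢ {a = a} {b} (b≢a ∘ sym) | ≡ᵇ-≢ {a = z} {b} (b≢z ∘ sym) = b5
    total : sumℕ (deg H) ≡ 17 + sumℕ f₃
    total = begin
      sumℕ (deg H) ≡⟨ sumℕ-split (deg H) z ⟩
      deg H z + sumℕ f₁ ≡⟨ cong₂ _+_ d7 (sumℕ-split f₁ a) ⟩
      7 + (f₁ a + sumℕ f₂) ≡⟨ cong₂ (λ s t → 7 + (s + t)) f₁-at (sumℕ-split f₂ b) ⟩
      12 + (f₂ b + sumℕ f₃) ≡⟨ cong (λ s → 12 + (s + sumℕ f₃)) f₂-at ⟩
      17 + sumℕ f₃ ∎
      where open ≡-Reasoning
    -- Parity again: 7 + 5 + 5 is odd, and degrees four cannot repair this.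
    x₂ : Σ (V H) λ v → v ≢ z × v ≢ a × v ≢ b × deg H v ≡ 5
    x₂ with Finₚ.any? (λ v → ¬? (v ≟ z) ×-dec (¬? (v ≟ a) ×-dec (¬? (v ≟ b) ×-dec (deg H v ℕₚ.≟ 5))))
    ... | yes h = h
    ... | no h = ⊥-elim (true≢false (trans (sym (handshake H)) (trans (cong isEven total)
            (cong not (trans (isEven-+ 16 (sumℕ f₃) refl) (isEven-sum f₃ ev))))))
      where
      ev : ∀ i → isEven (f₃ i) ≡ true
      ev i with b ≟ i | a ≟ i | z ≟ i
      ... | yes _ | _ | _ = refl
      ... | no _ | yes _ | _ = refl
      ... | no _ | no _ | yes _ = refl
      ... | no nb | no na | no nz = even-four (proj₁ (z? i (nz ∘ sym) λ q → h (i , nz ∘ sym , na ∘ sym , nb ∘ sym , q)))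
    c = proj₁ x₂
    c≢z = proj₁ (proj₂ x₂)
    c≢a = proj₁ (proj₂ (proj₂ x₂))
    c≢b = proj₁ (proj₂ (proj₂ (proj₂ x₂)))
    c5 = proj₂ (proj₂ (proj₂ (proj₂ x₂)))
    same : ∀ v → v ≢ z → deg H v ≡ 5 → SameD H ψ (cls id z) (cls id v)
    same v ne q = proj₂ (T v ne) (trans (cong (2 +_) q) (sym d7))
    ends2 : ∀ e → cr H (cls id z) e ≡ true → Σ (V H) λ u → ∀ v → v ≢ z → v ≢ u → touch H (cls id v) e ≡ false
    ends2 e ce with other H z e ce
    ... | u , _ , inj₁ q = u , λ v vz vu → cong₂ _∨_ (≡ᵇ-≢ λ h → vz (trans h (cong proj₁ q))) (≡ᵇ-≢ λ h → vu (trans h (cong proj₂ q)))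
    ... | u , _ , inj₂ q = u , λ v vz vu → cong₂ _∨_ (≡ᵇ-≢ λ h → vu (trans h (cong proj₁ q))) (≡ᵇ-≢ λ h → vz (trans h (cong proj₂ q)))
    -- Two edges at the tip have at most two other ends, so one of the three vertices of degree five
    -- is incident with neither. Its equality case gives both edges the same direction.
    avoid : ∀ u u' → Σ (V H) λ v → v ≢ z × v ≢ u × v ≢ u' × deg H v ≡ 5
    avoid u u' with a ≟ u | a ≟ u' | b ≟ u | b ≟ u'
    ... | no p | no q | _ | _ = a , a≢z , p , q , a5
    ... | yes _ | _ | no p | no q = b , b≢z , p , q , b5
    ... | no _ | yes _ | no p | no q = b , b≢z , p , q , b5
    ... | yes p | _ | yes q | _ = ⊥-elim (b≢a (trans q (sym p)))
    ... | no _ | yes p | _ | yes q = ⊥-elim (b≢a (trans q (sym p)))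
    ... | yes p | _ | no _ | yes q = c , c≢z , (λ h → c≢a (trans h (sym p))) , (λ h → c≢b (trans h (sym q))) , c5
    ... | no _ | yes p | yes q | no _ = c , c≢z , (λ h → c≢b (trans h (sym q))) , (λ h → c≢a (trans h (sym p))) , c5
    same2 : ∀ e e' → cr H (cls id z) e ≡ true → cr H (cls id z) e' ≡ true → cls id z (tl H ψ e) ≡ cls id z (tl H ψ e')
    same2 e e' ce ce' =
      let (u , hu) = ends2 e ce
          (u' , hu') = ends2 e' ce'
          (v , vz , vu , vu' , v5) = avoid u u'
          (s , hs) = same v vz v5
      in trans (hs e ce (hu v vz vu)) (sym (hs e' ce' (hu' v vz vu')))
    e₀ = no-edge {H} (Cv.loopless cv) z (ℕₚ.≤-trans (s≤s z≤n) (ℕₚ.≤-reflexive (sym d7)))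
    s₀ = cls id z (tl H ψ (proj₁ e₀))
    net7 : z0 ≡ rep (ct s₀ (not s₀)) 7
    net7 = trans (trans (sym (trans tp b0)) (nt-same H ψ (cls id z) s₀ λ e ce → same2 e (proj₁ e₀) ce (proj₂ e₀)))
      (cong (rep (ct s₀ (not s₀))) (trans (sym (deg-dd H (Cv.loopless cv) z)) d7))
    absurd : ∀ s → z0 ≢ rep (ct s (not s)) 7
    absurd true ()
    absurd false ()
    contra : ⊥
    contra = absurd s₀ net7
  go : ∀ d → deg H z ≡ d → 6 ≤ d → ∀ b → β H z ≡ b → 6 + at d b ≤ d
  go 0 _ () _ _
  go 1 _ (s≤s ()) _ _
  go 2 _ (s≤s (s≤s ())) _ _
  go 3 _ (s≤s (s≤s (s≤s ()))) _ _
  go 4 _ (s≤s (s≤s (s≤s (s≤s ())))) _ _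
  go 5 _ (s≤s (s≤s (s≤s (s≤s (s≤s ()))))) _ _
  go 6 dz _ z0 _ = ℕₚ.≤-refl
  go 6 dz _ z1 eb = ⊥-elim (six dz λ q → case trans (sym eb) q of λ ())
  go 6 dz _ z2 eb = ⊥-elim (six dz λ q → case trans (sym eb) q of λ ())
  go 7 dz _ z0 eb = ⊥-elim (Seven.contra dz eb)
  go 7 dz _ z1 _ = ℕₚ.≤-refl
  go 7 dz _ z2 _ = ℕₚ.≤-refl
  go 8 dz _ z0 _ = s≤s (s≤s (s≤s (s≤s (s≤s (s≤s z≤n)))))
  go 8 dz _ z1 _ = ℕₚ.≤-refl
  go 8 dz _ z2 _ = ℕₚ.≤-refl
  go (suc (suc (suc (suc (suc (suc (suc (suc (suc d))))))))) dz _ b _ =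
    ℕₚ.+-monoʳ-≤ 6 (ℕₚ.≤-trans (at-≤3 (9 + d) b) (ℕₚ.m≤m+n 3 d))

-- Sizes of edge cuts

LT-T : ∀ H z → Cv H z → TBound H z → ∀ ψ → TipPreflow H z ψ → ¬ Extends H z ψ → ∀ x → x ≢ z → 6 + at (deg H z) (β H z) ≤ deg H z
LT-T H z cv T ψ tp nx x xz = LT-tip H z cv ψ tp x xz (T cv ψ tp nx)

-- The tip of the restriction to `A` has degree `dd G A` and the negated boundary, which does not
-- change |τ|. The constant exceeds that of tameness by two, the number of boundary edges that a
-- lift can remove; parity and |τ| are then unchanged.
LT : ∀ G z → Cv G z → TBelow (ord G z) → ∀ A → A z ≡ false → Pair A → ∀ w → A w ≡ false → w ≢ z →
  6 + at (dd G A) (bs G A) ≤ dd G A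
LT G z cv tb A az pr@(u , _ , _ , au , _) w aw wz =
  let (φ , s , nx) = R-nonext G z A cv az pr
      Q = quot G (rf G A)
      b = rf G A z
      dA = trans (deg-quot G (rf G A) b) (trans (dd-cong G (cls-out G A az)) (dd-not G A))
      bA = trans (β-quot G (rf G A) b) (trans (bs-cong G (cls-out G A az)) (bs-not G A (Cv.tot cv)))
      l = LT-T Q b (RCv G z A cv az) (tb Q b (R-ord G z A az w aw wz)) (φ ∘ orig G (rf G A)) (TipQ← G (rf G A) b φ s)
            (λ x → nx (ExtQ→ G (rf G A) b φ x)) (rf G A u)
            (λ e → true≢false (trans (sym au) (trans (cong A (sym (rf-in G A au z (sym e)))) az)))
  in subst (λ k → 6 + k ≤ dd G A) (at-neg (dd G A) (bs G A)) (subst (λ b' → 6 + at (dd G A) b' ≤ dd G A) bA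
       (subst (λ d → 6 + at d (β Q b) ≤ d) dA l))

TR-deg : ∀ G z → Cv G z → TBelow (ord G z) → ∀ A → A z ≡ false → Pair A → ∀ w → A w ≡ false → w ≢ z → ∀ x → A x ≡ true → 2 + deg G x ≤ dd G A
TR-deg G z cv tb A az pr w aw wz x ax =
  let (φ , s , nx) = R-nonext G z A cv az pr in proj₁ (TR G z cv tb A az w aw wz φ s nx x ax)

-- Critical canvases and flows off a set

record Crit (G : Gr) (z : V G) (ψ : Orientation G) : Set where
  field
    cv : Cv G z
    tip : TipPreflow G z ψ
    nx : ¬ Ext G id z ψ
    crit : CritL G id z ψ

Agree : (G : Gr) → V G → Orientation G → Orientation G → Set
Agree G z ψ o = ∀ e → touch G (cls id z) e ≡ true → o e ≡ ψ e

Off : (G : Gr) → V G → Orientation G → VSet G → Orientation G → Set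
Off G z ψ A o = (∀ v → A v ≡ false → Sat G o (cls id v)) × Agree G z ψ o

off : ∀ {G z ψ} → Crit G z ψ → ∀ A → A z ≡ false → Pair A → Σ (Orientation G) (Off G z ψ A)
off {G} {z} {ψ} C A az (u , v , ne , au , av) =
  let (o , fl , ag) = Crit.crit C (setLab A) (setLab-tip A az) u v ne (setLab-eq A au av)
  in o , (λ w h → Sat-cong G {o} (setLab-suc A h) (fl (suc w)))
   , λ e t → ag e (touch-mono G {cls id z} {cls (setLab A) (setLab A z)} (λ w q → ≡ᵇ-≡ (cong (setLab A) (≡ᵇ-true z w q))) e t)

off-all : ∀ {G z ψ} → TipPreflow G z ψ → ∀ A → (∀ v → A v ≡ false → v ≡ z) → Off G z ψ A ψ
off-all {G} {z} {ψ} tp A h = (λ v k → subst (λ w → Sat G ψ (cls id w)) (sym (h v k)) (Tip→Sat G z ψ tp)) , λ _ _ → refl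

-- Balance at `x` follows from balance elsewhere by taking complements, so `o` would extend `ψ`.
almost : ∀ {G z ψ} → Tot G → ¬ Ext G id z ψ → ∀ o x → Agree G z ψ o → (∀ v → v ≢ x → Sat G o (cls id v)) → ⊥
almost {G} tot nx o x ag h = nx (o , fl , ag)
  where
  sx : Sat G o (cls id x)
  sx = Sat-compl G {o} tot (cls id x) (Sat-set G {o} (not ∘ cls id x) λ v k → h v λ q → true≢false (trans (sym k) (cong not (≡ᵇ-≡ (sym q)))))
  fl : Flow G id o
  fl v with v ≟ x
  ... | yes refl = sx
  ... | no n = h v n

Off-nonext : ∀ {G z ψ} → ¬ Ext G id z ψ → ∀ A → A z ≡ false → ∀ o → Off G z ψ A o → ¬ RExt G A z o
Off-nonext {G} {z} {ψ} nx A az o (off , ag) x = nx (glue G z ψ A az o off ag x)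

Off-TR : ∀ {G z ψ} → Crit G z ψ → TBelow (ord G z) → ∀ A → A z ≡ false → ∀ w → A w ≡ false → w ≢ z →
  ∀ o → Off G z ψ A o → ∀ x → A x ≡ true → 2 + deg G x ≤ dd G A × (2 + deg G x ≡ dd G A → SameD G o (not ∘ A) (cls id x))
Off-TR {G} {z} C tb A az w aw wz o of x ax = TR G z (Crit.cv C) tb A az w aw wz o (Sat-out G A {z} {o} az (proj₁ of))
  (Off-nonext (Crit.nx C) A az o of) x ax

Off-mono : ∀ {G z ψ} A B → (∀ v → A v ≡ true → B v ≡ true) → ∀ o → Off G z ψ A o → Off G z ψ B o
Off-mono A B h o (s , ag) = (λ v k → s v (bool-ne λ q → true≢false (trans (sym (h v q)) k))) , ag

setO : ∀ {k} {X : Set} → (Fin k → X) → Fin k → X → Fin k → X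
setO o e b i = if e ≡ᵇ i then b else o i

setO-at : ∀ {k} {X : Set} (o : Fin k → X) e b → setO o e b e ≡ b
setO-at o e b rewrite ≡ᵇ-refl e = refl

setO-ne : ∀ {k} {X : Set} (o : Fin k → X) e b {i} → e ≢ i → setO o e b i ≡ o i
setO-ne o e b h rewrite ≡ᵇ-≢ h = refl

-- If u is not an end of e, this directs e out of its second end.
outOf : (G : Gr) → E G → V G → Bool
outOf G e u = u ≡ᵇ p₁ G e

Joins-tl : ∀ {G o e u v} → u ≢ v → Joins G e u v → o e ≡ outOf G e u → tl G o e ≡ u × hd G o e ≡ v
Joins-tl {G} {o} {e} {u} {v} ne (inj₁ q) h rewrite h | q | ≡ᵇ-refl u = refl , refl
Joins-tl {G} {o} {e} {u} {v} ne (inj₂ q) h rewrite h | q | ≡ᵇ-≢ ne = refl , refl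

Joins-hd : ∀ {G o e u v} → u ≢ v → Joins G e u v → o e ≡ not (outOf G e u) → tl G o e ≡ v × hd G o e ≡ u
Joins-hd {G} {o} {e} {u} {v} ne (inj₁ q) h rewrite h | q | ≡ᵇ-refl u = refl , refl
Joins-hd {G} {o} {e} {u} {v} ne (inj₂ q) h rewrite h | q | ≡ᵇ-≢ ne = refl , refl

Joins-ctE : ∀ {G} o A {e u v} b → u ≢ v → Joins G e u v → o e ≡ (if b then outOf G e u else not (outOf G e u)) →
  ctE G o A e ≡ (if b then ct (A u) (A v) else ct (A v) (A u))
Joins-ctE {G} o A {e} true ne j h = let (a , b) = Joins-tl {G} {o} {e} ne j h in cong₂ (λ s t → ct (A s) (A t)) a b
Joins-ctE {G} o A {e} false ne j h = let (a , b) = Joins-hd {G} {o} {e} ne j h in cong₂ (λ s t → ct (A s) (A t)) a b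

Joins-touch : ∀ G {e u v} A → Joins G e u v → touch G A e ≡ A u ∨ A v
Joins-touch G A (inj₁ q) = cong₂ (λ s t → A s ∨ A t) (cong proj₁ q) (cong proj₂ q)
Joins-touch G A (inj₂ q) = trans (cong₂ (λ s t → A s ∨ A t) (cong proj₁ q) (cong proj₂ q)) (Boolₚ.∨-comm (A _) (A _))

Joins-cr : ∀ G {e u v} A → Joins G e u v → cr G A e ≡ A u xor A v
Joins-cr G A (inj₁ q) = cong₂ (λ s t → A s xor A t) (cong proj₁ q) (cong proj₂ q)
Joins-cr G A (inj₂ q) = trans (cong₂ (λ s t → A s xor A t) (cong proj₁ q) (cong proj₂ q)) (Boolₚ.xor-comm (A _) (A _))

two : ∀ {k} → Fin k → Fin k → Fin k → Bool
two u v w = (u ≡ᵇ w) ∨ (v ≡ᵇ w)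

two-false : ∀ {k} {u v w : Fin k} → u ≢ w → v ≢ w → two u v w ≡ false
two-false h k = cong₂ _∨_ (≡ᵇ-≢ h) (≡ᵇ-≢ k)

two-l : ∀ {k} (u v : Fin k) → two u v u ≡ true
two-l u v rewrite ≡ᵇ-refl u = refl

two-r : ∀ {k} (u v : Fin k) → two u v v ≡ true
two-r u v rewrite ≡ᵇ-refl v = Boolₚ.∨-zeroʳ _

two-ne : ∀ {k} {u v w : Fin k} → two u v w ≡ false → u ≢ w × v ≢ w
two-ne {u = u} {v} {w} h with u ≟ w | v ≟ w
two-ne {u = u} {v} {w} () | yes _ | _
two-ne {u = u} {v} {w} () | no _ | yes _
... | no a | no b = a , b

zeroAt₂-cong : ∀ {k} (i j : Fin k) (f g : Fin k → Z3) → (∀ l → i ≢ l → j ≢ l → f l ≡ g l) →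
  ∀ l → zeroAt j (zeroAt i f) l ≡ zeroAt j (zeroAt i g) l
zeroAt₂-cong i j f g h l with j ≟ l | i ≟ l
... | yes _ | _ = refl
... | no _ | yes _ = refl
... | no b | no a = h l a b

-- Two parallel edges can carry every value of ℤ₃ from u to v, so they absorb any defect at u and v.
parallel : ∀ {G z ψ} → Tot G → ¬ Ext G id z ψ → ∀ u v → u ≢ v → u ≢ z → v ≢ z → ∀ e₁ e₂ → e₁ ≢ e₂ → Joins G e₁ u v → Joins G e₂ u v →
  Σ (Orientation G) (Off G z ψ (two u v)) → ⊥
parallel {G} {z} {ψ} tot nx u v ne uz vz e₁ e₂ e≢ j₁ j₂ (o , off , ag) = go (choose (β G u) R)
  where
  dir : Bool → E G → Bool
  dir b e = if b then outOf G e u else not (outOf G e u)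
  oo : Bool → Bool → Orientation G
  oo a b = setO (setO o e₂ (dir b e₂)) e₁ (dir a e₁)
  F : Bool → Bool → E G → Z3
  F a b = ctE G (oo a b) (cls id u)
  rest : E G → Z3
  rest = zeroAt e₂ (zeroAt e₁ (ctE G o (cls id u)))
  R : Z3
  R = sumZ rest
  c : Bool → Z3
  c b = if b then z1 else z2
  choose : ∀ t r → Σ Bool λ a → Σ Bool λ b → (c a ⊕ (c b ⊕ r)) ≡ t
  choose = from-yes (all3? λ t → all3? λ r → anyB? λ a → anyB? λ b → (c a ⊕ (c b ⊕ r)) ≟3 t)
  oo₂ : ∀ a b → oo a b e₂ ≡ dir b e₂
  oo₂ a b = trans (setO-ne (setO o e₂ (dir b e₂)) e₁ (dir a e₁) e≢) (setO-at o e₂ (dir b e₂))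
  oo-ne : ∀ a b i → e₁ ≢ i → e₂ ≢ i → oo a b i ≡ o i
  oo-ne a b i h k = trans (setO-ne (setO o e₂ (dir b e₂)) e₁ (dir a e₁) h) (setO-ne o e₂ (dir b e₂) k)
  Fe : ∀ a b e s → Joins G e u v → oo a b e ≡ dir s e → F a b e ≡ c s
  Fe a b e true j h = trans (Joins-ctE {G} (oo a b) (cls id u) true ne j h) (cong₂ ct (≡ᵇ-refl u) (≡ᵇ-≢ ne))
  Fe a b e false j h = trans (Joins-ctE {G} (oo a b) (cls id u) false ne j h) (cong₂ ct (≡ᵇ-≢ ne) (≡ᵇ-refl u))
  z₂ : ∀ a b → zeroAt e₁ (F a b) e₂ ≡ F a b e₂
  z₂ a b rewrite ≡ᵇ-≢ e≢ = refl
  Frest : ∀ a b i → zeroAt e₂ (zeroAt e₁ (F a b)) i ≡ rest i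
  Frest a b = zeroAt₂-cong e₁ e₂ (F a b) (ctE G o (cls id u)) λ i h k → ctE-local G {oo a b} {o} (cls id u) i (λ _ → oo-ne a b i h k)
  netU : ∀ a b → nt G (oo a b) (cls id u) ≡ c a ⊕ (c b ⊕ R)
  netU a b = trans (sumZ-split (F a b) e₁) (cong₂ _⊕_ (Fe a b e₁ a j₁ (setO-at (setO o e₂ (dir b e₂)) e₁ (dir a e₁)))
    (trans (sumZ-split (zeroAt e₁ (F a b)) e₂) (cong₂ _⊕_ (trans (z₂ a b) (Fe a b e₂ b j₂ (oo₂ a b))) (sumZ-cong {m G} (Frest a b)))))
  loc : ∀ a b w → u ≢ w → v ≢ w → ∀ e → touch G (cls id w) e ≡ true → o e ≡ oo a b e
  loc a b w uw vw e t = sym (oo-ne a b e (λ { refl → no' j₁ }) (λ { refl → no' j₂ }))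
    where
    no' : Joins G e u v → ⊥
    no' j = true≢false (trans (sym t) (trans (Joins-touch G (cls id w) j) (cong₂ _∨_ (≡ᵇ-≢ (uw ∘ sym)) (≡ᵇ-≢ (vw ∘ sym)))))
  go : Σ Bool (λ a → Σ Bool λ b → (c a ⊕ (c b ⊕ R)) ≡ β G u) → ⊥
  go (a , b , eq) = almost {G} {z} {ψ} tot nx (oo a b) v (λ e t → trans (sym (loc a b z uz vz e t)) (ag e t)) sat
    where
    sat : ∀ w → w ≢ v → Sat G (oo a b) (cls id w)
    sat w wv with u ≟ w
    ... | yes refl = trans (netU a b) (trans eq (sym (bs-single G u)))
    ... | no uw = Sat-local G {o} {oo a b} (cls id w) (λ e k → loc a b w uw (wv ∘ sym) e (cr⇒touch G (cls id w) e k)) (off w (two-false uw (wv ∘ sym)))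

-- A flow off the complement of D, used on the edges meeting D, and a flow off D ∪ x, used elsewhere, are
-- together balanced except at x, and hence everywhere.
no-cut : ∀ {G z ψ} → Crit G z ψ → ∀ x → x ≢ z → (D : VSet G) → D z ≡ false → D x ≡ false →
  ∀ u → D u ≡ true → ∀ w → D w ≡ false → w ≢ z → w ≢ x →
  (∀ e a b → Joins G e a b → D a ≡ true → D b ≡ false → b ≡ z ⊎ b ≡ x) → ⊥
no-cut {G} {z} {ψ} C x xz D dz dx u du w dw wz wx sep =
  go (off C A₁ a₁z (u , x , (λ q → true≢false (trans (sym du) (trans (cong D q) dx))) , a₁D u du , a₁x))
     (off C A₂ a₂z (w , x , wx , a₂ w dw wz , a₂ x dx xz))
  where
  A₁ A₂ : VSet G
  A₁ v = D v ∨ (x ≡ᵇ v)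
  A₂ v = not (D v ∨ (z ≡ᵇ v))
  a₁D : ∀ v → D v ≡ true → A₁ v ≡ true
  a₁D v h rewrite h = refl
  a₁x : A₁ x ≡ true
  a₁x rewrite ≡ᵇ-refl x = Boolₚ.∨-zeroʳ _
  a₁z : A₁ z ≡ false
  a₁z rewrite dz = ≡ᵇ-≢ xz
  a₂ : ∀ v → D v ≡ false → v ≢ z → A₂ v ≡ true
  a₂ v h k rewrite h | ≡ᵇ-≢ {a = z} {v} (k ∘ sym) = refl
  a₂z : A₂ z ≡ false
  a₂z rewrite ≡ᵇ-refl z = cong not (Boolₚ.∨-zeroʳ (D z))
  go : Σ (Orientation G) (Off G z ψ A₁) → Σ (Orientation G) (Off G z ψ A₂) → ⊥
  go (o₁ , s₁ , g₁) (o₂ , s₂ , g₂) = almost {G} {z} {ψ} (Cv.tot (Crit.cv C)) (Crit.nx C) c x agc sat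
    where
    c : Orientation G
    c e = if touch G D e then o₂ e else o₁ e
    agc : Agree G z ψ c
    agc e t with touch G D e
    ... | true = g₂ e t
    ... | false = g₁ e t
    inD : ∀ v e → D v ≡ true → touch G (cls id v) e ≡ true → o₂ e ≡ c e
    inD v e h t rewrite touch-mono G {cls id v} {D} (λ y q → trans (cong D (sym (≡ᵇ-true v y q))) h) e t = refl
    joins : ∀ e v → D v ≡ false → touch G (cls id v) e ≡ true → touch G D e ≡ true → v ≡ z ⊎ v ≡ x
    joins e v h t k with D (p₁ G e) in e₁ | D (p₂ G e) in e₂ | v ≟ p₁ G e | v ≟ p₂ G e
    ... | true | _ | yes q | _ = ⊥-elim (true≢false (trans (sym e₁) (trans (cong D (sym q)) h)))
    ... | _ | true | _ | yes q = ⊥-elim (true≢false (trans (sym e₂) (trans (cong D (sym q)) h)))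
    ... | true | false | no _ | yes q = sep e (p₁ G e) v (inj₁ (cong (p₁ G e ,_) (sym q))) e₁ h
    ... | false | true | yes q | no _ = sep e (p₂ G e) v (inj₂ (cong (_, p₂ G e) (sym q))) e₂ h
    joins e v h t () | false | false | _ | _
    joins e v h () k | true | _ | no _ | no _
    joins e v h () k | false | true | no _ | no _
    outD : ∀ v e → D v ≡ false → v ≢ z → v ≢ x → touch G (cls id v) e ≡ true → o₁ e ≡ c e
    outD v e h vz vx t with touch G D e in eq
    ... | false = refl
    ... | true with joins e v h t eq
    ... | inj₁ q = ⊥-elim (vz q)
    ... | inj₂ q = ⊥-elim (vx q)
    satb : ∀ v → v ≢ x → ∀ b → D v ≡ b → Dec (v ≡ z) → Sat G c (cls id v)
    satb v vx true h _ = Sat-local G {o₂} {c} (cls id v) (λ e k → inD v e h (cr⇒touch G (cls id v) e k)) (s₂ v (cong (λ b → not (b ∨ (z ≡ᵇ v))) h))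
    satb v vx false h (no vz) = Sat-local G {o₁} {c} (cls id v) (λ e k → outD v e h vz vx (cr⇒touch G (cls id v) e k))
      (s₁ v (trans (cong (_∨ (x ≡ᵇ v)) h) (≡ᵇ-≢ (vx ∘ sym))))
    satb v vx false h (yes refl) = Sat-local G {o₁} {c} (cls id v) (λ e k → trans (g₁ e (cr⇒touch G (cls id v) e k)) (sym (agc e (cr⇒touch G (cls id v) e k))))
      (s₁ v a₁z)
    sat : ∀ v → v ≢ x → Sat G c (cls id v)
    sat v vx = satb v vx (D v) refl (v ≟ z)

fourth : ∀ {k} → 4 ≤ k → (a b c : Fin k) → Σ (Fin k) λ w → w ≢ a × w ≢ b × w ≢ c
fourth {k} le a b c with Finₚ.any? (λ w → ¬? (w ≟ a) ×-dec (¬? (w ≟ b) ×-dec ¬? (w ≟ c)))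
... | yes h = h
... | no h = ⊥-elim (ℕₚ.<⇒≱ le (subst (_≤ 3) (len k)
      (ℕₚ.≤-trans (sumℕ-mono {k} cover) (ℕₚ.≤-reflexive (trans (sumℕ-+ {k} _ _)
        (cong₂ _+_ (trans (sumℕ-+ {k} _ _) (cong₂ _+_ (count-≡ a) (count-≡ b))) (count-≡ c)))))))
  where
  len : ∀ k → sumℕ {k} (λ _ → 1) ≡ k
  len zero = refl
  len (suc k) = cong suc (len k)
  cover : ∀ w → 1 ≤ (ind (w ≡ᵇ a) + ind (w ≡ᵇ b)) + ind (w ≡ᵇ c)
  cover w with w ≟ a | w ≟ b | w ≟ c
  ... | yes _ | _ | _ = s≤s z≤n
  ... | no _ | yes _ | _ = s≤s z≤n
  ... | no _ | no _ | yes _ = s≤s z≤n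
  ... | no p | no q | no r = ⊥-elim (h (w , p , q , r))

-- What is needed of a reduced canvas: `B` is the modified graph, `f` contains the identifications
-- made in advance, and `N` is the order below which the degree bound is available.
record TQR {N N' : ℕ} (B : Gr) (f : V B → Fin N') (z : V B) (ψ : Orientation B) : Set where
  field
    coarse : Coarse B f z ψ
  open Coarse coarse public
  field
    tipSat : Sat B ψ (cls lab (lab z))
    canvas : Cv (quot B lab) (lab z)
    ord< : ord (quot B lab) (lab z) < N
    bound : ∀ q → q ≢ lab z → 2 + dd B (cls lab q) ≤ dd B (cls lab (lab z)) ×
      (2 + dd B (cls lab q) ≡ dd B (cls lab (lab z)) → SameD B ψ (cls lab (lab z)) (cls lab q))
    third : ∀ q → q ≢ lab z → Σ (V B) λ v → lab v ≢ lab z × lab v ≢ q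

-- Which contraction arises is not known in advance, so the inequality is asked for every union of
-- classes of `f` that may become a vertex other than the tip. The vertex `w` expresses that a
-- further class besides the tip remains.
TameSets : (B : Gr) {N' : ℕ} → (V B → Fin N') → V B → Set
TameSets B f z = ∀ U → (∀ u v → f u ≡ f v → U u ≡ U v) → U z ≡ false → ∀ v → U v ≡ true →
  ∀ w → U w ≡ false → f w ≢ f z → 4 + at (dd B U) (bs B U) ≤ dd B U

OrdBound : ℕ → (B : Gr) {N' : ℕ} → (V B → Fin N') → V B → Set
OrdBound N B f z = ∀ {p} (lab : V B → Fin p) → Surj lab → (∀ {u v} → f u ≡ f v → lab u ≡ lab v) →
  ord (quot B lab) (lab z) < N

coarse→TQR : ∀ {N N'} → TBelow N → ∀ B (f : V B → Fin N') z ψ → Tot B → Sat B ψ (cls f (f z)) → Coarse B f z ψ →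
  TameSets B f z → OrdBound N B f z → TQR {N} B f z ψ
coarse→TQR tb B f z ψ tot sat co tame ob = record
  { coarse = co ; tipSat = ts ; canvas = cv' ; ord< = o<
  ; bound = λ q ne → T-quot tb B lab (lab z) o< cv' ψ ts nonext q ne ; third = th }
  where
  open Coarse co
  ts : Sat B ψ (cls lab (lab z))
  ts = Sat-cong B {ψ} (λ v → ≡ᵇ-iff (f z) (f v) (lab z) (lab v) refines (λ e → sym (tip (sym e)))) sat
  -- With only one class besides the tip, `ψ` would be balanced there by taking complements, and so
  -- would extend itself.
  th : ∀ q → q ≢ lab z → Σ (V B) λ v → lab v ≢ lab z × lab v ≢ q
  th q ne with Finₚ.any? (λ v → ¬? (lab v ≟ lab z) ×-dec ¬? (lab v ≟ q))
  ... | yes h = h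
  ... | no h = ⊥-elim (nonext (ψ , fl , λ _ _ → refl))
    where
    fl : Flow B lab ψ
    fl r with r ≟ lab z | surj r
    ... | yes refl | _ = ts
    ... | no a | v , refl with lab v ≟ q
    ... | no b = ⊥-elim (h (v , a , b))
    ... | yes refl = Sat-compl B {ψ} tot (cls lab (lab v)) (Sat-cong B {ψ} k ts)
      where
      k : ∀ w → cls lab (lab z) w ≡ not (cls lab (lab v) w)
      k w with lab w ≟ lab z | lab w ≟ lab v
      ... | yes p | yes q = ⊥-elim (a (trans (sym q) p))
      ... | yes p | no q = trans (≡ᵇ-≡ (sym p)) (cong not (sym (≡ᵇ-≢ (q ∘ sym))))
      ... | no p | yes q = trans (≡ᵇ-≢ (p ∘ sym)) (cong not (sym (≡ᵇ-≡ (sym q))))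
      ... | no p | no q = ⊥-elim (h (w , p , q))
  tm : ∀ q → q ≢ lab z → 4 + at (dd B (cls lab q)) (bs B (cls lab q)) ≤ dd B (cls lab q)
  tm q ne = let (v , e) = surj q
                (w , wz , wq) = th q ne
            in tame (cls lab q) (λ u v e → cong (q ≡ᵇ_) (refines e)) (≡ᵇ-≢ ne) v (≡ᵇ-≡ (sym e)) w (≡ᵇ-≢ (wq ∘ sym)) (wz ∘ refines)
  cv' = Cv-quot B lab (lab z) tot (CritL→FCL B lab (lab z) ψ ts nonext crit) tm
  o< = ob lab surj refines

TQ : ∀ {N N'} → TBelow N → ∀ B (f : V B → Fin N') z ψ → Tot B → Sat B ψ (cls f (f z)) → ¬ Ext B f (f z) ψ →
  TameSets B f z → OrdBound N B f z → TQR {N} B f z ψ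
TQ tb B f z ψ tot sat nx = coarse→TQR tb B f z ψ tot sat (coarsen B f z ψ nx)

-- For two or more vertices `LT` is stronger; a singleton inherits the inequality from tameness of
-- its vertex.
tameSet : ∀ {G z} → Cv G z → TBelow (ord G z) → ∀ U → U z ≡ false → ∀ v → U v ≡ true → ∀ w → U w ≡ false → w ≢ z →
  4 + at (dd G U) (bs G U) ≤ dd G U
tameSet {G} {z} cv tb U uz v uv w uw wz with pair? U
... | yes pr = ℕₚ.≤-trans (ℕₚ.+-monoˡ-≤ (at (dd G U) (bs G U)) (ℕₚ.m≤n+m 4 2)) (LT G z cv tb U uz pr w uw wz)
... | no n = subst (λ d → 4 + at d (bs G U) ≤ d) (trans (deg-dd G (Cv.loopless cv) v) (dd-cong G e))
    (subst (λ b → 4 + at (deg G v) b ≤ deg G v) (trans (sym (bs-single G v)) (bs-cong G e)) (Cv.tame cv v λ { refl → true≢false (trans (sym uv) uz) }))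
  where
  e : ∀ u → cls id v u ≡ U u
  e u with v ≟ u | U u in eq
  ... | yes _ | true = refl
  ... | yes refl | false = trans (sym uv) eq
  ... | no h | true = ⊥-elim (n (v , u , h , uv , eq))
  ... | no _ | false = refl

-- There are at most as many classes as vertices, and the first hypothesis prevents former tip edges
-- from being counted among the edges away from the tip. The second hypothesis makes one of the two
-- terms of `ord` drop.
ordBound : ∀ {G : Gr} {z : V G} (ends' : E G → V G × V G) (β' : V G → Z3) {N'} (f : V G → Fin N') →
  let B = record { n = n G ; m = m G ; ends = ends' ; β = β' } in
  (∀ e → touch G (cls id z) e ≡ true → f (p₁ B e) ≡ f (p₂ B e) ⊎ f (p₁ B e) ≡ f z ⊎ f (p₂ B e) ≡ f z) →
  (Σ (V G) λ u → Σ (V G) λ v → u ≢ v × f u ≡ f v) ⊎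
  (Σ (E G) λ e → touch G (cls id z) e ≡ false × f (p₁ B e) ≡ f (p₂ B e)) →
  OrdBound (ord G z) B f z
ordBound {G} {z} ends' β' f h s {p} lab su ref = subst (_< ord G z) (sym (ord-quot B lab (lab z))) (k s)
  where
  B : Gr
  B = record { n = n G ; m = m G ; ends = ends' ; β = β' }
  inn-loop : ∀ e → f (p₁ B e) ≡ f (p₂ B e) → inn B lab (lab z) e ≡ false
  inn-loop e q = cong (λ b → not b ∧ not (touch B (cls lab (lab z)) e)) (≡ᵇ-≡ (ref q))
  inn-f : ∀ e → f (p₁ B e) ≡ f (p₂ B e) ⊎ f (p₁ B e) ≡ f z ⊎ f (p₂ B e) ≡ f z → inn B lab (lab z) e ≡ false
  inn-f e (inj₁ q) = inn-loop e q
  inn-f e (inj₂ (inj₁ q)) = trans (cong (λ b → keep B lab e ∧ not (b ∨ cls lab (lab z) (p₂ B e))) (≡ᵇ-≡ (sym (ref q)))) (Boolₚ.∧-zeroʳ _)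
  inn-f e (inj₂ (inj₂ q)) = trans (cong (λ b → keep B lab e ∧ not (cls lab (lab z) (p₁ B e) ∨ b)) (≡ᵇ-≡ (sym (ref q))))
    (trans (cong (λ b → keep B lab e ∧ not b) (Boolₚ.∨-zeroʳ _)) (Boolₚ.∧-zeroʳ _))
  le : ∀ e → ind (inn B lab (lab z) e) ≤ ind (not (touch G (cls id z) e))
  le e with touch G (cls id z) e in eq
  ... | true = ℕₚ.≤-reflexive (cong ind (inn-f e (h e eq)))
  ... | false with inn B lab (lab z) e
  ... | true = ℕₚ.≤-refl
  ... | false = z≤n
  k : _ → p + sumℕ (λ e → ind (inn B lab (lab z) e)) < ord G z
  k (inj₁ (u , v , ne , q)) = ℕₚ.+-mono-<-≤ (surj-lt lab su u v ne (ref q)) (sumℕ-mono {m G} le)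
  k (inj₂ (e , t , q)) = ℕₚ.+-mono-≤-< (surj-le lab su) (sumℕ-mono-< {m G} le e
    (subst (_< ind (not (touch G (cls id z) e))) (sym (cong ind (inn-loop e q))) (subst (λ b → 0 < ind (not b)) (sym t) (s≤s z≤n))))

-- Lifting the path u y₁ = y₂ v formed by the edges e₁, e₂ to the single edge e₁ = uv; e₂ becomes a loop.

lift : (G : Gr) (e₁ e₂ : E G) (u v : V G) → Gr
lift G e₁ e₂ u v = record { n = n G ; m = m G ; ends = setO (setO (ends G) e₂ (v , v)) e₁ (u , v) ; β = β G }

module Lift (G : Gr) (e₁ e₂ : E G) (u y₁ y₂ v : V G) (e≢ : e₁ ≢ e₂) (j₁ : Joins G e₁ u y₁) (j₂ : Joins G e₂ y₂ v)
    (uy : u ≢ y₁) (yv : y₂ ≢ v) where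
  B : Gr
  B = lift G e₁ e₂ u v

  ends₁ : ends B e₁ ≡ (u , v)
  ends₁ = setO-at (setO (ends G) e₂ (v , v)) e₁ (u , v)

  ends₂ : ends B e₂ ≡ (v , v)
  ends₂ = trans (setO-ne (setO (ends G) e₂ (v , v)) e₁ (u , v) e≢) (setO-at (ends G) e₂ (v , v))

  ends₀ : ∀ {e} → e₁ ≢ e → e₂ ≢ e → ends B e ≡ ends G e
  ends₀ h k = trans (setO-ne (setO (ends G) e₂ (v , v)) e₁ (u , v) h) (setO-ne (ends G) e₂ (v , v) k)

  dir : E G → V G → Bool → Bool
  dir e w b = if b then outOf G e w else not (outOf G e w)

  unl : Orientation B → Orientation G
  unl o = setO (setO o e₂ (dir e₂ y₂ (o e₁))) e₁ (dir e₁ u (o e₁))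

  unl₁ : ∀ o → unl o e₁ ≡ dir e₁ u (o e₁)
  unl₁ o = setO-at (setO o e₂ (dir e₂ y₂ (o e₁))) e₁ (dir e₁ u (o e₁))

  unl₂ : ∀ o → unl o e₂ ≡ dir e₂ y₂ (o e₁)
  unl₂ o = trans (setO-ne (setO o e₂ (dir e₂ y₂ (o e₁))) e₁ (dir e₁ u (o e₁)) e≢) (setO-at o e₂ (dir e₂ y₂ (o e₁)))

  unl₀ : ∀ o {e} → e₁ ≢ e → e₂ ≢ e → unl o e ≡ o e
  unl₀ o h k = trans (setO-ne (setO o e₂ (dir e₂ y₂ (o e₁))) e₁ (dir e₁ u (o e₁)) h) (setO-ne o e₂ (dir e₂ y₂ (o e₁)) k)

  -- Only the side of `A` on which `y₁` and `y₂` lie matters: if it is the same, the contributions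
  -- of the two edges in the middle of the path cancel.
  nt-lift : ∀ o A → A y₁ ≡ A y₂ → nt G (unl o) A ≡ nt B o A
  nt-lift o A h = sumZ-change₂ (ctE G (unl o) A) (ctE B o A) e₁ e₂ e≢ same z0 z0 (both (o e₁) refl)
    where
    same : ∀ e → e₁ ≢ e → e₂ ≢ e → ctE G (unl o) A e ≡ ctE B o A e
    same e p q rewrite unl₀ o p q | ends₀ p q = refl
    loop : ctE B o A e₂ ≡ z0
    loop = ctE-noncr B o A e₂ (cong (A ∘ proj₁) (trans ends₂ (sym (trans (cong (λ w → proj₂ w , proj₁ w) ends₂) refl))))
    eB : ∀ b → o e₁ ≡ b → ctE B o A e₁ ≡ (if b then ct (A u) (A v) else ct (A v) (A u))
    eB true q rewrite q | ends₁ = refl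
    eB false q rewrite q | ends₁ = refl
    calc : ∀ b s t r → ((if b then ct s t else ct t s) ⊕ (if b then ct t r else ct r t)) ≡ (if b then ct s r else ct r s) ⊕ z0
    calc = from-yes (allB? λ b → allB? λ s → allB? λ t → allB? λ r → ((if b then ct s t else ct t s) ⊕ (if b then ct t r else ct r t)) ≟3 ((if b then ct s r else ct r s) ⊕ z0))
    both : ∀ b → o e₁ ≡ b → ctE G (unl o) A e₁ ⊕ ctE G (unl o) A e₂ ≡ ctE B o A e₁ ⊕ ctE B o A e₂
    both b q = trans (cong₂ _⊕_
        (trans (Joins-ctE {G} (unl o) A b uy j₁ (trans (unl₁ o) (cong (dir e₁ u) q))) (cong (λ t → if b then ct (A u) t else ct t (A u)) h))
        (Joins-ctE {G} (unl o) A b yv j₂ (trans (unl₂ o) (cong (dir e₂ y₂) q))))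
      (trans (calc b (A u) (A y₂) (A v)) (sym (cong₂ _⊕_ (eB b q) loop)))

  Sat-lift : ∀ o A → A y₁ ≡ A y₂ → Sat B o A → Sat G (unl o) A
  Sat-lift o A h s = trans (nt-lift o A h) s

  -- Both sides carry summands because a lift either keeps the boundary or lowers it by two,
  -- depending on where the ends lie.
  dd-lift : ∀ A → ind (A u xor A v) + dd G A ≡ (ind (A u xor A y₁) + ind (A y₂ xor A v)) + dd B A
  dd-lift A = sumℕ-change₂ (λ e → ind (cr G A e)) (λ e → ind (cr B A e)) e₁ e₂ e≢ same _ _
    (trans (cong (ind (A u xor A v) +_) (cong₂ (λ a b → ind a + ind b) (Joins-cr G A j₁) (Joins-cr G A j₂)))
      (trans (ℕₚ.+-comm (ind (A u xor A v)) _) (cong₂ _+_ refl (sym (trans (cong₂ (λ a b → ind a + ind b) crB₁ crB₂) (ℕₚ.+-identityʳ _))))))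
    where
    same : ∀ e → e₁ ≢ e → e₂ ≢ e → ind (cr G A e) ≡ ind (cr B A e)
    same e p q rewrite ends₀ p q = refl
    crB₁ : cr B A e₁ ≡ A u xor A v
    crB₁ rewrite ends₁ = refl
    crB₂ : cr B A e₂ ≡ false
    crB₂ rewrite ends₂ = Boolₚ.xor-same (A v)

tail-bit : ∀ {G} o e u v → u ≢ v → Joins G e u v → o e ≡ (if u ≡ᵇ tl G o e then outOf G e u else not (outOf G e u))
tail-bit {G} o e u v ne (inj₁ q) with o e
... | true rewrite q | ≡ᵇ-refl u = refl
... | false rewrite q | ≡ᵇ-refl u | ≡ᵇ-≢ ne = refl
tail-bit {G} o e u v ne (inj₂ q) with o e
... | true rewrite q | ≡ᵇ-≢ ne = refl
... | false rewrite q | ≡ᵇ-refl u | ≡ᵇ-≢ ne = refl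

tail-bool : ∀ {G} (o : Orientation G) {e u v} → u ≢ v → Joins G e u v → ∀ s → (u ≡ᵇ tl G o e) ≡ s →
  o e ≡ (if s then outOf G e u else not (outOf G e u))
tail-bool {G} o {e} {u} {v} ne j s h = trans (tail-bit {G} o e u v ne j) (cong (if_then outOf G e u else not (outOf G e u)) h)

-- A set with as many boundary edges as the tip: if all flows off A extending ψ direct the boundary
-- edges of A alike, then lifting a tip edge of A together with an edge leaving A is again
-- non-extendable, and coarsening shrinks the surroundings of A indefinitely.

-- `b` tells whether the set contains the middle of the lifted path and `g` whether it contains the
-- end away from the tip. Only in the case of the middle without that end are two boundary edges
-- lost, and sets containing the middle satisfy the bound with 6.
lift-tame : ∀ b g dG dB β → ind g + dG ≡ (ind b + ind (b xor g)) + dB → (b ≡ false → 4 + at dG β ≤ dG) →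
  (b ≡ true → 6 + at dG β ≤ dG) → 4 + at dB β ≤ dB
lift-tame false g dG dB β e h k = subst (λ d → 4 + at d β ≤ d) (ℕₚ.+-cancelˡ-≡ (ind g) dG dB e) (h refl)
lift-tame true true dG dB β e h k = subst (λ d → 4 + at d β ≤ d) (ℕₚ.+-cancelˡ-≡ 1 dG dB e)
  (ℕₚ.≤-trans (ℕₚ.+-monoˡ-≤ (at dG β) (ℕₚ.m≤n+m 4 2)) (k refl))
lift-tame true false dG dB β e h k = ℕₚ.+-cancelˡ-≤ 2 (4 + at dB β) dB
  (subst (λ a → 6 + a ≤ 2 + dB) (at-2+ dB β) (subst (λ d → 6 + at d β ≤ d) e (k refl)))

cr-not : ∀ G A e → cr G (not ∘ A) e ≡ cr G A e
cr-not G A e = k (A (p₁ G e)) (A (p₂ G e))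
  where
  k : ∀ a b → not a xor not b ≡ a xor b
  k = from-yes (allB? λ a → allB? λ b → (not a xor not b) ≟B (a xor b))

module Absorb {G : Gr} {z : V G} {ψ : Orientation G} (C : Crit G z ψ) (tb : TBelow (ord G z))
    (A : VSet G) (az : A z ≡ false) (pr : Pair A) (S : VSet G) (SA : ∀ v → S v ≡ true → A v ≡ true)
    (hS : (∀ v → S v ≡ false) ⊎ (Σ (V G) λ x → ∀ v → S v ≡ (x ≡ᵇ v)))
    (e⁺ : E G) (a₁ : V G) (j⁺ : Joins G e⁺ z a₁) (a₁A : A a₁ ≡ true) (a₁S : S a₁ ≡ false)
    (h₁ : ∀ o → Off G z ψ A o → ∀ e → cr G A e ≡ true → touch G S e ≡ false → not (A (tl G o e)) ≡ (z ≡ᵇ tl G ψ e⁺)) where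

  cv : Cv G z
  cv = Crit.cv C

  -- True if `e⁺` leaves the tip and thus enters `A`. By `h₁`, flows off `A` then direct all
  -- boundary edges of `A` avoiding `S` into `A`; if it is false, they direct them out of `A`.
  w : Bool
  w = z ≡ᵇ tl G ψ e⁺

  za₁ : z ≢ a₁
  za₁ h = true≢false (trans (sym a₁A) (trans (cong A (sym h)) az))

  A≢ : ∀ {u v} → A u ≡ true → A v ≡ false → u ≢ v
  A≢ h k q = true≢false (trans (sym h) (trans (cong A q) k))

  exitB : VSet G → V G → V G → Bool
  exitB Cs a g = (A a ∧ not (S a)) ∧ (Cs g ∧ not (A g))

  record Exit (Cs : VSet G) : Set where
    field
      e₂ : E G
      a₂ g : V G
      j₂ : Joins G e₂ a₂ g
      a₂A : A a₂ ≡ true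
      a₂S : S a₂ ≡ false
      gC : Cs g ≡ true
      gA : A g ≡ false

  mkExit : ∀ Cs e a g → Joins G e a g → exitB Cs a g ≡ true → Exit Cs
  mkExit Cs e a g j h = record { e₂ = e ; a₂ = a ; g = g ; j₂ = j
    ; a₂A = ∧-trueˡ (∧-trueˡ h) ; a₂S = not-true (∧-trueʳ {A a} (∧-trueˡ h))
    ; gC = ∧-trueˡ (∧-trueʳ {A a ∧ not (S a)} h) ; gA = not-true (∧-trueʳ {Cs g} (∧-trueʳ {A a ∧ not (S a)} h)) }

  -- Without such an edge, counting the boundary edges of `Cs`, `S`, `A` and `U` yields
  -- `dd G U ≤ dd G S`. For empty `S` this contradicts the lower bound on cuts. For a single vertex
  -- it contradicts the degree bound in `U`, which contains that vertex and `d`.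
  exit : ∀ Cs → (∀ v → A v ≡ true → Cs v ≡ true) → Cs z ≡ false → ∀ d → Cs d ≡ true → A d ≡ false → dd G Cs ≤ dd G A → Exit Cs
  exit Cs AC cz d dC dA le = found (Finₚ.any? λ e → (exitB Cs (p₁ G e) (p₂ G e) ∨ exitB Cs (p₂ G e) (p₁ G e)) ≟B true)
    where
    U : VSet G
    U v = (Cs v ∧ not (A v)) ∨ S v
    found : Dec (Σ (E G) λ e → (exitB Cs (p₁ G e) (p₂ G e) ∨ exitB Cs (p₂ G e) (p₁ G e)) ≡ true) → Exit Cs
    found (yes (e , h)) with exitB Cs (p₁ G e) (p₂ G e) in eq
    ... | true = mkExit Cs e (p₁ G e) (p₂ G e) (inj₁ refl) eq
    ... | false = mkExit Cs e (p₂ G e) (p₁ G e) (inj₂ refl) h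
    found (no none) = ⊥-elim (case hS of λ { (inj₁ h) → emptyS h ; (inj₂ (x , h)) → oneS x h })
      where
      calc : ∀ a a' s s' c c' → (s ≡ true → a ≡ true) → (s' ≡ true → a' ≡ true) → (a ≡ true → c ≡ true) → (a' ≡ true → c' ≡ true) →
        (((a ∧ not s) ∧ (c' ∧ not a')) ∨ ((a' ∧ not s') ∧ (c ∧ not a))) ≡ false →
        ind (c xor c') + ind (s xor s') ≡ ind (a xor a') + ind (((c ∧ not a) ∨ s) xor ((c' ∧ not a') ∨ s'))
      calc = from-yes (allB? λ a → allB? λ a' → allB? λ s → allB? λ s' → allB? λ c → allB? λ c' →
        ((s ≟B true) →-dec (a ≟B true)) →-dec (((s' ≟B true) →-dec (a' ≟B true)) →-dec (((a ≟B true) →-dec (c ≟B true)) →-dec (((a' ≟B true) →-dec (c' ≟B true)) →-dec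
        (((((a ∧ not s) ∧ (c' ∧ not a')) ∨ ((a' ∧ not s') ∧ (c ∧ not a))) ≟B false) →-dec
        ((ind (c xor c') + ind (s xor s')) ℕₚ.≟ (ind (a xor a') + ind (((c ∧ not a) ∨ s) xor ((c' ∧ not a') ∨ s')))))))))
      sums : dd G Cs + dd G S ≡ dd G A + dd G U
      sums = trans (sym (sumℕ-+ {m G} _ _)) (trans (sumℕ-cong {m G} λ e → calc (A (p₁ G e)) (A (p₂ G e)) (S (p₁ G e)) (S (p₂ G e)) (Cs (p₁ G e)) (Cs (p₂ G e))
        (SA _) (SA _) (AC _) (AC _) (bool-ne λ q → none (e , q))) (sumℕ-+ {m G} _ _))
      uz : U z ≡ false
      uz = trans (cong (λ b → (b ∧ not (A z)) ∨ S z) cz) (bool-ne λ q → true≢false (trans (sym (SA z q)) az))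
      ud : U d ≡ true
      ud = trans (cong₂ (λ b c → (b ∧ not c) ∨ S d) dC dA) refl
      ua₁ : U a₁ ≡ false
      ua₁ = trans (cong₂ (λ b c → (Cs a₁ ∧ not b) ∨ c) a₁A a₁S) (trans (Boolₚ.∨-identityʳ _) (Boolₚ.∧-zeroʳ (Cs a₁)))
      small : dd G U ≤ dd G S
      small = ℕₚ.+-cancelˡ-≤ (dd G A) _ _ (ℕₚ.≤-trans (ℕₚ.≤-reflexive (sym sums)) (ℕₚ.+-monoˡ-≤ (dd G S) le))
      emptyS : (∀ v → S v ≡ false) → ⊥
      emptyS h = ℕₚ.<⇒≱ (ℕₚ.≤-trans (s≤s z≤n) (tameSet cv tb U uz d ud a₁ ua₁ (za₁ ∘ sym)))
        (ℕₚ.≤-trans small (ℕₚ.≤-reflexive (sumℕ-zero {m G} λ e → cong₂ (λ a b → ind (a xor b)) (h (p₁ G e)) (h (p₂ G e)))))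
      oneS : ∀ x → (∀ v → S v ≡ (x ≡ᵇ v)) → ⊥
      oneS x h = ℕₚ.<⇒≱ (ℕₚ.≤-trans (ℕₚ.n≤1+n _) (TR-deg G z cv tb U uz (x , d , xd , ux , ud) a₁ ua₁ (za₁ ∘ sym) x ux))
          (ℕₚ.≤-trans small (ℕₚ.≤-reflexive (trans (dd-cong G h) (sym (deg-dd G (Cv.loopless cv) x)))))
        where
        sx : S x ≡ true
        sx = trans (h x) (≡ᵇ-refl x)
        xd : x ≢ d
        xd = A≢ (SA x sx) dA
        ux : U x ≡ true
        ux = trans (cong ((Cs x ∧ not (A x)) ∨_) sx) (Boolₚ.∨-zeroʳ _)

  -- In the second alternative the boundary may stay equal. The edge inside `Cs` and the directions
  -- are recorded to exclude this when `Cs` is everything but the tip.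
  record StepR (Cs : VSet G) (o₀ : Orientation G) : Set where
    field
      A' : VSet G
      AA' : ∀ v → A v ≡ true → A' v ≡ true
      A'C : ∀ v → A' v ≡ true → Cs v ≡ true
      out : Σ (V G) λ v → Cs v ≡ true × A' v ≡ false
      alt : (2 + dd G A' ≤ dd G Cs) ⊎ (dd G A' ≤ dd G Cs × (Σ (E G) λ e → cr G A' e ≡ true × cr G Cs e ≡ false) ×
        (dd G A' ≡ dd G Cs → ∀ e → cr G Cs e ≡ true → touch G A' e ≡ false → not (Cs (tl G o₀ e)) ≡ w))

  module Step (Cs : VSet G) (AC : ∀ v → A v ≡ true → Cs v ≡ true) (cz : Cs z ≡ false)
      (d : V G) (dC : Cs d ≡ true) (dA : A d ≡ false) (le : dd G Cs ≤ dd G A)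
      (o₀ : Orientation G) (off₀ : Off G z ψ Cs o₀) where

    -- The outside of `Cs` becomes the tip, and `A` a single class represented by `a₁`.
    f : V G → Fin (suc (n G))
    f v = if not (Cs v) then zero else (if A v then suc a₁ else suc v)

    f-out : ∀ {v} → Cs v ≡ false → f v ≡ zero
    f-out h = cong (λ b → if not b then zero else (if A _ then suc a₁ else suc _)) h

    f-A : ∀ {v} → A v ≡ true → f v ≡ suc a₁
    f-A {v} h = trans (cong (λ b → if not b then zero else (if A v then suc a₁ else suc v)) (AC v h)) (cong (λ b → if b then suc a₁ else suc v) h)

    f-C : ∀ {v} → Cs v ≡ true → A v ≡ false → f v ≡ suc v
    f-C {v} h k = trans (cong (λ b → if not b then zero else (if A v then suc a₁ else suc v)) h) (cong (λ b → if b then suc a₁ else suc v) k)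

    f-zero : ∀ v → f v ≡ f z → Cs v ≡ false
    f-zero v h = bool-ne λ q → k q (A v) refl
      where
      k : Cs v ≡ true → ∀ b → A v ≡ b → ⊥
      k q true r with trans (sym (f-A r)) (trans h (f-out cz))
      ... | ()
      k q false r with trans (sym (f-C q r)) (trans h (f-out cz))
      ... | ()

    tipcls : ∀ v → cls f (f z) v ≡ not (Cs v)
    tipcls v = k (Cs v) refl
      where
      k : ∀ b → Cs v ≡ b → cls f (f z) v ≡ not b
      k false eq = ≡ᵇ-≡ (trans (f-out cz) (sym (f-out eq)))
      k true eq = ≡ᵇ-≢ λ h → true≢false (trans (sym eq) (f-zero v (sym h)))

    z-touch : ∀ e → touch G (cls id z) e ≡ true → touch G (cls f (f z)) e ≡ true
    z-touch = touch-mono G {cls id z} {cls f (f z)} (λ v q → ≡ᵇ-≡ (cong f (≡ᵇ-true z v q)))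

    toOff : ∀ o' → Flow G f o' → (∀ e → touch G (cls f (f z)) e ≡ true → o' e ≡ o₀ e) → Off G z ψ A o'
    toOff o' fl ag = (λ v h → sat v h (Cs v) refl) , λ e t → trans (ag e (z-touch e t)) (proj₂ off₀ e t)
      where
      sat : ∀ v → A v ≡ false → ∀ b → Cs v ≡ b → Sat G o' (cls id v)
      sat v h false q = Sat-local G {o₀} {o'} (cls id v) (λ e k → sym (ag e (touch-mono G {cls id v} {cls f (f z)}
        (λ u r → trans (tipcls u) (cong not (trans (cong Cs (sym (≡ᵇ-true v u r))) q))) e (cr⇒touch G (cls id v) e k)))) (proj₁ off₀ v q)
      sat v h true q = Sat-cong G {o'} k (fl (suc v))
        where
        k : ∀ u → cls f (suc v) u ≡ cls id v u
        k u = ≡ᵇ-iff (suc v) (f u) v u (λ r → fu r (Cs u) refl (A u) refl) (λ r → sym (trans (cong f (sym r)) (f-C q h)))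
          where
          fu : suc v ≡ f u → ∀ b → Cs u ≡ b → ∀ c → A u ≡ c → v ≡ u
          fu r false s c t with trans r (f-out s)
          ... | ()
          fu r true s true t = ⊥-elim (A≢ a₁A h (sym (Finₚ.suc-injective (trans r (f-A t)))))
          fu r true s false t = Finₚ.suc-injective (trans r (f-C s t))

    merged : Σ (V G) λ u → Σ (V G) λ v → u ≢ v × f u ≡ f v
    merged = let (u , v , ne , au , av) = pr in u , v , ne , trans (f-A au) (sym (f-A av))

    fA : ∀ {u v} → A u ≡ true → A v ≡ true → f u ≡ f v
    fA h k = trans (f-A h) (sym (f-A k))

    Sat-tip : Sat G o₀ (cls f (f z))
    Sat-tip = Sat-cong G {o₀} (λ v → sym (tipcls v)) (Sat-set G {o₀} (not ∘ Cs) λ v h → proj₁ off₀ v (not-true h))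

    -- The graph itself can be coarsened here. In the result, the class of `A` has at least two
    -- boundary edges fewer than the tip, whose degree is `dd G Cs`.
    nonextCase : ¬ Ext G f (f z) o₀ → StepR Cs o₀
    nonextCase nx = out' (TQ tb G f z o₀ (Cv.tot cv) Sat-tip nx
        (λ U _ uz v uv w' uw ne → tameSet cv tb U uz v uv w' uw (λ q → ne (cong f q)))
        (ordBound {G} {z} (ends G) (β G) f (λ e t → zt e t) (inj₁ merged)))
      where
      zt : ∀ e → touch G (cls id z) e ≡ true → f (p₁ G e) ≡ f (p₂ G e) ⊎ f (p₁ G e) ≡ f z ⊎ f (p₂ G e) ≡ f z
      zt e t with Incident-touch G z e t
      ... | inj₁ h = inj₂ (inj₁ (cong f h))
      ... | inj₂ h = inj₂ (inj₂ (cong f h))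
      out' : TQR {ord G z} G f z o₀ → StepR Cs o₀
      out' R = record { A' = cls lab q
          ; AA' = λ v h → ≡ᵇ-≡ (refines (fA a₁A h))
          ; A'C = λ v h → cC v (≡ᵇ-true q (lab v) h)
          ; out = let (v , vz , vq) = third q ne in v , cT v vz , ≡ᵇ-≢ (vq ∘ sym)
          ; alt = inj₁ (subst (2 + dd G (cls lab q) ≤_) (trans (dd-cong G tl') (dd-not G Cs)) (proj₁ (bound q ne))) }
        where
        open TQR R
        q = lab a₁
        tl' : ∀ v → cls lab (lab z) v ≡ not (Cs v)
        tl' v = trans (≡ᵇ-iff (lab z) (lab v) (f z) (f v) (λ h → sym (tip (sym h))) refines) (tipcls v)
        ne : q ≢ lab z
        ne h = true≢false (trans (sym (AC a₁ a₁A)) (f-zero a₁ (tip h)))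
        cT : ∀ v → lab v ≢ lab z → Cs v ≡ true
        cT v h with Cs v in eq
        ... | true = refl
        ... | false = ⊥-elim (h (refines (trans (f-out eq) (sym (f-out cz)))))
        cC : ∀ v → q ≡ lab v → Cs v ≡ true
        cC v h = cT v λ k → ne (trans h k)

    -- After contraction, `e⁺` and `e₂` form a path from the tip through `A` to `g`, and the lifted
    -- edge keeps the direction of `e⁺`. A flow after the lift would run through `A`, so `e₂` would
    -- leave `A` where `h₁` demands that it enter, or conversely.
    module ExtCase (x : Ext G f (f z) o₀) (ex : Exit Cs) where
      o' : Orientation G
      o' = proj₁ x
      ag' : ∀ e → touch G (cls f (f z)) e ≡ true → o' e ≡ o₀ e
      ag' = proj₂ (proj₂ x)
      open Exit ex
      zg : z ≢ g
      zg h = true≢false (trans (sym gC) (trans (cong Cs (sym h)) cz))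
      e≢ : e⁺ ≢ e₂
      e≢ h = true≢false (trans (sym (trans (Joins-touch G (cls id z) j⁺) (cong (_∨ cls id z a₁) (≡ᵇ-refl z))))
        (trans (cong (touch G (cls id z)) h) (trans (Joins-touch G (cls id z) j₂) (cong₂ _∨_ (≡ᵇ-≢ (A≢ a₂A az ∘ sym)) (≡ᵇ-≢ zg)))))
      module L = Lift G e⁺ e₂ z a₁ a₂ g e≢ j⁺ j₂ za₁ (A≢ a₂A gA)
      open L using (B)
      X : VSet G
      X = cls f (f z)
      ψB : Orientation B
      ψB = setO o' e⁺ w
      Xz : X z ≡ true
      Xz = ≡ᵇ-refl (f z)
      X₂ : touch G X e₂ ≡ false
      X₂ = trans (Joins-touch G X j₂) (cong₂ _∨_ (trans (tipcls a₂) (cong not (AC a₂ a₂A))) (trans (tipcls g) (cong not gC)))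
      X⁺ : touch G X e⁺ ≡ true
      X⁺ = trans (Joins-touch G X j⁺) (cong (_∨ X a₁) Xz)
      touch₀ : ∀ Y {e} → e⁺ ≢ e → e₂ ≢ e → touch B Y e ≡ touch G Y e
      touch₀ Y h k rewrite L.ends₀ h k = refl
      cr₀ : ∀ Y {e} → e⁺ ≢ e → e₂ ≢ e → cr B Y e ≡ cr G Y e
      cr₀ Y h k rewrite L.ends₀ h k = refl
      o'⁺ : o' e⁺ ≡ ψ e⁺
      o'⁺ = trans (ag' e⁺ X⁺) (proj₂ off₀ e⁺ (trans (Joins-touch G (cls id z) j⁺) (cong (_∨ cls id z a₁) (≡ᵇ-refl z))))
      un-agree : ∀ o'' → o'' e⁺ ≡ w → (∀ e → e⁺ ≢ e → e₂ ≢ e → touch G X e ≡ true → o'' e ≡ o' e) →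
        ∀ e → touch G X e ≡ true → L.unl o'' e ≡ o' e
      un-agree o'' h k e t = go (e⁺ ≟ e) (e₂ ≟ e)
        where
        go : Dec (e⁺ ≡ e) → Dec (e₂ ≡ e) → L.unl o'' e ≡ o' e
        go (yes refl) _ = trans (L.unl₁ o'') (trans (cong (L.dir e⁺ z) h) (sym (trans o'⁺ (tail-bit {G} ψ e⁺ z a₁ za₁ j⁺))))
        go (no _) (yes refl) = ⊥-elim (true≢false (trans (sym t) X₂))
        go (no p) (no q) = trans (L.unl₀ o'' p q) (k e p q t)
      satB : Sat B ψB X
      satB = trans (sym (L.nt-lift ψB X (cong (f z ≡ᵇ_) (fA a₁A a₂A))))
        (Sat-local G {o'} {L.unl ψB} X (λ e c → sym (un-agree ψB (setO-at o' e⁺ w) (λ e p _ _ → setO-ne o' e⁺ w p) e (cr⇒touch G X e c)))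
          (proj₁ (proj₂ x) (f z)))
      nxB : ¬ Ext B f (f z) ψB
      nxB (o'' , fl , ag) = absurd (h₁ o₃ (toOff o₃ fl₃ (λ e t → trans (agree e t) (ag' e t))) e₂ cr₂ tS)
        where
        o₃ : Orientation G
        o₃ = L.unl o''
        o''⁺ : o'' e⁺ ≡ w
        o''⁺ = trans (ag e⁺ (subst (λ p → X (proj₁ p) ∨ X (proj₂ p) ≡ true) (sym L.ends₁) (cong (_∨ X g) Xz))) (setO-at o' e⁺ w)
        agree : ∀ e → touch G X e ≡ true → o₃ e ≡ o' e
        agree = un-agree o'' o''⁺ λ e p q t → trans (ag e (trans (touch₀ X p q) t)) (setO-ne o' e⁺ w p)
        fl₃ : Flow G f o₃
        fl₃ q = L.Sat-lift o'' (cls f q) (cong (q ≡ᵇ_) (fA a₁A a₂A)) (fl q)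
        cr₂ : cr G A e₂ ≡ true
        cr₂ = trans (Joins-cr G A j₂) (cong₂ _xor_ a₂A gA)
        tS : touch G S e₂ ≡ false
        tS = trans (Joins-touch G S j₂) (cong₂ _∨_ a₂S (bool-ne λ q → true≢false (trans (sym (SA g q)) gA)))
        o₃₂ : o₃ e₂ ≡ L.dir e₂ a₂ w
        o₃₂ = trans (L.unl₂ o'') (cong (L.dir e₂ a₂) o''⁺)
        tail : ∀ b → o₃ e₂ ≡ L.dir e₂ a₂ b → not (A (tl G o₃ e₂)) ≡ not b
        tail true h = cong not (trans (cong A (proj₁ (Joins-tl {G} {o₃} (A≢ a₂A gA) j₂ h))) a₂A)
        tail false h = cong not (trans (cong A (proj₁ (Joins-hd {G} {o₃} (A≢ a₂A gA) j₂ h))) gA)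
        absurd : not (A (tl G o₃ e₂)) ≡ w → ⊥
        absurd h = Boolₚ.not-¬ refl (sym (trans (sym (tail w o₃₂)) h))
      tameB : TameSets B f z
      tameB U sat uz v uv w' uw ne = lift-tame (U a₁) (U g) (dd G U) (dd B U) (bs G U)
          (trans (cong (λ b → ind (b xor U g) + dd G U) (sym uz))
            (trans (L.dd-lift U) (cong₂ (λ b c → (ind (b xor U a₁) + ind (c xor U g)) + dd B U) uz (sat a₂ a₁ (fA a₂A a₁A)))))
          (λ _ → tameSet cv tb U uz v uv w' uw wz)
          (λ h → let (s , t , st , sA , tA) = pr in LT G z cv tb U uz (s , t , st , trans (sat s a₁ (fA sA a₁A)) h , trans (sat t a₁ (fA tA a₁A)) h) w' uw wz)
        where
        wz : w' ≢ z
        wz q = ne (cong f q)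
      ordB : OrdBound (ord G z) B f z
      ordB = ordBound {G} {z} (ends B) (β G) f zt (inj₁ merged)
        where
        zt : ∀ e → touch G (cls id z) e ≡ true → f (p₁ B e) ≡ f (p₂ B e) ⊎ f (p₁ B e) ≡ f z ⊎ f (p₂ B e) ≡ f z
        zt e t = go (e⁺ ≟ e) (e₂ ≟ e) (Incident-touch G z e t)
          where
          go : Dec (e⁺ ≡ e) → Dec (e₂ ≡ e) → Incident G z e → f (p₁ B e) ≡ f (p₂ B e) ⊎ f (p₁ B e) ≡ f z ⊎ f (p₂ B e) ≡ f z
          go (yes refl) _ _ = inj₂ (inj₁ (cong (f ∘ proj₁) L.ends₁))
          go (no _) (yes refl) _ = inj₁ (trans (cong (f ∘ proj₁) L.ends₂) (sym (cong (f ∘ proj₂) L.ends₂)))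
          go (no p) (no q) (inj₁ h) = inj₂ (inj₁ (cong f (trans (cong proj₁ (L.ends₀ p q)) h)))
          go (no p) (no q) (inj₂ h) = inj₂ (inj₂ (cong f (trans (cong proj₂ (L.ends₀ p q)) h)))
      out' : TQR {ord G z} B f z ψB → StepR Cs o₀
      out' R = record { A' = A'
          ; AA' = λ v h → ≡ᵇ-≡ (refines (fA a₁A h))
          ; A'C = λ v h → cC v (≡ᵇ-true q (lab v) h)
          ; out = let (v , vz , vq) = third q ne in v , cT v vz , ≡ᵇ-≢ (vq ∘ sym)
          ; alt = alt' (A' g) refl }
        where
        open TQR R
        q = lab a₁
        A' : VSet G
        A' = cls lab q
        tl' : ∀ v → cls lab (lab z) v ≡ not (Cs v)
        tl' v = trans (≡ᵇ-iff (lab z) (lab v) (f z) (f v) (λ h → sym (tip (sym h))) refines) (tipcls v)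
        ne : q ≢ lab z
        ne h = true≢false (trans (sym (AC a₁ a₁A)) (f-zero a₁ (tip h)))
        cT : ∀ v → lab v ≢ lab z → Cs v ≡ true
        cT v h with Cs v in eq
        ... | true = refl
        ... | false = ⊥-elim (h (refines (trans (f-out eq) (sym (f-out cz)))))
        cC : ∀ v → q ≡ lab v → Cs v ≡ true
        cC v h = cT v λ k → ne (trans h k)
        A'z : A' z ≡ false
        A'z = ≡ᵇ-≢ ne
        A'a : ∀ {a} → A a ≡ true → A' a ≡ true
        A'a h = ≡ᵇ-≡ (refines (fA a₁A h))
        dtip : dd B (cls lab (lab z)) ≡ dd G Cs
        dtip = trans (dd-cong B tl') (trans (ℕₚ.+-cancelˡ-≡ 1 _ _ (sym eq)) (dd-not G Cs))
          where
          eq : 1 + dd G (not ∘ Cs) ≡ 1 + dd B (not ∘ Cs)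
          eq = trans (cong (λ b → ind b + dd G (not ∘ Cs)) (sym (cong₂ (λ s t → not s xor not t) cz gC)))
            (trans (L.dd-lift (not ∘ Cs)) (cong₂ (λ b c → (ind b + ind c) + dd B (not ∘ Cs))
              (cong₂ (λ s t → not s xor not t) cz (AC a₁ a₁A)) (cong₂ (λ s t → not s xor not t) (AC a₂ a₂A) gC)))
        drel : ∀ b → A' g ≡ b → ind b + dd G A' ≡ (1 + ind (not b)) + dd B A'
        drel b h = trans (cong (λ c → ind c + dd G A') (sym (cong₂ _xor_ A'z h))) (trans (L.dd-lift A')
          (cong₂ (λ s t → (ind s + ind t) + dd B A') (cong₂ _xor_ A'z (A'a a₁A)) (cong₂ _xor_ (A'a a₂A) h)))
        b₁ : 2 + dd B A' ≤ dd G Cs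
        b₁ = subst (2 + dd B A' ≤_) dtip (proj₁ (bound q ne))
        -- If `g` lies in the class, the path crosses its boundary once before and once after the
        -- lift. Otherwise both crossings are lost, which uses up the two edges gained from the
        -- degree bound.
        alt' : ∀ b → A' g ≡ b → (2 + dd G A' ≤ dd G Cs) ⊎ (dd G A' ≤ dd G Cs × (Σ (E G) λ e → cr G A' e ≡ true × cr G Cs e ≡ false) ×
          (dd G A' ≡ dd G Cs → ∀ e → cr G Cs e ≡ true → touch G A' e ≡ false → not (Cs (tl G o₀ e)) ≡ w))
        alt' true h = inj₁ (subst (λ k → 2 + k ≤ dd G Cs) (sym (ℕₚ.+-cancelˡ-≡ 1 _ _ (drel true h))) b₁)
        alt' false h = inj₂ (subst (_≤ dd G Cs) (sym (drel false h)) b₁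
          , (e₂ , trans (Joins-cr G A' j₂) (cong₂ _xor_ (A'a a₂A) h) , trans (Joins-cr G Cs j₂) (cong₂ _xor_ (AC a₂ a₂A) gC))
          , λ eq → tight (proj₂ (bound q ne) (trans (sym (drel false h)) (trans eq (sym dtip)))))
          where
          tight : SameD B ψB (cls lab (lab z)) A' → ∀ e → cr G Cs e ≡ true → touch G A' e ≡ false → not (Cs (tl G o₀ e)) ≡ w
          tight (s , hs) e c t = trans dir-e s≡w
            where
            e⁺≢ : e⁺ ≢ e
            e⁺≢ r = true≢false (trans (sym (trans (Joins-touch G A' j⁺) (trans (cong (A' z ∨_) (A'a a₁A)) (Boolₚ.∨-zeroʳ _)))) (trans (cong (touch G A') r) t))
            e₂≢ : e₂ ≢ e
            e₂≢ r = true≢false (trans (sym c) (trans (cong (cr G Cs) (sym r)) (trans (Joins-cr G Cs j₂) (cong₂ _xor_ (AC a₂ a₂A) gC))))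
            lz : VSet B
            lz = cls lab (lab z)
            crz : cr B lz e ≡ true
            crz = trans (cr₀ lz e⁺≢ e₂≢) (trans (cong₂ _xor_ (tl' (p₁ G e)) (tl' (p₂ G e))) (trans (cr-not G Cs e) c))
            tX : touch G X e ≡ true
            tX = cr⇒touch G X e (trans (cong₂ _xor_ (tipcls (p₁ G e)) (tipcls (p₂ G e))) (trans (cr-not G Cs e) c))
            ψe : ψB e ≡ o₀ e
            ψe = trans (setO-ne o' e⁺ w e⁺≢) (ag' e tX)
            tlB : tl B ψB e ≡ tl G o₀ e
            tlB = trans (cong (λ p → if ψB e then proj₁ p else proj₂ p) (L.ends₀ e⁺≢ e₂≢)) (cong (λ b → if b then p₁ G e else p₂ G e) ψe)
            dir-e : not (Cs (tl G o₀ e)) ≡ s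
            dir-e = trans (sym (tl' (tl G o₀ e))) (trans (cong lz (sym tlB)) (hs e crz (trans (touch₀ A' e⁺≢ e₂≢) t)))
            gz : lz g ≡ false
            gz = trans (tl' g) (cong not gC)
            tl⁺ : ∀ b → ψB e⁺ ≡ b → lz (tl B ψB e⁺) ≡ b
            tl⁺ b r = trans (cong (λ p → lz (if ψB e⁺ then proj₁ p else proj₂ p)) L.ends₁) (trans (cong (λ c → lz (if c then z else g)) r) (k b))
              where
              k : ∀ b → lz (if b then z else g) ≡ b
              k true = ≡ᵇ-refl (lab z)
              k false = gz
            s≡w : s ≡ w
            s≡w = trans (sym (hs e⁺ (subst (λ p → lz (proj₁ p) xor lz (proj₂ p) ≡ true) (sym L.ends₁) (cong₂ _xor_ (≡ᵇ-refl (lab z)) gz))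
              (subst (λ p → A' (proj₁ p) ∨ A' (proj₂ p) ≡ false) (sym L.ends₁) (cong₂ _∨_ A'z h)))) (tl⁺ w (setO-at o' e⁺ w))
      result : StepR Cs o₀
      result = out' (TQ tb B f z ψB (Cv.tot cv) satB nxB tameB ordB)

    step' : StepR Cs o₀
    step' with Ext? G f (f z) o₀
    ... | yes x = ExtCase.result x (exit Cs AC cz d dC dA le)
    ... | no nx = nonextCase nx

  size : VSet G → ℕ
  size Cs = sumℕ (λ v → ind (Cs v))

  size< : ∀ {P Q : VSet G} → (∀ v → P v ≡ true → Q v ≡ true) → ∀ v → Q v ≡ true → P v ≡ false → size P < size Q
  size< h v q p = sumℕ-mono-< {n G} (λ u → ind-mono (h u)) v (subst (_< ind _) (sym (cong ind p)) (subst (λ b → 0 < ind b) (sym q) (s≤s z≤n)))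

  -- Each step replaces `Cs` by a smaller set that contains `A` and has no larger boundary. The
  -- process can only end at `A`, whose boundary is too large.
  noSmaller : ∀ N Cs → size Cs < N → (∀ v → A v ≡ true → Cs v ≡ true) → Cs z ≡ false → dd G Cs < dd G A → ⊥
  noSmaller zero Cs () AC cz lt
  noSmaller (suc N) Cs (s≤s sz) AC cz lt = go (Finₚ.any? λ d → (Cs d ≟B true) ×-dec (A d ≟B false))
    where
    go : Dec (Σ (V G) λ d → Cs d ≡ true × A d ≡ false) → ⊥
    go (no h) = ℕₚ.<⇒≢ lt (dd-cong G eq)
      where
      eq : ∀ v → Cs v ≡ A v
      eq v with A v in a | Cs v in c
      ... | true | true = refl
      ... | false | false = refl
      ... | true | false = trans (sym c) (AC v a)
      ... | false | true = ⊥-elim (h (v , c , a))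
    go (yes (d , dC , dA)) = rec (off C Cs cz (let (u , v , ne , au , av) = pr in u , v , ne , AC u au , AC v av))
      where
      next : ∀ {o} → StepR Cs o → ⊥
      next R = noSmaller N A' (ℕₚ.<-≤-trans (size< A'C (proj₁ out) (proj₁ (proj₂ out)) (proj₂ (proj₂ out))) sz) AA' (bool-ne λ q → true≢false (trans (sym (A'C z q)) cz)) (ℕₚ.≤-<-trans (le alt) lt)
        where
        open StepR R
        le : _ ⊎ _ → dd G A' ≤ dd G Cs
        le (inj₁ h) = ℕₚ.≤-trans (ℕₚ.m≤n+m _ 2) h
        le (inj₂ h) = proj₁ h
      rec : Σ (Orientation G) (Off G z ψ Cs) → ⊥
      rec (o , off₀) = next (Step.step' Cs AC cz d dC dA (ℕₚ.<⇒≤ lt) o off₀)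

  -- The first step starts from everything but the tip. By `noSmaller` the boundary does not shrink,
  -- so the step and `h₂` give opposite directions to tip edges avoiding `A'`, and every tip edge
  -- meets `A'`. Together with the recorded edge, which is not at the tip, the boundary of `A'`
  -- would exceed the tip degree.
  contradiction′ : dd G A ≡ deg G z → ∀ d → A d ≡ false → d ≢ z →
    (∀ e → cr G (cls id z) e ≡ true → touch G A e ≡ false → (z ≡ᵇ tl G ψ e) ≡ not w) → ⊥
  contradiction′ dAz d dA dz h₂ = fin (Step.step' Cs AC cz d (cong not (≡ᵇ-≢ (dz ∘ sym))) dA (ℕₚ.≤-reflexive dC) ψ (off-all {G} {z} {ψ} (Crit.tip C) Cs (λ v q → sym (≡ᵇ-true z v (trans (sym (Boolₚ.not-involutive _)) (cong not q))))))
    where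
    Cs : VSet G
    Cs v = not (z ≡ᵇ v)
    cz : Cs z ≡ false
    cz = cong not (≡ᵇ-refl z)
    AC : ∀ v → A v ≡ true → Cs v ≡ true
    AC v h = cong not (≡ᵇ-≢ (A≢ h az ∘ sym))
    dC : dd G Cs ≡ dd G A
    dC = trans (dd-not G (cls id z)) (trans (sym (deg-dd G (Cv.loopless cv) z)) (sym dAz))
    fin : StepR Cs ψ → ⊥
    fin R = k alt
      where
      open StepR R
      A'z : A' z ≡ false
      A'z = bool-ne λ q → true≢false (trans (sym (A'C z q)) cz)
      D : dd G A' < dd G A → ⊥
      D = noSmaller (suc (size A')) A' (ℕₚ.n<1+n _) AA' A'z
      k : _ ⊎ _ → ⊥
      k (inj₁ h) = D (ℕₚ.<-≤-trans (ℕₚ.≤-trans (ℕₚ.n≤1+n _) h) (ℕₚ.≤-reflexive dC))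
      k (inj₂ (le , (e , c , nc) , t)) with ℕₚ.m≤n⇒m<n∨m≡n le
      ... | inj₁ lt = D (ℕₚ.<-≤-trans lt (ℕₚ.≤-reflexive dC))
      ... | inj₂ eq = ℕₚ.<⇒≢ more (trans (sym (dd-not G (cls id z))) (sym eq))
        where
        all-touch : ∀ e → cr G (cls id z) e ≡ true → touch G A' e ≡ true
        all-touch e ce with touch G A' e in te
        ... | true = refl
        ... | false = ⊥-elim (Boolₚ.not-¬ refl (sym (trans (sym (h₂ e ce (bool-ne λ q → true≢false (trans (sym (touch-mono G {A} {A'} AA' e q)) te)))) (trans (sym (Boolₚ.not-involutive _)) (t eq e (trans (cr-not G (cls id z) e) ce) te)))))
        cross : ∀ a b → z ≡ᵇ a xor z ≡ᵇ b ≡ true → A' a ∨ A' b ≡ true → A' a xor A' b ≡ true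
        cross a b h t with z ≟ a | z ≟ b
        cross a b () t | yes _ | yes _
        cross a b () t | no _ | no _
        ... | yes refl | no _ rewrite A'z = t
        ... | no _ | yes refl rewrite A'z = trans (Boolₚ.xor-comm (A' a) false) (trans (sym (Boolₚ.∨-identityʳ (A' a))) t)
        more : dd G (cls id z) < dd G A'
        more = sumℕ-mono-< {m G} (λ e → ind-mono λ ce → cross (p₁ G e) (p₂ G e) ce (all-touch e ce)) e
          (subst (_< ind (cr G A' e)) (sym (cong ind (trans (sym (cr-not G (cls id z) e)) nc))) (subst (λ b → 0 < ind b) (sym c) (s≤s z≤n)))

-- The tallness conditions, with the preflow conditions abstracted

∅ : ∀ {k} → Fin k → Bool
∅ _ = false

record W (k r : ℤ) (dz dx : ℕ) (AS ASx : Set) : Set where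
  field
    tipdeg : pos dz ≤ℤ k +ℤ pos 1
    tall : pos dz ≡ k +ℤ pos 1 → ¬ AS
    xdeg : k - pos 2 - r ≤ℤ pos dx
    xtall : pos dx ≡ k - pos 2 - r → pos dz ≡ k +ℤ pos 1 → ¬ ASx

squeeze : ∀ {a b : ℕ} {c : ℤ} → pos a ≡ c → a ≤ b → pos b ≤ℤ c → a ≡ b
squeeze refl le h = ℕₚ.≤-antisym le (ℤₚ.drop‿+≤+ h)

squeeze' : ∀ {a b : ℕ} {c : ℤ} → pos b ≡ c → a ≤ b → c ≤ℤ pos a → b ≡ a
squeeze' refl le h = ℕₚ.≤-antisym (ℤₚ.drop‿+≤+ h) le

-- The conditions on directions apply only at extremal degrees. A smaller tip degree or a larger
-- degree of `x` makes them void, so the implications are asked for only in the case of equal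
-- degrees.
W-mono : ∀ {k r dz dx dz' dx' AS ASx AS' ASx'} → W k r dz dx AS ASx → dz' ≤ dz → dx ≤ dx' →
  (dz' ≡ dz → AS' → AS) → (dz' ≡ dz → dx' ≡ dx → ASx' → ASx) → W k r dz' dx' AS' ASx'
W-mono w lz lx h hx = record
  { tipdeg = ℤₚ.≤-trans (ℤ.+≤+ lz) tipdeg
  ; tall = λ e a → let q = squeeze e lz tipdeg in tall (trans (cong pos (sym q)) e) (h q a)
  ; xdeg = ℤₚ.≤-trans xdeg (ℤ.+≤+ lx)
  ; xtall = λ ex ez a → let q = squeeze ez lz tipdeg
                            s = squeeze' ex lx xdeg
                        in xtall (trans (cong pos (sym s)) ex) (trans (cong pos (sym q)) ez) (hx q s a) }
  where open W w

AS : (G : Gr) → V G → Orientation G → Set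
AS G z ψ = SameD G ψ (cls id z) ∅

ASx : (G : Gr) → V G → V G → Orientation G → Set
ASx G z x ψ = SameD G ψ (cls id z) (cls id x)

cr-Incident : ∀ G z e → cr G (cls id z) e ≡ true → Incident G z e
cr-Incident G z e c = Incident-touch G z e (cr⇒touch G (cls id z) e c)

Incident-cr : ∀ G → Loopless G → ∀ z e → Incident G z e → cr G (cls id z) e ≡ true
Incident-cr G ll z e (inj₁ q) = trans (cong₂ _xor_ (≡ᵇ-≡ (sym q)) (≡ᵇ-≢ λ r → ll e (trans q r))) refl
Incident-cr G ll z e (inj₂ q) = trans (cong₂ _xor_ (≡ᵇ-≢ λ r → ll e (trans (sym r) (sym q))) (≡ᵇ-≡ (sym q))) refl

cr-tl-hd : ∀ G o A e → cr G A e ≡ true → A (hd G o e) ≡ not (A (tl G o e))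
cr-tl-hd G o A e c with o e
... | true = trans (sym (Boolₚ.not-involutive _)) (cong not (sym (xor-true c)))
... | false = xor-true c

dir-hd : ∀ G o z e → cr G (cls id z) e ≡ true → (z ≡ᵇ tl G o e) ≡ false → hd G o e ≡ z
dir-hd G o z e c h = sym (≡ᵇ-true z (hd G o e) (trans (cr-tl-hd G o (cls id z) e c) (cong not h)))

hd-dir : ∀ G o z e → cr G (cls id z) e ≡ true → hd G o e ≡ z → (z ≡ᵇ tl G o e) ≡ false
hd-dir G o z e c h = trans (sym (Boolₚ.not-involutive _)) (cong not (trans (sym (cr-tl-hd G o (cls id z) e c)) (≡ᵇ-≡ (sym h))))

AllSame→ : ∀ G z X P ψ → (∀ e → cr G (cls id z) e ≡ true → touch G X e ≡ false → P e) → AllSame G z P ψ → SameD G ψ (cls id z) X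
AllSame→ G z X P ψ h (inj₁ a) = true , λ e c t → ≡ᵇ-≡ (sym (a e (h e c t)))
AllSame→ G z X P ψ h (inj₂ a) = false , λ e c t → hd-dir G ψ z e c (a e (h e c t))

AllSame← : ∀ G z X P ψ → (∀ e → P e → cr G (cls id z) e ≡ true × touch G X e ≡ false) → SameD G ψ (cls id z) X → AllSame G z P ψ
AllSame← G z X P ψ h (true , a) = inj₁ λ e p → sym (≡ᵇ-true z (tl G ψ e) (a e (proj₁ (h e p)) (proj₂ (h e p))))
AllSame← G z X P ψ h (false , a) = inj₂ λ e p → dir-hd G ψ z e (proj₁ (h e p)) (a e (proj₁ (h e p)) (proj₂ (h e p)))

XEdge : (G : Gr) → V G → V G → E G → Set
XEdge G z x e = ∃ λ w → w ≢ z × w ≢ x × Joins G e z w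

XEdge→ : ∀ G z x → x ≢ z → ∀ e → XEdge G z x e → cr G (cls id z) e ≡ true × touch G (cls id x) e ≡ false
XEdge→ G z x xz e (w , wz , wx , j) = trans (Joins-cr G (cls id z) j) (trans (cong₂ _xor_ (≡ᵇ-refl z) (≡ᵇ-≢ (wz ∘ sym))) refl)
  , trans (Joins-touch G (cls id x) j) (cong₂ _∨_ (≡ᵇ-≢ xz) (≡ᵇ-≢ (wx ∘ sym)))

XEdge← : ∀ G z x e → cr G (cls id z) e ≡ true → touch G (cls id x) e ≡ false → XEdge G z x e
XEdge← G z x e c t = let (w , zw , j) = other G z e c in
  w , (zw ∘ sym) , (λ q → true≢false (trans (sym (trans (Joins-touch G (cls id x) j) (trans (cong (cls id x z ∨_) (≡ᵇ-≡ (sym q))) (Boolₚ.∨-zeroʳ _)))) t)) , j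

record Easel (G : Gr) (z x : V G) (ψ : Orientation G) : Set where
  field
    cv : Cv G z
    tip : TipPreflow G z ψ
    nx : ¬ Extends G z ψ
    x≢z : x ≢ z

toInGkr : ∀ {k r G z x ψ} → Easel G z x ψ → W k r (deg G z) (deg G x) (AS G z ψ) (ASx G z x ψ) → InGkr k r G z x ψ
toInGkr {k} {r} {G} {z} {x} {ψ} E w = Cv→Bordered cv , Cv.tame cv , Cv.fc cv , tipdeg
  , (tip , nx , λ e a → tall e (AllSame→ G z ∅ (Incident G z) ψ (λ e c _ → cr-Incident G z e c) a))
  , x≢z , xdeg , λ ex ez a → xtall ex ez (AllSame→ G z (cls id x) (XEdge G z x) ψ (XEdge← G z x) a)
  where
  open Easel E
  open W w

fromInGkr : ∀ {k r G z x ψ} → InGkr k r G z x ψ → Easel G z x ψ × W k r (deg G z) (deg G x) (AS G z ψ) (ASx G z x ψ)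
fromInGkr {k} {r} {G} {z} {x} {ψ} (bd , tm , fc , td , (tp , nx , ta) , xz , xd , xt) =
  record { cv = record { loopless = proj₁ bd ; tot = Bordered→Tot {G} {z} {x} bd tm fc xz ; tame = tm ; fc = fc } ; tip = tp ; nx = nx ; x≢z = xz }
  , record { tipdeg = td
    ; tall = λ e a → ta e (AllSame← G z ∅ (Incident G z) ψ (λ e i → Incident-cr G (proj₁ bd) z e i , refl) a)
    ; xdeg = xd
    ; xtall = λ ex ez a → xt ex ez (AllSame← G z (cls id x) (XEdge G z x) ψ (XEdge→ G z x xz) a) }

-- A comparison that transfers tallness for all `k` and `r` at once, and likewise the degree bound.
record Mono (G : Gr) (z x : V G) (ψ : Orientation G) (G' : Gr) (z' x' : V G') (ψ' : Orientation G') : Set where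
  field
    easel : Easel G' z' x' ψ'
    dz≤ : deg G' z' ≤ deg G z
    dx≥ : deg G x ≤ deg G' x'
    as : deg G' z' ≡ deg G z → AS G' z' ψ' → AS G z ψ
    asx : deg G' z' ≡ deg G z → deg G' x' ≡ deg G x → ASx G' z' x' ψ' → ASx G z x ψ

Mono-W : ∀ {k r G z x ψ G' z' x' ψ'} → Mono G z x ψ G' z' x' ψ' → W k r (deg G z) (deg G x) (AS G z ψ) (ASx G z x ψ) →
  InGkr k r G' z' x' ψ'
Mono-W M w = toInGkr easel (W-mono w dz≤ dx≥ as asx)
  where open Mono M

-- Parts of an expansion

-- A preflow of the restriction to `A` that makes this part tall for every `k` and `r` for which the
-- ambient easel is tall. The last two fields turn uniform directions on the boundary of `A` into
-- uniform directions at the tip.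
record PartOK (G : Gr) (z x : V G) (ψ : Orientation G) (A : VSet G) : Set where
  field
    φ : Orientation G
    φtip : Sat G φ (cls (rf G A) (rf G A z))
    φnx : ¬ RExt G A z φ
    dA≤ : dd G A ≤ deg G z
    as : dd G A ≡ deg G z → SameD G φ (not ∘ A) ∅ → AS G z ψ
    asx : A x ≡ true → dd G A ≡ deg G z → SameD G φ (not ∘ A) (cls id x) → ASx G z x ψ

module Part {G : Gr} {z x : V G} {ψ : Orientation G} (cv : Cv G z) {p : ℕ} (f : V G → Fin p) (q : Fin p) (qz : q ≢ f z)
    (P : PartOK G z x ψ (cls f q)) where
  open PartOK P
  A : VSet G
  A = cls f q
  g : V G → Fin (rp G A)
  g = rf G A
  b : Fin (rp G A)
  b = g z
  az : A z ≡ false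
  az = ≡ᵇ-≢ qz
  degb : deg (quot G g) b ≡ dd G A
  degb = trans (deg-quot G g b) (trans (dd-cong G (cls-out G A az)) (dd-not G A))
  rep′ : RestrRep G (λ v → f v ≡ q) g b
  rep′ = Factor.fac-surj (Restr G A) , (λ v h → rf-out G A (≡ᵇ-≢ (h ∘ sym)) az)
    , (λ a h e → qz (sym (trans (cong f (rf-in G A (≡ᵇ-≡ (sym h)) z (sym e))) h)))
    , λ a a' h h' e → rf-in G A (≡ᵇ-≡ (sym h')) a e
  φ' : Orientation (quot G g)
  φ' = φ ∘ orig G g
  unSame : ∀ X → SameD (quot G g) φ' (cls id b) X → SameD G φ (not ∘ A) (X ∘ g)
  unSame X s = SameD-cong G φ {cls g b} {not ∘ A} {X ∘ g} {X ∘ g} (cls-out G A az) (λ _ → refl) (SameD-quot→ G g φ (cls id b) X s)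
  inGk : ∀ {k r} → W k r (deg G z) (deg G x) (AS G z ψ) (ASx G z x ψ) → InGk k (quot G g) b
  inGk {k} w = Cv→Bordered cvA , Cv.tame cvA , Cv.fc cvA , ℤₚ.≤-trans (ℤ.+≤+ le) tipdeg
    , φ' , TipQ← G g b φ φtip , (λ e → φnx (ExtQ→ G g b φ e)) , tl'
    where
    open W w
    cvA = RCv G z A cv az
    le : deg (quot G g) b ≤ deg G z
    le = subst (_≤ deg G z) (sym degb) dA≤
    tl' : pos (deg (quot G g) b) ≡ k +ℤ pos 1 → ¬ AllSame (quot G g) b (Incident (quot G g) b) φ'
    tl' e a = tall (trans (cong pos (sym eq)) e) (as (trans (sym degb) eq) (unSame ∅ (AllSame→ (quot G g) b ∅ (Incident (quot G g) b) φ' (λ i c _ → cr-Incident (quot G g) b i c) a)))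
      where
      eq : deg (quot G g) b ≡ deg G z
      eq = squeeze e le tipdeg
  inGkr : ∀ {k r} → f x ≡ q → W k r (deg G z) (deg G x) (AS G z ψ) (ASx G z x ψ) → InGkr k r (quot G g) b (g x) φ'
  inGkr fx w = toInGkr (record { cv = RCv G z A cv az ; tip = TipQ← G g b φ φtip ; nx = λ e → φnx (ExtQ→ G g b φ e)
      ; x≢z = λ e → true≢false (trans (sym ax) (trans (cong A (sym (rf-in G A ax z (sym e)))) az)) })
    (W-mono w (subst (_≤ deg G z) (sym degb) dA≤) (ℕₚ.≤-reflexive (sym dgx))
      (λ eq s → as (trans (sym degb) eq) (unSame ∅ s))
      (λ eq _ s → asx ax (trans (sym degb) eq) (SameD-cong G φ {not ∘ A} {not ∘ A} {cls g (g x)} {cls id x} (λ _ → refl) (cls-in G A ax) (unSame (cls id (g x)) s))))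
    where
    ax : A x ≡ true
    ax = ≡ᵇ-≡ (sym fx)
    dgx : deg (quot G g) (g x) ≡ deg G x
    dgx = trans (deg-quot G g (g x)) (trans (dd-cong G (cls-in G A ax)) (sym (deg-dd G (Cv.loopless cv) x)))

  restrInGk : ∀ {k r} → W k r (deg G z) (deg G x) (AS G z ψ) (ASx G z x ψ) → RestrInGk k G (λ v → f v ≡ q)
  restrInGk w = rp G A , g , b , rep′ , inGk w
  restrInGkr : ∀ {k r} → f x ≡ q → W k r (deg G z) (deg G x) (AS G z ψ) (ASx G z x ψ) → RestrInGkr k r G (λ v → f v ≡ q) x
  restrInGkr fx w = rp G A , g , b , rep′ , φ' , inGkr fx w

Big→Pair : ∀ {k p} {f : Fin k → Fin p} {q} → Big f q → Pair (cls f q)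
Big→Pair (u , v , ne , a , b) = u , v , ne , ≡ᵇ-≡ (sym a) , ≡ᵇ-≡ (sym b)

expansion : ∀ {k r G z x ψ} → Cv G z → W k r (deg G z) (deg G x) (AS G z ψ) (ASx G z x ψ) → x ≢ z →
  ∀ {H zH x'} Y {p} (f : V G → Fin p) → Surj f → TipResp f z → (I : Iso (quot G f) H) → vto I (f z) ≡ zH → vto I (f x) ≡ x' →
  (∀ q → q ≢ f z → Pair (cls f q) → PartOK G z x ψ (cls f q)) → All (λ y → y ≢ zH → Big f (vfrom I y)) Y →
  Expansion k r G z x H zH x' Y
expansion {k} {r} {G} {z} {x} {ψ} cv w xz Y f s tr I iz ix parts all =
  _ , f , s , tr , I , iz , ix , (λ q B → Part.restrInGk cv f q (ne q B) (part q B) w)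
  , (λ B → Part.restrInGkr cv f (f x) (ne (f x) B) (part (f x) B) refl w)
  , all
  where
  ne : ∀ q → Big f q → q ≢ f z
  ne q (u , v , uv , a , b) refl = uv (trans (tr u a) (sym (tr v b)))
  part : ∀ q → Big f q → PartOK G z x ψ (cls f q)
  part q B = parts q (ne q B) (Big→Pair B)

-- With fewer boundary edges than the tip, the degree of the restricted tip stays below `k + 1`,
-- where tallness says nothing about directions.
partLess : ∀ {G z x ψ} → Cv G z → ∀ A → A z ≡ false → Pair A → dd G A < deg G z → PartOK G z x ψ A
partLess {G} {z} cv A az pr lt = let (φ , s , nx) = R-nonext G z A cv az pr in record
  { φ = φ ; φtip = s ; φnx = nx ; dA≤ = ℕₚ.<⇒≤ lt ; as = λ e → ⊥-elim (ℕₚ.<⇒≢ lt e) ; asx = λ _ e → ⊥-elim (ℕₚ.<⇒≢ lt e) }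

idIso : ∀ G → Iso G G
idIso G = record { vm = record { to = id ; from = id ; to-cong = cong id ; from-cong = cong id ; inverse = (λ { refl → refl }) , (λ { refl → refl }) }
  ; em = record { to = id ; from = id ; to-cong = cong id ; from-cong = cong id ; inverse = (λ { refl → refl }) , (λ { refl → refl }) }
  ; ends-ok = λ e → inj₁ refl ; β-ok = λ v → refl }

-- Isomorphisms from permutations of edge lists

SwapEq : ∀ {A : Set} → A × A → A × A → Set
SwapEq a b = b ≡ a ⊎ b ≡ swapP a

PairSetoid : ℕ → Setoid _ _
PairSetoid k = record { Carrier = Fin k × Fin k ; _≈_ = SwapEq ; isEquivalence = record
  { refl = inj₁ refl
  ; sym = λ { (inj₁ refl) → inj₁ refl ; (inj₂ refl) → inj₂ refl }
  ; trans = λ { (inj₁ refl) b → b ; (inj₂ refl) (inj₁ refl) → inj₂ refl ; (inj₂ refl) (inj₂ refl) → inj₁ refl } } }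

module PS (k : ℕ) where
  open PermS (PairSetoid k) public renaming (_↭_ to _↭ˢ_)

lift↭ : ∀ {k} {L M : List (Fin k × Fin k)} → L ↭ M → PS._↭ˢ_ k L M
lift↭ {k} Perm.refl = PS.↭-refl k
lift↭ {k} (Perm.prep x p) = Hom.prep (inj₁ refl) (lift↭ p)
lift↭ {k} (Perm.swap x y p) = Hom.swap (inj₁ refl) (inj₁ refl) (lift↭ p)
lift↭ {k} (Perm.trans p q) = Hom.trans (lift↭ p) (lift↭ q)

-- Edges of `mkGr` are positions in a list, so an isomorphism that fixes the vertices is a
-- permutation of edge lists up to reversal of ends.
isoPerm : ∀ {k m₁} (ends₁ : Fin m₁ → Fin k × Fin k) β₁ (L : List (Fin k × Fin k)) β₂ → PS._↭ˢ_ k (tabulate ends₁) L →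
  (∀ v → β₂ v ≡ β₁ v) → Iso (record { n = k ; m = m₁ ; ends = ends₁ ; β = β₁ }) (mkGr k L β₂)
isoPerm {k} ends₁ β₁ L β₂ p h = record
  { vm = record { to = id ; from = id ; to-cong = cong id ; from-cong = cong id ; inverse = (λ { refl → refl }) , (λ { refl → refl }) }
  ; em = FinPerm.cast-id (sym (Listₚ.length-tabulate ends₁)) FinPerm.∘ₚ PS.onIndices k p
  ; ends-ok = λ e → subst (λ a → SwapEq a (lookup L (Inverse.to (PS.onIndices k p) (cast (sym (Listₚ.length-tabulate ends₁)) e)))) (Listₚ.lookup-tabulate ends₁ e)
      (PermSₚ.onIndices-lookup (PairSetoid k) p (cast (sym (Listₚ.length-tabulate ends₁)) e))
  ; β-ok = h }

filter-cong : ∀ {A : Set} {p q : A → Bool} L → All (λ e → p e ≡ q e) L → filterᵇ p L ≡ filterᵇ q L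
filter-cong [] _ = refl
filter-cong {p = p} {q} (x ∷ L) (h ∷ hs) with p x | q x
filter-cong (x ∷ L) (refl ∷ hs) | true | true = cong (x ∷_) (filter-cong L hs)
filter-cong (x ∷ L) (refl ∷ hs) | false | false = filter-cong L hs

filter-extract′ : ∀ {A : Set} (p q : A → Bool) e₀ L → Unique L → e₀ ∈ L → p e₀ ≡ true → q e₀ ≡ false → (∀ e → e₀ ≢ e → p e ≡ q e) →
  filterᵇ p L ↭ e₀ ∷ filterᵇ q L
filter-extract′ p q e₀ (.e₀ ∷ L) (u ∷ us) (here refl) pe qe h with p e₀ | q e₀
filter-extract′ p q e₀ (.e₀ ∷ L) (u ∷ us) (here refl) refl refl h | true | false =
  Perm.↭-reflexive (cong (e₀ ∷_) (filter-cong L (All.map (λ {e} n → h e n) u)))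
filter-extract′ p q e₀ (x ∷ L) (u ∷ us) (there i) pe qe h with p x in a | q x in b
... | true | true = Perm.trans (Perm.prep x (filter-extract′ p q e₀ L us i pe qe h)) (Perm.swap x e₀ Perm.refl)
... | false | false = filter-extract′ p q e₀ L us i pe qe h
... | true | false = ⊥-elim (true≢false (trans (sym a) (trans (h x λ { refl → All.lookup u i refl }) b)))
... | false | true = ⊥-elim (true≢false (trans (sym b) (trans (sym (h x λ { refl → All.lookup u i refl })) a)))

filter-extract : ∀ {k} (p q : Fin k → Bool) e₀ → p e₀ ≡ true → q e₀ ≡ false → (∀ e → e₀ ≢ e → p e ≡ q e) →
  filterᵇ p (allFin k) ↭ e₀ ∷ filterᵇ q (allFin k)
filter-extract {k} p q e₀ = filter-extract′ p q e₀ (allFin k) (Uniqueₚ.allFin⁺ k) (∈-allFin e₀)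

filter-all : ∀ {A : Set} (L : List A) → filterᵇ (λ _ → true) L ≡ L
filter-all [] = refl
filter-all (x ∷ L) = cong (x ∷_) (filter-all L)

map-filter-cong : ∀ {A B : Set} {F F' : A → B} (q : A → Bool) L → (∀ e → q e ≡ true → F e ≡ F' e) → map F (filterᵇ q L) ≡ map F' (filterᵇ q L)
map-filter-cong q [] h = refl
map-filter-cong q (x ∷ L) h with q x in eq
... | true = cong₂ _∷_ (h x eq) (map-filter-cong q L h)
... | false = map-filter-cong q L h

tabulate-lookup-map : ∀ {A B : Set} (F : A → B) L → tabulate (λ i → F (lookup L i)) ≡ map F L
tabulate-lookup-map F L = trans (sym (Listₚ.map-tabulate (lookup L) F)) (cong (map F) (Listₚ.tabulate-lookup L))

quotEdges : ∀ G {p} (f : V G → Fin p) → edgeList (quot G f) ≡ map (λ e → mapP f (ends G e)) (kept G f)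
quotEdges G f = tabulate-lookup-map (λ e → mapP f (ends G e)) (kept G f)

-- Deleting an edge directed from u to v: the edge becomes a loop

delG : (G : Gr) (e₀ : E G) (u v : V G) → Gr
delG G e₀ u v = record { n = n G ; m = m G ; ends = setO (ends G) e₀ (u , u)
  ; β = λ w → (β G w ⊕ (if w ≡ᵇ u then z2 else z0)) ⊕ (if w ≡ᵇ v then z1 else z0) }

module Del (G : Gr) (e₀ : E G) (u v : V G) (uv : u ≢ v) (j : Joins G e₀ u v) where
  B : Gr
  B = delG G e₀ u v

  ends₁ : ends B e₀ ≡ (u , u)
  ends₁ = setO-at (ends G) e₀ (u , u)

  ends₀ : ∀ {e} → e₀ ≢ e → ends B e ≡ ends G e
  ends₀ = setO-ne (ends G) e₀ (u , u)

  out : Orientation G → Orientation G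
  out o = setO o e₀ (outOf G e₀ u)

  nt-del : ∀ o A → nt G (out o) A ≡ ct (A u) (A v) ⊕ nt B o A
  nt-del o A = sumZ-change (ctE G (out o) A) (ctE B o A) e₀ same z0 (ct (A u) (A v))
    (trans (Joins-ctE {G} (out o) A true uv j (setO-at o e₀ (outOf G e₀ u))) (trans (sym (⊕-identityʳ _)) (cong (ct (A u) (A v) ⊕_) (sym loop))))
    where
    same : ∀ e → e₀ ≢ e → ctE G (out o) A e ≡ ctE B o A e
    same e h rewrite setO-ne o e₀ (outOf G e₀ u) h | ends₀ h = refl
    loop : ctE B o A e₀ ≡ z0
    loop = ctE-noncr B o A e₀ (trans (cong (A ∘ proj₁) ends₁) (sym (cong (A ∘ proj₂) ends₁)))

  bs-del : ∀ A → bs G A ≡ ct (A u) (A v) ⊕ bs B A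
  bs-del A = sym (trans (cong (ct (A u) (A v) ⊕_) eq) (from-yes (all3? λ b → allB? λ s → allB? λ t →
      (ct s t ⊕ ((b ⊕ (if s then z2 else z0)) ⊕ (if t then z1 else z0))) ≟3 b) (bs G A) (A u) (A v)))
    where
    dist : ∀ a b c d → (if a then (b ⊕ c) ⊕ d else z0) ≡ ((if a then b else z0) ⊕ (if a then c else z0)) ⊕ (if a then d else z0)
    dist true b c d = refl
    dist false b c d = refl
    eq : bs B A ≡ (bs G A ⊕ (if A u then z2 else z0)) ⊕ (if A v then z1 else z0)
    eq = trans (sumZ-cong {n G} λ w → dist (A w) (β G w) (if w ≡ᵇ u then z2 else z0) (if w ≡ᵇ v then z1 else z0))
      (trans (sumZ-⊕ {n G} _ _) (cong₂ _⊕_ (trans (sumZ-⊕ {n G} _ _) (cong (bs G A ⊕_) (sum-pick A u z2))) (sum-pick A v z1)))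

  Sat-del→ : ∀ o A → Sat B o A → Sat G (out o) A
  Sat-del→ o A s = trans (nt-del o A) (trans (cong (ct (A u) (A v) ⊕_) s) (sym (bs-del A)))

  Sat-del← : ∀ o A → Sat G (out o) A → Sat B o A
  Sat-del← o A s = ⊕-cancelˡ (ct (A u) (A v)) _ _ (trans (sym (nt-del o A)) (trans s (bs-del A)))

  dd-del : ∀ A → dd G A ≡ ind (A u xor A v) + dd B A
  dd-del A = sumℕ-change (λ e → ind (cr G A e)) (λ e → ind (cr B A e)) e₀ same 0 (ind (A u xor A v))
    (trans (cong ind (Joins-cr G A j)) (trans (sym (ℕₚ.+-identityʳ _)) (cong (ind (A u xor A v) +_) (sym loop))))
    where
    same : ∀ e → e₀ ≢ e → ind (cr G A e) ≡ ind (cr B A e)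
    same e h rewrite ends₀ h = refl
    loop : ind (cr B A e₀) ≡ 0
    loop = cong ind (trans (cong (λ p → A (proj₁ p) xor A (proj₂ p)) ends₁) (Boolₚ.xor-same (A u)))

  tot : Tot G → Tot B
  tot t = trans (sym (bs-del (λ _ → true))) t

  cr₀ : ∀ A {e} → e₀ ≢ e → cr B A e ≡ cr G A e
  cr₀ A h = cong (λ p → A (proj₁ p) xor A (proj₂ p)) (ends₀ h)

  touch₀ : ∀ A {e} → e₀ ≢ e → touch B A e ≡ touch G A e
  touch₀ A h = cong (λ p → A (proj₁ p) ∨ A (proj₂ p)) (ends₀ h)

  tl₀ : ∀ o {e} → e₀ ≢ e → tl B o e ≡ tl G o e
  tl₀ o {e} h = cong (λ p → if o e then proj₁ p else proj₂ p) (ends₀ h)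

  SameD-del : ∀ o T X → cr G T e₀ ≡ false → SameD B o T X → SameD G o T X
  SameD-del o T X c (s , h) = s , λ e ce te → let ne = λ q → true≢false (trans (sym ce) (trans (cong (cr G T) (sym q)) c)) in
    trans (cong T (sym (tl₀ o ne))) (h e (trans (cr₀ T ne) ce) (trans (touch₀ X ne) te))

  -- The loop replacing `e₀` disappears in the contraction of `B`, while `e₀` itself survives in
  -- that of `G` because its ends have different labels.
  iso : ∀ {p} (f : V G → Fin p) → f u ≢ f v → Iso (quot G f) (addEdge (quot B f) (f u) (f v))
  iso {p} f fuv = isoPerm (ends (quot G f)) (β (quot G f)) _ _ perm βeq
    where
    F : E G → Fin p × Fin p
    F e = mapP f (ends G e)
    F' : E G → Fin p × Fin p
    F' e = mapP f (ends B e)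
    keep₀ : keep B f e₀ ≡ false
    keep₀ = trans (cong (λ p → not (f (proj₁ p) ≡ᵇ f (proj₂ p))) ends₁) (cong not (≡ᵇ-refl (f u)))
    keepG : keep G f e₀ ≡ true
    keepG = go j
      where
      go : Joins G e₀ u v → keep G f e₀ ≡ true
      go (inj₁ q) = trans (cong (λ p → not (f (proj₁ p) ≡ᵇ f (proj₂ p))) q) (cong not (≡ᵇ-≢ fuv))
      go (inj₂ q) = trans (cong (λ p → not (f (proj₁ p) ≡ᵇ f (proj₂ p))) q) (cong not (≡ᵇ-≢ (fuv ∘ sym)))
    F₀ : SwapEq (F e₀) (f u , f v)
    F₀ = go j
      where
      go : Joins G e₀ u v → SwapEq (F e₀) (f u , f v)
      go (inj₁ q) = inj₁ (sym (cong (mapP f) q))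
      go (inj₂ q) = inj₂ (sym (cong (swapP ∘ mapP f) q))
    rest : map F (kept B f) ≡ map F' (kept B f)
    rest = map-filter-cong (keep B f) (allFin (m G)) λ e k → cong (mapP f) (sym (ends₀ λ q → true≢false (trans (sym k) (trans (cong (keep B f) (sym q)) keep₀))))
    p1 : map F (kept G f) ↭ F e₀ ∷ map F' (kept B f)
    p1 = Perm.trans (Permₚ.map⁺ F (filter-extract (keep G f) (keep B f) e₀ keepG keep₀ λ e h → sym (cong (λ p → not (f (proj₁ p) ≡ᵇ f (proj₂ p))) (ends₀ h))))
      (Perm.↭-reflexive (cong (F e₀ ∷_) rest))
    p2 : (f u , f v) ∷ map F' (kept B f) ↭ edgeList (quot B f) ++ (f u , f v) ∷ []
    p2 = Perm.trans (Permₚ.∷↭∷ʳ (f u , f v) (map F' (kept B f))) (Perm.↭-reflexive (cong (_++ (f u , f v) ∷ []) (sym (quotEdges B f))))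
    perm : PS._↭ˢ_ p (edgeList (quot G f)) (edgeList (quot B f) ++ (f u , f v) ∷ [])
    perm = Hom.trans (lift↭ (Perm.trans (Perm.↭-reflexive (quotEdges G f)) p1)) (Hom.trans (Hom.prep F₀ (PS.↭-refl p)) (lift↭ p2))
    βeq : ∀ q → (β (quot B f) q ⊕ (if q ≡ᵇ f u then z1 else z0)) ⊕ (if q ≡ᵇ f v then z2 else z0) ≡ β (quot G f) q
    βeq q = trans (cong (λ b → (b ⊕ (if q ≡ᵇ f u then z1 else z0)) ⊕ (if q ≡ᵇ f v then z2 else z0)) (β-quot B f q))
      (trans (trans (⊕-assoc (bs B (cls f q)) _ _) (⊕-comm (bs B (cls f q)) _)) (trans (sym (bs-del (cls f q))) (sym (β-quot G f q))))

  -- `ADD` compares with `G` itself; the contraction by `id` merely discards the loop.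
  isoId : Loopless G → Iso G (addEdge (quot B id) u v)
  isoId ll = isoPerm (ends G) (β G) _ _ perm βeq
    where
    keep₀ : keep B id e₀ ≡ false
    keep₀ = trans (cong (λ p → not (proj₁ p ≡ᵇ proj₂ p)) ends₁) (cong not (≡ᵇ-refl u))
    keepB : ∀ e → e₀ ≢ e → true ≡ keep B id e
    keepB e h = sym (trans (cong (λ p → not (proj₁ p ≡ᵇ proj₂ p)) (ends₀ h)) (cong not (≡ᵇ-≢ (ll e))))
    F₀ : SwapEq (ends G e₀) (u , v)
    F₀ = go j
      where
      go : Joins G e₀ u v → SwapEq (ends G e₀) (u , v)
      go (inj₁ q) = inj₁ (sym q)
      go (inj₂ q) = inj₂ (sym (cong swapP q))
    rest : map (ends G) (kept B id) ≡ map (ends B) (kept B id)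
    rest = map-filter-cong (keep B id) (allFin (m G)) λ e k → sym (ends₀ λ q → true≢false (trans (sym k) (trans (cong (keep B id) (sym q)) keep₀)))
    p1 : edgeList G ↭ ends G e₀ ∷ map (ends B) (kept B id)
    p1 = Perm.trans (Perm.↭-reflexive (trans (sym (Listₚ.map-tabulate {n = m G} id (ends G))) (cong (map (ends G)) (sym (filter-all (allFin (m G)))))))
      (Perm.trans (Permₚ.map⁺ (ends G) (filter-extract (λ _ → true) (keep B id) e₀ refl keep₀ keepB)) (Perm.↭-reflexive (cong (ends G e₀ ∷_) rest)))
    p2 : (u , v) ∷ map (ends B) (kept B id) ↭ edgeList (quot B id) ++ (u , v) ∷ []
    p2 = Perm.trans (Permₚ.∷↭∷ʳ (u , v) (map (ends B) (kept B id))) (Perm.↭-reflexive (cong (_++ (u , v) ∷ []) (sym (quotEdges B id))))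
    perm : PS._↭ˢ_ (n G) (edgeList G) (edgeList (quot B id) ++ (u , v) ∷ [])
    perm = Hom.trans (lift↭ p1) (Hom.trans (Hom.prep F₀ (PS.↭-refl (n G))) (lift↭ p2))
    βeq : ∀ q → (β (quot B id) q ⊕ (if q ≡ᵇ u then z1 else z0)) ⊕ (if q ≡ᵇ v then z2 else z0) ≡ β G q
    βeq q = trans (cong (λ b → (b ⊕ (if q ≡ᵇ u then z1 else z0)) ⊕ (if q ≡ᵇ v then z2 else z0)) (β-quot B id q))
      (trans (trans (⊕-assoc (bs B (cls id q)) _ _) (⊕-comm (bs B (cls id q)) _)) (trans (sym (bs-del (cls id q))) (bs-single G q)))

-- Reductions to a smaller easel

Rel : Set₁
Rel = ℤ → ℤ → (G' : Gr) → V G' → V G' → Set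

-- Reductions are recorded independently of `k` and `r`, so that they serve the theorem and, through
-- `Mono-Bound`, also the proof of the degree bound.
record Red (G : Gr) (z x : V G) (ψ : Orientation G) (R : Rel) : Set where
  field
    G' : Gr
    z' x' : V G'
    ψ' : Orientation G'
    mono : Mono G z x ψ G' z' x' ψ'
    prec : Prec G' z' x' G z x
    rel : ∀ {k r} → W k r (deg G z) (deg G x) (AS G z ψ) (ASx G z x ψ) → R k r G' z' x'

Red→Better : ∀ {k r G z x ψ} {R : Rel} → W k r (deg G z) (deg G x) (AS G z ψ) (ASx G z x ψ) → Red G z x ψ R → Better k r G z x (R k r)
Red→Better w D = G' , z' , x' , ψ' , Mono-W mono w , prec , rel w
  where open Red D

Red-map : ∀ {G z x ψ} {R S : Rel} → (∀ {k r G' z' x'} → R k r G' z' x' → S k r G' z' x') → Red G z x ψ R → Red G z x ψ S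
Red-map h D = record { G' = G' ; z' = z' ; x' = x' ; ψ' = ψ' ; mono = mono ; prec = prec ; rel = λ w → h (rel w) }
  where open Red D

single-or-pair : ∀ {k} (U : Fin k → Bool) v → U v ≡ true → Pair U ⊎ (∀ u → U u ≡ cls id v u)
single-or-pair U v uv with pair? U
... | yes p = inj₁ p
... | no n = inj₂ λ u → sym (≡ᵇ-single u)
  where
  ≡ᵇ-single : ∀ u → cls id v u ≡ U u
  ≡ᵇ-single u with v ≟ u | U u in eq
  ... | yes _ | true = refl
  ... | yes refl | false = trans (sym uv) eq
  ... | no h | true = ⊥-elim (n (v , u , h , uv , eq))
  ... | no _ | false = refl

-- The class of `x` may have grown. The hypothesis on equality of degrees makes it a singleton in
-- the critical case, so that the edges avoiding it are those avoiding `x`.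
quotMono : ∀ {G z x ψ N N'} (ends' : E G → V G × V G) (β' : V G → Z3) →
  let B = record { n = n G ; m = m G ; ends = ends' ; β = β' } in
  (f : V G → Fin N') (ψB : Orientation G) (R : TQR {N} B f z ψB) → (∀ v → TQR.lab R v ≡ TQR.lab R z → v ≡ z) → x ≢ z →
  dd B (cls id z) ≡ deg G z → deg G x ≤ dd B (cls (TQR.lab R) (TQR.lab R x)) →
  (dd B (cls (TQR.lab R) (TQR.lab R x)) ≡ deg G x → ∀ v → cls (TQR.lab R) (TQR.lab R x) v ≡ cls id x v) →
  (∀ X → SameD B ψB (cls id z) X → SameD G ψ (cls id z) X) →
  Mono G z x ψ (quot B (TQR.lab R)) (TQR.lab R z) (TQR.lab R x) (ψB ∘ orig B (TQR.lab R))
quotMono {G} {z} {x} {ψ} ends' β' f ψB R tz xz dz dx dxe sd = record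
  { easel = record { cv = canvas ; tip = TipQ← B lab (lab z) ψB tipSat ; nx = λ e → nonext (ExtQ→ B lab (lab z) ψB e) ; x≢z = λ e → xz (tz x e) }
  ; dz≤ = ℕₚ.≤-reflexive dz'
  ; dx≥ = subst (deg G x ≤_) (sym dx') dx
  ; as = λ _ s → sd ∅ (SameD-cong B ψB {cls lab (lab z)} {cls id z} {∅} {∅} tcl (λ _ → refl) (SameD-quot→ B lab ψB (cls id (lab z)) ∅ s))
  ; asx = λ _ e s → sd (cls id x) (SameD-cong B ψB {cls lab (lab z)} {cls id z} {cls lab (lab x)} {cls id x} tcl (dxe (trans (sym dx') e)) (SameD-quot→ B lab ψB (cls id (lab z)) (cls id (lab x)) s)) }
  where
  B : Gr
  B = record { n = n G ; m = m G ; ends = ends' ; β = β' }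
  open TQR R
  tcl : ∀ v → cls lab (lab z) v ≡ cls id z v
  tcl v = ≡ᵇ-iff (lab z) (lab v) z v (λ e → sym (tz v (sym e))) (cong lab)
  dz' : deg (quot B lab) (lab z) ≡ deg G z
  dz' = trans (deg-quot B lab (lab z)) (trans (dd-cong B tcl) dz)
  dx' : deg (quot B lab) (lab x) ≡ dd B (cls lab (lab x))
  dx' = deg-quot B lab (lab x)

-- The preflow does not extend to some contraction

BadLab : (G : Gr) (z : V G) (ψ : Orientation G) → Set
BadLab G z ψ = Σ ℕ λ N → Σ (V G → Fin N) λ f → (∀ v → f v ≡ f z → v ≡ z) × (Σ (V G) λ u → Σ (V G) λ v → u ≢ v × f u ≡ f v) × ¬ Ext G f (f z) ψ

merge-merges : ∀ {p} (u v : Fin (suc p)) (ne : u ≢ v) → merge u v ne u ≡ merge u v ne v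
merge-merges u v ne with v ≟ u | v ≟ v
... | yes e | _ = ⊥-elim (ne (sym e))
... | no _ | no h = ⊥-elim (h refl)
... | no n | yes _ = Finₚ.punchOut-cong v refl

critOrLab : ∀ G z ψ → CritL G id z ψ ⊎ BadLab G z ψ
critOrLab record { n = zero } ()
critOrLab G@(record { n = suc p }) z ψ with critOrBad G id z ψ
... | inj₁ c = inj₁ c
... | inj₂ (u , v , ne , a , b , x) = inj₂ (p , merge u v ne , merge-tip u v ne z a b , (u , v , ne , merge-merges u v ne) , x)

dz-eq : ∀ {G z} → Cv G z → dd G (cls id z) ≡ deg G z
dz-eq {G} {z} cv = sym (deg-dd G (Cv.loopless cv) z)

tip-edge : ∀ {G z N} (f : V G → Fin N) → ∀ e → touch G (cls id z) e ≡ true → f (p₁ G e) ≡ f (p₂ G e) ⊎ f (p₁ G e) ≡ f z ⊎ f (p₂ G e) ≡ f z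
tip-edge {G} {z} f e t = go (Incident-touch G z e t)
  where
  go : Incident G z e → _
  go (inj₁ h) = inj₂ (inj₁ (cong f h))
  go (inj₂ h) = inj₂ (inj₂ (cong f h))

-- The graph is only contracted. By the degree bound each part has two boundary edges fewer than the
-- tip, so `partLess` applies; if the class of `x` has several vertices, it has degree at least
-- `2 + deg G x`.
redEXP : ∀ {G z x ψ} → Easel G z x ψ → TBelow (ord G z) → BadLab G z ψ → Red G z x ψ (λ k r → EXP k r G z x)
redEXP {G} {z} {x} {ψ} E tb (N , f , ftip , merged , nxf) = go (TQ tb G f z ψ (Cv.tot cv)
    (Sat-cong G {ψ} (λ v → ≡ᵇ-iff z v (f z) (f v) (cong f) (λ e → sym (ftip v (sym e)))) (Tip→Sat G z ψ tip)) nxf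
    (λ U _ uz v uv w uw ne → tameSet cv tb U uz v uv w uw (λ q → ne (cong f q)))
    (ordBound {G} {z} (ends G) (β G) f (tip-edge {G} {z} f) (inj₁ merged)))
  where
  open Easel E
  go : TQR {ord G z} G f z ψ → Red G z x ψ (λ k r → EXP k r G z x)
  go R = record { mono = mono ; prec = inj₁ ord<
      ; rel = λ w → expansion cv w x≢z [] lab surj tz (idIso (quot G lab)) refl refl parts [] }
    where
    open TQR R hiding (tip)
    tz : ∀ v → lab v ≡ lab z → v ≡ z
    tz v e = ftip v (TQR.tip R e)
    dt : dd G (cls lab (lab z)) ≡ deg G z
    dt = trans (dd-cong G λ v → ≡ᵇ-iff (lab z) (lab v) z v (λ e → sym (tz v (sym e))) (cong lab)) (dz-eq cv)
    parts : ∀ q → q ≢ lab z → Pair (cls lab q) → PartOK G z x ψ (cls lab q)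
    parts q ne pr = partLess cv (cls lab q) (≡ᵇ-≢ ne) pr (ℕₚ.<-≤-trans (ℕₚ.n<1+n _) (ℕₚ.≤-trans (ℕₚ.n≤1+n _) (subst (2 + dd G (cls lab q) ≤_) dt (proj₁ (bound q ne)))))
    qx : lab x ≢ lab z
    qx e = x≢z (tz x e)
    U : VSet G
    U = cls lab (lab x)
    Ux : U x ≡ true
    Ux = ≡ᵇ-refl (lab x)
    pairU : Pair U → 2 + deg G x ≤ dd G U
    pairU pr = let (w , wz , wx) = third (lab x) qx in TR-deg G z cv tb U (≡ᵇ-≢ qx) pr w (≡ᵇ-≢ (wx ∘ sym)) (λ e → wz (cong lab e)) x Ux
    dx : Pair U ⊎ (∀ u → U u ≡ cls id x u) → deg G x ≤ dd G U
    dx (inj₁ pr) = ℕₚ.≤-trans (ℕₚ.m≤n+m _ 2) (pairU pr)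
    dx (inj₂ h) = ℕₚ.≤-reflexive (trans (deg-dd G (Cv.loopless cv) x) (sym (dd-cong G h)))
    dxe : Pair U ⊎ (∀ u → U u ≡ cls id x u) → dd G U ≡ deg G x → ∀ v → U v ≡ cls id x v
    dxe (inj₁ pr) e = ⊥-elim (ℕₚ.<⇒≱ (ℕₚ.≤-trans (ℕₚ.n<1+n _) (ℕₚ.n≤1+n _)) (ℕₚ.≤-trans (pairU pr) (ℕₚ.≤-reflexive e)))
    dxe (inj₂ h) e = h
    mono : Mono G z x ψ (quot G lab) (lab z) (lab x) (ψ ∘ orig G lab)
    mono = quotMono {G} {z} {x} {ψ} (ends G) (β G) f ψ R tz x≢z (dz-eq cv) (dx (single-or-pair U x Ux)) (dxe (single-or-pair U x Ux)) (λ X s → s)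

-- Friendliness and tameness after the deletion of an edge

odd-ge5 : ∀ d → isEven d ≡ false → 3 ≤ d → d ≢ 3 → 5 ≤ d
odd-ge5 0 ()
odd-ge5 1 _ (s≤s ()) _
odd-ge5 2 ()
odd-ge5 3 _ _ h = ⊥-elim (h refl)
odd-ge5 4 ()
odd-ge5 (suc (suc (suc (suc (suc d))))) _ _ _ = s≤s (s≤s (s≤s (s≤s (s≤s z≤n))))

-- Losing an outgoing edge lowers |τ| by one at an out-friendly vertex unless τ is zero. In that
-- case |τ| becomes one, and parity helps: an even degree of at least four, different from four, is
-- at least six.
outF : ∀ d b → Any (λ t → pos 0 ≤ℤ t) (tauOf (suc d) (z1 ⊕ b)) → 4 + at (suc d) (z1 ⊕ b) ≤ suc d → suc d ≢ 4 → 4 + at d b ≤ d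
outF d b h le ne with isEven d in eq | b
outF d b h (s≤s le) ne | true | z0 = le
outF d b (here ()) le ne | true | z1
outF d b (there ()) le ne | true | z1
outF d b h (s≤s le) ne | true | z2 = le
outF d b (here ()) le ne | false | z0
outF d b (there ()) le ne | false | z0
outF d b h (s≤s le) ne | false | z1 = le
outF d b h (s≤s le) ne | false | z2 = odd-ge5 d eq le (ne ∘ cong suc)

inF : ∀ d b → Any (λ t → t ≤ℤ pos 0) (tauOf (suc d) (z2 ⊕ b)) → 4 + at (suc d) (z2 ⊕ b) ≤ suc d → suc d ≢ 4 → 4 + at d b ≤ d
inF d b h le ne with isEven d in eq | b
inF d b h (s≤s le) ne | true | z0 = le
inF d b h (s≤s le) ne | true | z1 = le
inF d b (here (ℤ.+≤+ ())) le ne | true | z2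
inF d b (there ()) le ne | true | z2
inF d b (here (ℤ.+≤+ ())) le ne | false | z0
inF d b (there ()) le ne | false | z0
inF d b h (s≤s le) ne | false | z1 = odd-ge5 d eq le (ne ∘ cong suc)
inF d b h (s≤s le) ne | false | z2 = le

at-step : ∀ d c b → c ≢ z0 → at d b ≤ 1 + at (suc d) (c ⊕ b)
at-step d c b h with isEven d | c | b
... | _ | z0 | _ = ⊥-elim (h refl)
... | true | z1 | z0 = z≤n
... | true | z1 | z1 = s≤s (s≤s z≤n)
... | true | z1 | z2 = s≤s (s≤s z≤n)
... | true | z2 | z0 = z≤n
... | true | z2 | z1 = s≤s (s≤s z≤n)
... | true | z2 | z2 = s≤s (s≤s z≤n)
... | false | z1 | z0 = s≤s (s≤s (s≤s z≤n))
... | false | z1 | z1 = s≤s z≤n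
... | false | z1 | z2 = s≤s z≤n
... | false | z2 | z0 = s≤s (s≤s (s≤s z≤n))
... | false | z2 | z1 = s≤s z≤n
... | false | z2 | z2 = s≤s z≤n

-- Deleting an edge between an out-friendly and an in-friendly vertex

-- The surplus of two over tameness pays for the deleted edge and for the growth of |τ|, which is at
-- most one.
del-tame-pair : ∀ dG bG dB bB c → dG ≡ suc dB → bG ≡ c ⊕ bB → c ≢ z0 → 6 + at dG bG ≤ dG → 4 + at dB bB ≤ dB
del-tame-pair _ _ dB bB c refl refl h (s≤s le) = ℕₚ.≤-trans (ℕₚ.+-monoʳ-≤ 4 (at-step dB c bB h)) (ℕₚ.≤-trans (ℕₚ.≤-reflexive (ℕₚ.+-suc 4 _)) le)

out-tame : ∀ dG bG dB bB → dG ≡ suc dB → bG ≡ z1 ⊕ bB → Any (λ t → pos 0 ≤ℤ t) (tauOf dG bG) → 4 + at dG bG ≤ dG → dG ≢ 4 → 4 + at dB bB ≤ dB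
out-tame _ _ dB bB refl refl = outF dB bB

in-tame : ∀ dG bG dB bB → dG ≡ suc dB → bG ≡ z2 ⊕ bB → Any (λ t → t ≤ℤ pos 0) (tauOf dG bG) → 4 + at dG bG ≤ dG → dG ≢ 4 → 4 + at dB bB ≤ dB
in-tame _ _ dB bB refl refl = inF dB bB

single-deg : ∀ {G z} → Cv G z → ∀ {U : VSet G} {v} → (∀ u → U u ≡ cls id v u) → dd G U ≡ deg G v × bs G U ≡ β G v
single-deg {G} cv {U} {v} h = trans (dd-cong G h) (sym (deg-dd G (Cv.loopless cv) v)) , trans (bs-cong G h) (bs-single G v)

Joins-touch₁ : ∀ G z e u v → Joins G e u v → u ≢ z → v ≢ z → touch G (cls id z) e ≡ false
Joins-touch₁ G z e u v j uz vz = trans (Joins-touch G (cls id z) j) (cong₂ _∨_ (≡ᵇ-≢ (uz ∘ sym)) (≡ᵇ-≢ (vz ∘ sym)))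

module RedEXPB {G : Gr} {z x : V G} {ψ : Orientation G} (ES : Easel G z x ψ) (crit : CritL G id z ψ) (tb : TBelow (ord G z))
    (e₀ : E G) (u v : V G) (j : Joins G e₀ u v) (uv : u ≢ v) (uz : u ≢ z) (vz : v ≢ z) (ux : u ≢ x) (vx : v ≢ x)
    (fu : OutFriendly G u) (fv : InFriendly G v) (u4 : deg G u ≢ 4) (v4 : deg G v ≢ 4) where
  open Easel ES
  module D = Del G e₀ u v uv j
  open D using (B)

  e₀z : touch G (cls id z) e₀ ≡ false
  e₀z = Joins-touch₁ G z e₀ u v j uz vz

  e₀≢ : ∀ {e} → touch G (cls id z) e ≡ true → e₀ ≢ e
  e₀≢ t refl = true≢false (trans (sym t) e₀z)

  cr-of : ∀ A → touch G A e₀ ≡ false → cr G A e₀ ≡ false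
  cr-of A t = bool-ne λ q → true≢false (trans (sym (cr⇒touch G A e₀ q)) t)

  satB : Sat B ψ (cls id z)
  satB = D.Sat-del← ψ (cls id z) (Sat-local G {ψ} {D.out ψ} (cls id z) (λ e c → sym (setO-ne ψ e₀ _ (e₀≢ (cr⇒touch G (cls id z) e c)))) (Tip→Sat G z ψ tip))

  nxB : ¬ Ext B id z ψ
  nxB (o , fl , ag) = nx (Ext→Extends G z ψ (D.out o , (λ q → D.Sat-del→ o (cls id q) (fl q))
    , λ e t → trans (setO-ne o e₀ _ (e₀≢ t)) (ag e (trans (D.touch₀ (cls id z) (e₀≢ t)) t))))

  tameB : TameSets B id z
  tameB U _ uz' t ut w uw wz = go (U u) (U v) refl refl
    where
    old : 4 + at (dd G U) (bs G U) ≤ dd G U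
    old = tameSet cv tb U uz' t ut w uw wz
    dU : ∀ b c → U u ≡ b → U v ≡ c → dd G U ≡ ind (b xor c) + dd B U
    dU b c p q = trans (D.dd-del U) (cong₂ (λ s t → ind (s xor t) + dd B U) p q)
    bU : ∀ b c → U u ≡ b → U v ≡ c → bs G U ≡ ct b c ⊕ bs B U
    bU b c p q = trans (D.bs-del U) (cong₂ (λ s t → ct s t ⊕ bs B U) p q)
    same : dd G U ≡ dd B U → bs G U ≡ bs B U → 4 + at (dd B U) (bs B U) ≤ dd B U
    same p q = subst (λ d → 4 + at d (bs B U) ≤ d) p (subst (λ b → 4 + at (dd G U) b ≤ dd G U) q old)
    go : ∀ b c → U u ≡ b → U v ≡ c → 4 + at (dd B U) (bs B U) ≤ dd B U
    go true true p q = same (dU true true p q) (bU true true p q)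
    go false false p q = same (dU false false p q) (bU false false p q)
    go true false p q = k (single-or-pair U u p)
      where
      k : Pair U ⊎ (∀ w → U w ≡ cls id u w) → 4 + at (dd B U) (bs B U) ≤ dd B U
      k (inj₁ pr) = del-tame-pair (dd G U) (bs G U) (dd B U) (bs B U) z1 (dU true false p q) (bU true false p q) (λ ()) (LT G z cv tb U uz' pr w uw wz)
      k (inj₂ h) = let (a , b) = single-deg cv {U} {u} h in
        out-tame (dd G U) (bs G U) (dd B U) (bs B U) (dU true false p q) (bU true false p q)
          (subst (λ d → Any (λ t → pos 0 ≤ℤ t) (tauOf d (bs G U))) (sym a) (subst (λ b' → Any (λ t → pos 0 ≤ℤ t) (tauOf (deg G u) b')) (sym b) fu)) old (λ e → u4 (trans (sym a) e))
    go false true p q = k (single-or-pair U v q)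
      where
      k : Pair U ⊎ (∀ w → U w ≡ cls id v w) → 4 + at (dd B U) (bs B U) ≤ dd B U
      k (inj₁ pr) = del-tame-pair (dd G U) (bs G U) (dd B U) (bs B U) z2 (dU false true p q) (bU false true p q) (λ ()) (LT G z cv tb U uz' pr w uw wz)
      k (inj₂ h) = let (a , b) = single-deg cv {U} {v} h in
        in-tame (dd G U) (bs G U) (dd B U) (bs B U) (dU false true p q) (bU false true p q)
          (subst (λ d → Any (λ t → t ≤ℤ pos 0) (tauOf d (bs G U))) (sym a) (subst (λ b' → Any (λ t → t ≤ℤ pos 0) (tauOf (deg G v) b')) (sym b) fv)) old (λ e → v4 (trans (sym a) e))

  ordB : OrdBound (ord G z) B id z
  ordB = ordBound {G} {z} (ends B) (β B) id zt (inj₂ (e₀ , e₀z , trans (cong proj₁ D.ends₁) (sym (cong proj₂ D.ends₁))))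
    where
    zt : ∀ e → touch G (cls id z) e ≡ true → p₁ B e ≡ p₂ B e ⊎ p₁ B e ≡ z ⊎ p₂ B e ≡ z
    zt e t = subst (λ p → proj₁ p ≡ proj₂ p ⊎ proj₁ p ≡ z ⊎ proj₂ p ≡ z) (sym (D.ends₀ (e₀≢ t))) (tip-edge {G} {z} id e t)

  go : TQR {ord G z} B id z ψ → Red G z x ψ (λ k r → EXPB k r G z x)
  go R = record { mono = mono ; prec = inj₁ ord<
      ; rel = λ w → lab u , lab v , luv , (λ e → uz (tz u e)) , (λ e → vz (tz v e)) , expansion cv w x≢z [] lab surj tz (D.iso lab luv) refl refl parts [] }
    where
    open TQR R hiding (tip; crit)
    tz : ∀ v → lab v ≡ lab z → v ≡ z
    tz v e = TQR.tip R e
    -- If the contraction identified the ends of the deleted edge, criticality of `G` would supply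
    -- an extension to it, which the deletion does not affect.
    luv : lab u ≢ lab v
    luv e = let (o , fl , ag) = crit lab tz u v uv e in
      nonext (o , (λ q → D.Sat-del← o (cls lab q) (Sat-local G {o} {D.out o} (cls lab q) (λ e' c → sym (setO-ne o e₀ _ λ { refl → true≢false (trans (sym c)
          (trans (Joins-cr G (cls lab q) j) (trans (cong (λ l → cls lab q u xor (q ≡ᵇ l)) (sym e)) (Boolₚ.xor-same (cls lab q u))))) })) (fl q)))
        , λ e' t → ag e' (tt e' t (e₀ ≟ e')))
      where
      tt : ∀ e' → touch B (cls lab (lab z)) e' ≡ true → Dec (e₀ ≡ e') → touch G (cls lab (lab z)) e' ≡ true
      tt e' t (no n) = trans (sym (D.touch₀ (cls lab (lab z)) n)) t
      tt e' t (yes refl) = ⊥-elim (true≢false (trans (sym t) (trans (cong (λ p → cls lab (lab z) (proj₁ p) ∨ cls lab (lab z) (proj₂ p)) D.ends₁)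
        (cong₂ _∨_ (≡ᵇ-≢ λ h → uz (tz u (sym h))) (≡ᵇ-≢ λ h → uz (tz u (sym h)))))))
    dzB : dd B (cls id z) ≡ deg G z
    dzB = trans (sym (trans (D.dd-del (cls id z)) (cong₂ (λ s t → ind (s xor t) + dd B (cls id z)) (≡ᵇ-≢ (uz ∘ sym)) (≡ᵇ-≢ (vz ∘ sym))))) (dz-eq cv)
    dt : dd B (cls lab (lab z)) ≡ deg G z
    dt = trans (dd-cong B λ v → ≡ᵇ-iff (lab z) (lab v) z v (λ e → sym (tz v (sym e))) (cong lab)) dzB
    le1 : ∀ A → dd G A ≤ 1 + dd B A
    le1 A = subst (_≤ 1 + dd B A) (sym (D.dd-del A)) (ℕₚ.+-monoˡ-≤ (dd B A) (k (A u xor A v)))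
      where
      k : ∀ b → ind b ≤ 1
      k true = s≤s z≤n
      k false = z≤n
    -- Restoring the edge adds at most one boundary edge, while the degree bound leaves a gap of
    -- two.
    parts : ∀ q → q ≢ lab z → Pair (cls lab q) → PartOK G z x ψ (cls lab q)
    parts q ne pr = partLess cv (cls lab q) (≡ᵇ-≢ ne) pr (ℕₚ.≤-trans (s≤s (le1 (cls lab q))) (subst (2 + dd B (cls lab q) ≤_) dt (proj₁ (bound q ne))))
    qx : lab x ≢ lab z
    qx e = x≢z (tz x e)
    U : VSet G
    U = cls lab (lab x)
    Ux : U x ≡ true
    Ux = ≡ᵇ-refl (lab x)
    pairU : Pair U → 1 + deg G x ≤ dd B U
    pairU pr = let (w , wz , wx) = third (lab x) qx in
      ℕₚ.≤-pred (ℕₚ.≤-trans (TR-deg G z cv tb U (≡ᵇ-≢ qx) pr w (≡ᵇ-≢ (wx ∘ sym)) (λ e → wz (cong lab e)) x Ux) (le1 U))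
    single : (∀ u → U u ≡ cls id x u) → dd B U ≡ deg G x
    single h = trans (sym (trans (D.dd-del U) (cong₂ (λ s t → ind (s xor t) + dd B U) (trans (h u) (≡ᵇ-≢ (ux ∘ sym))) (trans (h v) (≡ᵇ-≢ (vx ∘ sym))))))
      (proj₁ (single-deg cv {U} {x} h))
    dx : Pair U ⊎ (∀ u → U u ≡ cls id x u) → deg G x ≤ dd B U
    dx (inj₁ pr) = ℕₚ.≤-trans (ℕₚ.n≤1+n _) (pairU pr)
    dx (inj₂ h) = ℕₚ.≤-reflexive (sym (single h))
    dxe : Pair U ⊎ (∀ u → U u ≡ cls id x u) → dd B U ≡ deg G x → ∀ v → U v ≡ cls id x v
    dxe (inj₁ pr) e = ⊥-elim (ℕₚ.<⇒≱ (ℕₚ.n<1+n _) (ℕₚ.≤-trans (pairU pr) (ℕₚ.≤-reflexive e)))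
    dxe (inj₂ h) e = h
    mono : Mono G z x ψ (quot B lab) (lab z) (lab x) (ψ ∘ orig B lab)
    mono = quotMono {G} {z} {x} {ψ} (ends B) (β B) id ψ R tz x≢z dzB (dx (single-or-pair U x Ux)) (dxe (single-or-pair U x Ux))
      (λ X s → D.SameD-del ψ (cls id z) X (cr-of (cls id z) e₀z) s)

  red : Red G z x ψ (λ k r → EXPB k r G z x)
  red = go (TQ tb B id z ψ (D.tot (Cv.tot cv)) satB nxB tameB ordB)

Mixed? : ∀ G z e → Dec (Mixed G z e)
Mixed? G z e = ¬? (p₁ G e ≟ z) ×-dec (¬? (p₂ G e ≟ z) ×-dec ((I? (p₁ G e) ×-dec O? (p₂ G e)) ⊎-dec (O? (p₁ G e) ×-dec I? (p₂ G e))))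
  where
  I? : ∀ v → Dec (InFriendly G v)
  I? v = Any.any? (λ t → t ℤₚ.≤? pos 0) (tau G v)
  O? : ∀ v → Dec (OutFriendly G v)
  O? v = Any.any? (λ t → pos 0 ℤₚ.≤? t) (tau G v)

Homog? : ∀ G z x → Dec (Homog G z x)
Homog? G z x = Finₚ.all? λ e → Mixed? G z e →-dec ((p₁ G e ≟ x) ⊎-dec (p₂ G e ≟ x))

-- Deleting an edge at the tip whose direction fits the sign of its other end

module RedADD {G : Gr} {z x : V G} {ψ : Orientation G} (ES : Easel G z x ψ) (crit : CritL G id z ψ)
    (e₀ : E G) (u v t : V G) (j : Joins G e₀ u v) (uv : u ≢ v) (tz : t ≢ z) (tx : t ≢ x) (ψ₀ : ψ e₀ ≡ outOf G e₀ u)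
    (side : (u ≡ z × v ≡ t × InFriendly G t) ⊎ (u ≡ t × v ≡ z × OutFriendly G t)) (t4 : deg G t ≢ 4) (hom : Homog G z x) where
  open Easel ES
  module D = Del G e₀ u v uv j
  open D using (B)

  e₀z : touch G (cls id z) e₀ ≡ true
  e₀z = k side
    where
    k : (u ≡ z × v ≡ t × InFriendly G t) ⊎ (u ≡ t × v ≡ z × OutFriendly G t) → touch G (cls id z) e₀ ≡ true
    k (inj₁ (refl , _)) = trans (Joins-touch G (cls id z) j) (cong (_∨ cls id z v) (≡ᵇ-refl z))
    k (inj₂ (_ , refl , _)) = trans (Joins-touch G (cls id z) j) (trans (cong (cls id z u ∨_) (≡ᵇ-refl z)) (Boolₚ.∨-zeroʳ _))

  out≗ : ∀ {o} → o e₀ ≡ ψ e₀ → ∀ e → o e ≡ D.out o e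
  out≗ {o} h e = k (e₀ ≟ e)
    where
    k : Dec (e₀ ≡ e) → o e ≡ D.out o e
    k (yes refl) = trans h (trans ψ₀ (sym (setO-at o e₀ _)))
    k (no n) = sym (setO-ne o e₀ _ n)

  Sat← : ∀ {o} → o e₀ ≡ ψ e₀ → ∀ A → Sat G o A → Sat B o A
  Sat← {o} h A s = D.Sat-del← o A (Sat-congO G {o} {D.out o} A (out≗ h) s)

  satB : Sat B ψ (cls id z)
  satB = Sat← refl (cls id z) (Tip→Sat G z ψ tip)

  nxB : ¬ Ext B id z ψ
  nxB (o , fl , ag) = nx (Ext→Extends G z ψ (D.out o , (λ q → D.Sat-del→ o (cls id q) (fl q)) , λ e te → k e te (e₀ ≟ e)))
    where
    k : ∀ e → touch G (cls id z) e ≡ true → Dec (e₀ ≡ e) → D.out o e ≡ ψ e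
    k e te (yes refl) = trans (setO-at o e₀ _) (sym ψ₀)
    k e te (no n) = trans (setO-ne o e₀ _ n) (ag e (trans (D.touch₀ (cls id z) n) te))

  -- The deleted edge is fixed by `ψ`, so each extension in a contraction of `G` restricts to one in
  -- `B`. Thus `B` is critical as it stands and is not coarsened.
  critB : CritL B id z ψ
  critB g tr a b ne e = let (o , fl , ag) = crit g tr a b ne e
                            h = ag e₀ (touch-mono G {cls id z} {cls g (g z)} (λ w q → ≡ᵇ-≡ (cong g (≡ᵇ-true z w q))) e₀ e₀z)
                        in o , (λ q → Sat← h (cls g q) (fl q)) , λ e te → k o h ag e te (e₀ ≟ e)
    where
    k : ∀ o → o e₀ ≡ ψ e₀ → (∀ e → touch G (cls g (g z)) e ≡ true → o e ≡ ψ e) → ∀ e → touch B (cls g (g z)) e ≡ true → Dec (e₀ ≡ e) → o e ≡ ψ e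
    k o h ag e te (yes refl) = h
    k o h ag e te (no n) = ag e (trans (sym (D.touch₀ (cls g (g z)) n)) te)

  eqs : ∀ w → dd G (cls id w) ≡ ind (cls id w u xor cls id w v) + dd B (cls id w) × bs G (cls id w) ≡ ct (cls id w u) (cls id w v) ⊕ bs B (cls id w)
  eqs w = D.dd-del (cls id w) , D.bs-del (cls id w)

  tameB : ∀ q → q ≢ z → 4 + at (dd B (cls id q)) (bs B (cls id q)) ≤ dd B (cls id q)
  tameB q qz = k (q ≟ t) side
    where
    dq = proj₁ (single-deg cv {cls id q} {q} (λ _ → refl))
    bq = bs-single G q
    old : 4 + at (dd G (cls id q)) (bs G (cls id q)) ≤ dd G (cls id q)
    old = subst (λ d → 4 + at d (bs G (cls id q)) ≤ d) (sym dq) (subst (λ b → 4 + at (deg G q) b ≤ deg G q) (sym bq) (Cv.tame cv q qz))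
    k : Dec (q ≡ t) → (u ≡ z × v ≡ t × InFriendly G t) ⊎ (u ≡ t × v ≡ z × OutFriendly G t) → 4 + at (dd B (cls id q)) (bs B (cls id q)) ≤ dd B (cls id q)
    k (yes refl) (inj₁ (uz , vt , f)) = in-tame (dd G (cls id q)) (bs G (cls id q)) (dd B (cls id q)) (bs B (cls id q))
        (trans (proj₁ (eqs q)) (cong₂ (λ s t → ind (s xor t) + dd B (cls id q)) qu qv)) (trans (proj₂ (eqs q)) (cong₂ (λ s t → ct s t ⊕ bs B (cls id q)) qu qv))
        (subst (λ d → Any (λ t → t ≤ℤ pos 0) (tauOf d (bs G (cls id q)))) (sym dq) (subst (λ b' → Any (λ t → t ≤ℤ pos 0) (tauOf (deg G q) b')) (sym bq) f)) old (λ e → t4 (trans (sym dq) e))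
      where
      qu : cls id q u ≡ false
      qu = ≡ᵇ-≢ λ h → qz (trans h uz)
      qv : cls id q v ≡ true
      qv = ≡ᵇ-≡ (sym vt)
    k (yes refl) (inj₂ (ut , vz , f)) = out-tame (dd G (cls id q)) (bs G (cls id q)) (dd B (cls id q)) (bs B (cls id q))
        (trans (proj₁ (eqs q)) (cong₂ (λ s t → ind (s xor t) + dd B (cls id q)) qu qv)) (trans (proj₂ (eqs q)) (cong₂ (λ s t → ct s t ⊕ bs B (cls id q)) qu qv))
        (subst (λ d → Any (λ t → pos 0 ≤ℤ t) (tauOf d (bs G (cls id q)))) (sym dq) (subst (λ b' → Any (λ t → pos 0 ≤ℤ t) (tauOf (deg G q) b')) (sym bq) f)) old (λ e → t4 (trans (sym dq) e))
      where
      qu : cls id q u ≡ true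
      qu = ≡ᵇ-≡ (sym ut)
      qv : cls id q v ≡ false
      qv = ≡ᵇ-≢ λ h → qz (trans h vz)
    k (no n) s = subst (λ d → 4 + at d (bs B (cls id q)) ≤ d) (trans (proj₁ (eqs q)) (cong₂ (λ s t → ind (s xor t) + dd B (cls id q)) (qu s) (qv s)))
        (subst (λ b → 4 + at (dd G (cls id q)) b ≤ dd G (cls id q)) (trans (proj₂ (eqs q)) (cong₂ (λ s t → ct s t ⊕ bs B (cls id q)) (qu s) (qv s))) old)
      where
      qu : _ → cls id q u ≡ false
      qu (inj₁ (uz , vt , _)) = ≡ᵇ-≢ λ h → qz (trans h uz)
      qu (inj₂ (ut , vz , _)) = ≡ᵇ-≢ λ h → n (trans h ut)
      qv : _ → cls id q v ≡ false
      qv (inj₁ (uz , vt , _)) = ≡ᵇ-≢ λ h → n (trans h vt)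
      qv (inj₂ (ut , vz , _)) = ≡ᵇ-≢ λ h → qz (trans h vz)

  x-uv : cls id x u ≡ false × cls id x v ≡ false
  x-uv = k side
    where
    k : _ → cls id x u ≡ false × cls id x v ≡ false
    k (inj₁ (uz , vt , _)) = ≡ᵇ-≢ (λ h → x≢z (trans h uz)) , ≡ᵇ-≢ (λ h → tx (sym (trans h vt)))
    k (inj₂ (ut , vz , _)) = ≡ᵇ-≢ (λ h → tx (sym (trans h ut))) , ≡ᵇ-≢ (λ h → x≢z (trans h vz))

  z-uv : cls id z u xor cls id z v ≡ true
  z-uv = trans (sym (Joins-cr G (cls id z) j)) (Incident-cr G (Cv.loopless cv) z e₀ (Incident-touch G z e₀ e₀z))

  G' : Gr
  G' = quot B id

  degz : deg G z ≡ suc (deg G' z)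
  degz = trans (sym (dz-eq cv)) (trans (proj₁ (eqs z)) (cong₂ _+_ (ind-true z-uv) (sym (deg-quot B id z))))

  degx : deg G' x ≡ deg G x
  degx = trans (deg-quot B id x) (trans (sym (trans (proj₁ (eqs x)) (cong₂ (λ s t → ind (s xor t) + dd B (cls id x)) (proj₁ x-uv) (proj₂ x-uv))))
    (sym (deg-dd G (Cv.loopless cv) x)))

  ord≡ : ord G' z ≡ ord G z
  ord≡ = trans (ord-quot B id z) (cong (λ s → n G + s) (sumℕ-cong {m G} λ e → k e (e₀ ≟ e)))
    where
    k : ∀ e → Dec (e₀ ≡ e) → ind (inn B id z e) ≡ ind (not (touch G (cls id z) e))
    k e (yes refl) = trans (cong (λ b → ind (b ∧ not (touch B (cls id z) e₀))) (trans (cong (λ p → not (proj₁ p ≡ᵇ proj₂ p)) D.ends₁) (cong not (≡ᵇ-refl u))))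
      (cong (ind ∘ not) (sym e₀z))
    k e (no n) = trans (cong (λ b → ind (b ∧ not (touch B (cls id z) e))) (trans (cong (λ p → not (proj₁ p ≡ᵇ proj₂ p)) (D.ends₀ n)) (cong not (≡ᵇ-≢ (Cv.loopless cv e)))))
      (cong (ind ∘ not) (D.touch₀ (cls id z) n))

  red : Red G z x ψ (λ k r → ADD k r G z x)
  red = record
    { G' = G' ; z' = z ; x' = x ; ψ' = ψ ∘ orig B id
    ; mono = record
      { easel = record { cv = Cv-quot B id z (D.tot (Cv.tot cv)) (CritL→FCL B id z ψ satB nxB critB) tameB
        ; tip = TipQ← B id z ψ satB ; nx = λ e → nxB (ExtQ→ B id z ψ e) ; x≢z = x≢z }
      ; dz≤ = ℕₚ.≤-trans (ℕₚ.n≤1+n _) (ℕₚ.≤-reflexive (sym degz))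
      ; dx≥ = ℕₚ.≤-reflexive (sym degx)
      ; as = λ e → ⊥-elim (ℕₚ.<⇒≢ (ℕₚ.n<1+n _) (trans e degz))
      ; asx = λ e → ⊥-elim (ℕₚ.<⇒≢ (ℕₚ.n<1+n _) (trans e degz)) }
    ; prec = pr (Homog? G' z x)
    ; rel = λ _ → t , tz , tx , isos side }
    where
    -- The order is unchanged, so the decrease comes from the loss of homogeneity or else from the
    -- smaller tip degree.
    pr : Dec (Homog G' z x) → Prec G' z x G z x
    pr (no h) = inj₂ (inj₁ (ord≡ , h , hom))
    pr (yes h) = inj₂ (inj₂ (ord≡ , h , hom , ℕₚ.≤-reflexive (sym degz)))
    isos : (u ≡ z × v ≡ t × InFriendly G t) ⊎ (u ≡ t × v ≡ z × OutFriendly G t) →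
      (Σ (Iso G (addEdge G' z t)) λ I → vto I z ≡ z × vto I x ≡ x) ⊎ (Σ (Iso G (addEdge G' t z)) λ I → vto I z ≡ z × vto I x ≡ x)
    isos (inj₁ (uz , vt , _)) = inj₁ (tr uz vt (D.isoId (Cv.loopless cv) , refl , refl))
      where
      tr : ∀ {a b} → u ≡ a → v ≡ b → (Σ (Iso G (addEdge G' u v)) λ I → vto I z ≡ z × vto I x ≡ x) → Σ (Iso G (addEdge G' a b)) λ I → vto I z ≡ z × vto I x ≡ x
      tr refl refl s = s
    isos (inj₂ (ut , vz , _)) = inj₂ (tr ut vz (D.isoId (Cv.loopless cv) , refl , refl))
      where
      tr : ∀ {a b} → u ≡ a → v ≡ b → (Σ (Iso G (addEdge G' u v)) λ I → vto I z ≡ z × vto I x ≡ x) → Σ (Iso G (addEdge G' a b)) λ I → vto I z ≡ z × vto I x ≡ x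
      tr refl refl s = s

-- Vertices of degree four

-- The other ends need not be distinct. In a critical canvas with `y` off the tip, `noPar` allows
-- coincidences only at the tip.
record Quad (G : Gr) (y : V G) : Set where
  field
    e₁ e₂ e₃ e₄ : E G
    w₁ w₂ w₃ w₄ : V G
    j₁ : Joins G e₁ y w₁
    j₂ : Joins G e₂ y w₂
    j₃ : Joins G e₃ y w₃
    j₄ : Joins G e₄ y w₄
    n₁ : y ≢ w₁
    n₂ : y ≢ w₂
    n₃ : y ≢ w₃
    n₄ : y ≢ w₄
    d₁₂ : e₁ ≢ e₂
    d₁₃ : e₁ ≢ e₃
    d₁₄ : e₁ ≢ e₄
    d₂₃ : e₂ ≢ e₃
    d₂₄ : e₂ ≢ e₄
    d₃₄ : e₃ ≢ e₄
    cover : ∀ e → e₁ ≢ e → e₂ ≢ e → e₃ ≢ e → e₄ ≢ e → cr G (cls id y) e ≡ false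

-- This and the next two transpositions generate the relabelings used in the choice of a pairing.
s₁₂ : ∀ {G y} → Quad G y → Quad G y
s₁₂ Q = record { e₁ = e₂ ; e₂ = e₁ ; e₃ = e₃ ; e₄ = e₄ ; w₁ = w₂ ; w₂ = w₁ ; w₃ = w₃ ; w₄ = w₄ ; j₁ = j₂ ; j₂ = j₁ ; j₃ = j₃ ; j₄ = j₄
  ; n₁ = n₂ ; n₂ = n₁ ; n₃ = n₃ ; n₄ = n₄ ; d₁₂ = d₁₂ ∘ sym ; d₁₃ = d₂₃ ; d₁₄ = d₂₄ ; d₂₃ = d₁₃ ; d₂₄ = d₁₄ ; d₃₄ = d₃₄
  ; cover = λ e a b c d → cover e b a c d }
  where open Quad Q

s₂₃ : ∀ {G y} → Quad G y → Quad G y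
s₂₃ Q = record { e₁ = e₁ ; e₂ = e₃ ; e₃ = e₂ ; e₄ = e₄ ; w₁ = w₁ ; w₂ = w₃ ; w₃ = w₂ ; w₄ = w₄ ; j₁ = j₁ ; j₂ = j₃ ; j₃ = j₂ ; j₄ = j₄
  ; n₁ = n₁ ; n₂ = n₃ ; n₃ = n₂ ; n₄ = n₄ ; d₁₂ = d₁₃ ; d₁₃ = d₁₂ ; d₁₄ = d₁₄ ; d₂₃ = d₂₃ ∘ sym ; d₂₄ = d₃₄ ; d₃₄ = d₂₄
  ; cover = λ e a b c d → cover e a c b d }
  where open Quad Q

s₃₄ : ∀ {G y} → Quad G y → Quad G y
s₃₄ Q = record { e₁ = e₁ ; e₂ = e₂ ; e₃ = e₄ ; e₄ = e₃ ; w₁ = w₁ ; w₂ = w₂ ; w₃ = w₄ ; w₄ = w₃ ; j₁ = j₁ ; j₂ = j₂ ; j₃ = j₄ ; j₄ = j₃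
  ; n₁ = n₁ ; n₂ = n₂ ; n₃ = n₄ ; n₄ = n₃ ; d₁₂ = d₁₂ ; d₁₃ = d₁₄ ; d₁₄ = d₁₃ ; d₂₃ = d₂₄ ; d₂₄ = d₂₃ ; d₃₄ = d₃₄ ∘ sym
  ; cover = λ e a b c d → cover e a b d c }
  where open Quad Q

quad : ∀ {G z} → Cv G z → ∀ y → deg G y ≡ 4 → Quad G y
quad {G} {z} cv y d4 =
  let P₀ = cr G (cls id y)
      (a , pa , ca) = count-pick P₀ (trans (sym (deg-dd G (Cv.loopless cv) y)) d4)
      P₁ = λ i → P₀ i ∧ not (a ≡ᵇ i)
      (b , pb , cb) = count-pick P₁ ca
      P₂ = λ i → P₁ i ∧ not (b ≡ᵇ i)
      (c , pc , cc) = count-pick P₂ cb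
      P₃ = λ i → P₂ i ∧ not (c ≡ᵇ i)
      (d , pd , cd) = count-pick P₃ cc
      ne : ∀ {u i : E G} → not (u ≡ᵇ i) ≡ true → u ≢ i
      ne {u} {i} h = ≡ᵇ-false u i (not-true h)
      ab = ne {a} {b} (∧-trueʳ {P₀ b} pb)
      bc = ne {b} {c} (∧-trueʳ {P₁ c} pc)
      ac = ne {a} {c} (∧-trueʳ {P₀ c} (∧-trueˡ pc))
      cd' = ne {c} {d} (∧-trueʳ {P₂ d} pd)
      bd = ne {b} {d} (∧-trueʳ {P₁ d} (∧-trueˡ pd))
      ad = ne {a} {d} (∧-trueʳ {P₀ d} (∧-trueˡ (∧-trueˡ pd)))
      (wa , na , ja) = other G y a pa
      (wb , nb , jb) = other G y b (∧-trueˡ pb)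
      (wc , nc , jc) = other G y c (∧-trueˡ (∧-trueˡ pc))
      (wd , nd , jd) = other G y d (∧-trueˡ (∧-trueˡ (∧-trueˡ pd)))
  in record { e₁ = a ; e₂ = b ; e₃ = c ; e₄ = d ; w₁ = wa ; w₂ = wb ; w₃ = wc ; w₄ = wd ; j₁ = ja ; j₂ = jb ; j₃ = jc ; j₄ = jd
    ; n₁ = na ; n₂ = nb ; n₃ = nc ; n₄ = nd ; d₁₂ = ab ; d₁₃ = ac ; d₁₄ = ad ; d₂₃ = bc ; d₂₄ = bd ; d₃₄ = cd'
    ; cover = λ e ha hb hc hd → k (P₀ e) (a ≡ᵇ e) (b ≡ᵇ e) (c ≡ᵇ e) (d ≡ᵇ e) (≡ᵇ-≢ ha) (≡ᵇ-≢ hb) (≡ᵇ-≢ hc) (≡ᵇ-≢ hd) (count-none (λ i → P₃ i ∧ not (d ≡ᵇ i)) cd e) }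
  where
  k : ∀ p a b c d → a ≡ false → b ≡ false → c ≡ false → d ≡ false → (((p ∧ not a) ∧ not b) ∧ not c) ∧ not d ≡ false → p ≡ false
  k false _ _ _ _ _ _ _ _ _ = refl
  k true false false false false _ _ _ _ ()

sgn : Bool → Z3
sgn b = ct b (not b)

module QuadSum {G : Gr} {y : V G} (Q : Quad G y) (β0 : β G y ≡ z0) where
  open Quad Q

  bit : Orientation G → E G → Bool
  bit o e = y ≡ᵇ tl G o e

  total : ∀ o → nt G o (cls id y) ≡ sgn (bit o e₁) ⊕ (sgn (bit o e₂) ⊕ (sgn (bit o e₃) ⊕ sgn (bit o e₄)))
  total o = trans (sumZ-split F e₁) (cong₂ _⊕_ (Fe j₁ n₁) (trans (sumZ-split F₁ e₂) (cong₂ _⊕_ (trans (z≢ F d₁₂) (Fe j₂ n₂))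
      (trans (sumZ-split F₂ e₃) (cong₂ _⊕_ (trans (z≢ F₁ d₂₃) (trans (z≢ F d₁₃) (Fe j₃ n₃)))
      (trans (sumZ-split F₃ e₄) (trans (cong₂ _⊕_ (trans (z≢ F₂ d₃₄) (trans (z≢ F₁ d₂₄) (trans (z≢ F d₁₄) (Fe j₄ n₄)))) (sumZ-zero {m G} rest)) (⊕-identityʳ _))))))))
    where
    F : E G → Z3
    F = ctE G o (cls id y)
    Fe : ∀ {e w} → Joins G e y w → y ≢ w → F e ≡ sgn (bit o e)
    Fe {e} {w} j n = cr-ctE G o (cls id y) e (bit o e) (trans (Joins-cr G (cls id y) j) (cong₂ _xor_ (≡ᵇ-refl y) (≡ᵇ-≢ n))) refl
    z≢ : ∀ {a b : E G} (f : E G → Z3) → a ≢ b → zeroAt a f b ≡ f b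
    z≢ f h rewrite ≡ᵇ-≢ h = refl
    F₁ F₂ F₃ R : E G → Z3
    F₁ = zeroAt e₁ F
    F₂ = zeroAt e₂ F₁
    F₃ = zeroAt e₃ F₂
    R = zeroAt e₄ F₃
    zz : ∀ a f e → f e ≡ z0 → zeroAt a f e ≡ z0
    zz a f e h with a ≟ e
    ... | yes _ = refl
    ... | no _ = h
    zs : ∀ (a : E G) (f : E G → Z3) e → a ≡ e → zeroAt a f e ≡ z0
    zs a f .a refl rewrite ≡ᵇ-refl a = refl
    rest : ∀ e → R e ≡ z0
    rest e = go (e₁ ≟ e) (e₂ ≟ e) (e₃ ≟ e) (e₄ ≟ e)
      where
      go : Dec (e₁ ≡ e) → Dec (e₂ ≡ e) → Dec (e₃ ≡ e) → Dec (e₄ ≡ e) → R e ≡ z0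
      go (yes p) _ _ _ = zz e₄ F₃ e (zz e₃ F₂ e (zz e₂ F₁ e (zs e₁ F e p)))
      go (no _) (yes p) _ _ = zz e₄ F₃ e (zz e₃ F₂ e (zs e₂ F₁ e p))
      go (no _) (no _) (yes p) _ = zz e₄ F₃ e (zs e₃ F₂ e p)
      go (no _) (no _) (no _) (yes p) = zs e₄ F₃ e p
      go (no a) (no b) (no c) (no d) = zz e₄ F₃ e (zz e₃ F₂ e (zz e₂ F₁ e (zz e₁ F e (ctE-noncr G o (cls id y) e (xor-false (cover e a b c d))))))

  -- Four signs sum to zero modulo 3 only if two are positive and two negative, so a flow passes `y`
  -- along two paths.
  four-sum : ∀ o → Sat G o (cls id y) → sgn (bit o e₁) ⊕ (sgn (bit o e₂) ⊕ (sgn (bit o e₃) ⊕ sgn (bit o e₄))) ≡ z0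
  four-sum o s = trans (sym (total o)) (trans s (trans (bs-single G y) β0))

noPar : ∀ {G z ψ} → Crit G z ψ → ∀ u v → u ≢ z → v ≢ z → ∀ {e e'} → e ≢ e' → ∀ {w} → Joins G e u v → Joins G e' u w → u ≢ v → v ≢ w
noPar {G} {z} {ψ} C u v uz vz ne j j' uv refl = parallel {G} {z} {ψ} (Cv.tot (Crit.cv C)) (Crit.nx C) u v uv uz vz _ _ ne j j'
  (off C (two u v) (two-false uz vz) (u , v , uv , two-l u v , two-r u v))

-- Lifting both pairs of edges at y

module Two {G : Gr} {y : V G} (Q : Quad G y) (ll : Loopless G) where
  open Quad Q

  B₁ : Gr
  B₁ = lift G e₁ e₂ w₁ w₂

  module L₁ = Lift G e₁ e₂ w₁ y y w₂ d₁₂ (Joins-sym {G} j₁) j₂ (n₁ ∘ sym) n₂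

  joins₁ : ∀ {e a b} → e₁ ≢ e → e₂ ≢ e → Joins G e a b → Joins B₁ e a b
  joins₁ p q (inj₁ h) = inj₁ (trans (L₁.ends₀ p q) h)
  joins₁ p q (inj₂ h) = inj₂ (trans (L₁.ends₀ p q) h)

  j₃' : Joins B₁ e₃ w₃ y
  j₃' = joins₁ d₁₃ d₂₃ (Joins-sym {G} j₃)

  j₄' : Joins B₁ e₄ y w₄
  j₄' = joins₁ d₁₄ d₂₄ j₄

  module L₂ = Lift B₁ e₃ e₄ w₃ y y w₄ d₃₄ j₃' j₄' (n₃ ∘ sym) n₄

  B : Gr
  B = lift B₁ e₃ e₄ w₃ w₄

  endsB₁ : ends B e₁ ≡ (w₁ , w₂)
  endsB₁ = trans (L₂.ends₀ (d₁₃ ∘ sym) (d₁₄ ∘ sym)) L₁.ends₁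

  endsB₂ : ends B e₂ ≡ (w₂ , w₂)
  endsB₂ = trans (L₂.ends₀ (d₂₃ ∘ sym) (d₂₄ ∘ sym)) L₁.ends₂

  endsB₃ : ends B e₃ ≡ (w₃ , w₄)
  endsB₃ = L₂.ends₁

  endsB₄ : ends B e₄ ≡ (w₄ , w₄)
  endsB₄ = L₂.ends₂

  endsB₀ : ∀ {e} → e₁ ≢ e → e₂ ≢ e → e₃ ≢ e → e₄ ≢ e → ends B e ≡ ends G e
  endsB₀ a b c d = trans (L₂.ends₀ c d) (L₁.ends₀ a b)

  unl : Orientation B → Orientation G
  unl o = L₁.unl (L₂.unl o)

  unl₀ : ∀ o {e} → e₁ ≢ e → e₂ ≢ e → e₃ ≢ e → e₄ ≢ e → unl o e ≡ o e
  unl₀ o a b c d = trans (L₁.unl₀ (L₂.unl o) a b) (L₂.unl₀ o c d)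

  unl₁ : ∀ o → unl o e₁ ≡ L₁.dir e₁ w₁ (o e₁)
  unl₁ o = trans (L₁.unl₁ (L₂.unl o)) (cong (L₁.dir e₁ w₁) (L₂.unl₀ o (d₁₃ ∘ sym) (d₁₄ ∘ sym)))

  unl₂ : ∀ o → unl o e₂ ≡ L₁.dir e₂ y (o e₁)
  unl₂ o = trans (L₁.unl₂ (L₂.unl o)) (cong (L₁.dir e₂ y) (L₂.unl₀ o (d₁₃ ∘ sym) (d₁₄ ∘ sym)))

  outOf₁ : ∀ {e} v → e₁ ≢ e → e₂ ≢ e → outOf B₁ e v ≡ outOf G e v
  outOf₁ v p q = cong (λ p → v ≡ᵇ proj₁ p) (L₁.ends₀ p q)

  dir₁ : ∀ {e} v b → e₁ ≢ e → e₂ ≢ e → L₂.dir e v b ≡ L₁.dir e v b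
  dir₁ v b p q = cong (λ c → if b then c else not c) (outOf₁ v p q)

  unl₃ : ∀ o → unl o e₃ ≡ L₁.dir e₃ w₃ (o e₃)
  unl₃ o = trans (L₁.unl₀ (L₂.unl o) d₁₃ d₂₃) (trans (L₂.unl₁ o) (dir₁ w₃ (o e₃) d₁₃ d₂₃))

  nt-two : ∀ o A → nt G (unl o) A ≡ nt B o A
  nt-two o A = trans (L₁.nt-lift (L₂.unl o) A refl) (L₂.nt-lift o A refl)

  Sat-two : ∀ o A → Sat B o A → Sat G (unl o) A
  Sat-two o A s = trans (nt-two o A) s

  -- For a set avoiding `y`, lifting a pair removes two boundary edges exactly when both ends of the
  -- pair lie in the set.
  dd-out : ∀ A → A y ≡ false → dd G A ≡ (ind (A w₁ ∧ A w₂) + ind (A w₁ ∧ A w₂)) + ((ind (A w₃ ∧ A w₄) + ind (A w₃ ∧ A w₄)) + dd B A)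
  dd-out A ay = trans (half (A w₁) (A w₂) (A y) ay (dd G A) (dd B₁ A) (L₁.dd-lift A))
      (cong ((ind (A w₁ ∧ A w₂) + ind (A w₁ ∧ A w₂)) +_) (half (A w₃) (A w₄) (A y) ay (dd B₁ A) (dd B A) (L₂.dd-lift A)))
    where
    half : ∀ a b c → c ≡ false → ∀ s t → ind (a xor b) + s ≡ (ind (a xor c) + ind (c xor b)) + t → s ≡ (ind (a ∧ b) + ind (a ∧ b)) + t
    half true true false refl s t e = e
    half true false false refl s t e = ℕₚ.suc-injective e
    half false true false refl s t e = ℕₚ.suc-injective e
    half false false false refl s t e = e

  dd-in : ∀ A → A y ≡ true → A w₁ ≡ true → A w₂ ≡ true → A w₃ ≡ true → A w₄ ≡ true → dd G A ≡ dd B A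
  dd-in A ay a b c d = trans (half (A w₁) (A w₂) (A y) a b ay (dd G A) (dd B₁ A) (L₁.dd-lift A)) (half (A w₃) (A w₄) (A y) c d ay (dd B₁ A) (dd B A) (L₂.dd-lift A))
    where
    half : ∀ a b c → a ≡ true → b ≡ true → c ≡ true → ∀ s t → ind (a xor b) + s ≡ (ind (a xor c) + ind (c xor b)) + t → s ≡ t
    half true true true _ _ _ s t e = e

  y-free : ∀ e → cls id y (p₁ B e) ≡ false × cls id y (p₂ B e) ≡ false
  y-free e = go (e₁ ≟ e) (e₂ ≟ e) (e₃ ≟ e) (e₄ ≟ e)
    where
    use : ∀ {p : V G × V G} → ends B e ≡ p → y ≢ proj₁ p → y ≢ proj₂ p → cls id y (p₁ B e) ≡ false × cls id y (p₂ B e) ≡ false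
    use h a b = trans (cong (cls id y ∘ proj₁) h) (≡ᵇ-≢ a) , trans (cong (cls id y ∘ proj₂) h) (≡ᵇ-≢ b)
    loop : ∀ a b → ends G e ≡ (a , b) → (y ≡ᵇ a) xor (y ≡ᵇ b) ≡ false → y ≢ a × y ≢ b
    loop a b q h = (λ r → ll e (trans (cong proj₁ q) (trans (sym r) (trans (≡ᵇ-true y b (trans (sym (xor-false h)) (≡ᵇ-≡ r))) (sym (cong proj₂ q))))))
      , (λ r → ll e (trans (cong proj₁ q) (trans (sym (≡ᵇ-true y a (trans (xor-false h) (≡ᵇ-≡ r)))) (trans r (sym (cong proj₂ q))))))
    go : Dec (e₁ ≡ e) → Dec (e₂ ≡ e) → Dec (e₃ ≡ e) → Dec (e₄ ≡ e) → cls id y (p₁ B e) ≡ false × cls id y (p₂ B e) ≡ false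
    go (yes refl) _ _ _ = use endsB₁ n₁ n₂
    go (no _) (yes refl) _ _ = use endsB₂ n₂ n₂
    go (no _) (no _) (yes refl) _ = use endsB₃ n₃ n₄
    go (no _) (no _) (no _) (yes refl) = use endsB₄ n₄ n₄
    go (no a) (no b) (no c) (no d) = use (endsB₀ a b c d) (proj₁ lp) (proj₂ lp)
      where
      lp = loop (p₁ G e) (p₂ G e) refl (cover e a b c d)

  dd-half₁ : ∀ A → A y ≡ true → A w₁ ≡ true → A w₂ ≡ true → A w₃ ≡ false → A w₄ ≡ false → dd G A ≡ 2 + dd B A
  dd-half₁ A ay a b c d = trans (inside (A w₁) (A w₂) (A y) a b ay (dd G A) (dd B₁ A) (L₁.dd-lift A)) (outside (A w₃) (A w₄) (A y) c d ay (dd B₁ A) (dd B A) (L₂.dd-lift A))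
    where
    inside : ∀ a b c → a ≡ true → b ≡ true → c ≡ true → ∀ s t → ind (a xor b) + s ≡ (ind (a xor c) + ind (c xor b)) + t → s ≡ t
    inside true true true _ _ _ s t e = e
    outside : ∀ a b c → a ≡ false → b ≡ false → c ≡ true → ∀ s t → ind (a xor b) + s ≡ (ind (a xor c) + ind (c xor b)) + t → s ≡ 2 + t
    outside false false true _ _ _ s t e = e

  dd-half₂ : ∀ A → A y ≡ true → A w₁ ≡ false → A w₂ ≡ false → A w₃ ≡ true → A w₄ ≡ true → dd G A ≡ 2 + dd B A
  dd-half₂ A ay a b c d = trans (outside (A w₁) (A w₂) (A y) a b ay (dd G A) (dd B₁ A) (L₁.dd-lift A)) (cong (2 +_) (inside (A w₃) (A w₄) (A y) c d ay (dd B₁ A) (dd B A) (L₂.dd-lift A)))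
    where
    inside : ∀ a b c → a ≡ true → b ≡ true → c ≡ true → ∀ s t → ind (a xor b) + s ≡ (ind (a xor c) + ind (c xor b)) + t → s ≡ t
    inside true true true _ _ _ s t e = e
    outside : ∀ a b c → a ≡ false → b ≡ false → c ≡ true → ∀ s t → ind (a xor b) + s ≡ (ind (a xor c) + ind (c xor b)) + t → s ≡ 2 + t
    outside false false true _ _ _ s t e = e

  -- After both lifts `y` is isolated, so sets differing only in `y` have the same boundary edges in
  -- `B`.
  iso-cong : ∀ {A A' : VSet G} → (∀ v → y ≢ v → A v ≡ A' v) → ∀ e → A (p₁ B e) ≡ A' (p₁ B e) × A (p₂ B e) ≡ A' (p₂ B e)
  iso-cong h e = h _ (≡ᵇ-false y (p₁ B e) (proj₁ (y-free e))) , h _ (≡ᵇ-false y (p₂ B e) (proj₂ (y-free e)))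

  dd-iso : ∀ {A A' : VSet G} → (∀ v → y ≢ v → A v ≡ A' v) → dd B A ≡ dd B A'
  dd-iso h = sumℕ-cong {m G} λ e → cong₂ (λ a b → ind (a xor b)) (proj₁ (iso-cong h e)) (proj₂ (iso-cong h e))

  nt-iso : ∀ o {A A' : VSet G} → (∀ v → y ≢ v → A v ≡ A' v) → nt B o A ≡ nt B o A'
  nt-iso o {A} {A'} h = sumZ-cong {m G} λ e → k (o e) e
    where
    k : ∀ b e → ct (A (if b then p₁ B e else p₂ B e)) (A (if b then p₂ B e else p₁ B e)) ≡ ct (A' (if b then p₁ B e else p₂ B e)) (A' (if b then p₂ B e else p₁ B e))
    k true e = cong₂ ct (proj₁ (iso-cong h e)) (proj₂ (iso-cong h e))
    k false e = cong₂ ct (proj₂ (iso-cong h e)) (proj₁ (iso-cong h e))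

  touch-iso : ∀ {A A' : VSet G} → (∀ v → y ≢ v → A v ≡ A' v) → ∀ e → touch B A e ≡ touch B A' e
  touch-iso h e = cong₂ _∨_ (proj₁ (iso-cong h e)) (proj₂ (iso-cong h e))

  bs-iso : β G y ≡ z0 → ∀ {A A' : VSet G} → (∀ v → y ≢ v → A v ≡ A' v) → bs G A ≡ bs G A'
  bs-iso β0 {A} {A'} h = sumZ-cong {n G} λ v → k v (y ≟ v)
    where
    zero′ : ∀ b → (if b then z0 else z0) ≡ z0
    zero′ true = refl
    zero′ false = refl
    k : ∀ v → Dec (y ≡ v) → (if A v then β G v else z0) ≡ (if A' v then β G v else z0)
    k v (no n) = cong (λ b → if b then β G v else z0) (h v n)
    k v (yes refl) = trans (cong (λ c → if A y then c else z0) β0) (trans (zero′ (A y)) (sym (trans (cong (λ c → if A' y then c else z0) β0) (zero′ (A' y)))))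

-- The contraction after splitting off a vertex of degree four

addV delV : ∀ {k} → Fin k → (Fin k → Bool) → Fin k → Bool
addV y A v = A v ∨ (y ≡ᵇ v)
delV y A v = A v ∧ not (y ≡ᵇ v)

delV-y : ∀ {k} (y : Fin k) A → delV y A y ≡ false
delV-y y A = trans (cong (λ b → A y ∧ not b) (≡ᵇ-refl y)) (Boolₚ.∧-zeroʳ (A y))

addV-y : ∀ {k} (y : Fin k) A → addV y A y ≡ true
addV-y y A = trans (cong (A y ∨_) (≡ᵇ-refl y)) (Boolₚ.∨-zeroʳ (A y))

delV-ne : ∀ {k} (y : Fin k) A v → y ≢ v → delV y A v ≡ A v
delV-ne y A v h = trans (cong (λ b → A v ∧ not b) (≡ᵇ-≢ h)) (Boolₚ.∧-identityʳ (A v))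

addV-ne : ∀ {k} (y : Fin k) A v → y ≢ v → addV y A v ≡ A v
addV-ne y A v h = trans (cong (A v ∨_) (≡ᵇ-≢ h)) (Boolₚ.∨-identityʳ (A v))

delV-sub : ∀ {k} (y : Fin k) A v → delV y A v ≡ true → A v ≡ true × y ≢ v
delV-sub y A v h = ∧-trueˡ h , ≡ᵇ-false y v (not-true (∧-trueʳ {A v} h))

module Deg4 {G : Gr} {z x : V G} {ψ : Orientation G} (ES : Easel G z x ψ) (crit : CritL G id z ψ) (tb : TBelow (ord G z))
    (y : V G) (yz : y ≢ z) (yx : y ≢ x) (y4 : deg G y ≡ 4) where
  open Easel ES

  C : Crit G z ψ
  C = record { cv = cv ; tip = tip ; nx = λ e → nx (Ext→Extends G z ψ e) ; crit = crit }

  ll : Loopless G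
  ll = Cv.loopless cv

  β0 : β G y ≡ z0
  β0 = k (small-deg (deg G y) (β G y) (Cv.tame cv y yz) (ℕₚ.≤-trans (ℕₚ.≤-reflexive y4) (ℕₚ.n≤1+n 4)))
    where
    k : (deg G y ≡ 4 × β G y ≡ z0) ⊎ (deg G y ≡ 5 × β G y ≢ z0) → β G y ≡ z0
    k (inj₁ (_ , h)) = h
    k (inj₂ (h , _)) = ⊥-elim (ℕₚ.<⇒≢ (ℕₚ.n<1+n 4) (trans (sym y4) h))

  -- The vertex `y`, isolated after the lifts, is put into the class of `x`. Merging two vertices
  -- lowers `ord`, and `x` is a vertex whose balance follows from that of the others.
  f₀ : V G → V G
  f₀ v = if y ≡ᵇ v then x else v

  f₀-ne : ∀ {v} → y ≢ v → f₀ v ≡ v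
  f₀-ne h = cong (λ b → if b then x else _) (≡ᵇ-≢ h)

  f₀-y : f₀ y ≡ x
  f₀-y = cong (λ b → if b then x else y) (≡ᵇ-refl y)

  f₀-tip : ∀ v → f₀ v ≡ f₀ z → v ≡ z
  f₀-tip v h = k (y ≟ v)
    where
    k : Dec (y ≡ v) → v ≡ z
    k (yes refl) = ⊥-elim (x≢z (trans (sym f₀-y) (trans h (f₀-ne yz))))
    k (no n) = trans (sym (f₀-ne n)) (trans h (f₀-ne yz))

  -- Convention for the tip: it may be the second end only in the first pair, and then that pair
  -- lies entirely at the tip and `ψ` directs it as a path through `y`. Otherwise the tip occurs
  -- only as a first end.
  module Pairing (Q : Quad G y) (vp₁ : Quad.w₂ Q ≡ z → Quad.w₁ Q ≡ z × (z ≡ᵇ tl G ψ (Quad.e₁ Q)) ≡ (y ≡ᵇ tl G ψ (Quad.e₂ Q)))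
      (vp₂ : Quad.w₄ Q ≢ z) where
    open Quad Q
    module T = Two Q ll
    open T using (B)

    ψB : Orientation B
    ψB = setO (setO ψ e₃ (w₃ ≡ᵇ tl G ψ e₃)) e₁ (w₁ ≡ᵇ tl G ψ e₁)

    ψB₁ : ψB e₁ ≡ (w₁ ≡ᵇ tl G ψ e₁)
    ψB₁ = setO-at (setO ψ e₃ (w₃ ≡ᵇ tl G ψ e₃)) e₁ _

    ψB₃ : ψB e₃ ≡ (w₃ ≡ᵇ tl G ψ e₃)
    ψB₃ = trans (setO-ne (setO ψ e₃ (w₃ ≡ᵇ tl G ψ e₃)) e₁ _ d₁₃) (setO-at ψ e₃ _)

    ψB₀ : ∀ {e} → e₁ ≢ e → e₃ ≢ e → ψB e ≡ ψ e
    ψB₀ p q = trans (setO-ne (setO ψ e₃ (w₃ ≡ᵇ tl G ψ e₃)) e₁ _ p) (setO-ne ψ e₃ _ q)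

    Z : VSet G
    Z = cls id z

    touchB : ∀ A {e p} → ends B e ≡ p → touch B A e ≡ A (proj₁ p) ∨ A (proj₂ p)
    touchB A h = cong (λ p → A (proj₁ p) ∨ A (proj₂ p)) h

    crB : ∀ A {e p} → ends B e ≡ p → cr B A e ≡ A (proj₁ p) xor A (proj₂ p)
    crB A h = cong (λ p → A (proj₁ p) xor A (proj₂ p)) h

    touch-w : ∀ {e w} → Joins G e y w → touch G Z e ≡ true → w ≡ z
    touch-w {e} {w} j t = sym (≡ᵇ-true z w (trans (sym (cong (_∨ (z ≡ᵇ w)) (≡ᵇ-≢ (yz ∘ sym)))) (trans (sym (Joins-touch G Z j)) t)))

    agreeU : ∀ o → (∀ e → touch B Z e ≡ true → o e ≡ ψB e) → Agree G z ψ (T.unl o)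
    agreeU o ag e t = go (e₁ ≟ e) (e₂ ≟ e) (e₃ ≟ e) (e₄ ≟ e)
      where
      head : ∀ {k w w'} → w ≡ z → ends B k ≡ (w , w') → Joins G k y w → y ≢ w → ψB k ≡ (w ≡ᵇ tl G ψ k) → T.unl o k ≡ T.L₁.dir k w (o k) → T.unl o k ≡ ψ k
      head {k} {w} {w'} h eb j n pb u = trans u (trans (cong (T.L₁.dir k w) (trans (ag k (trans (touchB Z eb) (cong (_∨ (z ≡ᵇ w')) (≡ᵇ-≡ (sym h))))) pb))
        (sym (tail-bit {G} ψ k w y (n ∘ sym) (Joins-sym {G} j))))
      go : Dec (e₁ ≡ e) → Dec (e₂ ≡ e) → Dec (e₃ ≡ e) → Dec (e₄ ≡ e) → T.unl o e ≡ ψ e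
      go (yes refl) _ _ _ = head (touch-w j₁ t) T.endsB₁ j₁ n₁ ψB₁ (T.unl₁ o)
      go (no _) (yes refl) _ _ = let (h , s) = vp₁ (touch-w j₂ t) in
        trans (T.unl₂ o) (trans (cong (T.L₁.dir e₂ y) (trans (ag e₁ (trans (touchB Z T.endsB₁) (cong (_∨ (z ≡ᵇ w₂)) (≡ᵇ-≡ (sym h))))) (trans ψB₁ (trans (cong (_≡ᵇ tl G ψ e₁) h) s))))
          (sym (tail-bit {G} ψ e₂ y w₂ n₂ j₂)))
      go (no _) (no _) (yes refl) _ = head (touch-w j₃ t) T.endsB₃ j₃ n₃ ψB₃ (T.unl₃ o)
      go (no _) (no _) (no _) (yes refl) = ⊥-elim (vp₂ (touch-w j₄ t))
      go (no a) (no b) (no c) (no d) = trans (T.unl₀ o a b c d) (trans (ag e (trans (cong (λ p → Z (proj₁ p) ∨ Z (proj₂ p)) (T.endsB₀ a b c d)) t)) (ψB₀ a c))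

    Zf : ∀ v → cls f₀ (f₀ z) v ≡ Z v
    Zf v = ≡ᵇ-iff (f₀ z) (f₀ v) z v (λ h → sym (f₀-tip v (sym h))) (cong f₀)

    satB : Sat B ψB (cls f₀ (f₀ z))
    satB = Sat-cong B {ψB} (λ v → sym (Zf v)) (trans (sym (T.nt-two ψB Z))
      (Sat-local G {ψ} {T.unl ψB} Z (λ e c → sym (agreeU ψB (λ _ _ → refl) e (cr⇒touch G Z e c))) (Tip→Sat G z ψ tip)))

    sat-y : ∀ o → Sat B o (cls id y)
    sat-y o = trans (sumZ-zero {m G} {ctE B o (cls id y)} (λ e → ctE-noncr B o (cls id y) e (trans (proj₁ (T.y-free e)) (sym (proj₂ (T.y-free e))))))
      (sym (trans (bs-single G y) β0))

    nxB : ¬ Ext B f₀ (f₀ z) ψB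
    nxB (o , fl , ag) = almost {G} {z} {ψ} (Cv.tot cv) (Crit.nx C) (T.unl o) x
        (agreeU o (λ e t → ag e (trans (touch-cong B Zf e) t))) λ v vx → sat v vx (y ≟ v)
      where
      sat : ∀ v → v ≢ x → Dec (y ≡ v) → Sat G (T.unl o) (cls id v)
      sat v vx (yes refl) = T.Sat-two o (cls id y) (sat-y o)
      sat v vx (no n) = T.Sat-two o (cls id v) (Sat-cong B {o} (λ w → k w (y ≟ w)) (fl v))
        where
        k : ∀ w → Dec (y ≡ w) → cls f₀ v w ≡ cls id v w
        k w (yes refl) = trans (cong (v ≡ᵇ_) f₀-y) (trans (≡ᵇ-≢ vx) (sym (≡ᵇ-≢ (n ∘ sym))))
        k w (no h) = cong (v ≡ᵇ_) (f₀-ne h)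

    w≢ : ∀ {A : VSet G} {w} → A z ≡ false → A w ≡ true → w ≢ z
    w≢ {A} az aw h = true≢false (trans (sym aw) (trans (cong A h) az))

    pair₁₂ : ∀ A → A z ≡ false → A w₁ ≡ true → A w₂ ≡ true → Pair A
    pair₁₂ A az a b = w₁ , w₂ , noPar C y w₁ yz (w≢ {A} az a) d₁₂ j₁ j₂ n₁ , a , b

    pair₃₄ : ∀ A → A z ≡ false → A w₃ ≡ true → A w₄ ≡ true → Pair A
    pair₃₄ A az a b = w₃ , w₄ , noPar C y w₃ yz (w≢ {A} az a) d₃₄ j₃ j₄ n₃ , a , b

    sub2 : ∀ {dG dB b} → dG ≡ 2 + dB → 6 + at dG b ≤ dG → 4 + at dB b ≤ dB
    sub2 {_} {dB} {b} refl h = ℕₚ.+-cancelˡ-≤ 2 (4 + at dB b) dB (subst (λ a → 6 + a ≤ 2 + dB) (at-2+ dB b) h)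

    tameB : TameSets B f₀ z
    tameB U sat uz v uv w uw ne = subst (λ d → 4 + at d (bs B U) ≤ d) (T.dd-iso (delV-ne y U)) (subst (λ b → 4 + at (dd B A) b ≤ dd B A) (T.bs-iso β0 (delV-ne y U))
        (go (A w₁ ∧ A w₂) (A w₃ ∧ A w₄) refl refl))
      where
      A : VSet G
      A = delV y U
      ay : A y ≡ false
      ay = delV-y y U
      az : A z ≡ false
      az = trans (delV-ne y U z yz) uz
      wz : w ≢ z
      wz h = ne (cong f₀ h)
      aw : A w ≡ false
      aw = cong (_∧ not (y ≡ᵇ w)) uw
      member : Σ (V G) λ u → A u ≡ true
      member = k (y ≟ v)
        where
        k : Dec (y ≡ v) → Σ (V G) λ u → A u ≡ true
        k (no n) = v , trans (delV-ne y U v n) uv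
        k (yes refl) = x , trans (delV-ne y U x yx) (trans (sat x y (trans (f₀-ne yx) (sym f₀-y))) uv)
      rel : ∀ b c → (A w₁ ∧ A w₂) ≡ b → (A w₃ ∧ A w₄) ≡ c → dd G A ≡ (ind b + ind b) + ((ind c + ind c) + dd B A)
      rel b c p q = trans (T.dd-out A ay) (cong₂ (λ s t → (ind s + ind s) + ((ind t + ind t) + dd B A)) p q)
      -- One pair inside the set costs two boundary edges, which `LT` covers. If both pairs are
      -- inside, `y` is added to the set; then the lifts do not change the boundary.
      go : ∀ b c → (A w₁ ∧ A w₂) ≡ b → (A w₃ ∧ A w₄) ≡ c → 4 + at (dd B A) (bs G A) ≤ dd B A
      go false false p q = subst (λ d → 4 + at d (bs G A) ≤ d) (rel false false p q) (tameSet cv tb A az (proj₁ member) (proj₂ member) w aw wz)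
      go true false p q = sub2 {dd G A} {dd B A} {bs G A} (rel true false p q) (LT G z cv tb A az (pair₁₂ A az (∧-trueˡ p) (∧-trueʳ {A w₁} p)) w aw wz)
      go false true p q = sub2 {dd G A} {dd B A} {bs G A} (rel false true p q) (LT G z cv tb A az (pair₃₄ A az (∧-trueˡ q) (∧-trueʳ {A w₃} q)) w aw wz)
      go true true p q = subst (λ d → 4 + at d (bs G A) ≤ d) (trans (T.dd-in A⁺ (addV-y y U) (up w₁ (∧-trueˡ p)) (up w₂ (∧-trueʳ {A w₁} p)) (up w₃ (∧-trueˡ q)) (up w₄ (∧-trueʳ {A w₃} q))) (T.dd-iso ne⁺))
          (subst (λ b → 4 + at (dd G A⁺) b ≤ dd G A⁺) (T.bs-iso β0 ne⁺) (tameSet cv tb A⁺ a⁺z y (addV-y y U) (proj₁ outside) (proj₁ (proj₂ outside)) (proj₂ (proj₂ outside))))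
        where
        A⁺ : VSet G
        A⁺ = addV y U
        up : ∀ v → A v ≡ true → A⁺ v ≡ true
        up v h = cong (_∨ (y ≡ᵇ v)) (proj₁ (delV-sub y U v h))
        ne⁺ : ∀ v → y ≢ v → A⁺ v ≡ A v
        ne⁺ v h = trans (addV-ne y U v h) (sym (delV-ne y U v h))
        a⁺z : A⁺ z ≡ false
        a⁺z = trans (addV-ne y U z yz) uz
        outside : Σ (V G) λ u → A⁺ u ≡ false × u ≢ z
        outside = k (y ≟ w)
          where
          k : Dec (y ≡ w) → Σ (V G) λ u → A⁺ u ≡ false × u ≢ z
          k (no n) = w , trans (addV-ne y U w n) uw , wz
          k (yes refl) = x , trans (addV-ne y U x yx) (trans (sat x y (trans (f₀-ne yx) (sym f₀-y))) uw) , x≢z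

    ordB : OrdBound (ord G z) B f₀ z
    ordB = ordBound {G} {z} (ends B) (β G) f₀ zt (inj₁ (y , x , yx , trans f₀-y (sym (f₀-ne yx))))
      where
      P : V G × V G → Set
      P p = f₀ (proj₁ p) ≡ f₀ (proj₂ p) ⊎ f₀ (proj₁ p) ≡ f₀ z ⊎ f₀ (proj₂ p) ≡ f₀ z
      zt : ∀ e → touch G Z e ≡ true → P (ends B e)
      zt e t = go (e₁ ≟ e) (e₂ ≟ e) (e₃ ≟ e) (e₄ ≟ e)
        where
        go : Dec (e₁ ≡ e) → Dec (e₂ ≡ e) → Dec (e₃ ≡ e) → Dec (e₄ ≡ e) → P (ends B e)
        go (yes refl) _ _ _ = subst P (sym T.endsB₁) (inj₂ (inj₁ (cong f₀ (touch-w j₁ t))))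
        go (no _) (yes refl) _ _ = subst P (sym T.endsB₂) (inj₁ refl)
        go (no _) (no _) (yes refl) _ = subst P (sym T.endsB₃) (inj₂ (inj₁ (cong f₀ (touch-w j₃ t))))
        go (no _) (no _) (no _) (yes refl) = subst P (sym T.endsB₄) (inj₁ refl)
        go (no a) (no b) (no c) (no d) = subst P (sym (T.endsB₀ a b c d)) (tip-edge {G} {z} f₀ e t)

    tqr : TQR {ord G z} B f₀ z ψB
    tqr = TQ tb B f₀ z ψB (Cv.tot cv) satB nxB tameB ordB

    module After (R : TQR {ord G z} B f₀ z ψB) where
      open TQR R hiding (tip; crit)

      ly : lab y ≡ lab x
      ly = refines (trans f₀-y (sym (f₀-ne yx)))

      tz : ∀ v → lab v ≡ lab z → v ≡ z
      tz v e = f₀-tip v (TQR.tip R e)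

      A : Fin p → VSet G
      A q = delV y (cls lab q)

      dB : ∀ q → dd B (cls lab q) ≡ dd B (A q)
      dB q = T.dd-iso (λ v h → sym (delV-ne y (cls lab q) v h))

      az : ∀ {q} → q ≢ lab z → A q z ≡ false
      az {q} h = trans (delV-ne y (cls lab q) z yz) (≡ᵇ-≢ h)

      ay : ∀ q → A q y ≡ false
      ay q = delV-y y (cls lab q)

      A-lab : ∀ {q v} → A q v ≡ true → lab v ≡ q
      A-lab {q} {v} h = sym (≡ᵇ-true q (lab v) (proj₁ (delV-sub y (cls lab q) v h)))

      -- If a lifted pair lies inside A q, then merging y into A q shows that the other pair avoids A q.
      inside : ∀ q → q ≢ lab z → (i i' k k' : E G) (a b c d : V G) → i ≢ i' → k ≢ k' → i ≢ k → i ≢ k' → i' ≢ k → i' ≢ k' →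
        Joins G i y a → Joins G i' y b → Joins G k y c → Joins G k' y d → y ≢ a → y ≢ b → y ≢ c → y ≢ d →
        ends B i ≡ (a , b) → ends B i' ≡ (b , b) → ends B k ≡ (c , d) → ends B k' ≡ (d , d) →
        (∀ {e} → i ≢ e → i' ≢ e → k ≢ e → k' ≢ e → ends B e ≡ ends G e × ψB e ≡ ψ e) → ψB k ≡ (c ≡ᵇ tl G ψ k) → (d ≡ z → c ≡ z) →
        A q a ≡ true → A q b ≡ true → A q c ≡ true ⊎ A q d ≡ true → ⊥
      inside q qz i i' k k' a b c d ii kk ik ik' ik₂ ik₃ ji ji' jk jk' ya yb yc yd Ei Ei' Ek Ek' E₀ ψk dz aA bA side =
        nonext (o'' side , flow side , agr side)
        where
        f⁺ : V G → Fin p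
        f⁺ v = if y ≡ᵇ v then q else lab v
        f⁺-ne : ∀ {v} → y ≢ v → f⁺ v ≡ lab v
        f⁺-ne h = cong (λ b → if b then q else _) (≡ᵇ-≢ h)
        f⁺-y : f⁺ y ≡ q
        f⁺-y = cong (λ b → if b then q else lab y) (≡ᵇ-refl y)
        f⁺-tip : ∀ v → f⁺ v ≡ f⁺ z → v ≡ z
        f⁺-tip v h = go (y ≟ v)
          where
          go : Dec (y ≡ v) → v ≡ z
          go (yes refl) = ⊥-elim (qz (trans (sym f⁺-y) (trans h (f⁺-ne yz))))
          go (no n) = tz v (trans (sym (f⁺-ne n)) (trans h (f⁺-ne yz)))
        ex = crit f⁺ f⁺-tip y a ya (trans f⁺-y (sym (trans (f⁺-ne ya) (A-lab aA))))
        o = proj₁ ex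
        fl = proj₁ (proj₂ ex)
        ag = proj₂ (proj₂ ex)
        -- In the contraction one edge of the second pair becomes a loop, so the lifted edge takes
        -- its direction from the other one.
        kbit : A q c ≡ true ⊎ A q d ≡ true → Bool
        kbit (inj₁ _) = y ≡ᵇ tl G o k'
        kbit (inj₂ _) = c ≡ᵇ tl G o k
        o'' : A q c ≡ true ⊎ A q d ≡ true → Orientation B
        o'' s = setO o k (kbit s)
        ov : ∀ {v} → y ≢ v → ∀ r → cls f⁺ r v ≡ cls lab r v
        ov h r = cong (r ≡ᵇ_) (f⁺-ne h)
        sameq : ∀ {v} → A q v ≡ true → y ≢ v → ∀ r → cls f⁺ r v ≡ cls f⁺ r y
        sameq h n r = cong (r ≡ᵇ_) (trans (f⁺-ne n) (trans (A-lab h) (sym f⁺-y)))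
        g-ct : ∀ {e w} X → Joins G e y w → y ≢ w → ctE G o X e ≡ (if y ≡ᵇ tl G o e then ct (X y) (X w) else ct (X w) (X y))
        g-ct {e} {w} X j n = Joins-ctE {G} o X (y ≡ᵇ tl G o e) n j (tail-bit {G} o e y w n j)
        g-ct' : ∀ {e w} X → Joins G e y w → y ≢ w → ctE G o X e ≡ (if w ≡ᵇ tl G o e then ct (X w) (X y) else ct (X y) (X w))
        g-ct' {e} {w} X j n = Joins-ctE {G} o X (w ≡ᵇ tl G o e) (n ∘ sym) (Joins-sym {G} j) (tail-bit {G} o e w y (n ∘ sym) (Joins-sym {G} j))
        B-ct : ∀ (o' : Orientation B) X {e s t} b → ends B e ≡ (s , t) → o' e ≡ b → ctE B o' X e ≡ (if b then ct (X s) (X t) else ct (X t) (X s))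
        B-ct o' X true h r rewrite r | h = refl
        B-ct o' X false h r rewrite r | h = refl
        B-zero : ∀ (o' : Orientation B) (X : VSet G) {e s t} → ends B e ≡ (s , t) → X s ≡ X t → ctE B o' X e ≡ z0
        B-zero o' X {e} h r = ctE-noncr B o' X e (trans (cong (X ∘ proj₁) h) (trans r (sym (cong (X ∘ proj₂) h))))
        G-zero : ∀ {e w} X → Joins G e y w → X w ≡ X y → ctE G o X e ≡ z0
        G-zero {e} X (inj₁ h) r = ctE-noncr G o X e (trans (cong (X ∘ proj₁) h) (trans (sym r) (sym (cong (X ∘ proj₂) h))))
        G-zero {e} X (inj₂ h) r = ctE-noncr G o X e (trans (cong (X ∘ proj₁) h) (trans r (sym (cong (X ∘ proj₂) h))))
        nts : ∀ s r → nt G o (cls f⁺ r) ≡ nt B (o'' s) (cls f⁺ r)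
        nts s r = trans (sumZ-change₂ (ctE G o X) H k k' kk (λ e p p' → sym (H-ne p p')) z0 z0 (kpair s)) (sumZ-change₂ H (ctE B (o'' s) X) i i' ii oth z0 z0 ipair)
          where
          X : VSet G
          X = cls f⁺ r
          H : E G → Z3
          H = setO (setO (ctE G o X) k (ctE B (o'' s) X k)) k' (ctE B (o'' s) X k')
          H-k : H k ≡ ctE B (o'' s) X k
          H-k = trans (setO-ne (setO (ctE G o X) k (ctE B (o'' s) X k)) k' (ctE B (o'' s) X k') (kk ∘ sym)) (setO-at (ctE G o X) k (ctE B (o'' s) X k))
          H-k' : H k' ≡ ctE B (o'' s) X k'
          H-k' = setO-at (setO (ctE G o X) k (ctE B (o'' s) X k)) k' (ctE B (o'' s) X k')
          H-ne : ∀ {e} → k ≢ e → k' ≢ e → H e ≡ ctE G o X e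
          H-ne {e} p p' = trans (setO-ne (setO (ctE G o X) k (ctE B (o'' s) X k)) k' (ctE B (o'' s) X k') p') (setO-ne (ctE G o X) k (ctE B (o'' s) X k) p)
          kz : ctE B (o'' s) X k' ≡ z0
          kz = B-zero (o'' s) X Ek' refl
          kpair : ∀ s' → ctE G o X k ⊕ ctE G o X k' ≡ H k ⊕ H k'
          kpair _ = trans (val s refl) (sym (trans (cong₂ _⊕_ H-k (trans H-k' kz)) (⊕-identityʳ _)))
            where
            val : ∀ s' → s ≡ s' → ctE G o X k ⊕ ctE G o X k' ≡ ctE B (o'' s) X k
            val (inj₁ cA) refl = trans (cong₂ _⊕_ (G-zero X jk (sameq cA yc r)) (g-ct X jk' yd))
              (sym (trans (B-ct (o'' s) X (y ≡ᵇ tl G o k') Ek (setO-at o k _)) (cong (λ t → if y ≡ᵇ tl G o k' then ct t (X d) else ct (X d) t) (sameq cA yc r))))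
            val (inj₂ dA) refl = trans (cong₂ _⊕_ (g-ct' X jk yc) (G-zero X jk' (sameq dA yd r)))
              (trans (⊕-identityʳ _) (sym (trans (B-ct (o'' s) X (c ≡ᵇ tl G o k) Ek (setO-at o k _)) (cong (λ t → if c ≡ᵇ tl G o k then ct (X c) t else ct t (X c)) (sameq dA yd r)))))
          ipair : H i ⊕ H i' ≡ ctE B (o'' s) X i ⊕ ctE B (o'' s) X i'
          ipair = cong₂ _⊕_ (trans (H-ne (ik ∘ sym) (ik' ∘ sym)) (trans (G-zero X ji (sameq aA ya r)) (sym (B-zero (o'' s) X Ei (trans (sameq aA ya r) (sym (sameq bA yb r)))))))
            (trans (H-ne (ik₂ ∘ sym) (ik₃ ∘ sym)) (trans (G-zero X ji' (sameq bA yb r)) (sym (B-zero (o'' s) X Ei' refl))))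
          oth : ∀ e → i ≢ e → i' ≢ e → H e ≡ ctE B (o'' s) X e
          oth e p p' = go (k ≟ e) (k' ≟ e)
            where
            go : Dec (k ≡ e) → Dec (k' ≡ e) → H e ≡ ctE B (o'' s) X e
            go (yes refl) _ = H-k
            go (no _) (yes refl) = H-k'
            go (no a') (no b') = trans (H-ne a' b') (sym (cong₂ (λ b (ab : V G × V G) → ct (X (if b then proj₁ ab else proj₂ ab)) (X (if b then proj₂ ab else proj₁ ab)))
              (setO-ne o k (kbit s) a') (proj₁ (E₀ p p' a' b'))))
        flow : ∀ s → Flow B lab (o'' s)
        flow s r = trans (T.nt-iso (o'' s) (λ v h → sym (ov h r))) (trans (sym (nts s r)) (trans (fl r) (T.bs-iso β0 (λ v h → ov h r))))
        tipl : ∀ v → cls lab (lab z) v ≡ Z v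
        tipl v = ≡ᵇ-iff (lab z) (lab v) z v (λ h → sym (tz v (sym h))) (cong lab)
        agz : ∀ e → touch G Z e ≡ true → o e ≡ ψ e
        agz e t = ag e (touch-mono G {Z} {cls f⁺ (f⁺ z)} (λ v h → ≡ᵇ-≡ (cong f⁺ (≡ᵇ-true z v h))) e t)
        notz : ∀ {v} → A q v ≡ true → Z v ≡ false
        notz {v} h = ≡ᵇ-≢ λ r → true≢false (trans (sym h) (trans (cong (A q) (sym r)) (az qz)))
        agr : ∀ s e → touch B (cls lab (lab z)) e ≡ true → o'' s e ≡ ψB e
        agr s e t₀ = go (i ≟ e) (i' ≟ e) (k ≟ e) (k' ≟ e)
          where
          t : touch B Z e ≡ true
          t = trans (sym (touch-cong B tipl e)) t₀
          absurd : ∀ {s' t'} → ends B e ≡ (s' , t') → Z s' ≡ false → Z t' ≡ false → o'' s e ≡ ψB e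
          absurd h u v = ⊥-elim (true≢false (trans (sym t) (trans (touchB Z h) (cong₂ _∨_ u v))))
          dz' : (s' : A q c ≡ true ⊎ A q d ≡ true) → Z d ≡ false
          dz' (inj₁ cA) = ≡ᵇ-≢ λ h → true≢false (trans (sym (≡ᵇ-≡ (sym (dz (sym h))))) (notz cA))
          dz' (inj₂ dA) = notz dA
          kcase : ∀ s' → s ≡ s' → k ≡ e → o'' s e ≡ ψB e
          kcase (inj₁ cA) _ refl = absurd Ek (notz cA) (dz' s)
          kcase (inj₂ dA) refl refl = trans (setO-at o k _) (trans (cong (c ≡ᵇ_) (cong (λ b → if b then p₁ G k else p₂ G k) (agz k tk))) (sym ψk))
            where
            tk : touch G Z k ≡ true
            tk = trans (Joins-touch G Z jk) (trans (cong (_∨ Z c) (≡ᵇ-≢ (yz ∘ sym))) (trans (sym (Boolₚ.∨-identityʳ (Z c))) (trans (cong (Z c ∨_) (sym (notz dA))) (trans (sym (touchB Z Ek)) t))))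
          go : Dec (i ≡ e) → Dec (i' ≡ e) → Dec (k ≡ e) → Dec (k' ≡ e) → o'' s e ≡ ψB e
          go (yes refl) _ _ _ = absurd Ei (notz aA) (notz bA)
          go (no _) (yes refl) _ _ = absurd Ei' (notz bA) (notz bA)
          go (no _) (no _) (yes r) _ = kcase s refl r
          go (no _) (no _) (no _) (yes refl) = absurd Ek' (dz' s) (dz' s)
          go (no a') (no b') (no c') (no d') = trans (setO-ne o k (kbit s) c') (trans (agz e (trans (sym (cong (λ p → Z (proj₁ p) ∨ Z (proj₂ p)) (proj₁ (E₀ a' b' c' d')))) t)) (sym (proj₂ (E₀ a' b' c' d'))))

-- Parts with as many boundary edges as the tip

SameD-congO : ∀ G {o o' : Orientation G} T X → (∀ e → o e ≡ o' e) → SameD G o T X → SameD G o' T X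
SameD-congO G T X h (s , k) = s , λ e c t → trans (cong (λ b → T (if b then p₁ G e else p₂ G e)) (sym (h e))) (k e c t)

Ext-congO : ∀ G {p} (f : V G → Fin p) t {φ φ' : Orientation G} → (∀ e → φ e ≡ φ' e) → Ext G f t φ → Ext G f t φ'
Ext-congO G f t h (o , fl , ag) = o , fl , λ e k → trans (ag e k) (h e)

dir : (G : Gr) → V G → Orientation G → E G → Bool
dir G z ψ e = z ≡ᵇ tl G ψ e

end-dir : ∀ {G} (o : Orientation G) (X : VSet G) {e a b} → a ≢ b → Joins G e a b → X a ≡ true → X b ≡ false → X (tl G o e) ≡ (a ≡ᵇ tl G o e)
end-dir {G} o X {e} {a} {b} ab j xa xb = k (o e) j
  where
  k : ∀ s → Joins G e a b → X (if s then p₁ G e else p₂ G e) ≡ (a ≡ᵇ (if s then p₁ G e else p₂ G e))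
  k true (inj₁ q) = trans (cong (X ∘ proj₁) q) (trans xa (sym (trans (cong (λ p → a ≡ᵇ proj₁ p) q) (≡ᵇ-refl a))))
  k false (inj₁ q) = trans (cong (X ∘ proj₂) q) (trans xb (sym (trans (cong (λ p → a ≡ᵇ proj₂ p) q) (≡ᵇ-≢ ab))))
  k true (inj₂ q) = trans (cong (X ∘ proj₁) q) (trans xb (sym (trans (cong (λ p → a ≡ᵇ proj₁ p) q) (≡ᵇ-≢ ab))))
  k false (inj₂ q) = trans (cong (X ∘ proj₂) q) (trans xa (sym (trans (cong (λ p → a ≡ᵇ proj₂ p) q) (≡ᵇ-refl a))))

-- The restricted tip has the degree of the original tip, so `PartOK` needs a preflow that varies on
-- the boundary of `A` whenever `ψ` varies at the tip. If all candidates were constant, `Absorb`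
-- would give a contradiction.
module PartTight {G : Gr} {z : V G} {ψ : Orientation G} (C : Crit G z ψ) (tb : TBelow (ord G z)) (x : V G)
    (A : VSet G) (az : A z ≡ false) (pr : Pair A) (dA : dd G A ≡ deg G z) (s : Bool)
    (hs : ∀ e → cr G (cls id z) e ≡ true → touch G A e ≡ false → dir G z ψ e ≡ s)
    (y : V G) (ay : A y ≡ false) (yz : y ≢ z) where

  Good : VSet G → Orientation G → Set
  Good S φ = Sat G φ (cls (rf G A) (rf G A z)) × (¬ RExt G A z φ × ¬ SameD G φ (not ∘ A) S)

  Good? : ∀ S → Dec (Σ (Orientation G) (Good S))
  Good? S = anyOr?
    (λ {φ} {φ'} h (a , b , c) → Sat-congO G {φ} {φ'} (cls (rf G A) (rf G A z)) h a
      , (λ r → b (Ext-congO G (rf G A) (rf G A z) (λ e → sym (h e)) r)) , λ r → c (SameD-congO G {φ'} {φ} (not ∘ A) S (λ e → sym (h e)) r))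
    (λ φ → (nt G φ (cls (rf G A) (rf G A z)) ≟3 bs G (cls (rf G A) (rf G A z)))
      ×-dec (¬? (Ext? G (rf G A) (rf G A z) φ) ×-dec ¬? (SameD? G φ (not ∘ A) S)))

  deviant : ∀ S → ¬ SameD G ψ (cls id z) S → Σ (E G) λ e → cr G (cls id z) e ≡ true × touch G S e ≡ false × dir G z ψ e ≢ s
  deviant S n with Finₚ.any? (λ e → (cr G (cls id z) e ≟B true) ×-dec ((touch G S e ≟B false) ×-dec ¬? (dir G z ψ e ≟B s)))
  ... | yes h = h
  ... | no h = ⊥-elim (n (s , λ e c t → k e c t (dir G z ψ e ≟B s)))
    where
    k : ∀ e → cr G (cls id z) e ≡ true → touch G S e ≡ false → Dec (dir G z ψ e ≡ s) → dir G z ψ e ≡ s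
    k e c t (yes q) = q
    k e c t (no q) = ⊥-elim (h (e , c , t , q))

  -- The search in `Good?` keeps the argument constructive. Its failure says that each flow off `A`
  -- directs the boundary edges avoiding `S` alike, which is the hypothesis of `Absorb`.
  exists : ∀ S → (∀ v → S v ≡ true → A v ≡ true) → ((∀ v → S v ≡ false) ⊎ (Σ (V G) λ x → ∀ v → S v ≡ (x ≡ᵇ v))) →
    ¬ SameD G ψ (cls id z) S → Σ (Orientation G) (Good S)
  exists S SA hS n = go (Good? S) (deviant S n)
    where
    go : Dec (Σ (Orientation G) (Good S)) → (Σ (E G) λ e → cr G (cls id z) e ≡ true × touch G S e ≡ false × dir G z ψ e ≢ s) → Σ (Orientation G) (Good S)
    go (yes h) _ = h
    go (no none) (e⁺ , c⁺ , t⁺ , ne) = ⊥-elim (Ab.contradiction′ dA y ay yz λ e c t → trans (hs e c t) s≡)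
      where
      o⁺ = other G z e⁺ c⁺
      a₁ = proj₁ o⁺
      j⁺ : Joins G e⁺ z a₁
      j⁺ = proj₂ (proj₂ o⁺)
      -- `hs` fixes the direction of all tip edges avoiding `A`, so the deviating edge ends in `A`.
      a₁A : A a₁ ≡ true
      a₁A with A a₁ in eq
      ... | true = refl
      ... | false = ⊥-elim (ne (hs e⁺ c⁺ (trans (Joins-touch G A j⁺) (cong₂ _∨_ az eq))))
      a₁S : S a₁ ≡ false
      a₁S = bool-ne λ q → true≢false (trans (sym (trans (cong (S z ∨_) q) (Boolₚ.∨-zeroʳ (S z)))) (trans (sym (Joins-touch G S j⁺)) t⁺))
      s≡ : s ≡ not (dir G z ψ e⁺)
      s≡ = k s (dir G z ψ e⁺) ne
        where
        k : ∀ a b → b ≢ a → a ≡ not b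
        k = from-yes (allB? λ a → allB? λ b → ¬? (b ≟B a) →-dec (a ≟B not b))
      h₁ : ∀ o → Off G z ψ A o → ∀ e → cr G A e ≡ true → touch G S e ≡ false → not (A (tl G o e)) ≡ dir G z ψ e⁺
      h₁ o of′ e c t = use (SameD? G o (not ∘ A) S)
        where
        use : Dec (SameD G o (not ∘ A) S) → not (A (tl G o e)) ≡ dir G z ψ e⁺
        use (no q) = ⊥-elim (none (o , Sat-out G A {z} {o} az (proj₁ of′) , Off-nonext (Crit.nx C) A az o of′ , q))
        use (yes (s' , h)) = trans (h e (trans (cr-not G A e) c) t) (trans (sym (h e⁺ (trans (cr-not G A e⁺) (trans (Joins-cr G A j⁺) (cong₂ _xor_ az a₁A))) t⁺)) tails)
          where
          oe : o e⁺ ≡ ψ e⁺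
          oe = proj₂ of′ e⁺ (cr⇒touch G (cls id z) e⁺ c⁺)
          tails : not (A (tl G o e⁺)) ≡ dir G z ψ e⁺
          tails = trans (end-dir {G} o (not ∘ A) za j⁺ (cong not az) (cong not a₁A)) (cong (λ b → z ≡ᵇ (if b then p₁ G e⁺ else p₂ G e⁺)) oe)
            where
            za : z ≢ a₁
            za q = true≢false (trans (sym a₁A) (trans (cong A (sym q)) az))
      module Ab = Absorb C tb A az pr S SA hS e⁺ a₁ j⁺ a₁A a₁S h₁

  SameD-weaken : ∀ φ T X → SameD G φ T ∅ → SameD G φ T X
  SameD-weaken φ T X (s' , h) = s' , λ e c _ → h e c refl

  part : PartOK G z x ψ A
  part = go (A x ≟B true) (SameD? G ψ (cls id z) (cls id x)) (SameD? G ψ (cls id z) ∅)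
    where
    go : Dec (A x ≡ true) → Dec (ASx G z x ψ) → Dec (AS G z ψ) → PartOK G z x ψ A
    go (yes ax) (no nx) _ = mk (exists (cls id x) (λ v h → trans (cong A (sym (≡ᵇ-true x v h))) ax) (inj₂ (x , λ _ → refl)) nx)
      where
      mk : Σ (Orientation G) (Good (cls id x)) → PartOK G z x ψ A
      mk (φ , a , b , c) = record { φ = φ ; φtip = a ; φnx = b ; dA≤ = ℕₚ.≤-reflexive dA
        ; as = λ _ h → ⊥-elim (c (SameD-weaken φ (not ∘ A) (cls id x) h)) ; asx = λ _ _ h → ⊥-elim (c h) }
    go _ (yes hx) (yes h) = mk (R-nonext G z A (Crit.cv C) az pr)
      where
      mk : Σ (Orientation G) _ → PartOK G z x ψ A
      mk (φ , a , b) = record { φ = φ ; φtip = a ; φnx = b ; dA≤ = ℕₚ.≤-reflexive dA ; as = λ _ _ → h ; asx = λ _ _ _ → hx }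
    go (no ax) (no _) (yes h) = mk (R-nonext G z A (Crit.cv C) az pr)
      where
      mk : Σ (Orientation G) _ → PartOK G z x ψ A
      mk (φ , a , b) = record { φ = φ ; φtip = a ; φnx = b ; dA≤ = ℕₚ.≤-reflexive dA ; as = λ _ _ → h ; asx = λ q → ⊥-elim (ax q) }
    go ax hx (no n) = mk ax hx (exists ∅ (λ v ()) (inj₁ λ _ → refl) n)
      where
      mk : Dec (A x ≡ true) → Dec (ASx G z x ψ) → Σ (Orientation G) (Good ∅) → PartOK G z x ψ A
      mk _ (yes h) (φ , a , b , c) = record { φ = φ ; φtip = a ; φnx = b ; dA≤ = ℕₚ.≤-reflexive dA ; as = λ _ q → ⊥-elim (c q) ; asx = λ _ _ _ → h }
      mk (no ax) (no _) (φ , a , b , c) = record { φ = φ ; φtip = a ; φnx = b ; dA≤ = ℕₚ.≤-reflexive dA ; as = λ _ q → ⊥-elim (c q) ; asx = λ q → ⊥-elim (ax q) }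
      mk (yes ax) (no nx) _ = go (yes ax) (no nx) (no n)

-- Obstructions to the tallness of the reduced canvas

-- The class of `x` keeps the degree of `x` although it has several vertices, and uniform directions
-- at the reduced tip do not come from `ψ`. Both `A` and `A` with `y` added then attain equality in
-- the degree bound for `x`.
record Bad {G : Gr} {y : V G} (z x : V G) (ψ : Orientation G) (Q : Quad G y) : Set where
  open Quad Q
  field
    A : VSet G
    Ax : A x ≡ true
    Ay : A y ≡ false
    Az : A z ≡ false
    pr : Pair A
    dA : dd G A ≡ 2 + deg G x
    dA⁺ : dd G (addV y A) ≡ 2 + deg G x
    s : Bool
    hs : ∀ e → cr G (cls id z) e ≡ true → touch G (addV y A) e ≡ false → dir G z ψ e ≡ s
    side : (A w₁ ≡ false × A w₂ ≡ false × A w₃ ≡ true × (w₁ ≡ z → dir G z ψ e₁ ≡ s)) ⊎ (A w₃ ≡ false × A w₄ ≡ false × A w₁ ≡ true × (w₃ ≡ z → dir G z ψ e₃ ≡ s))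

module Split {G : Gr} {z x : V G} {ψ : Orientation G} (ES : Easel G z x ψ) (crit : CritL G id z ψ) (tb : TBelow (ord G z))
    (y : V G) (yz : y ≢ z) (yx : y ≢ x) (y4 : deg G y ≡ 4) (Q : Quad G y)
    (vp₁ : Quad.w₂ Q ≡ z → Quad.w₁ Q ≡ z × (z ≡ᵇ tl G ψ (Quad.e₁ Q)) ≡ (y ≡ᵇ tl G ψ (Quad.e₂ Q))) (vp₂ : Quad.w₄ Q ≢ z)
    (R : TQR {ord G z} (Two.B Q (Cv.loopless (Easel.cv ES))) (Deg4.f₀ ES crit tb y yz yx y4) z (Deg4.Pairing.ψB ES crit tb y yz yx y4 Q vp₁ vp₂)) where
  open Easel ES
  open Deg4 ES crit tb y yz yx y4
  open Quad Q
  module P = Pairing Q vp₁ vp₂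
  open P using (ψB; Z; module T)
  open T using (B)
  open P.After R
  open TQR R hiding (tip; crit)

  -- By `inside`, a set that contains one lifted pair avoids the other pair altogether.
  data Ins (q : Fin p) : Set where
    none : dd G (A q) ≡ dd B (A q) → Ins q
    in₁₂ : A q w₁ ≡ true → A q w₂ ≡ true → A q w₃ ≡ false → A q w₄ ≡ false → dd G (A q) ≡ 2 + dd B (A q) → Ins q
    in₃₄ : A q w₁ ≡ false → A q w₂ ≡ false → A q w₃ ≡ true → A q w₄ ≡ true → dd G (A q) ≡ 2 + dd B (A q) → Ins q

  ends₀ : ∀ {e} → e₁ ≢ e → e₂ ≢ e → e₃ ≢ e → e₄ ≢ e → ends B e ≡ ends G e × ψB e ≡ ψ e
  ends₀ a b c d = T.endsB₀ a b c d , P.ψB₀ a c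

  ins : ∀ q → q ≢ lab z → Ins q
  ins q qz = go (A q w₁ ∧ A q w₂) (A q w₃ ∧ A q w₄) refl refl
    where
    rel : ∀ b c → (A q w₁ ∧ A q w₂) ≡ b → (A q w₃ ∧ A q w₄) ≡ c → dd G (A q) ≡ (ind b + ind b) + ((ind c + ind c) + dd B (A q))
    rel b c h k = trans (T.dd-out (A q) (ay q)) (cong₂ (λ s t → (ind s + ind s) + ((ind t + ind t) + dd B (A q))) h k)
    i₁₂ : A q w₁ ≡ true → A q w₂ ≡ true → A q w₃ ≡ true ⊎ A q w₄ ≡ true → ⊥
    i₁₂ = inside q qz e₁ e₂ e₃ e₄ w₁ w₂ w₃ w₄ d₁₂ d₃₄ d₁₃ d₁₄ d₂₃ d₂₄ j₁ j₂ j₃ j₄ n₁ n₂ n₃ n₄ T.endsB₁ T.endsB₂ T.endsB₃ T.endsB₄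
      ends₀ P.ψB₃ (λ h → ⊥-elim (vp₂ h))
    i₃₄ : A q w₃ ≡ true → A q w₄ ≡ true → A q w₁ ≡ true ⊎ A q w₂ ≡ true → ⊥
    i₃₄ = inside q qz e₃ e₄ e₁ e₂ w₃ w₄ w₁ w₂ d₃₄ d₁₂ (d₁₃ ∘ sym) (d₂₃ ∘ sym) (d₁₄ ∘ sym) (d₂₄ ∘ sym) j₃ j₄ j₁ j₂ n₃ n₄ n₁ n₂ T.endsB₃ T.endsB₄ T.endsB₁ T.endsB₂
      (λ c d a b → ends₀ a b c d) P.ψB₁ (λ h → proj₁ (vp₁ h))
    go : ∀ b c → (A q w₁ ∧ A q w₂) ≡ b → (A q w₃ ∧ A q w₄) ≡ c → Ins q
    go false false h k = none (rel false false h k)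
    go true c h k = in₁₂ a b (bool-ne λ r → i₁₂ a b (inj₁ r)) w₄f (rel′ c k)
      where
      a = ∧-trueˡ h
      b = ∧-trueʳ {A q w₁} h
      w₄f : A q w₄ ≡ false
      w₄f = bool-ne λ r → i₁₂ a b (inj₂ r)
      rel′ : ∀ c → (A q w₃ ∧ A q w₄) ≡ c → dd G (A q) ≡ 2 + dd B (A q)
      rel′ false k = rel true false h k
      rel′ true k = ⊥-elim (true≢false (trans (sym (∧-trueʳ {A q w₃} k)) w₄f))
    go false true h k = in₃₄ (bool-ne λ r → i₃₄ a b (inj₁ r)) (bool-ne λ r → i₃₄ a b (inj₂ r)) a b (rel false true h k)
      where
      a = ∧-trueˡ k
      b = ∧-trueʳ {A q w₃} k

  le2 : ∀ q → Ins q → dd G (A q) ≤ 2 + dd B (A q)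
  le2 q (none e) = ℕₚ.≤-trans (ℕₚ.≤-reflexive e) (ℕₚ.m≤n+m _ 2)
  le2 q (in₁₂ _ _ _ _ e) = ℕₚ.≤-reflexive e
  le2 q (in₃₄ _ _ _ _ e) = ℕₚ.≤-reflexive e

  Zl : ∀ v → cls lab (lab z) v ≡ Z v
  Zl v = ≡ᵇ-iff (lab z) (lab v) z v (λ h → sym (tz v (sym h))) (cong lab)

  Zy : Z y ≡ false
  Zy = ≡ᵇ-≢ (yz ∘ sym)

  dZ : ∀ b → (Z w₁ ∧ Z w₂) ≡ b → deg G z ≡ (ind b + ind b) + dd B Z
  dZ b h = trans (sym (dz-eq cv)) (trans (T.dd-out Z Zy) (cong₂ (λ s t → (ind s + ind s) + ((ind t + ind t) + dd B Z)) h
    (trans (cong (Z w₃ ∧_) (≡ᵇ-≢ (vp₂ ∘ sym))) (Boolₚ.∧-zeroʳ (Z w₃)))))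

  dZ≤ : dd B Z ≤ deg G z
  dZ≤ = subst (dd B Z ≤_) (sym (dZ (Z w₁ ∧ Z w₂) refl)) (ℕₚ.m≤n+m _ _)

  bnd : ∀ q → q ≢ lab z → 2 + dd B (A q) ≤ dd B Z × (2 + dd B (A q) ≡ dd B Z → SameD B ψB Z (cls lab q))
  bnd q qz = subst (λ d → 2 + d ≤ dd B Z) (dB q) (subst (2 + dd B (cls lab q) ≤_) dt (proj₁ (bound q qz)))
    , λ e → SameD-cong B ψB {cls lab (lab z)} {Z} {cls lab q} {cls lab q} Zl (λ _ → refl) (proj₂ (bound q qz) (trans (cong (2 +_) (dB q)) (trans e (sym dt))))
    where
    dt : dd B (cls lab (lab z)) ≡ dd B Z
    dt = dd-cong B Zl

  module Dirs (X : VSet G) (sd : SameD B ψB Z X) where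
    s : Bool
    s = proj₁ sd

    old : ∀ e → e₁ ≢ e → e₂ ≢ e → e₃ ≢ e → e₄ ≢ e → cr G Z e ≡ true → touch G X e ≡ false → dir G z ψ e ≡ s
    old e a b c d h t = trans (cong₂ (λ p b → z ≡ᵇ (if b then proj₁ p else proj₂ p)) (sym (T.endsB₀ a b c d)) (sym (P.ψB₀ a c)))
      (proj₂ sd e (trans (cong (λ p → Z (proj₁ p) xor Z (proj₂ p)) (T.endsB₀ a b c d)) h) (trans (cong (λ p → X (proj₁ p) ∨ X (proj₂ p)) (T.endsB₀ a b c d)) t))

    lifted : ∀ {e w w'} → ends B e ≡ (w , w') → ψB e ≡ (w ≡ᵇ tl G ψ e) → w' ≢ z → w ≡ z → X z ≡ false → X w' ≡ false → dir G z ψ e ≡ s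
    lifted {e} {w} {w'} eb pb w'z refl xz xw = trans (sym tlz) (proj₂ sd e (trans (P.crB Z eb) (cong₂ _xor_ (≡ᵇ-refl z) Zw')) (trans (P.touchB X eb) (cong₂ _∨_ xz xw)))
      where
      Zw' : Z w' ≡ false
      Zw' = ≡ᵇ-≢ (w'z ∘ sym)
      tlz : Z (tl B ψB e) ≡ dir G z ψ e
      tlz = trans (cong₂ (λ p b → Z (if b then proj₁ p else proj₂ p)) eb pb) (k (z ≡ᵇ tl G ψ e))
        where
        k : ∀ b → Z (if b then z else w') ≡ b
        k true = ≡ᵇ-refl z
        k false = Zw'

  at-y : ∀ {e w} → Joins G e y w → cr G Z e ≡ true → w ≡ z
  at-y j c = P.touch-w j (cr⇒touch G Z _ c)

  qx : lab x ≢ lab z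
  qx e = x≢z (tz x e)

  Ax : VSet G
  Ax = A (lab x)

  Axx : Ax x ≡ true
  Axx = trans (delV-ne y (cls lab (lab x)) x yx) (≡ᵇ-refl (lab x))

  trDeg : ∀ q → q ≢ lab z → Pair (A q) → ∀ v → A q v ≡ true → 2 + deg G v ≤ dd G (A q)
  trDeg q ne pr v av = TR-deg G z cv tb (A q) (az ne) pr y (ay q) yz v av

  -- The lifts cost at most two boundary edges, and a class with several vertices has two to spare.
  -- A singleton loses none, since two distinct vertices would have to lie in it.
  dx≥ : deg G x ≤ dd B Ax
  dx≥ = go (single-or-pair Ax x Axx)
    where
    go : Pair Ax ⊎ (∀ u → Ax u ≡ cls id x u) → deg G x ≤ dd B Ax
    go (inj₁ pr) = ℕₚ.+-cancelˡ-≤ 2 _ _ (ℕₚ.≤-trans (trDeg (lab x) qx pr x Axx) (le2 (lab x) (ins (lab x) qx)))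
    go (inj₂ h) = k (ins (lab x) qx)
      where
      two-in : ∀ {a b} → Ax a ≡ true → Ax b ≡ true → a ≢ b → ⊥
      two-in {a} {b} p q ne = ne (trans (sym (≡ᵇ-true x a (trans (sym (h a)) p))) (≡ᵇ-true x b (trans (sym (h b)) q)))
      k : Ins (lab x) → deg G x ≤ dd B Ax
      k (none e) = ℕₚ.≤-reflexive (trans (sym (proj₁ (single-deg cv {Ax} {x} h))) e)
      k (in₁₂ a b _ _ _) = ⊥-elim (let (_ , _ , ne , p , q) = P.pair₁₂ Ax (az qx) a b in two-in p q ne)
      k (in₃₄ _ _ a b _) = ⊥-elim (let (_ , _ , ne , p , q) = P.pair₃₄ Ax (az qx) a b in two-in p q ne)

  dgz : deg (quot B lab) (lab z) ≡ dd B Z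
  dgz = trans (deg-quot B lab (lab z)) (dd-cong B Zl)

  dgx : deg (quot B lab) (lab x) ≡ dd B Ax
  dgx = trans (deg-quot B lab (lab x)) (dB (lab x))

  easel' : Easel (quot B lab) (lab z) (lab x) (ψB ∘ orig B lab)
  easel' = record { cv = canvas ; tip = TipQ← B lab (lab z) ψB tipSat ; nx = λ e → nonext (ExtQ→ B lab (lab z) ψB e) ; x≢z = qx }

  Mono' : Set
  Mono' = Mono G z x ψ (quot B lab) (lab z) (lab x) (ψB ∘ orig B lab)

  mkMono : (dd B Z ≡ deg G z → SameD B ψB Z ∅ → AS G z ψ) → (dd B Z ≡ deg G z → dd B Ax ≡ deg G x → SameD B ψB Z (cls lab (lab x)) → ASx G z x ψ) → Mono'
  mkMono h k = record { easel = easel' ; dz≤ = subst (_≤ deg G z) (sym dgz) dZ≤ ; dx≥ = subst (deg G x ≤_) (sym dgx) dx≥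
    ; as = λ e s → h (trans (sym dgz) e) (SameD-cong B ψB {cls lab (lab z)} {Z} {∅} {∅} Zl (λ _ → refl) (SameD-quot→ B lab ψB (cls id (lab z)) ∅ s))
    ; asx = λ e e' s → k (trans (sym dgz) e) (trans (sym dgx) e') (SameD-cong B ψB {cls lab (lab z)} {Z} {cls lab (lab x)} {cls lab (lab x)} Zl (λ _ → refl) (SameD-quot→ B lab ψB (cls id (lab z)) (cls id (lab x)) s)) }

  Parts : Set
  Parts = ∀ q → q ≢ lab z → ∀ A' → (∀ v → A' v ≡ A q v) → Pair A' → PartOK G z x ψ A'

  -- The tip degree drops by two, so no equality case arises and every part has fewer boundary edges
  -- than the original tip.
  module TipPair (h₁ : w₁ ≡ z) (h₂ : w₂ ≡ z) where
    lost : deg G z ≡ 2 + dd B Z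
    lost = dZ true (cong₂ _∧_ (≡ᵇ-≡ (sym h₁)) (≡ᵇ-≡ (sym h₂)))
    less : dd B Z ≢ deg G z
    less e = ℕₚ.<⇒≢ (ℕₚ.≤-trans (ℕₚ.n<1+n _) (ℕₚ.n≤1+n _)) (trans e lost)
    mono : Mono'
    mono = mkMono (λ e → ⊥-elim (less e)) (λ e → ⊥-elim (less e))
    parts : Parts
    parts q ne A' h pr = partLess cv A' (trans (h z) (az ne)) pr (ℕₚ.≤-trans (s≤s (ℕₚ.≤-trans (ℕₚ.≤-reflexive (dd-cong G h)) (le2 q (ins q ne))))
      (ℕₚ.≤-trans (s≤s (proj₁ (bnd q ne))) (ℕₚ.≤-trans (ℕₚ.n≤1+n _) (ℕₚ.≤-reflexive (sym lost)))))

  -- The tip keeps its degree, so a part containing a lifted pair can reach it, and directions have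
  -- to be compared edge by edge.
  module NoTipPair (w₂z : w₂ ≢ z) where
    kept′ : deg G z ≡ dd B Z
    kept′ = dZ false (trans (cong (Z w₁ ∧_) (≡ᵇ-≢ (w₂z ∘ sym))) (Boolₚ.∧-zeroʳ (Z w₁)))

    all-dirs : ∀ X s → (∀ e → e₁ ≢ e → e₂ ≢ e → e₃ ≢ e → e₄ ≢ e → cr G Z e ≡ true → touch G X e ≡ false → dir G z ψ e ≡ s) →
      (touch G X e₁ ≡ false → w₁ ≡ z → dir G z ψ e₁ ≡ s) → (touch G X e₃ ≡ false → w₃ ≡ z → dir G z ψ e₃ ≡ s) → ∀ e → cr G Z e ≡ true → touch G X e ≡ false → dir G z ψ e ≡ s
    all-dirs X s old l₁ l₃ e c t = go (e₁ ≟ e) (e₂ ≟ e) (e₃ ≟ e) (e₄ ≟ e)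
      where
      go : Dec (e₁ ≡ e) → Dec (e₂ ≡ e) → Dec (e₃ ≡ e) → Dec (e₄ ≡ e) → dir G z ψ e ≡ s
      go (yes refl) _ _ _ = l₁ t (at-y j₁ c)
      go (no _) (yes refl) _ _ = ⊥-elim (w₂z (at-y j₂ c))
      go (no _) (no _) (yes refl) _ = l₃ t (at-y j₃ c)
      go (no _) (no _) (no _) (yes refl) = ⊥-elim (vp₂ (at-y j₄ c))
      go (no a) (no b) (no c') (no d) = old e a b c' d c t

    as' : SameD B ψB Z ∅ → AS G z ψ
    as' sd = D.s , all-dirs ∅ D.s D.old (λ _ h → D.lifted T.endsB₁ P.ψB₁ w₂z h refl refl) (λ _ h → D.lifted T.endsB₃ P.ψB₃ vp₂ h refl refl)
      where module D = Dirs ∅ sd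

    lab-touch : ∀ q e → e₁ ≢ e → e₂ ≢ e → e₃ ≢ e → e₄ ≢ e → touch G (cls lab q) e ≡ touch G (A q) e
    lab-touch q e a b c d = trans (sym (cong (λ p → cls lab q (proj₁ p) ∨ cls lab q (proj₂ p)) (T.endsB₀ a b c d)))
      (trans (T.touch-iso (λ v h → sym (delV-ne y (cls lab q) v h)) e) (cong (λ p → A q (proj₁ p) ∨ A q (proj₂ p)) (T.endsB₀ a b c d)))

    lab-false : ∀ q {w} → y ≢ w → A q w ≡ false → cls lab q w ≡ false
    lab-false q {w} n h = trans (sym (delV-ne y (cls lab q) w n)) h

    parts : Parts
    parts q ne A' h pr = go (ins q ne)
      where
      A'z : A' z ≡ false
      A'z = trans (h z) (az ne)
      strict : dd G A' < deg G z → PartOK G z x ψ A'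
      strict = partLess cv A' A'z pr
      b≤ : 2 + dd B (A q) ≤ deg G z
      b≤ = ℕₚ.≤-trans (proj₁ (bnd q ne)) (ℕₚ.≤-reflexive (sym kept′))
      touch' : ∀ e → touch G A' e ≡ touch G (A q) e
      touch' = touch-cong G h
      onA : ∀ {w e} → Joins G e y w → A q w ≡ true → touch G A' e ≡ false → ⊥
      onA {w} {e} j a t = true≢false (trans (sym (trans (touch' e) (trans (Joins-touch G (A q) j) (trans (cong (A q y ∨_) a) (Boolₚ.∨-zeroʳ _))))) t)
      tight : dd G (A q) ≡ 2 + dd B (A q) → (∀ sd → let module D = Dirs (cls lab q) sd in
          (touch G A' e₁ ≡ false → w₁ ≡ z → dir G z ψ e₁ ≡ D.s) × (touch G A' e₃ ≡ false → w₃ ≡ z → dir G z ψ e₃ ≡ D.s)) → PartOK G z x ψ A'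
      tight e lf = use (ℕₚ.m≤n⇒m<n∨m≡n b≤)
        where
        dA' : dd G A' ≡ 2 + dd B (A q)
        dA' = trans (dd-cong G h) e
        use : 2 + dd B (A q) < deg G z ⊎ 2 + dd B (A q) ≡ deg G z → PartOK G z x ψ A'
        use (inj₁ lt) = strict (subst (_< deg G z) (sym dA') lt)
        use (inj₂ eq) = PartTight.part C tb x A' A'z pr (trans dA' eq) (proj₁ sd)
            (all-dirs A' (proj₁ sd) (λ e a b c d cr' t → Dirs.old (cls lab q) sd e a b c d cr' (trans (lab-touch q e a b c d) (trans (sym (touch' e)) t)))
              (proj₁ (lf sd)) (proj₂ (lf sd))) y (trans (h y) (ay q)) yz
          where
          sd : SameD B ψB Z (cls lab q)
          sd = proj₂ (bnd q ne) (trans eq kept′)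
      go : Ins q → PartOK G z x ψ A'
      go (none e) = strict (ℕₚ.≤-trans (s≤s (ℕₚ.≤-reflexive (trans (dd-cong G h) e))) (ℕₚ.≤-trans (ℕₚ.n≤1+n _) b≤))
      go (in₁₂ a₁ a₂ a₃ a₄ e) = tight e λ sd → (λ t _ → ⊥-elim (onA j₁ a₁ t)) , λ _ r → Dirs.lifted (cls lab q) sd T.endsB₃ P.ψB₃ vp₂ r (≡ᵇ-≢ ne) (lab-false q n₄ a₄)
      go (in₃₄ a₁ a₂ a₃ a₄ e) = tight e λ sd → (λ _ r → Dirs.lifted (cls lab q) sd T.endsB₁ P.ψB₁ w₂z r (≡ᵇ-≢ ne) (lab-false q n₂ a₂)) , λ t _ → ⊥-elim (onA j₃ a₃ t)

    -- A lifted tip edge ending in `x` is ignored in the reduced canvas, whereas the original edge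
    -- ends in `y` and counts in `ASx`. The hypothesis `hx` supplies the directions that are missing
    -- for this reason.
    mono : (hx : ∀ s → (w₁ ≡ z → w₂ ≢ x → dir G z ψ e₁ ≡ s) → (w₃ ≡ z → w₄ ≢ x → dir G z ψ e₃ ≡ s) →
        (w₁ ≡ z → dir G z ψ e₁ ≡ s) × (w₃ ≡ z → dir G z ψ e₃ ≡ s)) → Mono' ⊎ (Bad z x ψ Q × ¬ ASx G z x ψ)
    mono hx = go (SameD? G ψ Z (cls id x)) (SameD? B ψB Z (cls lab (lab x))) (dd B Ax ℕₚ.≟ deg G x)
      where
      fine : (dd B Z ≡ deg G z → dd B Ax ≡ deg G x → SameD B ψB Z (cls lab (lab x)) → ASx G z x ψ) → Mono' ⊎ (Bad z x ψ Q × ¬ ASx G z x ψ)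
      fine h = inj₁ (mkMono (λ _ → as') h)
      module _ (sd : SameD B ψB Z (cls lab (lab x))) where
        module D = Dirs (cls lab (lab x)) sd
        l₁ : A (lab x) w₂ ≡ false → w₁ ≡ z → dir G z ψ e₁ ≡ D.s
        l₁ a r = D.lifted T.endsB₁ P.ψB₁ w₂z r (≡ᵇ-≢ qx) (lab-false (lab x) n₂ a)
        l₃ : A (lab x) w₄ ≡ false → w₃ ≡ z → dir G z ψ e₃ ≡ D.s
        l₃ a r = D.lifted T.endsB₃ P.ψB₃ vp₂ r (≡ᵇ-≢ qx) (lab-false (lab x) n₄ a)
        singleton : (∀ u → Ax u ≡ cls id x u) → ASx G z x ψ
        singleton h = D.s , all-dirs (cls id x) D.s (λ e a b c d cr' t → D.old e a b c d cr' (trans (lab-touch (lab x) e a b c d) (trans (touch-cong G h e) t)))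
            (λ _ → proj₁ k) (λ _ → proj₂ k)
          where
          k = hx D.s (λ r n → l₁ (trans (h w₂) (≡ᵇ-≢ (n ∘ sym))) r) (λ r n → l₃ (trans (h w₄) (≡ᵇ-≢ (n ∘ sym))) r)
        old⁺ : ∀ e → cr G Z e ≡ true → touch G (addV y Ax) e ≡ false → dir G z ψ e ≡ D.s
        old⁺ e c t = all-dirs (addV y Ax) D.s (λ e a b c d cr' t → D.old e a b c d cr' (trans (lab-touch (lab x) e a b c d)
              (bool-ne λ q → true≢false (trans (sym (touch-mono G {Ax} {addV y Ax} (λ v h → cong (_∨ (y ≡ᵇ v)) h) e q)) t))))
            (λ t → ⊥-elim (touches j₁ t)) (λ t → ⊥-elim (touches j₃ t)) e c t
          where
          touches : ∀ {e w} → Joins G e y w → touch G (addV y Ax) e ≡ false → ⊥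
          touches j t = true≢false (trans (sym (trans (Joins-touch G (addV y Ax) j) (cong (_∨ addV y Ax _) (addV-y y Ax)))) t)
        bad : dd B Ax ≡ deg G x → ¬ ASx G z x ψ → Bad z x ψ Q
        bad dx nx' = k (single-or-pair Ax x Axx) (ins (lab x) qx)
          where
          dB⁺ : dd B (addV y Ax) ≡ dd B Ax
          dB⁺ = T.dd-iso (λ v h → addV-ne y Ax v h)
          up : ∀ {w b} → y ≢ w → Ax w ≡ b → addV y Ax w ≡ b
          up {w} n h = trans (addV-ne y Ax w n) h
          k : Pair Ax ⊎ (∀ u → Ax u ≡ cls id x u) → Ins (lab x) → Bad z x ψ Q
          k (inj₂ h) _ = ⊥-elim (nx' (singleton h))
          k (inj₁ pr) (none e) = ⊥-elim (ℕₚ.<⇒≱ (ℕₚ.≤-trans (ℕₚ.n<1+n _) (ℕₚ.n≤1+n _)) (ℕₚ.≤-trans (trDeg (lab x) qx pr x Axx) (ℕₚ.≤-reflexive (trans e dx))))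
          k (inj₁ pr) (in₁₂ a₁ a₂ a₃ a₄ e) = record { A = Ax ; Ax = Axx ; Ay = ay (lab x) ; Az = az qx ; pr = pr ; dA = trans e (cong (2 +_) dx)
            ; dA⁺ = trans (T.dd-half₁ (addV y Ax) (addV-y y Ax) (up n₁ a₁) (up n₂ a₂) (up n₃ a₃) (up n₄ a₄)) (cong (2 +_) (trans dB⁺ dx))
            ; s = D.s ; hs = old⁺ ; side = inj₂ (a₃ , a₄ , a₁ , l₃ a₄) }
          k (inj₁ pr) (in₃₄ a₁ a₂ a₃ a₄ e) = record { A = Ax ; Ax = Axx ; Ay = ay (lab x) ; Az = az qx ; pr = pr ; dA = trans e (cong (2 +_) dx)
            ; dA⁺ = trans (T.dd-half₂ (addV y Ax) (addV-y y Ax) (up n₁ a₁) (up n₂ a₂) (up n₃ a₃) (up n₄ a₄)) (cong (2 +_) (trans dB⁺ dx))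
            ; s = D.s ; hs = old⁺ ; side = inj₁ (a₁ , a₂ , a₃ , l₁ a₂) }
      go : Dec (ASx G z x ψ) → Dec (SameD B ψB Z (cls lab (lab x))) → Dec (dd B Ax ≡ deg G x) → Mono' ⊎ (Bad z x ψ Q × ¬ ASx G z x ψ)
      go (yes h) _ _ = fine (λ _ _ _ → h)
      go (no _) (no n) _ = fine (λ _ _ s → ⊥-elim (n s))
      go (no _) (yes _) (no n) = fine (λ _ e _ → ⊥-elim (n e))
      go (no n) (yes sd) (yes e) = inj₂ (bad sd e n , n)

-- The edges of a 2-alteration

inItem : (H : Gr) → Item H → E H → Bool
inItem H (inj₁ _) e = false
inItem H (inj₂ e') e = e' ≡ᵇ e

gad : (H : Gr) → Item H → List (Fin (suc (n H)) × Fin (suc (n H)))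
gad H (inj₁ w) = (zero , suc w) ∷ (zero , suc w) ∷ []
gad H (inj₂ e) = (suc (p₁ H e) , zero) ∷ (zero , suc (p₂ H e)) ∷ []

filter-ext : ∀ {A : Set} {p q : A → Bool} → (∀ e → p e ≡ q e) → ∀ L → filterᵇ p L ≡ filterᵇ q L
filter-ext h L = filter-cong L (All.tabulate λ {e} _ → h e)

alt2Edges : ∀ H y₁ y₂ → y₁ ≢ y₂ → edgeList (alt2 H y₁ y₂) ≡
  map (λ e → mapP suc (ends H e)) (filterᵇ (λ e → not (inItem H y₁ e ∨ inItem H y₂ e)) (allFin (m H))) ++ (gad H y₁ ++ gad H y₂)
alt2Edges H (inj₁ w) (inj₁ w') ne rewrite ≡ᵇ-≢ {a = w} {w'} (ne ∘ cong inj₁) = Listₚ.tabulate-lookup _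
alt2Edges H (inj₁ w) (inj₂ e') ne = trans (Listₚ.tabulate-lookup _) (cong (λ L → map (λ e → mapP suc (ends H e)) L ++ (gad H (inj₁ w) ++ gad H (inj₂ e'))) (filter-ext (λ e → cong not (Boolₚ.∨-identityʳ (e' ≡ᵇ e))) (allFin (m H))))
alt2Edges H (inj₂ e') (inj₁ w) ne = Listₚ.tabulate-lookup _
alt2Edges H (inj₂ e') (inj₂ e'') ne rewrite ≡ᵇ-≢ {a = e'} {e''} (ne ∘ cong inj₂) =
  trans (Listₚ.tabulate-lookup _) (cong (λ L → map (λ e → mapP suc (ends H e)) L ++ (gad H (inj₂ e') ++ gad H (inj₂ e''))) (filter-ext (λ e → cong (λ b → not ((e' ≡ᵇ e) ∨ b)) (Boolₚ.∨-identityʳ (e'' ≡ᵇ e))) (allFin (m H))))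

isoPerm′ : ∀ (H : Gr) {m₁} (ends₁ : Fin m₁ → V H × V H) β₁ → PS._↭ˢ_ (n H) (tabulate ends₁) (edgeList H) →
  (∀ v → β H v ≡ β₁ v) → Σ (Iso (record { n = n H ; m = m₁ ; ends = ends₁ ; β = β₁ }) H) λ I → ∀ v → vto I v ≡ v × vfrom I v ≡ v
isoPerm′ H ends₁ β₁ p h = record
    { vm = record { to = id ; from = id ; to-cong = cong id ; from-cong = cong id ; inverse = (λ { refl → refl }) , (λ { refl → refl }) }
    ; em = em₁ FinPerm.∘ₚ FinPerm.cast-id (Listₚ.length-tabulate (ends H))
    ; ends-ok = λ e → subst (SwapEq (ends₁ e)) (sym (eq (Inverse.to em₁ e))) (sw e)
    ; β-ok = h } , λ v → refl , refl
  where
  em₁ = FinPerm.cast-id (sym (Listₚ.length-tabulate ends₁)) FinPerm.∘ₚ PS.onIndices (n H) p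
  eq : ∀ i → ends H (cast (Listₚ.length-tabulate (ends H)) i) ≡ lookup (edgeList H) i
  eq i = trans (sym (Listₚ.lookup-tabulate (ends H) (cast (Listₚ.length-tabulate (ends H)) i)))
    (cong (lookup (edgeList H)) (trans (Finₚ.cast-trans (Listₚ.length-tabulate (ends H)) (sym (Listₚ.length-tabulate (ends H))) i) (Finₚ.cast-is-id refl i)))
  sw : ∀ e → SwapEq (ends₁ e) (lookup (edgeList H) (Inverse.to em₁ e))
  sw e = subst (λ a → SwapEq a (lookup (edgeList H) (Inverse.to (PS.onIndices (n H) p) (cast (sym (Listₚ.length-tabulate ends₁)) e)))) (Listₚ.lookup-tabulate ends₁ e)
    (PermSₚ.onIndices-lookup (PairSetoid (n H)) p (cast (sym (Listₚ.length-tabulate ends₁)) e))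

map-lookup-filter : ∀ {A : Set} (q : A → Bool) L → map (lookup L) (filterᵇ (λ i → q (lookup L i)) (allFin (length L))) ≡ filterᵇ q L
map-lookup-filter q L = trans (filter-map q (lookup L) (allFin (length L))) (cong (filterᵇ q) (trans (Listₚ.map-tabulate {n = length L} id (lookup L)) (Listₚ.tabulate-lookup L)))
  where
  filter-map : ∀ {A B : Set} (q : B → Bool) (g : A → B) L → map g (filterᵇ (q ∘ g) L) ≡ filterᵇ q (map g L)
  filter-map q g [] = refl
  filter-map q g (x ∷ L) with q (g x)
  ... | true = cong (g x ∷_) (filter-map q g L)
  ... | false = filter-map q g L

filter-filter : ∀ {A : Set} (p q : A → Bool) L → filterᵇ q (filterᵇ p L) ≡ filterᵇ (λ e → p e ∧ q e) L
filter-filter p q [] = refl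
filter-filter p q (x ∷ L) with p x
... | false = filter-filter p q L
... | true with q x
... | true = cong (x ∷_) (filter-filter p q L)
... | false = filter-filter p q L

module Alt {G : Gr} {y : V G} (Q : Quad G y) (ll : Loopless G) (β0 : β G y ≡ z0) {p : ℕ} (lab : V G → Fin p) where
  open Quad Q
  module T = Two Q ll
  open T using (B)

  H : Gr
  H = quot B lab

  -- In the expansion `y` becomes the new vertex of the 2-alteration, so it is taken out of the
  -- class of `x` again.
  fG : V G → Fin (suc p)
  fG v = if y ≡ᵇ v then zero else suc (lab v)

  fG-y : fG y ≡ zero
  fG-y = cong (λ b → if b then zero else suc (lab y)) (≡ᵇ-refl y)

  fG-ne : ∀ {v} → y ≢ v → fG v ≡ suc (lab v)
  fG-ne h = cong (λ b → if b then zero else suc (lab _)) (≡ᵇ-≢ h)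

  -- If the ends of a lifted edge are identified, the edge is gone from the contraction, and the
  -- 2-alteration is taken on the common vertex instead.
  data ItemFor (e : E G) (a b : V G) : Item H → Set where
    vert : lab a ≡ lab b → ItemFor e a b (inj₁ (lab a))
    edge : ∀ i → orig B lab i ≡ e → ends B e ≡ (a , b) → lab a ≢ lab b → ItemFor e a b (inj₂ i)

  itemFor : ∀ e a b → ends B e ≡ (a , b) → Σ (Item H) (ItemFor e a b)
  itemFor e a b h with lab a ≟ lab b
  ... | yes q = inj₁ (lab a) , vert q
  ... | no q = let (i , r) = back B lab e (trans (cong (λ p → not (lab (proj₁ p) ≡ᵇ lab (proj₂ p))) h) (cong not (≡ᵇ-≢ q))) in inj₂ i , edge i r h q

  inItem-orig : ∀ {e a b it} → ends B e ≡ (a , b) → ItemFor e a b it → ∀ i → inItem H it i ≡ (e ≡ᵇ orig B lab i)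
  inItem-orig {e} h (vert q) i = sym (≡ᵇ-≢ λ r → true≢false (trans (sym (orig-keep B lab i)) (trans (cong (keep B lab) (sym r))
    (trans (cong (λ p → not (lab (proj₁ p) ≡ᵇ lab (proj₂ p))) h) (cong not (≡ᵇ-≡ q))))))
  inItem-orig {e} h (edge i' r _ _) i = ≡ᵇ-iff i' i e (orig B lab i) (λ s → trans (sym r) (cong (orig B lab) s)) (λ s → orig-inj B lab (trans r s))

  F : E G → Fin (suc p) × Fin (suc p)
  F e = mapP fG (ends G e)

  K : E G → Fin (suc p) × Fin (suc p)
  K e = mapP suc (mapP lab (ends B e))

  F-at : ∀ {e w} → Joins G e y w → y ≢ w → SwapEq (F e) (zero , suc (lab w)) × SwapEq (F e) (suc (lab w) , zero)
  F-at {e} {w} (inj₁ q) n = inj₁ (sym eq) , inj₂ (sym (cong swapP eq))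
    where
    eq : F e ≡ (zero , suc (lab w))
    eq = trans (cong (mapP fG) q) (cong₂ _,_ fG-y (fG-ne n))
  F-at {e} {w} (inj₂ q) n = inj₂ (sym (cong swapP eq)) , inj₁ (sym eq)
    where
    eq : F e ≡ (suc (lab w) , zero)
    eq = trans (cong (mapP fG) q) (cong₂ _,_ (fG-ne n) fG-y)

  gad-perm : ∀ {e e' a b it} → Joins G e y a → Joins G e' y b → y ≢ a → y ≢ b → ItemFor e a b it → ∀ {L M} → PS._↭ˢ_ (suc p) L M →
    PS._↭ˢ_ (suc p) (F e ∷ F e' ∷ L) (gad H it ++ M)
  gad-perm {e} {e'} j j' n n' (vert q) r = Hom.prep (proj₁ (F-at j n)) (Hom.prep (subst (λ l → SwapEq (F e') (zero , suc l)) (sym q) (proj₁ (F-at j' n'))) r)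
  gad-perm {e} {e'} {a} {b} j j' n n' (edge i h eb _) r = Hom.prep (subst (λ l → SwapEq (F e) (suc l , zero)) (sym e₁') (proj₂ (F-at j n)))
      (Hom.prep (subst (λ l → SwapEq (F e') (zero , suc l)) (sym e₂') (proj₁ (F-at j' n'))) r)
    where
    e₁' : p₁ H i ≡ lab a
    e₁' = trans (cong (λ k → lab (p₁ B k)) h) (cong (lab ∘ proj₁) eb)
    e₂' : p₂ H i ≡ lab b
    e₂' = trans (cong (λ k → lab (p₂ B k)) h) (cong (lab ∘ proj₂) eb)

  P₀ P₁ P₂ P₃ P₄ P' : E G → Bool
  P₀ = keep G fG
  P₁ = setO P₀ e₁ false
  P₂ = setO P₁ e₂ false
  P₃ = setO P₂ e₃ false
  P₄ = setO P₃ e₄ false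
  P' e = keep B lab e ∧ not ((e₁ ≡ᵇ e) ∨ (e₃ ≡ᵇ e))

  keep-y : ∀ {e w} → Joins G e y w → y ≢ w → P₀ e ≡ true
  keep-y {e} {w} (inj₁ q) n = trans (cong (λ p → not (fG (proj₁ p) ≡ᵇ fG (proj₂ p))) q) (cong₂ (λ a b → not (a ≡ᵇ b)) fG-y (fG-ne n))
  keep-y {e} {w} (inj₂ q) n = trans (cong (λ p → not (fG (proj₁ p) ≡ᵇ fG (proj₂ p))) q) (cong₂ (λ a b → not (a ≡ᵇ b)) (fG-ne n) fG-y)

  P≗ : ∀ e → P₄ e ≡ P' e
  P≗ e = go (e₁ ≟ e) (e₂ ≟ e) (e₃ ≟ e) (e₄ ≟ e)
    where
    loop : ∀ {e w} → ends B e ≡ (w , w) → keep B lab e ≡ false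
    loop h = trans (cong (λ p → not (lab (proj₁ p) ≡ᵇ lab (proj₂ p))) h) (cong not (≡ᵇ-refl (lab _)))
    go : Dec (e₁ ≡ e) → Dec (e₂ ≡ e) → Dec (e₃ ≡ e) → Dec (e₄ ≡ e) → P₄ e ≡ P' e
    go (yes refl) _ _ _ = trans (trans (setO-ne P₃ e₄ false (d₁₄ ∘ sym)) (trans (setO-ne P₂ e₃ false (d₁₃ ∘ sym)) (trans (setO-ne P₁ e₂ false (d₁₂ ∘ sym)) (setO-at P₀ e₁ false))))
      (sym (trans (cong (λ b → keep B lab e₁ ∧ not (b ∨ (e₃ ≡ᵇ e₁))) (≡ᵇ-refl e₁)) (Boolₚ.∧-zeroʳ _)))
    go (no _) (yes refl) _ _ = trans (trans (setO-ne P₃ e₄ false (d₂₄ ∘ sym)) (trans (setO-ne P₂ e₃ false (d₂₃ ∘ sym)) (setO-at P₁ e₂ false)))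
      (sym (cong (_∧ not ((e₁ ≡ᵇ e₂) ∨ (e₃ ≡ᵇ e₂))) (loop T.endsB₂)))
    go (no _) (no _) (yes refl) _ = trans (trans (setO-ne P₃ e₄ false (d₃₄ ∘ sym)) (setO-at P₂ e₃ false))
      (sym (trans (cong (λ b → keep B lab e₃ ∧ not ((e₁ ≡ᵇ e₃) ∨ b)) (≡ᵇ-refl e₃)) (trans (cong (λ b → keep B lab e₃ ∧ not b) (Boolₚ.∨-zeroʳ _)) (Boolₚ.∧-zeroʳ _))))
    go (no _) (no _) (no _) (yes refl) = trans (setO-at P₃ e₄ false) (sym (cong (_∧ not ((e₁ ≡ᵇ e₄) ∨ (e₃ ≡ᵇ e₄))) (loop T.endsB₄)))
    go (no a) (no b) (no c) (no d) = trans (trans (setO-ne P₃ e₄ false d) (trans (setO-ne P₂ e₃ false c) (trans (setO-ne P₁ e₂ false b) (setO-ne P₀ e₁ false a))))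
      (trans same (sym (trans (cong₂ (λ s t → keep B lab e ∧ not (s ∨ t)) (≡ᵇ-≢ a) (≡ᵇ-≢ c)) (Boolₚ.∧-identityʳ _))))
      where
      yf = T.y-free e
      q : ends B e ≡ ends G e
      q = T.endsB₀ a b c d
      same : P₀ e ≡ keep B lab e
      same = trans (cong (λ p → not (fG (proj₁ p) ≡ᵇ fG (proj₂ p))) (sym q))
        (trans (cong₂ (λ s t → not (s ≡ᵇ t)) (fG-ne (≡ᵇ-false y (p₁ B e) (proj₁ yf))) (fG-ne (≡ᵇ-false y (p₂ B e) (proj₂ yf))))
          (cong not (≡ᵇ-iff (suc (lab (p₁ B e))) (suc (lab (p₂ B e))) (lab (p₁ B e)) (lab (p₂ B e)) Finₚ.suc-injective (cong suc))))

  FK : ∀ e → P' e ≡ true → F e ≡ K e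
  FK e h = trans (cong (mapP fG) (sym (T.endsB₀ a b c d))) (cong₂ _,_ (fG-ne (≡ᵇ-false y (p₁ B e) (proj₁ (T.y-free e)))) (fG-ne (≡ᵇ-false y (p₂ B e) (proj₂ (T.y-free e)))))
    where
    P₄e : P₄ e ≡ true
    P₄e = trans (P≗ e) h
    a : e₁ ≢ e
    a r = true≢false (trans (sym h) (trans (cong (λ b → keep B lab e ∧ not (b ∨ (e₃ ≡ᵇ e))) (≡ᵇ-≡ r)) (Boolₚ.∧-zeroʳ _)))
    b : e₂ ≢ e
    b r = true≢false (trans (sym P₄e) (trans (cong P₄ (sym r)) (trans (setO-ne P₃ e₄ false (d₂₄ ∘ sym)) (trans (setO-ne P₂ e₃ false (d₂₃ ∘ sym)) (setO-at P₁ e₂ false)))))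
    c : e₃ ≢ e
    c r = true≢false (trans (sym P₄e) (trans (cong P₄ (sym r)) (trans (setO-ne P₃ e₄ false (d₃₄ ∘ sym)) (setO-at P₂ e₃ false))))
    d : e₄ ≢ e
    d r = true≢false (trans (sym P₄e) (trans (cong P₄ (sym r)) (setO-at P₃ e₄ false)))

  rest : List (E G)
  rest = filterᵇ P' (allFin (m G))

  split : map F (kept G fG) ↭ F e₁ ∷ F e₂ ∷ F e₃ ∷ F e₄ ∷ map K rest
  split = Perm.trans (Permₚ.map⁺ F four) (Perm.↭-reflexive (cong (λ L → F e₁ ∷ F e₂ ∷ F e₃ ∷ F e₄ ∷ L) (trans (cong (map F) (filter-ext P≗ (allFin (m G)))) (map-filter-cong P' (allFin (m G)) FK))))
    where
    ex : (P : E G → Bool) (e : E G) → P e ≡ true → filterᵇ P (allFin (m G)) ↭ e ∷ filterᵇ (setO P e false) (allFin (m G))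
    ex P e h = filter-extract P (setO P e false) e h (setO-at P e false) (λ e' n → sym (setO-ne P e false n))
    four : kept G fG ↭ e₁ ∷ e₂ ∷ e₃ ∷ e₄ ∷ filterᵇ P₄ (allFin (m G))
    four = Perm.trans (ex P₀ e₁ (keep-y j₁ n₁)) (Perm.prep e₁ (Perm.trans (ex P₁ e₂ (trans (setO-ne P₀ e₁ false d₁₂) (keep-y j₂ n₂)))
      (Perm.prep e₂ (Perm.trans (ex P₂ e₃ (trans (setO-ne P₁ e₂ false d₂₃) (trans (setO-ne P₀ e₁ false d₁₃) (keep-y j₃ n₃))))
      (Perm.prep e₃ (ex P₃ e₄ (trans (setO-ne P₂ e₃ false d₃₄) (trans (setO-ne P₁ e₂ false d₂₄) (trans (setO-ne P₀ e₁ false d₁₄) (keep-y j₄ n₄))))))))))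

  restB : ∀ {y₁ y₂} → ItemFor e₁ w₁ w₂ y₁ → ItemFor e₃ w₃ w₄ y₂ →
    map (λ i → mapP suc (ends H i)) (filterᵇ (λ i → not (inItem H y₁ i ∨ inItem H y₂ i)) (allFin (m H))) ≡ map K rest
  restB {y₁} {y₂} i₁ i₂ = begin
    map (λ i → K (orig B lab i)) (filterᵇ (λ i → not (inItem H y₁ i ∨ inItem H y₂ i)) (allFin (m H)))
      ≡⟨ cong (map (λ i → K (orig B lab i))) (filter-ext (λ i → cong₂ (λ a b → not (a ∨ b)) (inItem-orig T.endsB₁ i₁ i) (inItem-orig T.endsB₃ i₂ i)) (allFin (m H))) ⟩
    map (λ i → K (orig B lab i)) (filterᵇ (λ i → q (orig B lab i)) (allFin (m H)))
      ≡⟨ Listₚ.map-∘ (filterᵇ (λ i → q (orig B lab i)) (allFin (m H))) ⟩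
    map K (map (orig B lab) (filterᵇ (λ i → q (orig B lab i)) (allFin (m H))))
      ≡⟨ cong (map K) (map-lookup-filter q (kept B lab)) ⟩
    map K (filterᵇ q (kept B lab))
      ≡⟨ cong (map K) (filter-filter (keep B lab) q (allFin (m G))) ⟩
    map K rest ∎
    where
    open ≡-Reasoning
    q : E G → Bool
    q e = not ((e₁ ≡ᵇ e) ∨ (e₃ ≡ᵇ e))

  isoAlt : ∀ {y₁ y₂} → ItemFor e₁ w₁ w₂ y₁ → ItemFor e₃ w₃ w₄ y₂ → y₁ ≢ y₂ →
    Σ (Iso (quot G fG) (alt2 H y₁ y₂)) λ I → ∀ v → vto I v ≡ v × vfrom I v ≡ v
  isoAlt {y₁} {y₂} i₁ i₂ ne = isoPerm′ (alt2 H y₁ y₂) (ends (quot G fG)) (β (quot G fG)) perm βeq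
    where
    perm : PS._↭ˢ_ (suc p) (edgeList (quot G fG)) (edgeList (alt2 H y₁ y₂))
    perm = Hom.trans (lift↭ (Perm.trans (Perm.↭-reflexive (quotEdges G fG)) split))
      (Hom.trans (gad-perm j₁ j₂ n₁ n₂ i₁ (gad-perm j₃ j₄ n₃ n₄ i₂ (PS.↭-refl (suc p))))
        (lift↭ (Perm.trans (Perm.↭-reflexive (sym (Listₚ.++-assoc (gad H y₁) (gad H y₂) (map K rest))))
          (Perm.trans (Permₚ.++-comm (gad H y₁ ++ gad H y₂) (map K rest))
            (Perm.↭-reflexive (trans (cong (_++ (gad H y₁ ++ gad H y₂)) (sym (restB i₁ i₂))) (sym (alt2Edges H y₁ y₂ ne))))))))
    βeq : ∀ v → β (alt2 H y₁ y₂) v ≡ β (quot G fG) v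
    βeq zero = sym (trans (β-quot G fG zero) (trans (bs-cong G cz) (trans (bs-single G y) β0)))
      where
      cz : ∀ v → cls fG zero v ≡ cls id y v
      cz v with y ≟ v
      ... | yes _ = refl
      ... | no _ = refl
    βeq (suc q) = trans (β-quot B lab q) (sym (trans (β-quot G fG (suc q)) (T.bs-iso β0 λ v h → trans (cong (suc q ≡ᵇ_) (fG-ne h)) (≡ᵇ-iff (suc q) (suc (lab v)) q (lab v) Finₚ.suc-injective (cong suc)))))

-- Reducing a vertex of degree four

tail-flip : ∀ {G} (o : Orientation G) e u v → u ≢ v → Joins G e u v → (u ≡ᵇ tl G o e) ≡ not (v ≡ᵇ tl G o e)
tail-flip {G} o e u v ne j = k (o e) j
  where
  k : ∀ s → Joins G e u v → (u ≡ᵇ (if s then p₁ G e else p₂ G e)) ≡ not (v ≡ᵇ (if s then p₁ G e else p₂ G e))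
  k true (inj₁ q) = trans (cong (λ p → u ≡ᵇ proj₁ p) q) (trans (≡ᵇ-refl u) (sym (cong not (trans (cong (λ p → v ≡ᵇ proj₁ p) q) (≡ᵇ-≢ (ne ∘ sym))))))
  k false (inj₁ q) = trans (cong (λ p → u ≡ᵇ proj₂ p) q) (trans (≡ᵇ-≢ ne) (sym (cong not (trans (cong (λ p → v ≡ᵇ proj₂ p) q) (≡ᵇ-refl v)))))
  k true (inj₂ q) = trans (cong (λ p → u ≡ᵇ proj₁ p) q) (trans (≡ᵇ-≢ ne) (sym (cong not (trans (cong (λ p → v ≡ᵇ proj₁ p) q) (≡ᵇ-refl v)))))
  k false (inj₂ q) = trans (cong (λ p → u ≡ᵇ proj₂ p) q) (trans (≡ᵇ-refl u) (sym (cong not (trans (cong (λ p → v ≡ᵇ proj₂ p) q) (≡ᵇ-≢ (ne ∘ sym))))))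

module RedEXPA {G : Gr} {z x : V G} {ψ : Orientation G} (ES : Easel G z x ψ) (crit : CritL G id z ψ) (tb : TBelow (ord G z)) (n4 : 4 ≤ n G)
    (y : V G) (yz : y ≢ z) (yx : y ≢ x) (y4 : deg G y ≡ 4) where
  open Easel ES
  open Deg4 ES crit tb y yz yx y4

  Result : Set
  Result = Red G z x ψ (λ k r → EXPA k r G z x)

  VP : Quad G y → Set
  VP Q = Quad.w₂ Q ≡ z → Quad.w₁ Q ≡ z × (z ≡ᵇ tl G ψ (Quad.e₁ Q)) ≡ (y ≡ᵇ tl G ψ (Quad.e₂ Q))

  R-of : (Q : Quad G y) → VP Q → Quad.w₄ Q ≢ z → Set
  R-of Q vp₁ vp₂ = TQR {ord G z} (Two.B Q ll) f₀ z (Pairing.ψB Q vp₁ vp₂)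

  assemble : (Q : Quad G y) (vp₁ : VP Q) (vp₂ : Quad.w₄ Q ≢ z) (R : R-of Q vp₁ vp₂) →
    Split.Mono' ES crit tb y yz yx y4 Q vp₁ vp₂ R → Split.Parts ES crit tb y yz yx y4 Q vp₁ vp₂ R → Result
  assemble Q vp₁ vp₂ R mono parts = go (AL.itemFor e₁ w₁ w₂ T.endsB₁) (AL.itemFor e₃ w₃ w₄ T.endsB₃)
    where
    open Quad Q
    module T = Two Q ll
    module S = Split ES crit tb y yz yx y4 Q vp₁ vp₂ R
    module A = Pairing.After Q vp₁ vp₂ R
    module AL = Alt Q ll β0 (TQR.lab R)
    open TQR R hiding (tip; crit)
    open AL using (fG; fG-y; fG-ne; ItemFor; vert; edge)
    surjG : Surj fG
    surjG zero = y , fG-y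
    surjG (suc q) = k (surj q)
      where
      k : (Σ (V G) λ v → lab v ≡ q) → Σ (V G) λ v → fG v ≡ suc q
      k (v , e) = k' (y ≟ v)
        where
        k' : Dec (y ≡ v) → Σ (V G) λ v → fG v ≡ suc q
        k' (no n) = v , trans (fG-ne n) (cong suc e)
        k' (yes refl) = x , trans (fG-ne yx) (cong suc (trans (sym A.ly) e))
    tipG : TipResp fG z
    tipG v e = k (y ≟ v)
      where
      k : Dec (y ≡ v) → v ≡ z
      k (no n) = A.tz v (Finₚ.suc-injective (trans (sym (fG-ne n)) (trans e (fG-ne yz))))
      k (yes refl) with trans (sym fG-y) (trans e (fG-ne yz))
      ... | ()
    cls-suc : ∀ q v → cls fG (suc q) v ≡ A.A q v
    cls-suc q v = k (y ≟ v)
      where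
      k : Dec (y ≡ v) → cls fG (suc q) v ≡ A.A q v
      k (no n) = trans (cong (suc q ≡ᵇ_) (fG-ne n)) (trans (≡ᵇ-iff (suc q) (suc (lab v)) q (lab v) Finₚ.suc-injective (cong suc)) (sym (delV-ne y (cls lab q) v n)))
      k (yes refl) = trans (cong (suc q ≡ᵇ_) fG-y) (sym (A.ay q))
    partsG : ∀ q → q ≢ fG z → Pair (cls fG q) → PartOK G z x ψ (cls fG q)
    partsG zero _ (u , v , ne , a , b) = ⊥-elim (ne (trans (isY u a) (sym (isY v b))))
      where
      isY : ∀ v → cls fG zero v ≡ true → v ≡ y
      isY v h = k (y ≟ v)
        where
        k : Dec (y ≡ v) → v ≡ y
        k (yes r) = sym r
        k (no n) with trans (≡ᵇ-true zero (fG v) h) (fG-ne n)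
        ... | ()
    partsG (suc q) ne pr = parts q (λ e → ne (trans (cong suc e) (sym (fG-ne yz)))) (cls fG (suc q)) (cls-suc q) pr
    inA : ∀ {q w} → y ≢ w → lab w ≡ q → A.A q w ≡ true
    inA {q} {w} n h = trans (delV-ne y (cls lab q) w n) (≡ᵇ-≡ (sym h))
    -- A common vertex would have all four neighbours of `y` in one class, which `ins` excludes, or
    -- at the tip, which `vp₂` excludes.
    distinct : ∀ {y₁ y₂} → ItemFor e₁ w₁ w₂ y₁ → ItemFor e₃ w₃ w₄ y₂ → y₁ ≢ y₂
    distinct (vert a) (vert b) e = k (lab w₁ ≟ lab z)
      where
      e' : lab w₁ ≡ lab w₃
      e' = inj₁-inj e
        where
        inj₁-inj : ∀ {A B : Set} {a b : A} → _≡_ {A = A ⊎ B} (inj₁ a) (inj₁ b) → a ≡ b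
        inj₁-inj refl = refl
      k : Dec (lab w₁ ≡ lab z) → ⊥
      k (yes h) = vp₂ (A.tz w₄ (trans (sym b) (trans (sym e') h)))
      k (no h) = i (S.ins (lab w₁) h)
        where
        t₁ = inA {lab w₁} n₁ refl
        t₂ = inA {lab w₁} n₂ (sym a)
        t₃ = inA {lab w₁} n₃ (sym e')
        t₄ = inA {lab w₁} n₄ (trans (sym b) (sym e'))
        i : S.Ins (lab w₁) → ⊥
        i (S.none r) = ℕₚ.<⇒≢ (ℕₚ.<-≤-trans (ℕₚ.n<1+n _) (ℕₚ.m≤n+m _ 3)) (trans (sym r) (trans (T.dd-out (A.A (lab w₁)) (A.ay (lab w₁)))
          (cong₂ (λ s t → (ind s + ind s) + ((ind t + ind t) + dd T.B (A.A (lab w₁)))) (cong₂ _∧_ t₁ t₂) (cong₂ _∧_ t₃ t₄))))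
        i (S.in₁₂ _ _ f _ _) = true≢false (trans (sym t₃) f)
        i (S.in₃₄ f _ _ _ _) = true≢false (trans (sym t₁) f)
    distinct (edge i h _ _) (edge .i h' _ _) refl = d₁₃ (trans (sym h) h')
    -- A vertex item comes from two neighbours of `y` in one class; by `noPar` they are distinct, so
    -- the part has the required size.
    bigs : ∀ {e e' a b it} {P : Fin (suc p) → Set} → Joins G e y a → Joins G e' y b → e ≢ e' → y ≢ a → y ≢ b → ItemFor e a b it →
      (∀ q → (q ≢ suc (lab z) → Big fG q) → P q) → All P (itemV2 {quot T.B lab} it)
    bigs {a = a} {b} j j' ne na nb (vert h) k = k (suc (lab a)) (λ nz → a , b , noPar C y a yz (λ r → nz (cong (suc ∘ lab) r)) ne j j' na , fG-ne na , trans (fG-ne nb) (cong suc (sym h))) ∷ []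
    bigs _ _ _ _ _ (edge _ _ _ _) k = []
    go : Σ _ (ItemFor e₁ w₁ w₂) → Σ _ (ItemFor e₃ w₃ w₄) → Result
    go (y₁ , i₁) (y₂ , i₂) = fin (AL.isoAlt i₁ i₂ (distinct i₁ i₂))
      where
      fin : (Σ (Iso (quot G fG) (alt2 (quot T.B lab) y₁ y₂)) λ I → ∀ v → vto I v ≡ v × vfrom I v ≡ v) → Result
      fin (I , h) = record { mono = mono ; prec = inj₁ ord<
          ; rel = λ w → y₁ , y₂ , expansion cv w x≢z (itemV2 {quot T.B lab} y₁ ++ itemV2 {quot T.B lab} y₂) fG surjG tipG I
              (trans (proj₁ (h (fG z))) (fG-ne yz)) (trans (proj₁ (h (fG x))) (fG-ne yx)) partsG
              (Allₚ.++⁺ (bigs j₁ j₂ d₁₂ n₁ n₂ i₁ conv) (bigs j₃ j₄ d₃₄ n₃ n₄ i₂ conv)) }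
        where
        conv : ∀ q → (q ≢ suc (lab z) → Big fG q) → q ≢ suc (lab z) → Big fG (vfrom I q)
        conv q k nz = subst (Big fG) (sym (proj₂ (h q))) (k nz)

  tipPair : (Q : Quad G y) → Quad.w₁ Q ≡ z → Quad.w₂ Q ≡ z → (y ≡ᵇ tl G ψ (Quad.e₁ Q)) ≢ (y ≡ᵇ tl G ψ (Quad.e₂ Q)) → Quad.w₄ Q ≢ z → Result
  tipPair Q h₁ h₂ opp vp₂ = go (Pairing.tqr Q vp₁ vp₂)
    where
    open Quad Q
    vp₁ : VP Q
    vp₁ _ = h₁ , trans (trans (sym (Boolₚ.not-involutive _)) (cong not (sym (tail-flip {G} ψ e₁ y z yz (subst (Joins G e₁ y) h₁ j₁))))) (k _ _ opp)
      where
      k : ∀ a b → a ≢ b → not a ≡ b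
      k = from-yes (allB? λ a → allB? λ b → ¬? (a ≟B b) →-dec (not a ≟B b))
    go : R-of Q vp₁ vp₂ → Result
    go R = assemble Q vp₁ vp₂ R (Split.TipPair.mono ES crit tb y yz yx y4 Q vp₁ vp₂ R h₁ h₂) (Split.TipPair.parts ES crit tb y yz yx y4 Q vp₁ vp₂ R h₁ h₂)

  noTipPair : (Q : Quad G y) → Quad.w₂ Q ≢ z → Quad.w₄ Q ≢ z →
    (let open Quad Q in ∀ s → (w₁ ≡ z → w₂ ≢ x → dir G z ψ e₁ ≡ s) → (w₃ ≡ z → w₄ ≢ x → dir G z ψ e₃ ≡ s) →
        (w₁ ≡ z → dir G z ψ e₁ ≡ s) × (w₃ ≡ z → dir G z ψ e₃ ≡ s)) → Result ⊎ (Bad z x ψ Q × ¬ ASx G z x ψ)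
  noTipPair Q w₂z vp₂ hx = go (Pairing.tqr Q vp₁ vp₂)
    where
    vp₁ : VP Q
    vp₁ h = ⊥-elim (w₂z h)
    go : R-of Q vp₁ vp₂ → Result ⊎ (Bad z x ψ Q × ¬ ASx G z x ψ)
    go R = k (Split.NoTipPair.mono ES crit tb y yz yx y4 Q vp₁ vp₂ R w₂z hx)
      where
      k : Split.Mono' ES crit tb y yz yx y4 Q vp₁ vp₂ R ⊎ (Bad z x ψ Q × ¬ ASx G z x ψ) → Result ⊎ (Bad z x ψ Q × ¬ ASx G z x ψ)
      k (inj₁ m) = inj₁ (assemble Q vp₁ vp₂ R m (Split.NoTipPair.parts ES crit tb y yz yx y4 Q vp₁ vp₂ R w₂z))
      k (inj₂ b) = inj₂ b

  bit : Orientation G → E G → Bool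
  bit o e = y ≡ᵇ tl G o e

  -- Everything besides `z` and `y` may be contracted, since it contains `x` and a fourth vertex. So
  -- `ψ` is compatible with balance at `y`.
  flowY : Σ (Orientation G) λ o → Agree G z ψ o × Sat G o (cls id y)
  flowY = let (w , wz , wy , wx) = fourth n4 z y x
              (o , s , ag) = off C Y (cong not (cong (_∨ (y ≡ᵇ z)) (≡ᵇ-refl z))) (x , w , (wx ∘ sym) , inY x≢z (yx ∘ sym) , inY wz wy)
          in o , ag , s y (cong not (trans (cong ((z ≡ᵇ y) ∨_) (≡ᵇ-refl y)) (Boolₚ.∨-zeroʳ _)))
    where
    Y : VSet G
    Y v = not ((z ≡ᵇ v) ∨ (y ≡ᵇ v))
    inY : ∀ {v} → v ≢ z → v ≢ y → Y v ≡ true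
    inY a b = cong not (cong₂ _∨_ (≡ᵇ-≢ (a ∘ sym)) (≡ᵇ-≢ (b ∘ sym)))

  z-bit : ∀ {o e w} → Agree G z ψ o → Joins G e y w → w ≡ z → bit o e ≡ bit ψ e
  z-bit {o} {e} ag j refl = cong (λ b → y ≡ᵇ (if b then p₁ G e else p₂ G e)) (ag e (trans (Joins-touch G (cls id z) j) (trans (cong ((z ≡ᵇ y) ∨_) (≡ᵇ-refl z)) (Boolₚ.∨-zeroʳ _))))

  -- All edges at `y` are fixed by `ψ`, and `flowY` shows that they balance. A flow off `y` and `x`
  -- is then unbalanced at most at `x`.
  all-tip : (Q : Quad G y) → Quad.w₁ Q ≡ z → Quad.w₂ Q ≡ z → Quad.w₃ Q ≡ z → Quad.w₄ Q ≡ z → ⊥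
  all-tip Q h₁ h₂ h₃ h₄ = go flowY (off C (two y x) (two-false yz x≢z) (y , x , yx , two-l y x , two-r y x))
    where
    open Quad Q
    go : _ → Σ (Orientation G) (Off G z ψ (two y x)) → ⊥
    go (o , ag , sy) (o' , s , ag') = almost {G} {z} {ψ} (Cv.tot cv) (Crit.nx C) o' x ag' λ v vx → k v vx (y ≟ v)
      where
      same : ∀ e → cr G (cls id y) e ≡ true → o e ≡ o' e
      same e c = i (e₁ ≟ e) (e₂ ≟ e) (e₃ ≟ e) (e₄ ≟ e)
        where
        eq : ∀ {k w} → Joins G k y w → w ≡ z → o k ≡ o' k
        eq {k} j refl = trans (ag k t) (sym (ag' k t))
          where
          t : touch G (cls id z) k ≡ true
          t = trans (Joins-touch G (cls id z) j) (trans (cong ((z ≡ᵇ y) ∨_) (≡ᵇ-refl z)) (Boolₚ.∨-zeroʳ _))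
        i : Dec (e₁ ≡ e) → Dec (e₂ ≡ e) → Dec (e₃ ≡ e) → Dec (e₄ ≡ e) → o e ≡ o' e
        i (yes refl) _ _ _ = eq j₁ h₁
        i (no _) (yes refl) _ _ = eq j₂ h₂
        i (no _) (no _) (yes refl) _ = eq j₃ h₃
        i (no _) (no _) (no _) (yes refl) = eq j₄ h₄
        i (no a) (no b) (no c') (no d) = ⊥-elim (true≢false (trans (sym c) (cover e a b c' d)))
      k : ∀ v → v ≢ x → Dec (y ≡ v) → Sat G o' (cls id v)
      k v vx (yes refl) = Sat-local G {o} {o'} (cls id y) same sy
      k v vx (no n) = s v (two-false n (vx ∘ sym))

  -- A flow through `y` has two edges each way, so among three tip edges two have opposite
  -- directions; they form the first pair.
  three-tip : (Q : Quad G y) → Quad.w₁ Q ≡ z → Quad.w₂ Q ≡ z → Quad.w₃ Q ≡ z → Quad.w₄ Q ≢ z → Result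
  three-tip Q h₁ h₂ h₃ h₄ = go (bit ψ e₁ ≟B bit ψ e₂)
    where
    open Quad Q
    ne₁₃ : bit ψ e₁ ≡ bit ψ e₂ → bit ψ e₁ ≢ bit ψ e₃
    ne₁₃ e e' = let (o , ag , sy) = flowY in
      k (bit o e₁) (bit o e₂) (bit o e₃) (bit o e₄) (QuadSum.four-sum Q β0 o sy)
        (trans (z-bit {o} ag j₁ h₁) (trans e (sym (z-bit {o} ag j₂ h₂)))) (trans (z-bit {o} ag j₁ h₁) (trans e' (sym (z-bit {o} ag j₃ h₃))))
      where
      k : ∀ a b c d → sgn a ⊕ (sgn b ⊕ (sgn c ⊕ sgn d)) ≡ z0 → a ≡ b → a ≡ c → ⊥
      k true true true true () _ _
      k true true true false () _ _
      k false false false true () _ _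
      k false false false false () _ _
    go : Dec (bit ψ e₁ ≡ bit ψ e₂) → Result
    go (no n) = tipPair Q h₁ h₂ n h₄
    go (yes e) = tipPair (s₂₃ Q) h₁ h₃ (ne₁₃ e) h₄

  -- Tip edges of equal direction go into different pairs. Their partners are distinct, so at most
  -- one of them is `x` and both directions are visible. An obstruction cannot occur because its set
  -- would contain a first end, that is, the tip.
  two-tip : (Q : Quad G y) → Quad.w₁ Q ≡ z → Quad.w₂ Q ≡ z → Quad.w₃ Q ≢ z → Quad.w₄ Q ≢ z → Result
  two-tip Q h₁ h₂ h₃ h₄ = go (bit ψ e₁ ≟B bit ψ e₂)
    where
    open Quad Q
    go : Dec (bit ψ e₁ ≡ bit ψ e₂) → Result
    go (no n) = tipPair Q h₁ h₂ n h₄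
    go (yes e) = use (noTipPair (s₂₃ Q) h₃ h₄ hx)
      where
      dirs : dir G z ψ e₁ ≡ dir G z ψ e₂
      dirs = trans (sym (Boolₚ.not-involutive _)) (trans (cong not (trans (sym (fl j₁ h₁)) (trans e (fl j₂ h₂)))) (Boolₚ.not-involutive _))
        where
        fl : ∀ {k w} → Joins G k y w → w ≡ z → bit ψ k ≡ not (dir G z ψ k)
        fl {k} j refl = tail-flip {G} ψ k y z yz j
      hx : ∀ s → (w₁ ≡ z → w₃ ≢ x → dir G z ψ e₁ ≡ s) → (w₂ ≡ z → w₄ ≢ x → dir G z ψ e₂ ≡ s) →
        (w₁ ≡ z → dir G z ψ e₁ ≡ s) × (w₂ ≡ z → dir G z ψ e₂ ≡ s)
      hx s a b = k (w₃ ≟ x)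
        where
        k : Dec (w₃ ≡ x) → (w₁ ≡ z → dir G z ψ e₁ ≡ s) × (w₂ ≡ z → dir G z ψ e₂ ≡ s)
        k (no n) = (λ h → a h n) , λ _ → trans (sym dirs) (a h₁ n)
        k (yes r) = (λ _ → trans dirs (b h₂ w₄x)) , λ h → b h w₄x
          where
          w₄x : w₄ ≢ x
          w₄x q = noPar C y w₃ yz h₃ d₃₄ j₃ j₄ n₃ (trans r (sym q))
      use : Result ⊎ (Bad z x ψ (s₂₃ Q) × ¬ ASx G z x ψ) → Result
      use (inj₁ r) = r
      use (inj₂ (b , _)) = ⊥-elim (k (Bad.side b))
        where
        k : _ → ⊥
        k (inj₁ (_ , _ , t , _)) = true≢false (trans (sym t) (trans (cong (Bad.A b) h₂) (Bad.Az b)))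
        k (inj₂ (_ , _ , t , _)) = true≢false (trans (sym t) (trans (cong (Bad.A b) h₁) (Bad.Az b)))

  -- `dA⁺` is the equality case of the degree bound for the set enlarged by `y`.
  tight : ∀ {Q : Quad G y} (b : Bad z x ψ Q) v → addV y (Bad.A b) v ≡ false → v ≢ z → ∀ o → Off G z ψ (addV y (Bad.A b)) o →
    SameD G o (not ∘ addV y (Bad.A b)) (cls id x)
  tight b v av vz o of′ = proj₂ (Off-TR C tb (addV y A) (trans (addV-ne y A z yz) Az) v av vz o of′ x (trans (addV-ne y A x yx) Ax)) (sym dA⁺)
    where open Bad b

  -- As `e₁` joins the tip to `y`, flows off `addV y A` direct the tip edges into this set like
  -- `e₁`, except possibly those at `x`. The direction of `e₁` is `s`, as is that of the tip edges
  -- avoiding the set, so `ASx` would hold.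
  bad-tip : ∀ (Q : Quad G y) (b : Bad z x ψ Q) → Quad.w₁ Q ≡ z → Quad.w₂ Q ≢ z → ¬ ASx G z x ψ → ⊥
  bad-tip Q b h₁ h₂ nas = k side
    where
    open Quad Q
    open Bad b
    A⁺ : VSet G
    A⁺ = addV y A
    z⁺ : A⁺ z ≡ false
    z⁺ = trans (addV-ne y A z yz) Az
    k : _ → ⊥
    k (inj₂ (_ , _ , t , _)) = true≢false (trans (sym t) (trans (cong A h₁) Az))
    k (inj₁ (_ , f₂ , _ , l)) = go (off C A⁺ z⁺ (y , x , yx , addV-y y A , trans (addV-ne y A x yx) Ax))
      where
      go : Σ (Orientation G) (Off G z ψ A⁺) → ⊥
      go (o , of′) = nas (s , λ e c t → fin e c t (touch G A⁺ e) refl)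
        where
        sd = tight b w₂ (trans (addV-ne y A w₂ n₂) f₂) h₂ o of′
        tail : ∀ {e u} → Joins G e z u → A⁺ u ≡ true → touch G (cls id x) e ≡ false → dir G z ψ e ≡ proj₁ sd
        tail {e} {u} j au t = trans (sym (cong (λ b → z ≡ᵇ (if b then p₁ G e else p₂ G e)) (proj₂ of′ e (trans (Joins-touch G (cls id z) j) (cong (_∨ (z ≡ᵇ u)) (≡ᵇ-refl z))))))
          (trans (sym (end-dir {G} o (not ∘ A⁺) zu j (cong not z⁺) (cong not au)))
            (proj₂ sd e (trans (cr-not G A⁺ e) (trans (Joins-cr G A⁺ j) (cong₂ _xor_ z⁺ au))) t))
          where
          zu : z ≢ u
          zu q = true≢false (trans (sym au) (trans (cong A⁺ (sym q)) z⁺))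
        e₁s : s ≡ proj₁ sd
        e₁s = trans (sym (l h₁)) (tail (Joins-sym {G} (subst (Joins G e₁ y) h₁ j₁)) (addV-y y A)
          (trans (Joins-touch G (cls id x) j₁) (cong₂ _∨_ (≡ᵇ-≢ (yx ∘ sym)) (≡ᵇ-≢ λ r → x≢z (trans r h₁)))))
        fin : ∀ e → cr G (cls id z) e ≡ true → touch G (cls id x) e ≡ false → ∀ b → touch G A⁺ e ≡ b → dir G z ψ e ≡ s
        fin e c t false q = hs e c q
        fin e c t true q = let (u , zu , j) = other G z e c in
          trans (tail j (trans (sym (cong (_∨ A⁺ u) z⁺)) (trans (sym (Joins-touch G A⁺ j)) q)) t) (sym e₁s)

  -- At most one neighbour of `y` equals `x`, so the tip edge can be paired with an edge to a
  -- different vertex.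
  one-tip : (Q : Quad G y) → Quad.w₁ Q ≡ z → Quad.w₂ Q ≢ z → Quad.w₃ Q ≢ z → Quad.w₄ Q ≢ z → Result
  one-tip Q h₁ h₂ h₃ h₄ = go (Quad.w₂ Q ≟ x)
    where
    open Quad Q
    use : ∀ Q → Quad.w₁ Q ≡ z → Quad.w₂ Q ≢ z → Quad.w₃ Q ≢ z → Quad.w₄ Q ≢ z → Quad.w₂ Q ≢ x → Result
    use Q h₁ h₂ h₃ h₄ nx' = k (noTipPair Q h₂ h₄ λ s a b → (λ h → a h nx') , λ h → ⊥-elim (h₃ h))
      where
      k : Result ⊎ (Bad z x ψ Q × ¬ ASx G z x ψ) → Result
      k (inj₁ r) = r
      k (inj₂ (b , nas)) = ⊥-elim (bad-tip Q b h₁ h₂ nas)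
    go : Dec (w₂ ≡ x) → Result
    go (no n) = use Q h₁ h₂ h₃ h₄ n
    go (yes r) = use (s₂₃ Q) h₁ h₃ h₂ h₄ λ q → noPar C y w₂ yz h₂ d₂₃ j₂ j₃ n₂ (trans r (sym q))

  module NoTip (Q : Quad G y) (h₁ : Quad.w₁ Q ≢ z) (h₂ : Quad.w₂ Q ≢ z) (h₃ : Quad.w₃ Q ≢ z) (h₄ : Quad.w₄ Q ≢ z) where
    -- The edges of one pair both leave the enlarged set and avoid `x`, so `tight` directs them
    -- alike at `y`. The edges of the other pair then both have the opposite direction.
    bits : (b : Bad z x ψ Q) → ∀ o → Off G z ψ (addV y (Bad.A b)) o → Sat G o (cls id y) →
      let open Quad Q in bit o e₁ ≡ bit o e₂ × bit o e₃ ≡ bit o e₄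
    bits b o of′ sy = k side
      where
      open Quad Q
      open Bad b
      A⁺ : VSet G
      A⁺ = addV y A
      other-pair : ∀ a b c d → sgn a ⊕ (sgn b ⊕ (sgn c ⊕ sgn d)) ≡ z0 → (a ≡ b → c ≡ d) × (c ≡ d → a ≡ b)
      other-pair true true true true ()
      other-pair true true true false ()
      other-pair true true false true ()
      other-pair true true false false _ = (λ _ → refl) , λ _ → refl
      other-pair true false true true ()
      other-pair true false true false _ = (λ ()) , λ ()
      other-pair true false false true _ = (λ ()) , λ ()
      other-pair true false false false ()
      other-pair false true true true ()
      other-pair false true true false _ = (λ ()) , λ ()
      other-pair false true false true _ = (λ ()) , λ ()
      other-pair false true false false ()
      other-pair false false true true _ = (λ _ → refl) , λ _ → refl
      other-pair false false true false ()
      other-pair false false false true ()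
      other-pair false false false false ()
      fs = other-pair (bit o e₁) (bit o e₂) (bit o e₃) (bit o e₄) (QuadSum.four-sum Q β0 o sy)
      eq : ∀ {e e' w w'} → Joins G e y w → Joins G e' y w' → y ≢ w → y ≢ w' → A w ≡ false → A w' ≡ false → w ≢ z → bit o e ≡ bit o e'
      eq {e} {e'} {w} {w'} j j' n n' a a' wz = trans (sym (end-dir {G} o A⁺ n j (addV-y y A) (up n a))) (trans (trans (sym (Boolₚ.not-involutive _))
          (trans (cong not (trans (hit j n a) (sym (hit j' n' a')))) (Boolₚ.not-involutive _))) (end-dir {G} o A⁺ n' j' (addV-y y A) (up n' a')))
        where
        up : ∀ {w} → y ≢ w → A w ≡ false → A⁺ w ≡ false
        up {w} n h = trans (addV-ne y A w n) h
        sd = tight b w (up n a) wz o of′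
        hit : ∀ {e w} → Joins G e y w → y ≢ w → A w ≡ false → not (A⁺ (tl G o e)) ≡ proj₁ sd
        hit {e} {w} j n a = proj₂ sd e (trans (cr-not G A⁺ e) (trans (Joins-cr G A⁺ j) (cong₂ _xor_ (addV-y y A) (up n a))))
          (trans (Joins-touch G (cls id x) j) (cong₂ _∨_ (≡ᵇ-≢ (yx ∘ sym)) (≡ᵇ-≢ λ r → true≢false (trans (sym Ax) (trans (cong A r) a)))))
      k : _ → bit o e₁ ≡ bit o e₂ × bit o e₃ ≡ bit o e₄
      k (inj₁ (a , a' , _)) = let r = eq j₁ j₂ n₁ n₂ a a' h₁ in r , proj₁ fs r
      k (inj₂ (a , a' , _)) = let r = eq j₃ j₄ n₃ n₄ a a' h₃ in proj₂ fs r , r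

    no-tip-edge : ∀ e → Joins G e z y → ⊥
    no-tip-edge e j = go (e₁ ≟ e) (e₂ ≟ e) (e₃ ≟ e) (e₄ ≟ e)
      where
      open Quad Q
      other-end : ∀ {w} → y ≢ w → Joins G e y w → w ≡ z
      other-end {w} n j' = sym (≡ᵇ-true z w (trans (sym (trans (Joins-touch G (cls id z) j') (cong (_∨ (z ≡ᵇ w)) (≡ᵇ-≢ (yz ∘ sym)))))
        (trans (Joins-touch G (cls id z) j) (cong (_∨ (z ≡ᵇ y)) (≡ᵇ-refl z)))))
      go : Dec (e₁ ≡ e) → Dec (e₂ ≡ e) → Dec (e₃ ≡ e) → Dec (e₄ ≡ e) → ⊥
      go (yes refl) _ _ _ = h₁ (other-end n₁ j₁)
      go (no _) (yes refl) _ _ = h₂ (other-end n₂ j₂)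
      go (no _) (no _) (yes refl) _ = h₃ (other-end n₃ j₃)
      go (no _) (no _) (no _) (yes refl) = h₄ (other-end n₄ j₄)
      go (no a) (no b) (no c) (no d) = true≢false (trans (sym (trans (Joins-cr G (cls id y) j) (cong₂ _xor_ (≡ᵇ-≢ yz) (≡ᵇ-refl y)))) (cover e a b c d))

  -- Two bad pairings have sets meeting only in x, hence opposite directions at the tip.
  clash : ∀ {Q Q' : Quad G y} (b : Bad z x ψ Q) (b' : Bad z x ψ Q') → (∀ e → Joins G e z y → ⊥) → ¬ ASx G z x ψ →
    (∀ o → Off G z ψ (addV y (Bad.A b)) o → Off G z ψ (addV y (Bad.A b')) o → Sat G o (cls id y) → ⊥) → Bad.s b ≢ Bad.s b'
  clash b b' nzy nas absurd s≡ = go (Finₚ.any? λ e → (cr G (cls id z) e ≟B true) ×-dec ((touch G (cls id x) e ≟B false) ×-dec ¬? (dir G z ψ e ≟B s)))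
    where
    open Bad b
    module B' = Bad b'
    -- A second common vertex would permit a flow off the intersection. It is a flow off both
    -- enlarged sets and balanced at `y`, which `absurd` rules out.
    meet : ∀ u → u ≢ x → A u ≡ true → B'.A u ≡ true → ⊥
    meet u ux a a' = k (off C I (cong₂ _∧_ Az B'.Az) (u , x , ux , cong₂ _∧_ a a' , cong₂ _∧_ Ax B'.Ax))
      where
      I : VSet G
      I v = A v ∧ B'.A v
      k : Σ (Orientation G) (Off G z ψ I) → ⊥
      k (o , of′) = absurd o (Off-mono {G} {z} {ψ} I (addV y A) (λ v h → cong (_∨ (y ≡ᵇ v)) (∧-trueˡ h)) o of′)
        (Off-mono {G} {z} {ψ} I (addV y B'.A) (λ v h → cong (_∨ (y ≡ᵇ v)) (∧-trueʳ {A v} h)) o of′) (proj₁ of′ y (cong₂ _∧_ Ay B'.Ay))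
    go : Dec (Σ (E G) λ e → cr G (cls id z) e ≡ true × touch G (cls id x) e ≡ false × dir G z ψ e ≢ s) → ⊥
    go (no h) = nas (s , λ e c t → k e c t (dir G z ψ e ≟B s))
      where
      k : ∀ e → cr G (cls id z) e ≡ true → touch G (cls id x) e ≡ false → Dec (dir G z ψ e ≡ s) → dir G z ψ e ≡ s
      k e c t (yes q) = q
      k e c t (no q) = ⊥-elim (h (e , c , t , q))
    go (yes (e , c , t , ne)) = ne (trans (B'.hs e c t') (sym s≡))
      where
      ow = other G z e c
      u = proj₁ ow
      j : Joins G e z u
      j = proj₂ (proj₂ ow)
      yu : y ≢ u
      yu q = nzy e (subst (Joins G e z) (sym q) j)
      au : A u ≡ true
      au with A u in eq
      ... | true = refl
      ... | false = ⊥-elim (ne (hs e c (trans (Joins-touch G (addV y A) j) (cong₂ _∨_ (trans (addV-ne y A z yz) Az) (trans (addV-ne y A u yu) eq)))))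
      ux : u ≢ x
      ux q = true≢false (trans (sym (trans (Joins-touch G (cls id x) j) (trans (cong ((x ≡ᵇ z) ∨_) (≡ᵇ-≡ (sym q))) (Boolₚ.∨-zeroʳ _)))) t)
      t' : touch G (addV y B'.A) e ≡ false
      t' = trans (Joins-touch G (addV y B'.A) j) (cong₂ _∨_ (trans (addV-ne y B'.A z yz) B'.Az) (trans (addV-ne y B'.A u yu) (bool-ne (meet u ux au))))

  all-equal : ∀ a b c d → sgn a ⊕ (sgn b ⊕ (sgn c ⊕ sgn d)) ≡ z0 → a ≡ b → a ≡ c → a ≡ d → ⊥
  all-equal true true true true () _ _ _
  all-equal false false false false () _ _ _

  -- If all three pairings fail, two of their three directions coincide. `clash` excludes this,
  -- since two failing pairings would together force all four edges at `y` to have one direction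
  -- there.
  no-tip : (Q : Quad G y) → Quad.w₁ Q ≢ z → Quad.w₂ Q ≢ z → Quad.w₃ Q ≢ z → Quad.w₄ Q ≢ z → Result
  no-tip Q h₁ h₂ h₃ h₄ = go (noTipPair Q h₂ h₄ (λ s _ _ → (λ h → ⊥-elim (h₁ h)) , λ h → ⊥-elim (h₃ h)))
      (noTipPair Q₂ h₃ h₄ (λ s _ _ → (λ h → ⊥-elim (h₁ h)) , λ h → ⊥-elim (h₂ h)))
      (noTipPair Q₃ h₄ h₂ (λ s _ _ → (λ h → ⊥-elim (h₁ h)) , λ h → ⊥-elim (h₃ h)))
    where
    open Quad Q
    Q₂ Q₃ : Quad G y
    Q₂ = s₂₃ Q
    Q₃ = s₂₃ (s₃₄ (s₂₃ Q))
    go : Result ⊎ (Bad z x ψ Q × ¬ ASx G z x ψ) → Result ⊎ (Bad z x ψ Q₂ × ¬ ASx G z x ψ) → Result ⊎ (Bad z x ψ Q₃ × ¬ ASx G z x ψ) → Result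
    go (inj₁ r) _ _ = r
    go (inj₂ _) (inj₁ r) _ = r
    go (inj₂ _) (inj₂ _) (inj₁ r) = r
    go (inj₂ (b , nas)) (inj₂ (b₂ , _)) (inj₂ (b₃ , _)) = ⊥-elim (pigeon (Bad.s b) (Bad.s b₂) (Bad.s b₃)
        (clash b b₂ nt' nas λ o o₁ o₂ sy → let (p , q) = B₁ b o o₁ sy
                                               (p' , q') = B₂ b₂ o o₂ sy in
          all-equal _ _ _ _ (QuadSum.four-sum Q β0 o sy) p p' (trans p q'))
        (clash b b₃ nt' nas λ o o₁ o₃ sy → let (p , q) = B₁ b o o₁ sy
                                               (p' , q') = B₃ b₃ o o₃ sy in
          all-equal _ _ _ _ (QuadSum.four-sum Q β0 o sy) p (trans p (sym q')) p')
        (clash b₂ b₃ nt' nas λ o o₂ o₃ sy → let (p , q) = B₂ b₂ o o₂ sy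
                                                (p' , q') = B₃ b₃ o o₃ sy in
          all-equal _ _ _ _ (QuadSum.four-sum Q β0 o sy) (trans p q') p p'))
      where
      pigeon : ∀ a b c → a ≢ b → a ≢ c → b ≢ c → ⊥
      pigeon = from-yes (allB? λ a → allB? λ b → allB? λ c → ¬? (a ≟B b) →-dec (¬? (a ≟B c) →-dec (¬? (b ≟B c) →-dec no (λ ()))))
      nt' = NoTip.no-tip-edge Q h₁ h₂ h₃ h₄
      B₁ = NoTip.bits Q h₁ h₂ h₃ h₄
      B₂ = NoTip.bits Q₂ h₁ h₃ h₂ h₄
      B₃ = NoTip.bits Q₃ h₁ h₄ h₃ h₂

  red : Result
  red = sort (quad cv y y4)
    where
    Dz : V G → Set
    Dz w = Dec (w ≡ z)
    sort₄ : (Q : Quad G y) → Quad.w₁ Q ≡ z → Quad.w₂ Q ≡ z → Quad.w₃ Q ≡ z → Dz (Quad.w₄ Q) → Result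
    sort₄ Q a b c (yes d) = ⊥-elim (all-tip Q a b c d)
    sort₄ Q a b c (no d) = three-tip Q a b c d
    sort₃ : (Q : Quad G y) → Quad.w₁ Q ≡ z → Quad.w₂ Q ≡ z → Dz (Quad.w₃ Q) → Dz (Quad.w₄ Q) → Result
    sort₃ Q a b (yes c) d = sort₄ Q a b c d
    sort₃ Q a b (no c) (yes d) = sort₄ (s₃₄ Q) a b d (no c)
    sort₃ Q a b (no c) (no d) = two-tip Q a b c d
    sort₂ : (Q : Quad G y) → Quad.w₁ Q ≡ z → Dz (Quad.w₂ Q) → Dz (Quad.w₃ Q) → Dz (Quad.w₄ Q) → Result
    sort₂ Q a (yes b) c d = sort₃ Q a b c d
    sort₂ Q a (no b) (yes c) d = sort₃ (s₂₃ Q) a c (no b) d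
    sort₂ Q a (no b) (no c) (yes d) = sort₃ (s₂₃ (s₃₄ Q)) a d (no b) (no c)
    sort₂ Q a (no b) (no c) (no d) = one-tip Q a b c d
    sort₁ : (Q : Quad G y) → Dz (Quad.w₁ Q) → Dz (Quad.w₂ Q) → Dz (Quad.w₃ Q) → Dz (Quad.w₄ Q) → Result
    sort₁ Q (yes a) b c d = sort₂ Q a b c d
    sort₁ Q (no a) (yes b) c d = sort₂ (s₁₂ Q) b (no a) c d
    sort₁ Q (no a) (no b) (yes c) d = sort₂ (s₁₂ (s₂₃ Q)) c (no a) (no b) d
    sort₁ Q (no a) (no b) (no c) (yes d) = sort₂ (s₁₂ (s₂₃ (s₃₄ Q))) d (no a) (no b) (no c)
    sort₁ Q (no a) (no b) (no c) (no d) = no-tip Q a b c d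
    sort : Quad G y → Result
    sort Q = sort₁ Q (Quad.w₁ Q ≟ z) (Quad.w₂ Q ≟ z) (Quad.w₃ Q ≟ z) (Quad.w₄ Q ≟ z)

-- Canvases with three vertices

distinct-≤ : ∀ {k} (P : Fin k → ℕ) → (∀ w → P w ≤ 1) → sumℕ P ≤ k
distinct-≤ {k} P h = ℕₚ.≤-trans (sumℕ-mono {k} h) (ℕₚ.≤-reflexive (len k))
  where
  len : ∀ k → sumℕ {k} (λ _ → 1) ≡ k
  len zero = refl
  len (suc k) = cong suc (len k)

three-≤ : ∀ {k} {a b c : Fin k} → a ≢ b → a ≢ c → b ≢ c → 3 ≤ k
three-≤ {k} {a} {b} {c} ab ac bc = ℕₚ.≤-trans (ℕₚ.≤-reflexive (sym s)) (distinct-≤ P h)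
  where
  P : Fin k → ℕ
  P w = ind (w ≡ᵇ a) + (ind (w ≡ᵇ b) + ind (w ≡ᵇ c))
  s : sumℕ P ≡ 3
  s = trans (sumℕ-+ {k} _ _) (cong₂ _+_ (count-≡ a) (trans (sumℕ-+ {k} _ _) (cong₂ _+_ (count-≡ b) (count-≡ c))))
  h : ∀ w → P w ≤ 1
  h w with w ≟ a | w ≟ b | w ≟ c
  ... | yes p | yes q | _ = ⊥-elim (ab (trans (sym p) q))
  ... | yes p | no _ | yes q = ⊥-elim (ac (trans (sym p) q))
  ... | yes _ | no _ | no _ = s≤s z≤n
  ... | no _ | yes p | yes q = ⊥-elim (bc (trans (sym p) q))
  ... | no _ | yes _ | no _ = s≤s z≤n
  ... | no _ | no _ | yes _ = s≤s z≤n
  ... | no _ | no _ | no _ = z≤n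

four-≤ : ∀ {k} {a b c d : Fin k} → a ≢ b → a ≢ c → b ≢ c → d ≢ a → d ≢ b → d ≢ c → 4 ≤ k
four-≤ {k} {a} {b} {c} {d} ab ac bc da db dc = ℕₚ.≤-trans (ℕₚ.≤-reflexive (sym s)) (distinct-≤ P h)
  where
  P : Fin k → ℕ
  P w = ind (w ≡ᵇ d) + (ind (w ≡ᵇ a) + (ind (w ≡ᵇ b) + ind (w ≡ᵇ c)))
  s : sumℕ P ≡ 4
  s = trans (sumℕ-+ {k} _ _) (cong₂ _+_ (count-≡ d) (trans (sumℕ-+ {k} _ _) (cong₂ _+_ (count-≡ a) (trans (sumℕ-+ {k} _ _) (cong₂ _+_ (count-≡ b) (count-≡ c))))))
  h : ∀ w → P w ≤ 1
  h w with w ≟ d | w ≟ a | w ≟ b | w ≟ c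
  ... | yes r | yes p | _ | _ = ⊥-elim (da (trans (sym r) p))
  ... | yes r | no _ | yes p | _ = ⊥-elim (db (trans (sym r) p))
  ... | yes r | no _ | no _ | yes p = ⊥-elim (dc (trans (sym r) p))
  ... | yes _ | no _ | no _ | no _ = s≤s z≤n
  ... | no _ | yes p | yes q | _ = ⊥-elim (ab (trans (sym p) q))
  ... | no _ | yes p | no _ | yes q = ⊥-elim (ac (trans (sym p) q))
  ... | no _ | yes _ | no _ | no _ = s≤s z≤n
  ... | no _ | no _ | yes p | yes q = ⊥-elim (bc (trans (sym p) q))
  ... | no _ | no _ | yes _ | no _ = s≤s z≤n
  ... | no _ | no _ | no _ | yes _ = s≤s z≤n
  ... | no _ | no _ | no _ | no _ = z≤n

-- With only `z` and `x` present, the preflow is balanced at `z`, hence also at `x`, and extends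
-- itself.
thirdV : ∀ {G z x ψ} → Easel G z x ψ → Σ (V G) λ v → v ≢ z × v ≢ x
thirdV {G} {z} {x} {ψ} ES with Finₚ.any? (λ v → ¬? (v ≟ z) ×-dec ¬? (v ≟ x))
... | yes h = h
... | no h = ⊥-elim (almost {G} {z} {ψ} (Cv.tot cv) (λ e → nx (Ext→Extends G z ψ e)) ψ x (λ _ _ → refl) λ v vx → k v vx (v ≟ z))
  where
  open Easel ES
  k : ∀ v → v ≢ x → Dec (v ≡ z) → Sat G ψ (cls id v)
  k v vx (yes refl) = Tip→Sat G v ψ tip
  k v vx (no vz) = ⊥-elim (h (v , vz , vx))

size-cases : ∀ {G z x ψ} → Easel G z x ψ → n G ≡ 3 ⊎ 4 ≤ n G
size-cases {G} ES = let (v , vz , vx) = thirdV ES in k (ℕₚ.m≤n⇒m<n∨m≡n (three-≤ (vx ∘ sym) (Easel.x≢z ES) vz))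
  where
  k : 3 < n G ⊎ 3 ≡ n G → n G ≡ 3 ⊎ 4 ≤ n G
  k (inj₁ l) = inj₂ l
  k (inj₂ e) = inj₁ (sym e)

Bound : (G : Gr) (z x : V G) → Orientation G → Set
Bound G z x ψ = 2 + deg G x ≤ deg G z × (2 + deg G x ≡ deg G z → ASx G z x ψ)

-- Equality in the bound for the original easel makes all intermediate inequalities equalities,
-- which is when `asx` can transfer directions.
Mono-Bound : ∀ {G z x ψ G' z' x' ψ'} → Mono G z x ψ G' z' x' ψ' → Bound G' z' x' ψ' → Bound G z x ψ
Mono-Bound {G} {z} {x} {ψ} {G'} {z'} {x'} M (le , t) = ℕₚ.≤-trans low dz≤ , λ e →
    let ez = ℕₚ.≤-antisym dz≤ (ℕₚ.≤-trans (ℕₚ.≤-reflexive (sym e)) low)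
        ex = ℕₚ.≤-antisym (ℕₚ.+-cancelˡ-≤ 2 _ _ (ℕₚ.≤-trans le (ℕₚ.≤-trans dz≤ (ℕₚ.≤-reflexive (sym e))))) dx≥
    in asx ez ex (t (trans (cong (2 +_) ex) (trans e (sym ez))))
  where
  open Mono M
  low : 2 + deg G x ≤ deg G' z'
  low = ℕₚ.≤-trans (ℕₚ.+-monoʳ-≤ 2 dx≥) le

module Three {G : Gr} {z x : V G} {ψ : Orientation G} (ES : Easel G z x ψ) (n3 : n G ≡ 3) where
  open Easel ES
  v = proj₁ (thirdV ES)
  vz = proj₁ (proj₂ (thirdV ES))
  vx = proj₂ (proj₂ (thirdV ES))

  ll : Loopless G
  ll = Cv.loopless cv

  only : ∀ w → w ≢ z → w ≢ x → w ≡ v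
  only w wz wx with w ≟ v
  ... | yes q = q
  ... | no q = ⊥-elim (ℕₚ.<⇒≱ (four-≤ (vx ∘ sym) x≢z vz wx q wz) (ℕₚ.≤-reflexive n3))

  away : E G → Bool
  away e = not (touch G (cls id z) e)

  away-joins : ∀ e → away e ≡ true → Joins G e x v
  away-joins e h = k (p₁ G e ≟ x) (p₂ G e ≟ x)
    where
    t : touch G (cls id z) e ≡ false
    t = not-true h
    a : p₁ G e ≢ z
    a q = true≢false (trans (sym (cong (_∨ (z ≡ᵇ p₂ G e)) (≡ᵇ-≡ (sym q)))) t)
    b : p₂ G e ≢ z
    b q = true≢false (trans (sym (trans (cong ((z ≡ᵇ p₁ G e) ∨_) (≡ᵇ-≡ (sym q))) (Boolₚ.∨-zeroʳ _))) t)
    k : Dec (p₁ G e ≡ x) → Dec (p₂ G e ≡ x) → Joins G e x v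
    k (yes p) (yes q) = ⊥-elim (ll e (trans p (sym q)))
    k (yes p) (no q) = inj₁ (cong₂ _,_ p (only (p₂ G e) b q))
    k (no p) (yes q) = inj₂ (cong₂ _,_ (only (p₁ G e) a p) q)
    k (no p) (no q) = ⊥-elim (ll e (trans (only (p₁ G e) a p) (sym (only (p₂ G e) b q))))

  c : ℕ
  c = sumℕ (λ e → ind (away e))

  -- The preflow itself is a flow off `x` and `v`, so two parallel edges between them would complete
  -- it.
  two-away : ∀ e e' → e ≢ e' → away e ≡ true → away e' ≡ true → ⊥
  two-away e e' ne h h' = parallel {G} {z} {ψ} (Cv.tot cv) (λ r → nx (Ext→Extends G z ψ r)) x v (vx ∘ sym) x≢z vz e e' ne (away-joins e h) (away-joins e' h')
    (ψ , off-all {G} {z} {ψ} tip (two x v) λ w f → k w (two-ne f) (w ≟ z))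
    where
    k : ∀ w → x ≢ w × v ≢ w → Dec (w ≡ z) → w ≡ z
    k w _ (yes q) = q
    k w (a , b) (no q) = ⊥-elim (b (sym (only w q (a ∘ sym))))

  degs : deg G z + (c + c) ≡ deg G x + deg G v
  degs = trans (cong₂ _+_ (deg-dd G ll z) (sym (sumℕ-+ {m G} _ _))) (trans (sym (sumℕ-+ {m G} _ _)) (trans (sumℕ-cong {m G} per)
    (trans (sumℕ-+ {m G} _ _) (cong₂ _+_ (sym (deg-dd G ll x)) (sym (deg-dd G ll v))))))
    where
    class : ∀ w → (z ≡ᵇ w) ≡ true × (x ≡ᵇ w) ≡ false × (v ≡ᵇ w) ≡ false ⊎ (z ≡ᵇ w) ≡ false × (x ≡ᵇ w) ≡ true × (v ≡ᵇ w) ≡ false ⊎ (z ≡ᵇ w) ≡ false × (x ≡ᵇ w) ≡ false × (v ≡ᵇ w) ≡ true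
    class w with w ≟ z | w ≟ x
    ... | yes refl | _ = inj₁ (≡ᵇ-refl w , ≡ᵇ-≢ x≢z , ≡ᵇ-≢ vz)
    ... | no a | yes refl = inj₂ (inj₁ (≡ᵇ-≢ (a ∘ sym) , ≡ᵇ-refl w , ≡ᵇ-≢ vx))
    ... | no a | no b = inj₂ (inj₂ (≡ᵇ-≢ (a ∘ sym) , ≡ᵇ-≢ (b ∘ sym) , ≡ᵇ-≡ (sym (only w a b))))
    per : ∀ e → ind (cr G (cls id z) e) + (ind (away e) + ind (away e)) ≡ ind (cr G (cls id x) e) + ind (cr G (cls id v) e)
    per e with class (p₁ G e) | class (p₂ G e)
    ... | inj₁ (a , b , d) | inj₁ (a' , b' , d') = ⊥-elim (ll e (trans (sym (≡ᵇ-true z (p₁ G e) a)) (≡ᵇ-true z (p₂ G e) a')))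
    ... | inj₁ (a , b , d) | inj₂ (inj₁ (a' , b' , d')) rewrite a | b | d | a' | b' | d' = refl
    ... | inj₁ (a , b , d) | inj₂ (inj₂ (a' , b' , d')) rewrite a | b | d | a' | b' | d' = refl
    ... | inj₂ (inj₁ (a , b , d)) | inj₁ (a' , b' , d') rewrite a | b | d | a' | b' | d' = refl
    ... | inj₂ (inj₁ (a , b , d)) | inj₂ (inj₁ (a' , b' , d')) = ⊥-elim (ll e (trans (sym (≡ᵇ-true x (p₁ G e) b)) (≡ᵇ-true x (p₂ G e) b')))
    ... | inj₂ (inj₁ (a , b , d)) | inj₂ (inj₂ (a' , b' , d')) rewrite a | b | d | a' | b' | d' = refl
    ... | inj₂ (inj₂ (a , b , d)) | inj₁ (a' , b' , d') rewrite a | b | d | a' | b' | d' = refl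
    ... | inj₂ (inj₂ (a , b , d)) | inj₂ (inj₁ (a' , b' , d')) rewrite a | b | d | a' | b' | d' = refl
    ... | inj₂ (inj₂ (a , b , d)) | inj₂ (inj₂ (a' , b' , d')) = ⊥-elim (ll e (trans (sym (≡ᵇ-true v (p₁ G e) d)) (≡ᵇ-true v (p₂ G e) d')))

  v4 : 4 ≤ deg G v
  v4 = ℕₚ.≤-trans (ℕₚ.m≤m+n 4 _) (Cv.tame cv v vz)

  -- with one edge between x and v, which has degree four, the three tip edges of v must agree
  module Tight (d4 : deg G v ≡ 4) (e₀ : E G) (h₀ : away e₀ ≡ true) where
    β0 : β G v ≡ z0
    β0 = k (small-deg (deg G v) (β G v) (Cv.tame cv v vz) (ℕₚ.≤-trans (ℕₚ.≤-reflexive d4) (ℕₚ.n≤1+n 4)))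
      where
      k : _ ⊎ _ → β G v ≡ z0
      k (inj₁ (_ , h)) = h
      k (inj₂ (h , _)) = ⊥-elim (ℕₚ.<⇒≢ (ℕₚ.n<1+n 4) (trans (sym d4) h))

    use : (Q : Quad G v) → Quad.e₄ Q ≡ e₀ → ASx G z x ψ
    use Q refl = fin (bit ψ e₁ ≟B bit ψ e₂) (bit ψ e₁ ≟B bit ψ e₃)
      where
      open Quad Q
      open QuadSum Q β0 using (bit; total)
      isz : ∀ {e w} → Joins G e v w → v ≢ w → e ≢ e₄ → w ≡ z
      isz {e} {w} j n ne = k (w ≟ z)
        where
        k : Dec (w ≡ z) → w ≡ z
        k (yes q) = q
        k (no q) = ⊥-elim (two-away e e₄ ne (cong not (trans (Joins-touch G (cls id z) j) (cong₂ _∨_ (≡ᵇ-≢ (vz ∘ sym)) (≡ᵇ-≢ (q ∘ sym))))) h₀)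
      module _ (b : Bool) where
        o : Orientation G
        o = setO ψ e₄ (if b then outOf G e₄ v else not (outOf G e₄ v))
        same : ∀ {e} → e₄ ≢ e → bit o e ≡ bit ψ e
        same {e} h = cong (λ s → v ≡ᵇ (if s then p₁ G e else p₂ G e)) (setO-ne ψ e₄ _ h)
        last : bit o e₄ ≡ b
        last = k b refl
          where
          k : ∀ b' → b ≡ b' → bit o e₄ ≡ b'
          k true refl = ≡ᵇ-≡ (sym (proj₁ (Joins-tl {G} {o} n₄ j₄ (setO-at ψ e₄ _))))
          k false refl = ≡ᵇ-≢ λ q → n₄ (trans q (proj₁ (Joins-hd {G} {o} n₄ j₄ (setO-at ψ e₄ _))))
        ag : Agree G z ψ o
        ag e t = setO-ne ψ e₄ _ λ { refl → true≢false (trans (sym t) (not-true h₀)) }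
        bad : sgn (bit ψ e₁) ⊕ (sgn (bit ψ e₂) ⊕ (sgn (bit ψ e₃) ⊕ sgn b)) ≢ z0
        bad h = almost {G} {z} {ψ} (Cv.tot cv) (λ r → nx (Ext→Extends G z ψ r)) o x ag λ w wx → k w wx (w ≟ z)
          where
          sv : Sat G o (cls id v)
          sv = trans (total o) (trans (cong₂ _⊕_ (cong sgn (same (d₁₄ ∘ sym))) (cong₂ _⊕_ (cong sgn (same (d₂₄ ∘ sym))) (cong₂ _⊕_ (cong sgn (same (d₃₄ ∘ sym))) (cong sgn last))))
            (trans h (sym (trans (bs-single G v) β0))))
          k : ∀ w → w ≢ x → Dec (w ≡ z) → Sat G o (cls id w)
          k w wx (yes refl) = Sat-local G {ψ} {o} (cls id w) (λ e cr' → sym (ag e (cr⇒touch G (cls id w) e cr'))) (Tip→Sat G w ψ tip)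
          k w wx (no wz) = subst (λ u → Sat G o (cls id u)) (sym (only w wz wx)) sv
      balance : ∀ a b c → (a ≡ b → a ≡ c → ⊥) → Σ Bool λ d → sgn a ⊕ (sgn b ⊕ (sgn c ⊕ sgn d)) ≡ z0
      balance true true true h = ⊥-elim (h refl refl)
      balance true true false h = false , refl
      balance true false true h = false , refl
      balance true false false h = true , refl
      balance false true true h = false , refl
      balance false true false h = true , refl
      balance false false true h = true , refl
      balance false false false h = ⊥-elim (h refl refl)
      nope : (bit ψ e₁ ≡ bit ψ e₂ → bit ψ e₁ ≡ bit ψ e₃ → ⊥) → ⊥
      nope h = let (b , q) = balance _ _ _ h in bad b q
      dir-bit : ∀ {e w} → Joins G e v w → v ≢ w → e ≢ e₄ → dir G z ψ e ≡ not (bit ψ e)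
      dir-bit {e} j n ne = tail-flip {G} ψ e z v (vz ∘ sym) (Joins-sym {G} (subst (Joins G e v) (isz j n ne) j))
      fin : Dec (bit ψ e₁ ≡ bit ψ e₂) → Dec (bit ψ e₁ ≡ bit ψ e₃) → ASx G z x ψ
      fin (no q) _ = ⊥-elim (nope λ h _ → q h)
      fin (yes _) (no q) = ⊥-elim (nope λ _ h → q h)
      fin (yes q₂) (yes q₃) = not (bit ψ e₁) , λ e ce te → k e ce te (e₁ ≟ e) (e₂ ≟ e) (e₃ ≟ e) (e₄ ≟ e)
        where
        k : ∀ e → cr G (cls id z) e ≡ true → touch G (cls id x) e ≡ false → Dec (e₁ ≡ e) → Dec (e₂ ≡ e) → Dec (e₃ ≡ e) → Dec (e₄ ≡ e) → dir G z ψ e ≡ not (bit ψ e₁)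
        k e ce te (yes refl) _ _ _ = dir-bit j₁ n₁ d₁₄
        k e ce te (no _) (yes refl) _ _ = trans (dir-bit j₂ n₂ d₂₄) (cong not (sym q₂))
        k e ce te (no _) (no _) (yes refl) _ = trans (dir-bit j₃ n₃ d₃₄) (cong not (sym q₃))
        k e ce te (no _) (no _) (no _) (yes refl) = ⊥-elim (true≢false (trans (sym (cr⇒touch G (cls id z) e ce)) (not-true h₀)))
        k e ce te (no a) (no b) (no c') (no d) = let (u , zu , j) = other G z e ce in
          ⊥-elim (true≢false (trans (sym (trans (Joins-cr G (cls id v) j) (cong₂ _xor_ (≡ᵇ-≢ vz) (≡ᵇ-≡ (sym (only u (zu ∘ sym) (ux u j)))))))
            (cover e a b c' d)))
          where
          ux : ∀ u → Joins G e z u → u ≢ x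
          ux u j q = true≢false (trans (sym (trans (Joins-touch G (cls id x) j) (trans (cong ((x ≡ᵇ z) ∨_) (≡ᵇ-≡ (sym q))) (Boolₚ.∨-zeroʳ _)))) te)

    asx : ASx G z x ψ
    asx = go (quad cv v d4)
      where
      go : Quad G v → ASx G z x ψ
      go Q = k (Quad.e₁ Q ≟ e₀) (Quad.e₂ Q ≟ e₀) (Quad.e₃ Q ≟ e₀) (Quad.e₄ Q ≟ e₀)
        where
        open Quad Q
        k : Dec (e₁ ≡ e₀) → Dec (e₂ ≡ e₀) → Dec (e₃ ≡ e₀) → Dec (e₄ ≡ e₀) → ASx G z x ψ
        k (yes q) _ _ _ = use (s₃₄ (s₂₃ (s₁₂ Q))) q
        k (no _) (yes q) _ _ = use (s₃₄ (s₂₃ Q)) q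
        k (no _) (no _) (yes q) _ = use (s₃₄ Q) q
        k (no _) (no _) (no _) (yes q) = use Q q
        k (no a) (no b) (no c') (no d) = ⊥-elim (true≢false (trans (sym (trans (Joins-cr G (cls id v) (away-joins e₀ h₀)) (cong₂ _xor_ (≡ᵇ-≢ vx) (≡ᵇ-refl v)))) (cover e₀ a b c' d)))

  -- `degs` with at most one edge between `x` and `v` gives the bound. Equality requires this edge
  -- and degree four at `v`.
  bound₃ : Bound G z x ψ
  bound₃ = go c refl
    where
    go : ∀ k → c ≡ k → Bound G z x ψ
    go zero e = ℕₚ.≤-trans (ℕₚ.≤-trans (ℕₚ.≤-reflexive (ℕₚ.+-comm 2 (deg G x))) (ℕₚ.+-monoʳ-≤ (deg G x) (ℕₚ.≤-trans (s≤s (s≤s z≤n)) v4))) (ℕₚ.≤-reflexive (sym dz))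
        , λ q → ⊥-elim (ℕₚ.<⇒≢ (ℕₚ.≤-trans (s≤s (s≤s (s≤s z≤n))) v4) (ℕₚ.+-cancelˡ-≡ (deg G x) 2 (deg G v) (trans (ℕₚ.+-comm (deg G x) 2) (trans q dz))))
      where
      dz : deg G z ≡ deg G x + deg G v
      dz = trans (sym (ℕₚ.+-identityʳ (deg G z))) (trans (cong (λ k → deg G z + (k + k)) (sym e)) degs)
    go (suc zero) e = ℕₚ.+-cancelʳ-≤ 2 _ _ (ℕₚ.≤-trans (ℕₚ.≤-trans (ℕₚ.≤-reflexive (trans (cong (_+ 2) (ℕₚ.+-comm 2 (deg G x))) (ℕₚ.+-assoc (deg G x) 2 2))) (ℕₚ.+-monoʳ-≤ (deg G x) v4)) (ℕₚ.≤-reflexive (sym dz)))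
        , λ q → let (e₀ , h₀ , _) = count-pick away {0} e in
            Tight.asx (sym (ℕₚ.+-cancelˡ-≡ (deg G x) 4 (deg G v) (trans (sym (trans (cong (_+ 2) (ℕₚ.+-comm 2 (deg G x))) (ℕₚ.+-assoc (deg G x) 2 2))) (trans (cong (_+ 2) q) dz)))) e₀ h₀
      where
      dz : deg G z + 2 ≡ deg G x + deg G v
      dz = trans (cong (λ k → deg G z + (k + k)) (sym e)) degs
    go (suc (suc k)) e = let (a , ha , ca) = count-pick away e
                             (b , hb , _) = count-pick (λ i → away i ∧ not (a ≡ᵇ i)) ca
                         in ⊥-elim (two-away a b (≡ᵇ-false a b (not-true (∧-trueʳ {away b} hb))) ha (∧-trueˡ hb))

-- Homogeneous critical canvases in which no edge at the tip can be deleted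

-- Both kinds of friendliness, with `true` for out-friendly. Degree and boundary are arguments, so
-- that the effect of changing them can be stated.
Fr : Bool → ℕ → Z3 → Set
Fr true d b = Any (λ t → pos 0 ≤ℤ t) (tauOf d b)
Fr false d b = Any (λ t → t ≤ℤ pos 0) (tauOf d b)

Fr? : ∀ s d b → Dec (Fr s d b)
Fr? true d b = Any.any? (λ t → pos 0 ℤₚ.≤? t) (tauOf d b)
Fr? false d b = Any.any? (λ t → t ℤₚ.≤? pos 0) (tauOf d b)

Fr-z0 : ∀ s d → Fr s d z0
Fr-z0 true d with isEven d
... | true = here (ℤ.+≤+ z≤n)
... | false = there (here (ℤ.+≤+ z≤n))
Fr-z0 false d with isEven d
... | true = here (ℤ.+≤+ z≤n)
... | false = here ℤ.-≤+

Fr-total : ∀ s d b → ¬ Fr s d b → Fr (not s) d b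
Fr-total s d z0 _ = Fr-z0 (not s) d
Fr-total true d z1 h with isEven d
... | true = here ℤ.-≤+
... | false = ⊥-elim (h (here (ℤ.+≤+ z≤n)))
Fr-total false d z1 h with isEven d
... | true = ⊥-elim (h (here ℤ.-≤+))
... | false = here (ℤ.+≤+ z≤n)
Fr-total true d z2 h with isEven d
... | true = ⊥-elim (h (here (ℤ.+≤+ z≤n)))
... | false = here ℤ.-≤+
Fr-total false d z2 h with isEven d
... | true = here (ℤ.+≤+ z≤n)
... | false = ⊥-elim (h (here ℤ.-≤+))

-- For nonzero boundary, a change of the parity of the degree reverses the sign of τ; for boundary
-- zero a vertex is friendly in both ways.
Fr-suc : ∀ s d b → ¬ Fr s d b → Fr s (suc d) b
Fr-suc s d z0 h = ⊥-elim (h (Fr-z0 s d))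
Fr-suc true d z1 h with isEven d
... | true = here (ℤ.+≤+ z≤n)
... | false = ⊥-elim (h (here (ℤ.+≤+ z≤n)))
Fr-suc false d z1 h with isEven d
... | true = ⊥-elim (h (here ℤ.-≤+))
... | false = here ℤ.-≤+
Fr-suc true d z2 h with isEven d
... | true = ⊥-elim (h (here (ℤ.+≤+ z≤n)))
... | false = here (ℤ.+≤+ z≤n)
Fr-suc false d z2 h with isEven d
... | true = here ℤ.-≤+
... | false = ⊥-elim (h (here ℤ.-≤+))

-- For `s` true, τ is positive at all vertices besides `z` and `x`, and the edges from the tip to
-- them leave the tip. For `s` false, signs and directions are reversed.
record Final (G : Gr) (z x : V G) (ψ : Orientation G) : Set where
  field
    s : Bool
    strict : ∀ v → v ≢ z → v ≢ x → ¬ Fr (not s) (deg G v) (β G v)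
    dirs : ∀ e → cr G (cls id z) e ≡ true → touch G (cls id x) e ≡ false → dir G z ψ e ≡ s

Crit-of : ∀ {G z x ψ} → Easel G z x ψ → CritL G id z ψ → Crit G z ψ
Crit-of {G} {z} {x} {ψ} ES crit = record { cv = cv ; tip = tip ; nx = λ e → nx (Ext→Extends G z ψ e) ; crit = crit }
  where open Easel ES

module Classify {G : Gr} {z x : V G} {ψ : Orientation G} (ES : Easel G z x ψ) (crit : CritL G id z ψ) (n4 : 4 ≤ n G)
    (no4 : ∀ v → v ≢ z → v ≢ x → deg G v ≢ 4) (hom : Homog G z x) where
  open Easel ES

  F : Bool → V G → Set
  F s v = Fr s (deg G v) (β G v)

  F? : ∀ s v → Dec (F s v)
  F? s v = Fr? s (deg G v) (β G v)

  F-total : ∀ s v → ¬ F s v → F (not s) v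
  F-total s v = Fr-total s (deg G v) (β G v)

  flip : ∀ {e a b} → Joins G e a b → Joins G e b a
  flip {e} {a} {b} = Joins-sym {G} {e} {a} {b}

  unmixed : ∀ s {e u v} → Joins G e u v → u ≢ z → u ≢ x → v ≢ z → v ≢ x → F s u → F (not s) v → ⊥
  unmixed s {e} {u} {v} j uz ux vz vx fu fv = k s j fu fv (hom e)
    where
    k : ∀ s → Joins G e u v → F s u → F (not s) v → (Mixed G z e → Incident G x e) → ⊥
    k s (inj₁ q) fu fv h = l s fu fv (subst (λ p → (proj₁ p ≢ z × proj₂ p ≢ z × ((F false (proj₁ p) × F true (proj₂ p)) ⊎ (F true (proj₁ p) × F false (proj₂ p)))) → proj₁ p ≡ x ⊎ proj₂ p ≡ x) q h)
      where
      l : ∀ s → F s u → F (not s) v → (u ≢ z × v ≢ z × ((F false u × F true v) ⊎ (F true u × F false v)) → u ≡ x ⊎ v ≡ x) → ⊥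
      l true fu fv h = Sum.[ ux , vx ]′ (h (uz , vz , inj₂ (fu , fv)))
      l false fu fv h = Sum.[ ux , vx ]′ (h (uz , vz , inj₁ (fu , fv)))
    k s (inj₂ q) fu fv h = l s fu fv (subst (λ p → (proj₁ p ≢ z × proj₂ p ≢ z × ((F false (proj₁ p) × F true (proj₂ p)) ⊎ (F true (proj₁ p) × F false (proj₂ p)))) → proj₁ p ≡ x ⊎ proj₂ p ≡ x) q h)
      where
      l : ∀ s → F s u → F (not s) v → (v ≢ z × u ≢ z × ((F false v × F true u) ⊎ (F true v × F false u)) → v ≡ x ⊎ u ≡ x) → ⊥
      l true fu fv h = Sum.[ vx , ux ]′ (h (vz , uz , inj₁ (fv , fu)))
      l false fu fv h = Sum.[ vx , ux ]′ (h (vz , uz , inj₂ (fv , fu)))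

  C : Crit G z ψ
  C = Crit-of ES crit

  inner : V G → Bool
  inner v = not (two z x v)

  inner-≢ : ∀ {v} → inner v ≡ true → v ≢ z × v ≢ x
  inner-≢ h = let (a , b) = two-ne (trans (sym (Boolₚ.not-involutive _)) (cong not h)) in a ∘ sym , b ∘ sym

  ≢-inner : ∀ {v} → v ≢ z → v ≢ x → inner v ≡ true
  ≢-inner a b = cong not (two-false (a ∘ sym) (b ∘ sym))

  D : Bool → V G → Bool
  D s v = inner v ∧ does (F? s v)

  does-yes : ∀ {P : Set} (d : Dec P) → P → does d ≡ true
  does-yes (yes _) _ = refl
  does-yes (no n) p = ⊥-elim (n p)

  does-P : ∀ {P : Set} (d : Dec P) → does d ≡ true → P
  does-P (yes p) _ = p

  -- An edge between a vertex of `D s` and one outside, other than `z` and `x`, would be mixed. By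
  -- homogeneity there is none, so `z` and `x` separate `D s`, contrary to `no-cut`.
  all-or-none : ∀ s u v → u ≢ z → u ≢ x → v ≢ z → v ≢ x → F s u → ¬ F s v → ⊥
  all-or-none s u v uz ux vz vx fu nv = no-cut C x x≢z (D s) (cong (λ b → not b ∧ _) (two-l z x)) (cong (λ b → not b ∧ _) (two-r z x))
    u (cong₂ _∧_ (≢-inner uz ux) (does-yes (F? s u) fu)) v (bool-ne λ q → nv (does-P (F? s v) (∧-trueʳ {inner v} q))) vz vx
    λ e a b j da db → sep e a b j (inner-≢ (∧-trueˡ {inner a} da)) (does-P (F? s a) (∧-trueʳ {inner a} da)) db (b ≟ z) (b ≟ x)
    where
    sep : ∀ e a b → Joins G e a b → a ≢ z × a ≢ x → F s a → D s b ≡ false → Dec (b ≡ z) → Dec (b ≡ x) → b ≡ z ⊎ b ≡ x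
    sep e a b j _ fa db (yes p) _ = inj₁ p
    sep e a b j _ fa db (no _) (yes p) = inj₂ p
    sep e a b j (az , ax) fa db (no bz) (no bx) = ⊥-elim (unmixed s j az ax bz bx fa (F-total s b λ fb →
      true≢false (trans (sym (cong₂ _∧_ (≢-inner bz bx) (does-yes (F? s b) fb))) db)))

  Addable : E G → Set
  Addable e = cr G (cls id z) e ≡ true × touch G (cls id x) e ≡ false ×
    (F (not (dir G z ψ e)) (p₁ G e) × p₁ G e ≢ z ⊎ F (not (dir G z ψ e)) (p₂ G e) × p₂ G e ≢ z)

  addable? : ∀ e → Dec (Addable e)
  addable? e = (cr G (cls id z) e ≟B true) ×-dec ((touch G (cls id x) e ≟B false) ×-dec
    ((F? _ (p₁ G e) ×-dec ¬? (p₁ G e ≟ z)) ⊎-dec (F? _ (p₂ G e) ×-dec ¬? (p₂ G e ≟ z))))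

  joins-addable : ∀ {e t} → t ≢ z → t ≢ x → Joins G e z t → F (not (dir G z ψ e)) t → Addable e
  joins-addable {e} {t} tz tx j f = proj₁ w , proj₂ w , k j
    where
    w : cr G (cls id z) e ≡ true × touch G (cls id x) e ≡ false
    w = XEdge→ G z x x≢z e (t , tz , tx , j)
    k : Joins G e z t → F (not (dir G z ψ e)) (p₁ G e) × p₁ G e ≢ z ⊎ F (not (dir G z ψ e)) (p₂ G e) × p₂ G e ≢ z
    k (inj₁ q) = inj₂ (subst (λ v → F (not (dir G z ψ e)) v × v ≢ z) (sym (cong proj₂ q)) (f , tz))
    k (inj₂ q) = inj₁ (subst (λ v → F (not (dir G z ψ e)) v × v ≢ z) (sym (cong proj₁ q)) (f , tz))

  addable-joins : ∀ {e} → Addable e → Σ (V G) λ t → t ≢ z × t ≢ x × Joins G e z t × F (not (dir G z ψ e)) t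
  addable-joins {e} (c , nt , f) = let (t , tz , tx , j) = XEdge← G z x e c nt in t , tz , tx , j , k t j f
    where
    k : ∀ t → Joins G e z t → F (not (dir G z ψ e)) (p₁ G e) × p₁ G e ≢ z ⊎ F (not (dir G z ψ e)) (p₂ G e) × p₂ G e ≢ z → F (not (dir G z ψ e)) t
    k t (inj₁ q) (inj₁ (_ , h)) = ⊥-elim (h (cong proj₁ q))
    k t (inj₁ q) (inj₂ (f , _)) = subst (F _) (cong proj₂ q) f
    k t (inj₂ q) (inj₁ (f , _)) = subst (F _) (cong proj₁ q) f
    k t (inj₂ q) (inj₂ (_ , h)) = ⊥-elim (h (cong proj₂ q))

  add : ∀ e → Addable e → Red G z x ψ (λ k r → ADD k r G z x)
  add e a = go (addable-joins a)
    where
    go : (Σ (V G) λ t → t ≢ z × t ≢ x × Joins G e z t × F (not (dir G z ψ e)) t) → Red G z x ψ (λ k r → ADD k r G z x)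
    go (t , tz , tx , j , f) = by (dir G z ψ e) refl f
      where
      by : ∀ b → dir G z ψ e ≡ b → F (not b) t → Red G z x ψ (λ k r → ADD k r G z x)
      by true h f = RedADD.red ES crit e z t t j (tz ∘ sym) tz tx (tail-bool {G} ψ (tz ∘ sym) j true h) (inj₁ (refl , refl , f)) (no4 t tz tx) hom
      by false h f = RedADD.red ES crit e t z t (flip j) tz tz tx
        (tail-bool {G} ψ tz (flip j) true (trans (tail-flip {G} ψ e t z tz (flip j)) (cong not h))) (inj₂ (refl , refl , f)) (no4 t tz tx) hom

  final : (∀ e → ¬ Addable e) → Final G z x ψ
  final na = let (w , wz , wx , _) = fourth n4 z x x in start w wz wx (F? true w) (F? false w)
    where
    done : ∀ s → (∀ v → v ≢ z → v ≢ x → ¬ F (not s) v) → Final G z x ψ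
    done s st = record { s = s ; strict = st ; dirs = λ e c nt → k e (XEdge← G z x e c nt) }
      where
      k : ∀ e → XEdge G z x e → dir G z ψ e ≡ s
      k e (t , tz , tx , j) = l (dir G z ψ e) s (st t tz tx) (λ f → na e (joins-addable tz tx j f))
        where
        l : ∀ d s → ¬ F (not s) t → ¬ F (not d) t → d ≡ s
        l true true _ _ = refl
        l false false _ _ = refl
        l true false a b = ⊥-elim (b (F-total true t a))
        l false true a b = ⊥-elim (b (F-total false t a))
    start : ∀ w → w ≢ z → w ≢ x → Dec (F true w) → Dec (F false w) → Final G z x ψ
    start w wz wx (no nt) _ = done false λ v vz vx f → all-or-none true v w vz vx wz wx f nt
    start w wz wx _ (no nf) = done true λ v vz vx f → all-or-none false v w vz vx wz wx f nf
    -- A vertex friendly in both ways forms a mixed edge with any neighbour besides `z` and `x`, so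
    -- `no-cut` applies to it alone.
    start w wz wx (yes ft) (yes ff) = let (v , vz , vx , vw) = fourth n4 z x w in
      ⊥-elim (no-cut C x x≢z (cls id w) (≡ᵇ-≢ wz) (≡ᵇ-≢ wx) w (≡ᵇ-refl w) v (≡ᵇ-≢ (vw ∘ sym)) vz vx
        λ e a b j da db → sep e b (subst (λ u → Joins G e u b) (sym (≡ᵇ-true w a da)) j) (λ { refl → true≢false (trans (sym (≡ᵇ-refl b)) db) }) (b ≟ z) (b ≟ x))
      where
      sep : ∀ e b → Joins G e w b → w ≢ b → Dec (b ≡ z) → Dec (b ≡ x) → b ≡ z ⊎ b ≡ x
      sep e b j _ (yes p) _ = inj₁ p
      sep e b j _ (no _) (yes p) = inj₂ p
      sep e b j wb (no bz) (no bx) = ⊥-elim (by (F? true b) (F? false b))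
        where
        by : Dec (F true b) → Dec (F false b) → ⊥
        by (yes f) _ = unmixed true (flip j) bz bx wz wx f ff
        by (no h) _ = unmixed true j wz wx bz bx ft (F-total true b h)

  reduce : Red G z x ψ (λ k r → ADD k r G z x) ⊎ Final G z x ψ
  reduce with Finₚ.any? addable?
  ... | yes (e , a) = inj₁ (add e a)
  ... | no h = inj₂ (final λ e a → h (e , a))

redEXPB : ∀ {G z x ψ} → Easel G z x ψ → CritL G id z ψ → TBelow (ord G z) → (∀ v → v ≢ z → v ≢ x → deg G v ≢ 4) →
  ¬ Homog G z x → Red G z x ψ (λ k r → EXPB k r G z x)
redEXPB {G} {z} {x} {ψ} ES crit tb no4 nh = go (Finₚ.¬∀⟶∃¬ (m G) (λ e → Mixed G z e → Incident G x e) (λ e → Mixed? G z e →-dec ((p₁ G e ≟ x) ⊎-dec (p₂ G e ≟ x))) nh)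
  where
  go : (Σ (E G) λ e → ¬ (Mixed G z e → Incident G x e)) → Red G z x ψ (λ k r → EXPB k r G z x)
  go (e , h) = by (Mixed? G z e)
    where
    ax : ¬ Incident G x e
    ax i = h λ _ → i
    by : Dec (Mixed G z e) → Red G z x ψ (λ k r → EXPB k r G z x)
    by (no nm) = ⊥-elim (h λ m → ⊥-elim (nm m))
    by (yes (az , bz , inj₁ (fi , fo))) = RedEXPB.red ES crit tb e (p₂ G e) (p₁ G e) (inj₂ refl) (Cv.loopless (Easel.cv ES) e ∘ sym) bz az (ax ∘ inj₂) (ax ∘ inj₁) fo fi (no4 _ bz (ax ∘ inj₂)) (no4 _ az (ax ∘ inj₁))
    by (yes (az , bz , inj₂ (fo , fi))) = RedEXPB.red ES crit tb e (p₁ G e) (p₂ G e) (inj₁ refl) (Cv.loopless (Easel.cv ES) e) az bz (ax ∘ inj₁) (ax ∘ inj₂) fo fi (no4 _ az (ax ∘ inj₁)) (no4 _ bz (ax ∘ inj₂))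

-- Adding an edge at the tip

addZ : (G : Gr) → V G → V G → (V G → Z3) → Gr
addZ G z w β' = record { n = n G ; m = suc (m G) ; ends = cons (z , w) (ends G) ; β = β' }

inner : ∀ {k} → Fin k → Fin k → Fin k → Bool
inner z x v = not (two z x v)

tip-away : (G : Gr) → V G → V G → E G → Bool
tip-away G z x e = cr G (cls id z) e ∧ not (touch G (cls id x) e)

module Final-count {G : Gr} {z x : V G} {ψ : Orientation G} (ES : Easel G z x ψ) (tb : TBelow (ord G z)) where
  open Easel ES

  q : ℕ
  q = sumℕ (ind ∘ tip-away G z x)

  degs : deg G x + (q + q) ≡ deg G z + dd G (inner z x)
  degs = trans (cong₂ _+_ (deg-dd G (Cv.loopless cv) x) (sym (sumℕ-+ {m G} _ _))) (trans (sym (sumℕ-+ {m G} _ _)) (trans (sumℕ-cong {m G} per)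
    (trans (sumℕ-+ {m G} _ _) (cong (_+ dd G (inner z x)) (sym (deg-dd G (Cv.loopless cv) z))))))
    where
    bits : ∀ a b a' b' → a ∧ b ≡ false → a' ∧ b' ≡ false → ind (b xor b') + (ind ((a xor a') ∧ not (b ∨ b')) + ind ((a xor a') ∧ not (b ∨ b'))) ≡ ind (a xor a') + ind (not (a ∨ b) xor not (a' ∨ b'))
    bits = from-yes (allB? λ a → allB? λ b → allB? λ a' → allB? λ b' → ((a ∧ b) ≟B false) →-dec (((a' ∧ b') ≟B false) →-dec
      ((ind (b xor b') + (ind ((a xor a') ∧ not (b ∨ b')) + ind ((a xor a') ∧ not (b ∨ b')))) ℕₚ.≟ (ind (a xor a') + ind (not (a ∨ b) xor not (a' ∨ b'))))))
    disj : ∀ v → (z ≡ᵇ v) ∧ (x ≡ᵇ v) ≡ false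
    disj v = bool-ne λ h → x≢z (trans (≡ᵇ-true x v (∧-trueʳ {z ≡ᵇ v} h)) (sym (≡ᵇ-true z v (∧-trueˡ h))))
    per : ∀ e → ind (cr G (cls id x) e) + (ind (tip-away G z x e) + ind (tip-away G z x e)) ≡ ind (cr G (cls id z) e) + ind (cr G (inner z x) e)
    per e = bits (z ≡ᵇ p₁ G e) (x ≡ᵇ p₁ G e) (z ≡ᵇ p₂ G e) (x ≡ᵇ p₂ G e) (disj (p₁ G e)) (disj (p₂ G e))

  -- The set of all vertices besides `z` and `x` has at least four boundary edges by `tameSet`.
  lower : deg G z + 4 ≤ deg G x + (q + q)
  lower = let (v , vz , vx) = thirdV ES in subst (deg G z + 4 ≤_) (sym degs) (ℕₚ.+-monoʳ-≤ (deg G z)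
    (ℕₚ.≤-trans (ℕₚ.m≤m+n 4 _) (tameSet cv tb (inner z x) (cong not (two-l z x)) v (cong not (two-false (vz ∘ sym) (vx ∘ sym))) x (cong not (two-r z x)) x≢z)))

two-picks : ∀ {k} (p : Fin k → Bool) → 2 ≤ sumℕ (ind ∘ p) → Σ (Fin k) λ i → Σ (Fin k) λ j → i ≢ j × p i ≡ true × p j ≡ true
two-picks p h = go _ refl h
  where
  go : ∀ c → sumℕ (ind ∘ p) ≡ c → 2 ≤ c → Σ _ λ i → Σ _ λ j → i ≢ j × p i ≡ true × p j ≡ true
  go (suc (suc c)) e _ = let (i , pi , r) = count-pick p e
                             (j , pj , _) = count-pick (λ l → p l ∧ not (i ≡ᵇ l)) r
    in i , j , ≡ᵇ-false i j (not-true (∧-trueʳ {p j} pj)) , pi , ∧-trueˡ {p j} pj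
  go (suc zero) e (s≤s ())

-- An orientation of G is transferred by flipping the edges in φ; b directs the new edge out of z.
module AddZ {G : Gr} {z x : V G} {ψ : Orientation G} (ES : Easel G z x ψ) (crit : CritL G id z ψ) (F : Final G z x ψ) (hom : Homog G z x) (n4 : 4 ≤ n G)
    (w : V G) (wz : w ≢ z) (wx : w ≢ x) (b : Bool) (φ : E G → Bool) (β' : V G → Z3)
    (β'≡ : ∀ v → v ≢ z → v ≢ w → β' v ≡ β G v)
    (transfer : ∀ o A → Agree G z ψ o → (ct (A (if b then z else w)) (A (if b then w else z)) ⊕ nt G (λ e → φ e xor o e) A) ⊕ bs G A ≡ nt G o A ⊕ bs (addZ G z w β') A)
    (tame-w : 4 + at (suc (deg G w)) (β' w) ≤ suc (deg G w))
    (friendly : Fr (not (Final.s F)) (suc (deg G w)) (β' w)) where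
  open Easel ES
  open Final F

  GA : Gr
  GA = addZ G z w β'

  un : Orientation G → Orientation GA
  un o = cons b (λ e → φ e xor o e)

  ψA : Orientation GA
  ψA = un ψ

  key : ∀ o A → Agree G z ψ o → nt GA (un o) A ⊕ bs G A ≡ nt G o A ⊕ bs GA A
  key = transfer

  Sat→ : ∀ {o} A → Agree G z ψ o → Sat G o A → Sat GA (un o) A
  Sat→ {o} A ag s = ⊕-cancelʳ (bs G A) _ _ (trans (key o A ag) (trans (⊕-comm (nt G o A) (bs GA A)) (cong (bs GA A ⊕_) s)))

  Sat← : ∀ {o} A → Agree G z ψ o → Sat GA (un o) A → Sat G o A
  Sat← {o} A ag s = ⊕-cancelʳ (bs GA A) _ _ (trans (sym (key o A ag)) (trans (cong (_⊕ bs G A) s) (⊕-comm (bs GA A) (bs G A))))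

  tipA : Sat GA ψA (cls id z)
  tipA = Sat→ {ψ} (cls id z) (λ _ _ → refl) (Tip→Sat G z ψ tip)

  xor-move : ∀ {a b c} → b ≡ a xor c → a xor b ≡ c
  xor-move {true} {_} {c} refl = Boolₚ.not-involutive c
  xor-move {false} refl = refl

  nxA : ¬ Ext GA id z ψA
  nxA (o' , fl , ag) = nx (Ext→Extends G z ψ (o , (λ q → Sat← {o} (cls id q) ago (Sat-congO GA {o'} {un o} (cls id q) same (fl q))) , ago))
    where
    o : Orientation G
    o e = φ e xor o' (suc e)
    ago : Agree G z ψ o
    ago e t = xor-move {φ e} (ag (suc e) t)
    same : ∀ e → o' e ≡ un o e
    same zero = ag zero (cong (_∨ (z ≡ᵇ w)) (≡ᵇ-refl z))
    same (suc e) = sym (xor-move {φ e} refl)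

  critA : CritL GA id z ψA
  critA g tr u v ne e = let (o , fl , ag) = crit g tr u v ne e
                            ago = λ e t → ag e (touch-mono G {cls id z} {cls g (g z)} (λ v q → ≡ᵇ-≡ (cong g (≡ᵇ-true z v q))) e t)
    in un o , (λ q → Sat→ {o} (cls g q) ago (fl q)) , λ { zero _ → refl ; (suc e) t → cong (φ e xor_) (ag e t) }

  deg-z : deg GA z ≡ suc (deg G z)
  deg-z = cong (_+ deg G z) (cong₂ (λ s t → ind s + ind t) (≡ᵇ-refl z) (≡ᵇ-≢ (wz ∘ sym)))

  deg-w : deg GA w ≡ suc (deg G w)
  deg-w = cong (_+ deg G w) (cong₂ (λ s t → ind s + ind t) (≡ᵇ-≢ wz) (≡ᵇ-refl w))

  deg-v : ∀ v → v ≢ z → v ≢ w → deg GA v ≡ deg G v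
  deg-v v vz vw = cong (_+ deg G v) (cong₂ (λ s t → ind s + ind t) (≡ᵇ-≢ vz) (≡ᵇ-≢ vw))

  cvA : Cv GA z
  cvA = record
    { loopless = λ { zero → wz ∘ sym ; (suc e) → Cv.loopless cv e }
    ; tot = (trans (cong (_⊕ bs GA (λ _ → true)) (sym (nt-all G ψ))) (trans (sym (key ψ (λ _ → true) λ _ _ → refl)) (trans (cong₂ _⊕_ (nt-all GA ψA) (Cv.tot cv)) refl)))
    ; tame = λ v vz → tm v vz (v ≟ w)
    ; fc = λ p f su tr (u , v , ne , e) → ψA , Sat→Tip GA z ψA tipA , ExtQ← GA f (f z) ψA (critA f tr u v ne e) , λ x → nxA (Extends→Ext GA z ψA x) }
    where
    tm : ∀ v → v ≢ z → Dec (v ≡ w) → 4 + absTau GA v ≤ deg GA v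
    tm v vz (yes refl) = subst (λ d → 4 + at d (β' v) ≤ d) (sym deg-w) tame-w
    tm v vz (no vw) = subst (λ d → 4 + at d (β' v) ≤ d) (sym (deg-v v vz vw)) (subst (λ c → 4 + at (deg G v) c ≤ deg G v) (sym (β'≡ v vz vw)) (Cv.tame cv v vz))

  easel : Easel GA z x ψA
  easel = record { cv = cvA ; tip = Sat→Tip GA z ψA tipA ; nx = λ e → nxA (Extends→Ext GA z ψA e) ; x≢z = x≢z }

  deg-x : deg GA x ≡ deg G x
  deg-x = deg-v x x≢z (wx ∘ sym)

  ord≡ : ord GA z ≡ ord G z
  ord≡ = cong (n G +_) (cong (_+ sumℕ (λ e → ind (not (touch G (cls id z) e)))) (cong (λ s → ind (not (s ∨ (z ≡ᵇ w)))) (≡ᵇ-refl z)))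

  -- Otherwise `z` and `x` would separate `w` from a fourth vertex, contrary to `no-cut`.
  neighbour : Σ (E G) λ e → Σ (V G) λ v → Joins G e w v × v ≢ z × v ≢ x × w ≢ v
  neighbour with Finₚ.any? (λ e → (cr G (cls id w) e ≟B true) ×-dec ((touch G (cls id z) e ≟B false) ×-dec (touch G (cls id x) e ≟B false)))
  ... | yes (e , c , tz , tx) = let (v , wv , j) = other G w e c in e , v , j
        , (λ { refl → true≢false (trans (sym (trans (Joins-touch G (cls id v) j) (trans (cong (cls id v w ∨_) (≡ᵇ-refl v)) (Boolₚ.∨-zeroʳ _)))) tz) })
        , (λ { refl → true≢false (trans (sym (trans (Joins-touch G (cls id v) j) (trans (cong (cls id v w ∨_) (≡ᵇ-refl v)) (Boolₚ.∨-zeroʳ _)))) tx) }) , wv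
  ... | no h = let (v , vz , vx , vw) = fourth n4 z x w in
      ⊥-elim (no-cut (Crit-of ES crit) x x≢z (cls id w) (≡ᵇ-≢ wz) (≡ᵇ-≢ wx) w (≡ᵇ-refl w) v (≡ᵇ-≢ (vw ∘ sym)) vz vx
        λ e a c j da dc → sep e c (subst (λ u → Joins G e u c) (sym (≡ᵇ-true w a da)) j) dc (c ≟ z) (c ≟ x))
    where
    sep : ∀ e c → Joins G e w c → cls id w c ≡ false → Dec (c ≡ z) → Dec (c ≡ x) → c ≡ z ⊎ c ≡ x
    sep e c j _ (yes p) _ = inj₁ p
    sep e c j _ (no _) (yes p) = inj₂ p
    sep e c j dc (no cz) (no cx) = ⊥-elim (h (e , trans (Joins-cr G (cls id w) j) (cong₂ _xor_ (≡ᵇ-refl w) dc)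
      , trans (Joins-touch G (cls id z) j) (cong₂ _∨_ (≡ᵇ-≢ (wz ∘ sym)) (≡ᵇ-≢ (cz ∘ sym)))
      , trans (Joins-touch G (cls id x) j) (cong₂ _∨_ (≡ᵇ-≢ (wx ∘ sym)) (≡ᵇ-≢ (cx ∘ sym)))))

  -- `w` has become friendly in the sense `not s`, while its neighbour is still friendly in the
  -- sense `s`. Their edge is mixed and avoids `x`.
  inhom : ¬ Homog GA z x
  inhom h = let (e , v , j , vz , vx , wv) = neighbour in k e v j vz vx wv (h (suc e))
    where
    F' : Bool → V G → Set
    F' s v = Fr s (deg GA v) (β' v)
    Fw : F' (not s) w
    Fw = subst (λ d → Fr (not s) d (β' w)) (sym deg-w) friendly
    k : ∀ e v → Joins G e w v → v ≢ z → v ≢ x → w ≢ v → (Mixed GA z (suc e) → Incident G x e) → ⊥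
    k e v j vz vx wv im = l s Fw Fv j (ends G e) refl im
      where
      Fv : F' s v
      Fv = subst₂ (Fr s) (sym (deg-v v vz (wv ∘ sym))) (sym (β'≡ v vz (wv ∘ sym)))
        (subst (λ t → Fr t (deg G v) (β G v)) (Boolₚ.not-involutive s) (Fr-total (not s) (deg G v) (β G v) (strict v vz vx)))
      MixE IncE : V G × V G → Set
      MixE p = proj₁ p ≢ z × proj₂ p ≢ z × ((F' false (proj₁ p) × F' true (proj₂ p)) ⊎ (F' true (proj₁ p) × F' false (proj₂ p)))
      IncE p = proj₁ p ≡ x ⊎ proj₂ p ≡ x
      l : ∀ s → F' (not s) w → F' s v → Joins G e w v → ∀ p → ends G e ≡ p → (MixE (ends G e) → IncE (ends G e)) → ⊥
      l true fw fv (inj₁ q) _ _ im = Sum.[ wx , vx ]′ (subst (λ p → MixE p → IncE p) q im (wz , vz , inj₁ (fw , fv)))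
      l false fw fv (inj₁ q) _ _ im = Sum.[ wx , vx ]′ (subst (λ p → MixE p → IncE p) q im (wz , vz , inj₂ (fw , fv)))
      l true fw fv (inj₂ q) _ _ im = Sum.[ vx , wx ]′ (subst (λ p → MixE p → IncE p) q im (vz , wz , inj₂ (fv , fw)))
      l false fw fv (inj₂ q) _ _ im = Sum.[ vx , wx ]′ (subst (λ p → MixE p → IncE p) q im (vz , wz , inj₁ (fv , fw)))

tame-suc : ∀ d b → b ≢ z0 → 4 + at d b ≤ d → 4 + at (suc d) b ≤ suc d
tame-suc d z0 h _ = ⊥-elim (h refl)
tame-suc d z1 h le with isEven d
... | true = ℕₚ.≤-trans (ℕₚ.n≤1+n 5) (ℕₚ.≤-trans le (ℕₚ.n≤1+n d))
... | false = s≤s le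
tame-suc d z2 h le with isEven d
... | true = ℕₚ.≤-trans (ℕₚ.n≤1+n 5) (ℕₚ.≤-trans le (ℕₚ.n≤1+n d))
... | false = s≤s le

tame-zero : ∀ d b → b ≢ z0 → 4 + at d b ≤ d → 4 + at (suc d) z0 ≤ suc d
tame-zero d z0 h _ = ⊥-elim (h refl)
tame-zero d z1 h le with isEven d
... | true = s≤s le
... | false = ℕₚ.≤-trans (ℕₚ.n≤1+n 4) (ℕₚ.≤-trans le (ℕₚ.n≤1+n d))
tame-zero d z2 h le with isEven d
... | true = s≤s le
... | false = ℕₚ.≤-trans (ℕₚ.n≤1+n 4) (ℕₚ.≤-trans le (ℕₚ.n≤1+n d))

-- Modulo 3, two parallel edges of one direction amount to one of the other direction.
double-flip : ∀ {G} (A : VSet G) {z w e₂} s (o : Orientation G) → z ≢ w → Joins G e₂ z w → (z ≡ᵇ tl G o e₂) ≡ s →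
  ct (A (if not s then z else w)) (A (if not s then w else z)) ⊕ nt G (λ e → (e₂ ≡ᵇ e) xor o e) A ≡ nt G o A
double-flip {G} A {z} {w} {e₂} s o zw j h = sumZ-change {m G} (ctE G o′ A) (ctE G o A) e₂
  (λ i ne → ctE-local G {o′} {o} A i λ _ → cong (_xor o i) (≡ᵇ-≢ ne)) _ z0
  (at-e₂ s (tail-bool {G} o zw j s h))
  where
  o′ : Orientation G
  o′ e = (e₂ ≡ᵇ e) xor o e
  o′-e₂ : o′ e₂ ≡ not (o e₂)
  o′-e₂ = cong (_xor o e₂) (≡ᵇ-refl e₂)
  twice : ∀ a c → ct a c ⊕ ct a c ≡ ct c a
  twice = from-yes (allB? λ a → allB? λ c → (ct a c ⊕ ct a c) ≟3 ct c a)
  at-e₂ : ∀ s → o e₂ ≡ (if s then outOf G e₂ z else not (outOf G e₂ z)) →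
    ct (A (if not s then z else w)) (A (if not s then w else z)) ⊕ ctE G o′ A e₂ ≡ ctE G o A e₂
  at-e₂ true q = trans (cong (ct (A w) (A z) ⊕_) (Joins-ctE {G} o′ A false zw j (trans o′-e₂ (cong not q))))
    (trans (twice (A w) (A z)) (sym (Joins-ctE {G} o A true zw j q)))
  at-e₂ false q = trans (cong (ct (A z) (A w) ⊕_) (Joins-ctE {G} o′ A true zw j (trans o′-e₂ (trans (cong not q) (Boolₚ.not-involutive _)))))
    (trans (twice (A z) (A w)) (sym (Joins-ctE {G} o A false zw j q)))

-- The new edge is parallel to `e₂` and both receive the direction opposite to `s`. As `e₃` keeps
-- direction `s`, the new preflow is not uniform.
module Plus {G : Gr} {z x : V G} {ψ : Orientation G} (ES : Easel G z x ψ) (crit : CritL G id z ψ) (F : Final G z x ψ) (hom : Homog G z x) (n4 : 4 ≤ n G)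
    (w : V G) (wz : w ≢ z) (wx : w ≢ x) (e₂ e₃ : E G) (e≢ : e₂ ≢ e₃) (j : Joins G e₂ z w)
    (t₂ : tip-away G z x e₂ ≡ true) (t₃ : tip-away G z x e₃ ≡ true) where
  open Final F

  dir-s : ∀ e → tip-away G z x e ≡ true → dir G z ψ e ≡ s
  dir-s e t = dirs e (∧-trueˡ t) (not-true (∧-trueʳ {cr G (cls id z) e} t))

  βw : β G w ≢ z0
  βw h = strict w wz wx (subst (Fr (not s) (deg G w)) (sym h) (Fr-z0 (not s) (deg G w)))

  agree-s : ∀ o → Agree G z ψ o → dir G z o e₂ ≡ s
  agree-s o ag = trans (cong (λ b → z ≡ᵇ (if b then p₁ G e₂ else p₂ G e₂)) (ag e₂ (cr⇒touch G (cls id z) e₂ (∧-trueˡ t₂)))) (dir-s e₂ t₂)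

  module A = AddZ ES crit F hom n4 w wz wx (not s) (e₂ ≡ᵇ_) (β G) (λ _ _ _ → refl)
    (λ o A ag → cong (_⊕ bs G A) (double-flip {G} A s o (wz ∘ sym) j (agree-s o ag)))
    (tame-suc _ _ βw (Cv.tame (Easel.cv ES) w wz)) (Fr-suc (not s) _ _ (strict w wz wx))
  open A public using (GA; ψA)

  not-same : ∀ X → X z ≡ false → X w ≡ false → touch G X e₃ ≡ false → ¬ SameD GA ψA (cls id z) X
  not-same X xz xw x₃ (t , h) = ne s (trans (sym (k s)) (trans (h zero (cong₂ _xor_ (≡ᵇ-refl z) (≡ᵇ-≢ (wz ∘ sym))) (cong₂ _∨_ xz xw))
    (trans (sym (h (suc e₃) (∧-trueˡ t₃) x₃)) (trans (cong (λ b → z ≡ᵇ (if b xor ψ e₃ then p₁ G e₃ else p₂ G e₃)) (≡ᵇ-≢ e≢)) (dir-s e₃ t₃)))))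
    where
    ne : ∀ s → not s ≢ s
    ne true ()
    ne false ()
    k : ∀ s → (z ≡ᵇ (if not s then z else w)) ≡ not s
    k true = ≡ᵇ-≢ (wz ∘ sym)
    k false = ≡ᵇ-refl z

  ¬AS : ¬ AS GA z ψA
  ¬AS = not-same ∅ refl refl refl

  ¬ASx : ¬ ASx GA z x ψA
  ¬ASx = not-same (cls id x) (≡ᵇ-≢ (Easel.x≢z ES)) (≡ᵇ-≢ (wx ∘ sym)) (not-true (∧-trueʳ {cr G (cls id z) e₃} t₃))

-- The new edge is directed so that the boundary of `w` becomes zero, which makes `w` friendly in
-- both ways. This serves when there are too few tip edges for `Plus`.
module Hat {G : Gr} {z x : V G} {ψ : Orientation G} (ES : Easel G z x ψ) (crit : CritL G id z ψ) (F : Final G z x ψ) (hom : Homog G z x) (n4 : 4 ≤ n G)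
    (w : V G) (wz : w ≢ z) (wx : w ≢ x) where
  open Final F

  βw : β G w ≢ z0
  βw h = strict w wz wx (subst (Fr (not s) (deg G w)) (sym h) (Fr-z0 (not s) (deg G w)))

  out : Z3 → Bool
  out z1 = true
  out _ = false

  β' : V G → Z3
  β' v = if w ≡ᵇ v then z0 else (if z ≡ᵇ v then β G z ⊕ β G w else β G v)

  β'w : β' w ≡ z0
  β'w rewrite ≡ᵇ-refl w = refl

  β'z : β' z ≡ β G z ⊕ β G w
  β'z rewrite ≡ᵇ-≢ wz | ≡ᵇ-refl z = refl

  β'≡ : ∀ v → v ≢ z → v ≢ w → β' v ≡ β G v
  β'≡ v vz vw rewrite ≡ᵇ-≢ (vw ∘ sym) | ≡ᵇ-≢ (vz ∘ sym) = refl

  boundary : ∀ A → ct (A (if out (β G w) then z else w)) (A (if out (β G w) then w else z)) ⊕ bs G A ≡ bs (addZ G z w β') A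
  boundary A = sumZ-change₂ {n G} (λ v → if A v then β G v else z0) (λ v → if A v then β' v else z0) z w (wz ∘ sym)
    (λ v zv wv → cong (λ b → if A v then b else z0) (sym (β'≡ v (zv ∘ sym) (wv ∘ sym)))) _ z0
    (trans (k (β G w) (β G z) βw) (sym (cong₂ _⊕_ (cong (λ b → if A z then b else z0) β'z) (cong (λ b → if A w then b else z0) β'w))))
    where
    k₁ : ∀ a c d → ct a c ⊕ ((if a then d else z0) ⊕ (if c then z1 else z0)) ≡ (if a then d ⊕ z1 else z0) ⊕ (if c then z0 else z0)
    k₁ = from-yes (allB? λ a → allB? λ c → all3? λ d → (ct a c ⊕ ((if a then d else z0) ⊕ (if c then z1 else z0))) ≟3 ((if a then d ⊕ z1 else z0) ⊕ (if c then z0 else z0)))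
    k₂ : ∀ a c d → ct c a ⊕ ((if a then d else z0) ⊕ (if c then z2 else z0)) ≡ (if a then d ⊕ z2 else z0) ⊕ (if c then z0 else z0)
    k₂ = from-yes (allB? λ a → allB? λ c → all3? λ d → (ct c a ⊕ ((if a then d else z0) ⊕ (if c then z2 else z0))) ≟3 ((if a then d ⊕ z2 else z0) ⊕ (if c then z0 else z0)))
    k : ∀ b d → b ≢ z0 → ct (A (if out b then z else w)) (A (if out b then w else z)) ⊕ ((if A z then d else z0) ⊕ (if A w then b else z0)) ≡ (if A z then d ⊕ b else z0) ⊕ (if A w then z0 else z0)
    k z0 d h = ⊥-elim (h refl)
    k z1 d _ = k₁ (A z) (A w) d
    k z2 d _ = k₂ (A z) (A w) d

  swap : ∀ a b c d → a ⊕ c ≡ d → (a ⊕ b) ⊕ c ≡ b ⊕ d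
  swap a b c d refl = from-yes (all3? λ a → all3? λ b → all3? λ c → ((a ⊕ b) ⊕ c) ≟3 (b ⊕ (a ⊕ c))) a b c

  module A = AddZ ES crit F hom n4 w wz wx (out (β G w)) (λ _ → false) β' β'≡
    (λ o A _ → swap _ (nt G o A) (bs G A) _ (boundary A))
    (subst (λ b → 4 + at (suc (deg G w)) b ≤ suc (deg G w)) (sym β'w) (tame-zero _ _ βw (Cv.tame (Easel.cv ES) w wz)))
    (subst (Fr (not s) (suc (deg G w))) (sym β'w) (Fr-z0 (not s) _))
  open A public using (GA; ψA)

Final-ASx : ∀ {G z x ψ} → Final G z x ψ → ASx G z x ψ
Final-ASx F = s , dirs
  where open Final F

plus-end : ∀ G {z x e} → x ≢ z → tip-away G z x e ≡ true → XEdge G z x e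
plus-end G {z} {x} {e} xz t = XEdge← G z x e (∧-trueˡ t) (not-true (∧-trueʳ {cr G (cls id z) e} t))

-- The added edge makes the bound obtained from the inhomogeneous canvas weaker by one. For `2 ≤ q`,
-- equality there would force uniform directions, which `Plus` excludes; for `q < 2`, even the
-- weaker bound contradicts `lower`.
final-bound : ∀ {G z x ψ} → Easel G z x ψ → CritL G id z ψ → TBelow (ord G z) → Final G z x ψ → Homog G z x → 4 ≤ n G →
  (∀ G' z' x' ψ' → Easel G' z' x' ψ' → ord G' z' ≡ ord G z → ¬ Homog G' z' x' → Bound G' z' x' ψ') → Bound G z x ψ
final-bound {G} {z} {x} {ψ} ES crit tb F hom n4 hyp = go (ℕₚ.<-≤-connex q 2)
  where
  open Easel ES
  open Final-count ES tb
  go : q < 2 ⊎ 2 ≤ q → Bound G z x ψ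
  go (inj₁ (s≤s q≤)) = ⊥-elim (ℕₚ.<⇒≱ (ℕₚ.n<1+n (suc (deg G z))) (ℕₚ.+-cancelʳ-≤ 2 _ _
      (ℕₚ.≤-trans (ℕₚ.≤-reflexive (trans (cong (2 +_) (ℕₚ.+-comm (deg G z) 2)) (ℕₚ.+-comm 4 (deg G z)))) (ℕₚ.≤-trans lower (ℕₚ.≤-trans (ℕₚ.+-monoʳ-≤ (deg G x) (ℕₚ.+-mono-≤ q≤ q≤)) (ℕₚ.≤-trans (ℕₚ.≤-reflexive (ℕₚ.+-comm (deg G x) 2)) (ℕₚ.≤-trans hat (ℕₚ.m≤m+n _ 2))))))))
    where
    hat : 2 + deg G x ≤ suc (deg G z)
    hat = let (w , wz , wx) = thirdV ES
              module H = Hat ES crit F hom n4 w wz wx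
          in subst₂ (λ s t → 2 + s ≤ t) H.A.deg-x H.A.deg-z (proj₁ (hyp H.GA z x H.ψA H.A.easel H.A.ord≡ H.A.inhom))
  go (inj₂ le) = let (e₂ , e₃ , ne , t₂ , t₃) = two-picks (tip-away G z x) le
                     (w , wz , wx , j) = plus-end G x≢z t₂
                     module P = Plus ES crit F hom n4 w wz wx e₂ e₃ ne j t₂ t₃
                     (a , b) = hyp P.GA z x P.ψA P.A.easel P.A.ord≡ P.A.inhom
    in ℕₚ.≤-pred (ℕₚ.≤∧≢⇒< (subst₂ (λ s t → 2 + s ≤ t) P.A.deg-x P.A.deg-z a)
         (λ e → P.¬ASx (b (trans (cong (2 +_) P.A.deg-x) (trans e (sym P.A.deg-z)))))) , λ _ → Final-ASx F

filter-tabulate : ∀ {A : Set} (p : A → Bool) {k} (f : Fin k → A) → (∀ i → p (f i) ≡ true) → filterᵇ p (tabulate f) ≡ tabulate f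
filter-tabulate p {zero} f h = refl
filter-tabulate p {suc k} f h with p (f zero) | h zero
... | true | refl = cong (f zero ∷_) (filter-tabulate p (f ∘ suc) (h ∘ suc))

delete-zero : ∀ {A : Set} {k} (a : A) (f : Fin k → A) → tabulate f ≡ map (cons a f) (filterᵇ (λ e → not (e ≡ᵇ zero)) (allFin (suc k)))
delete-zero a f = sym (trans (cong (map (cons a f)) (filter-tabulate (λ e → not (e ≡ᵇ zero)) suc λ _ → refl)) (Listₚ.map-tabulate suc (cons a f)))

≤-or-suc : ∀ {i j : ℤ} → i ≤ℤ j → i ≡ j ⊎ pos 1 +ℤ i ≤ℤ j
≤-or-suc {i} {j} h with i ℤₚ.≟ j
... | yes e = inj₁ e
... | no n = inj₂ (ℤₚ.i<j⇒suc[i]≤j (ℤₚ.≤∧≢⇒< h n))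

-- If the tip degree is below `k + 1`, the added edge is admissible for `k`; otherwise `k` is raised
-- by one. This raises the degree required of `x`, but `x` exceeds the old requirement: with
-- equality, the uniform directions of `Final` would contradict tallness.
final-REM : ∀ {k r G z x ψ} → Easel G z x ψ → CritL G id z ψ → TBelow (ord G z) → Final G z x ψ → Homog G z x → 4 ≤ n G →
  2 + deg G x ≤ deg G z → W k r (deg G z) (deg G x) (AS G z ψ) (ASx G z x ψ) → REM k r G z x
final-REM {k} {r} {G} {z} {x} {ψ} ES crit tb F hom n4 bound w = go (two-picks (tip-away G z x) q≥2)
  where
  open Easel ES
  open Final-count ES tb
  -- With at most one such tip edge, `lower` would make the tip degree smaller than the degree bound
  -- allows.
  q≥2 : 2 ≤ q
  q≥2 = ℕₚ.≮⇒≥ λ { (s≤s q≤) → ℕₚ.<⇒≱ (ℕₚ.m<m+n (deg G z) {4} (s≤s z≤n)) (ℕₚ.≤-trans lower (ℕₚ.≤-trans (ℕₚ.+-monoʳ-≤ (deg G x) (ℕₚ.+-mono-≤ q≤ q≤)) (ℕₚ.≤-trans (ℕₚ.≤-reflexive (ℕₚ.+-comm (deg G x) 2)) bound))) }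
  go : (Σ (E G) λ e₂ → Σ (E G) λ e₃ → e₂ ≢ e₃ × tip-away G z x e₂ ≡ true × tip-away G z x e₃ ≡ true) → REM k r G z x
  go (e₂ , e₃ , ne , t₂ , t₃) = by (plus-end G x≢z t₂)
    where
    by : XEdge G z x e₂ → REM k r G z x
    by (v , vz , vx , j) = GA , z , x , ψA , member (≤-or-suc (W.tipdeg w))
      , inj₂ (inj₁ (A.ord≡ , A.inhom , hom)) , v , vx , zero , suc e₂ , (λ ()) , inj₁ refl , j
      , isoPerm (ends G) (β G) _ (β G) (lift↭ {n G} (Perm.↭-reflexive (delete-zero (z , v) (ends G)))) (λ _ → refl) , refl , refl
      where
      open Plus ES crit F hom n4 v vz vx e₂ e₃ ne j t₂ t₃
      W⁺ : ∀ κ → pos 1 +ℤ pos (deg G z) ≤ℤ κ +ℤ pos 1 → κ - pos 2 - r ≤ℤ pos (deg G x) → W κ r (deg GA z) (deg GA x) (AS GA z ψA) (ASx GA z x ψA)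
      W⁺ κ a b = record { tipdeg = subst (λ d → pos d ≤ℤ κ +ℤ pos 1) (sym A.deg-z) a ; tall = λ _ → ¬AS
        ; xdeg = subst (λ d → κ - pos 2 - r ≤ℤ pos d) (sym A.deg-x) b ; xtall = λ _ _ → ¬ASx }
      shift : ∀ k r → pos 1 +ℤ (k - pos 2 - r) ≡ (k +ℤ pos 1) - pos 2 - r
      shift k r = trans (sym (ℤₚ.+-assoc (pos 1) (k - pos 2) (- r))) (cong (_- r) (trans (sym (ℤₚ.+-assoc (pos 1) k (- pos 2))) (cong (_- pos 2) (ℤₚ.+-comm (pos 1) k))))
      member : pos (deg G z) ≡ k +ℤ pos 1 ⊎ pos 1 +ℤ pos (deg G z) ≤ℤ k +ℤ pos 1 → InGkr k r GA z x ψA ⊎ InGkr (k +ℤ pos 1) r GA z x ψA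
      member (inj₂ lt) = inj₁ (toInGkr A.easel (W⁺ k lt (W.xdeg w)))
      member (inj₁ e) = inj₂ (toInGkr A.easel (W⁺ (k +ℤ pos 1) (ℤₚ.≤-reflexive (trans (cong (pos 1 +ℤ_) e) (ℤₚ.+-comm (pos 1) (k +ℤ pos 1)))) (xd (≤-or-suc (W.xdeg w)))))
        where
        xd : k - pos 2 - r ≡ pos (deg G x) ⊎ pos 1 +ℤ (k - pos 2 - r) ≤ℤ pos (deg G x) → (k +ℤ pos 1) - pos 2 - r ≤ℤ pos (deg G x)
        xd (inj₁ f) = ⊥-elim (W.xtall w (sym f) e (Final-ASx F))
        xd (inj₂ l) = subst (_≤ℤ pos (deg G x)) (shift k r) l

-- The induction and the theorem

data Outcome (G : Gr) (z x : V G) (ψ : Orientation G) : Set where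
  by-EXP : Red G z x ψ (λ k r → EXP k r G z x) → Outcome G z x ψ
  by-EXPA : Red G z x ψ (λ k r → EXPA k r G z x) → Outcome G z x ψ
  by-EXPB : Red G z x ψ (λ k r → EXPB k r G z x) → Outcome G z x ψ
  by-ADD : Red G z x ψ (λ k r → ADD k r G z x) → Outcome G z x ψ
  irreducible : CritL G id z ψ → Homog G z x → Final G z x ψ → Outcome G z x ψ

-- The same case distinction drives the proof of the degree bound and that of the theorem.
outcome : ∀ {G z x ψ} → Easel G z x ψ → TBelow (ord G z) → 4 ≤ n G → Outcome G z x ψ
outcome {G} {z} {x} {ψ} ES tb n4 = a (critOrLab G z ψ)
  where
  c : CritL G id z ψ → (∀ v → v ≢ z → v ≢ x → deg G v ≢ 4) → Dec (Homog G z x) → Outcome G z x ψ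
  c crit no4 (no nh) = by-EXPB (redEXPB ES crit tb no4 nh)
  c crit no4 (yes h) = d (Classify.reduce ES crit n4 no4 h)
    where
    d : Red G z x ψ (λ k r → ADD k r G z x) ⊎ Final G z x ψ → Outcome G z x ψ
    d (inj₁ red) = by-ADD red
    d (inj₂ F) = irreducible crit h F
  b : CritL G id z ψ → Dec (Σ (V G) λ v → v ≢ z × v ≢ x × deg G v ≡ 4) → Outcome G z x ψ
  b crit (yes (y , yz , yx , y4)) = by-EXPA (RedEXPA.red ES crit tb n4 y yz yx y4)
  b crit (no h) = c crit (λ v vz vx v4 → h (v , vz , vx , v4)) (Homog? G z x)
  a : CritL G id z ψ ⊎ BadLab G z ψ → Outcome G z x ψ
  a (inj₁ crit) = b crit (Finₚ.any? λ v → ¬? (v ≟ z) ×-dec (¬? (v ≟ x) ×-dec (deg G v ℕₚ.≟ 4)))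
  a (inj₂ bad) = by-EXP (redEXP ES tb bad)

Below : (G : Gr) (z x : V G) → Set
Below G z x = ∀ G' z' x' ψ' → Easel G' z' x' ψ' → Prec G' z' x' G z x → Bound G' z' x' ψ'

Red-Bound : ∀ {G z x ψ R} → Below G z x → Red G z x ψ R → Bound G z x ψ
Red-Bound below red = Mono-Bound mono (below G' z' x' ψ' (Mono.easel mono) prec)
  where open Red red

bound-step : ∀ {G z x ψ} → Easel G z x ψ → TBelow (ord G z) → Below G z x → Bound G z x ψ
bound-step {G} {z} {x} {ψ} ES tb below = go (size-cases ES)
  where
  by : 4 ≤ n G → Outcome G z x ψ → Bound G z x ψ
  by _ (by-EXP red) = Red-Bound below red
  by _ (by-EXPA red) = Red-Bound below red
  by _ (by-EXPB red) = Red-Bound below red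
  by _ (by-ADD red) = Red-Bound below red
  by n4 (irreducible crit h F) = final-bound ES crit tb F h n4 λ G' z' x' ψ' ES' e nh → below G' z' x' ψ' ES' (inj₂ (inj₁ (e , nh , h)))
  go : n G ≡ 3 ⊎ 4 ≤ n G → Bound G z x ψ
  go (inj₁ n3) = Three.bound₃ ES n3
  go (inj₂ n4) = by n4 (outcome ES tb n4)

tbelow : ∀ {N} → (∀ G z x ψ → Easel G z x ψ → ord G z < N → Bound G z x ψ) → TBelow N
tbelow h H z lt cv ψ tip nx x xz = h H z x ψ (record { cv = cv ; tip = tip ; nx = nx ; x≢z = xz }) lt

-- Only canvases of smaller order precede an inhomogeneous one. These are therefore settled before
-- the homogeneous canvases of the same order, which refer to them.
bound-inhom : ∀ {G z x ψ} → TBelow (ord G z) → Easel G z x ψ → ¬ Homog G z x → Bound G z x ψ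
bound-inhom {G} {z} {x} tb ES nh = bound-step ES tb below
  where
  below : Below G z x
  below G' z' x' ψ' ES' (inj₁ lt) = tb G' z' lt (Easel.cv ES') ψ' (Easel.tip ES') (Easel.nx ES') x' (Easel.x≢z ES')
  below _ _ _ _ _ (inj₂ (inj₁ (_ , _ , h))) = ⊥-elim (nh h)
  below _ _ _ _ _ (inj₂ (inj₂ (_ , _ , h , _))) = ⊥-elim (nh h)

-- Within one order, homogeneous canvases are handled by induction on the tip degree, of which `d`
-- is a strict upper bound.
bound-ord : ∀ d {N G z x ψ} → TBelow N → Easel G z x ψ → ord G z ≡ N → deg G z < d → Bound G z x ψ
bound-ord (suc d) {N} {G} {z} {x} {ψ} tb ES refl (s≤s le) = bound-step ES tb below
  where
  below : Below G z x
  below G' z' x' ψ' ES' (inj₁ lt) = tb G' z' lt (Easel.cv ES') ψ' (Easel.tip ES') (Easel.nx ES') x' (Easel.x≢z ES')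
  below G' z' x' ψ' ES' (inj₂ (inj₁ (e , nh , _))) = bound-inhom (subst TBelow (sym e) tb) ES' nh
  below G' z' x' ψ' ES' (inj₂ (inj₂ (e , _ , _ , lt))) = bound-ord d tb ES' e (ℕₚ.<-≤-trans lt le)

bound-below : ∀ N → TBelow N
bound-below (suc N) = tbelow λ G z x ψ ES → λ { (s≤s le) → bound-ord (suc (deg G z)) (λ H z' lt → bound-below N H z' (ℕₚ.<-≤-trans lt le)) ES refl ℕₚ.≤-refl }

CritL→PsiCritical : ∀ {G z ψ} → ¬ Extends G z ψ → CritL G id z ψ → PsiCritical G z ψ
CritL→PsiCritical {G} {z} {ψ} nx crit = nx , λ p f _ tr (u , v , ne , e) → ExtQ← G f (f z) ψ (crit f tr u v ne e)

mainTheorem9 : (k r : ℤ) (G : Gr) (z x : V G) (ψ : Orientation G) → InGkr k r G z x ψ →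
    ((n G ≡ 3
    ⊎ Better k r G z x (λ G' z' x' → EXP k r G z x G' z' x' ⊎ EXPA k r G z x G' z' x'
    ⊎ EXPX k r G z x G' z' x' ⊎ EXPB k r G z x G' z' x' ⊎ ADD k r G z x G' z' x'))
    ⊎ REM k r G z x)
    × ((∃ λ v → v ≢ x × deg G v ≡ 4)
    → n G ≡ 3 ⊎ Better k r G z x (λ G' z' x' → EXP k r G z x G' z' x'
    ⊎ EXPA k r G z x G' z' x' ⊎ EXPX k r G z x G' z' x'))
    × (¬ PsiCritical G z ψ → Better k r G z x (EXP k r G z x))
mainTheorem9 k r G z x ψ mem = first (size-cases ES) , (λ (v , vx , v4) → second v vx v4 (size-cases ES)) , third (critOrLab G z ψ)
  where
  ES : Easel G z x ψ
  ES = proj₁ (fromInGkr {k} {r} mem)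
  w : W k r (deg G z) (deg G x) (AS G z ψ) (ASx G z x ψ)
  w = proj₂ (fromInGkr {k} {r} mem)
  open Easel ES
  tb : TBelow (ord G z)
  tb = bound-below (ord G z)
  bound : 2 + deg G x ≤ deg G z
  bound = proj₁ (bound-below (suc (ord G z)) G z ℕₚ.≤-refl cv ψ tip nx x x≢z)
  better : ∀ {R S : Rel} → (∀ {k r G' z' x'} → R k r G' z' x' → S k r G' z' x') → Red G z x ψ R → Better k r G z x (S k r)
  better {R} {S} h red = Red→Better {R = S} w (Red-map {R = R} {S} h red)

  All-cases : Rel
  All-cases k r G' z' x' = EXP k r G z x G' z' x' ⊎ EXPA k r G z x G' z' x' ⊎ EXPX k r G z x G' z' x' ⊎ EXPB k r G z x G' z' x' ⊎ ADD k r G z x G' z' x'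
  EXP-cases : Rel
  EXP-cases k r G' z' x' = EXP k r G z x G' z' x' ⊎ EXPA k r G z x G' z' x' ⊎ EXPX k r G z x G' z' x'

  by : 4 ≤ n G → Outcome G z x ψ → (n G ≡ 3 ⊎ Better k r G z x (All-cases k r)) ⊎ REM k r G z x
  by _ (by-EXP red) = inj₁ (inj₂ (better {S = All-cases} inj₁ red))
  by _ (by-EXPA red) = inj₁ (inj₂ (better {S = All-cases} (inj₂ ∘ inj₁) red))
  by _ (by-EXPB red) = inj₁ (inj₂ (better {S = All-cases} (inj₂ ∘ inj₂ ∘ inj₂ ∘ inj₁) red))
  by _ (by-ADD red) = inj₁ (inj₂ (better {S = All-cases} (inj₂ ∘ inj₂ ∘ inj₂ ∘ inj₂) red))
  by n4 (irreducible crit h F) = inj₂ (final-REM ES crit tb F h n4 bound w)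

  first : n G ≡ 3 ⊎ 4 ≤ n G → (n G ≡ 3 ⊎ Better k r G z x (All-cases k r)) ⊎ REM k r G z x
  first (inj₁ n3) = inj₁ (inj₁ n3)
  first (inj₂ n4) = by n4 (outcome ES tb n4)

  second : ∀ v → v ≢ x → deg G v ≡ 4 → n G ≡ 3 ⊎ 4 ≤ n G → n G ≡ 3 ⊎ Better k r G z x (EXP-cases k r)
  second v vx v4 (inj₁ n3) = inj₁ n3
  second v vx v4 (inj₂ n4) = inj₂ (go (critOrLab G z ψ))
    where
    -- By tameness of `x` and the degree bound, the tip has degree at least six.
    vz : v ≢ z
    vz refl = ℕₚ.<⇒≱ (ℕₚ.≤-trans (ℕₚ.n<1+n 4) (ℕₚ.n≤1+n 5)) (ℕₚ.≤-trans (ℕₚ.+-monoʳ-≤ 2 (ℕₚ.≤-trans (ℕₚ.m≤m+n 4 _) (Cv.tame cv x x≢z))) (ℕₚ.≤-trans bound (ℕₚ.≤-reflexive v4)))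
    go : CritL G id z ψ ⊎ BadLab G z ψ → Better k r G z x (EXP-cases k r)
    go (inj₁ crit) = better {S = EXP-cases} (inj₂ ∘ inj₁) (RedEXPA.red ES crit tb n4 v vz vx v4)
    go (inj₂ bad) = better {S = EXP-cases} inj₁ (redEXP ES tb bad)

  third : CritL G id z ψ ⊎ BadLab G z ψ → ¬ PsiCritical G z ψ → Better k r G z x (EXP k r G z x)
  third (inj₁ crit) np = ⊥-elim (np (CritL→PsiCritical nx crit))
  third (inj₂ bad) _ = Red→Better w (redEXP ES tb bad)
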